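{- Let $\mathcal{L}_1,\mathcal{L}_2\in \mathrm{Mat}_d(\mathbb{Z})$ be irreducible and coprime. Then there are constants $D>0$ and $\sigma>0$ such that, for every finite subset $A$ of $\mathbb{R}^d$, $$|\mathcal{L}_1 A+\mathcal{L}_2 A|\geq \left(|\det(\mathcal{L}_1)|^{1/d}+|\det(\mathcal{L}_2)|^{1/d}\right)^d|A|-D|A|^{1-\sigma}.$$
   Context: $\mathcal{L}A=\{\mathcal{L}a:a\in A\}$. Irreducible: there are no non-trivial subspaces $U,V$ of $\mathbb{Q}^d$ of the same dimension (non-trivial meaning neither $\{0\}$ nor $\mathbb{Q}^d$) with $\mathcal{L}_1U\subseteq V$ and $\mathcal{L}_2U\subseteq V$. Coprime: there are no $\mathcal{P},\mathcal{Q}\in \mathrm{GL}_d(\mathbb{Q})$ with $0<|\det(\mathcal{P})\det(\mathcal{Q})|<1$ such that $\mathcal{P}\mathcal{L}_1\mathcal{Q},\mathcal{P}\mathcal{L}_2\mathcal{Q}\in\mathrm{Mat}_d(\mathbb{Z})$. -}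

module Defs where

open import Algebra.Bundles using (CommutativeRing; Semiring)
import Algebra.Definitions.RawSemiring as RawSemiringDefs
import Algebra.Properties.Ring as RingProperties
open import Data.Bool.Base using (if_then_else_)
open import Data.Empty using (⊥-elim)
open import Data.Fin.Base using (Fin; zero; suc; toℕ; punchIn)
import Data.Fin.Properties as Fin
open import Data.Integer.Base using (ℤ; -[1+_]) renaming (+_ to pos)
import Data.Integer.Properties as ℤ
open import Data.List.Base using (List; length; map; deduplicate; cartesianProductWith)
open import Data.Nat.Base using (ℕ; zero; suc)
open import Data.Product.Base using (∃; ∃₂; ∃-syntax; Σ-syntax; _×_; _,_; proj₁; proj₂)
open import Data.Rational.Base as ℚ using (ℚ; 0ℚ; 1ℚ)
import Data.Rational.Properties as ℚ
open import Data.Sum.Base using (inj₁; inj₂)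
import Data.Vec.Functional as Vector
open Vector using (Vector)
import Data.Vec.Functional.Relation.Binary.Pointwise.Properties as Pointwise
open import Level using (0ℓ) renaming (suc to lsuc)
open import Relation.Binary.Core using (Rel)
import Relation.Binary.Construct.NonStrictToStrict as NonStrictToStrict
open import Relation.Binary.PropositionalEquality using (_≡_; _≗_)
open import Relation.Binary.Structures using (IsDecTotalOrder)
open import Relation.Nullary.Decidable using (does)
open import Relation.Nullary.Negation using (¬_)
open import Relation.Unary using (Pred; _∈_)

Mat : ∀ {a} → Set a → ℕ → Set a
Mat A d = Vector (Vector A d) d

mapMat : ∀ {a b} {A : Set a} {B : Set b} {d} → (A → B) → Mat A d → Mat B d
mapMat f = Vector.map (Vector.map f)

module LinearAlgebra {c ℓ} (R : CommutativeRing c ℓ) where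
  open CommutativeRing R hiding (zero)
  open RawSemiringDefs (Semiring.rawSemiring semiring) using (sum; _^_)

  infixr 7 _*ᵥ_ _*ₘ_

  _*ᵥ_ : ∀ {d} → Mat Carrier d → Vector Carrier d → Vector Carrier d
  (M *ᵥ v) i = sum (λ j → M i j * v j)

  _*ₘ_ : ∀ {d} → Mat Carrier d → Mat Carrier d → Mat Carrier d
  (M *ₘ N) i k = sum (λ j → M i j * N j k)

  identity : ∀ {d} → Mat Carrier d
  identity i j = if does (i Fin.≟ j) then 1# else 0#

  -- Laplace expansion along the first row.
  det : ∀ {d} → Mat Carrier d → Carrier
  det {zero}  M = 1#
  det {suc d} M =
    sum (λ j → (- 1#) ^ toℕ j * (M zero j * det (λ i k → M (suc i) (punchIn j k))))

  Invertible : ∀ {d} → Mat Carrier d → Set _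
  Invertible M = ∃[ N ] (∀ i j → (M *ₘ N) i j ≈ identity i j)
                      × (∀ i j → (N *ₘ M) i j ≈ identity i j)

  linearCombination : ∀ {d k} → Vector Carrier k → Vector (Vector Carrier d) k → Vector Carrier d
  linearCombination a b j = sum (λ i → a i * b i j)

detℤ : ∀ {d} → Mat ℤ d → ℤ
detℤ = LinearAlgebra.det ℤ.+-*-commutativeRing

module _ where
  open LinearAlgebra ℚ.+-*-commutativeRing

  toℚ : ℤ → ℚ
  toℚ z = z ℚ./ 1

  -- Vectors are functions, so a subset of ℚᵈ is a predicate invariant under
  -- pointwise equality.
  record IsSubspace {d} (U : Pred (Vector ℚ d) 0ℓ) : Set where
    field
      respects : ∀ {u v} → u ≗ v → u ∈ U → v ∈ U
      zero∈    : (λ _ → 0ℚ) ∈ U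
      +-closed : ∀ {u v} → u ∈ U → v ∈ U → (λ i → u i ℚ.+ v i) ∈ U
      *-closed : ∀ a {u} → u ∈ U → (λ i → a ℚ.* u i) ∈ U

  record IsBasis {d k} (U : Pred (Vector ℚ d) 0ℓ) (b : Vector (Vector ℚ d) k) : Set where
    field
      members     : ∀ i → b i ∈ U
      independent : ∀ a → linearCombination a b ≗ (λ _ → 0ℚ) → a ≗ (λ _ → 0ℚ)
      spanning    : ∀ {u} → u ∈ U → ∃[ a ] u ≗ linearCombination a b

  HasDimension : ∀ {d} → Pred (Vector ℚ d) 0ℓ → ℕ → Set
  HasDimension {d} U k = ∃[ b ] IsBasis {d} {k} U b

  NonTrivial : ∀ {d} → Pred (Vector ℚ d) 0ℓ → Set
  NonTrivial U = ¬ (∀ {u} → u ∈ U → u ≗ (λ _ → 0ℚ)) × ¬ (∀ u → u ∈ U)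

  MapsInto : ∀ {d} → Mat ℤ d → Pred (Vector ℚ d) 0ℓ → Pred (Vector ℚ d) 0ℓ → Set
  MapsInto L U V = ∀ {u} → u ∈ U → (mapMat toℚ L *ᵥ u) ∈ V

  Irreducible : ∀ {d} → Mat ℤ d → Mat ℤ d → Set₁
  Irreducible {d} L₁ L₂ = ¬ (Σ[ U ∈ Pred (Vector ℚ d) 0ℓ ] Σ[ V ∈ Pred (Vector ℚ d) 0ℓ ]
    IsSubspace U × IsSubspace V × NonTrivial U × NonTrivial V ×
    (∃[ k ] HasDimension U k × HasDimension V k) ×
    MapsInto L₁ U V × MapsInto L₂ U V)

  IsIntegral : ∀ {d} → Mat ℚ d → Set
  IsIntegral {d} M = Σ[ N ∈ Mat ℤ d ] (∀ i j → M i j ≡ toℚ (N i j))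

  Coprime : ∀ {d} → Mat ℤ d → Mat ℤ d → Set
  Coprime {d} L₁ L₂ = ¬ (Σ[ P ∈ Mat ℚ d ] Σ[ Q ∈ Mat ℚ d ]
    Invertible P × Invertible Q ×
    0ℚ ℚ.< ℚ.∣ det P ℚ.* det Q ∣ × ℚ.∣ det P ℚ.* det Q ∣ ℚ.< 1ℚ ×
    IsIntegral (P *ₘ mapMat toℚ L₁ *ₘ Q) × IsIntegral (P *ₘ mapMat toℚ L₂ *ₘ Q))

-- The library has no real numbers. ℝ enters as an arbitrary complete ordered
-- field: classically there is exactly one up to isomorphism.
record CompleteOrderedField ℓ : Set (lsuc ℓ) where
  infix 8 _⁻¹
  infix 4 _≤_

  field
    commutativeRing : CommutativeRing ℓ ℓ

  open CommutativeRing commutativeRing public hiding (zero) renaming (Carrier to ℝ)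

  field
    0≉1         : ¬ 0# ≈ 1#
    -- total, with an unspecified value at 0#
    _⁻¹         : ℝ → ℝ
    *-inverseʳ  : ∀ x → ¬ x ≈ 0# → x * x ⁻¹ ≈ 1#

    _≤_             : Rel ℝ ℓ
    isDecTotalOrder : IsDecTotalOrder _≈_ _≤_
    +-monoˡ-≤       : ∀ z {x y} → x ≤ y → x + z ≤ y + z
    *-nonNegative   : ∀ {x y} → 0# ≤ x → 0# ≤ y → 0# ≤ x * y

  open NonStrictToStrict _≈_ _≤_ public using (_<_)

  UpperBound : Pred ℝ ℓ → Pred ℝ ℓ
  UpperBound P b = ∀ {x} → x ∈ P → x ≤ b

  -- Leastness is stated as approximation from within P. Constructively this
  -- is stronger than "no smaller upper bound"; with it, the completeness field
  -- below makes the logic classical (excluded middle for Set ℓ is derivable).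
  IsSupremum : Pred ℝ ℓ → Pred ℝ ℓ
  IsSupremum P s = UpperBound P s × (∀ {y} → y < s → ∃[ x ] x ∈ P × y < x)

  field
    complete : ∀ (P : Pred ℝ ℓ) → ∃ P → ∃ (UpperBound P) → ∃ (IsSupremum P)

module Real {ℓ} (R : CompleteOrderedField ℓ) where
  open CompleteOrderedField R
  open IsDecTotalOrder isDecTotalOrder
    using (total; antisym; _≟_)
    renaming (refl to ≤-refl; reflexive to ≤-reflexive; trans to ≤-trans;
              ≤-respʳ-≈ to ≤-respʳ; ≤-respˡ-≈ to ≤-respˡ)
  open RingProperties ring using (-‿distribʳ-*; -‿involutive)
  open RawSemiringDefs (Semiring.rawSemiring semiring) public using (_^_)
  open RawSemiringDefs (Semiring.rawSemiring semiring) using () renaming (_×_ to _·_)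
  open LinearAlgebra commutativeRing

  infixr 8 _^ᶻ_ _^ʳ_

  fromℕ : ℕ → ℝ
  fromℕ n = n · 1#

  fromℤ : ℤ → ℝ
  fromℤ (pos n)  = fromℕ n
  fromℤ -[1+ n ] = - fromℕ (suc n)

  _^ᶻ_ : ℝ → ℤ → ℝ
  x ^ᶻ pos n    = x ^ n
  x ^ᶻ -[1+ n ] = (x ^ suc n) ⁻¹

  private
    +-monoʳ-≤ : ∀ z {x y} → x ≤ y → z + x ≤ z + y
    +-monoʳ-≤ z {x} {y} x≤y =
      ≤-respˡ (+-comm x z) (≤-respʳ (+-comm y z) (+-monoˡ-≤ z x≤y))

    0≤1 : 0# ≤ 1#
    0≤1 with total 0# 1#
    ... | inj₁ p = p
    ... | inj₂ 1≤0 = ≤-respʳ -1*-1≈1 (*-nonNegative 0≤-1 0≤-1)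
      where
      0≤-1 : 0# ≤ - 1#
      0≤-1 = ≤-respˡ (-‿inverseʳ 1#) (≤-respʳ (+-identityˡ (- 1#)) (+-monoˡ-≤ (- 1#) 1≤0))
      -1*-1≈1 : - 1# * - 1# ≈ 1#
      -1*-1≈1 = trans (sym (-‿distribʳ-* (- 1#) 1#))
                      (trans (-‿cong (*-identityʳ (- 1#))) (-‿involutive 1#))

    x-y+y≈x : ∀ x y → (x - y) + y ≈ x
    x-y+y≈x x y = trans (+-assoc x (- y) y) (trans (+-congˡ (-‿inverseˡ y)) (+-identityʳ x))

    x-1<x : ∀ x → x - 1# < x
    x-1<x x = ≤-respʳ (x-y+y≈x x 1#) (≤-respˡ (+-identityʳ _) (+-monoʳ-≤ (x - 1#) 0≤1))
            , λ eq → 0≉1 (sym (trans (sym (x+y-x (x - 1#) 1#))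
                (trans (+-congʳ (trans (x-y+y≈x x 1#) (sym eq))) (-‿inverseʳ (x - 1#)))))
      where
      x+y-x : ∀ x y → (x + y) - x ≈ y
      x+y-x x y = trans (+-congʳ (+-comm x y))
        (trans (+-assoc y x (- x)) (trans (+-congˡ (-‿inverseʳ x)) (+-identityʳ y)))

    fromℕ-nonNeg : ∀ n → 0# ≤ fromℕ n
    fromℕ-nonNeg zero    = ≤-refl
    fromℕ-nonNeg (suc n) =
      ≤-trans 0≤1 (≤-respˡ (+-identityʳ 1#) (+-monoʳ-≤ 1# (fromℕ-nonNeg n)))

    ^-nonNeg : ∀ {x} n → 0# ≤ x → 0# ≤ x ^ n
    ^-nonNeg zero    0≤x = 0≤1
    ^-nonNeg (suc n) 0≤x = *-nonNegative 0≤x (^-nonNeg n 0≤x)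

  archimedean : ∀ x → ∃[ n ] x ≤ fromℕ n
  archimedean x with total x 0#
  ... | inj₁ x≤0 = 0 , x≤0
  ... | inj₂ 0≤x
    with complete (λ y → y ≤ x × (∃[ n ] y ≤ fromℕ n)) (0# , 0≤x , 0 , ≤-refl) (x , proj₁)
  ... | s , upper , approx with approx (x-1<x s)
  ... | y , (y≤x , n , y≤n) , (s-1≤y , s-1≉y) with total x (fromℕ (suc n))
  ... | inj₁ x≤1+n = suc n , x≤1+n
  ... | inj₂ 1+n≤x = ⊥-elim (s-1≉y (antisym s-1≤y y≤s-1))
    where
    1+y≤s : 1# + y ≤ s
    1+y≤s = ≤-trans (+-monoʳ-≤ 1# y≤n) (upper (1+n≤x , suc n , ≤-refl))
    y≤s-1 : y ≤ s - 1#
    y≤s-1 = ≤-respˡ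
      (trans (+-congʳ (+-comm 1# y))
        (trans (+-assoc y 1# (- 1#)) (trans (+-congˡ (-‿inverseʳ 1#)) (+-identityʳ y))))
      (+-monoˡ-≤ (- 1#) 1+y≤s)

  -- y ≥ b^(p/q) for some rational p/q ≥ s, where q = suc r.
  AbovePower : ℕ → ℝ → Pred ℝ ℓ
  AbovePower b s y = 0# ≤ y ×
    (∃₂ λ (p : ℤ) (r : ℕ) → s * fromℕ (suc r) ≤ fromℤ p × fromℕ b ^ᶻ p ≤ y ^ suc r)

  -- Real power of a natural base: b^s = inf { b^t : t ∈ ℚ, t ≥ s } for b ≥ 1,
  -- the infimum being the supremum of the lower bounds. For b = 0 this gives
  -- 0^s = 0, the usual value when s > 0.
  _^ʳ_ : ℕ → ℝ → ℝ
  b ^ʳ s = proj₁ (complete (λ x → ∀ y → y ∈ AbovePower b s → x ≤ y)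
    (0# , λ y → proj₁)
    (fromℕ b ^ N , λ lower → lower (fromℕ b ^ N) power∈))
    where
    N = proj₁ (archimedean s)
    power∈ : (fromℕ b ^ N) ∈ AbovePower b s
    power∈ = ^-nonNeg N (fromℕ-nonNeg b) , pos N , 0
           , ≤-respˡ (sym (trans (*-congˡ (+-identityʳ 1#)) (*-identityʳ s))) (proj₂ (archimedean s))
           , ≤-reflexive (sym (*-identityʳ (fromℕ b ^ N)))

  -- A list represents the finite set of its entries; repetitions are allowed
  -- and not counted.
  ∣_∣ₛ : ∀ {d} → List (Vector ℝ d) → ℕ
  ∣ A ∣ₛ = length (deduplicate (Pointwise.decidable _≟_) A)

  infixr 7 _∙_
  infixl 6 _⊕_

  _∙_ : ∀ {d} → Mat ℤ d → List (Vector ℝ d) → List (Vector ℝ d)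
  L ∙ A = map (mapMat fromℤ L *ᵥ_) A

  _⊕_ : ∀ {d} → List (Vector ℝ d) → List (Vector ℝ d) → List (Vector ℝ d)
  _⊕_ = cartesianProductWith (Vector.zipWith _+_)

-- The relations between the finitely many coordinates of A can be realised by integers, so A may
-- be taken in ℤᵈ. If |L₁A + L₂A| ≤ h|A|, the Plünnecke–Petridis inequality and Ruzsa covering bound
-- the iterated difference sets of L₂A, and comparing binary digits with respect to a covering set
-- yields a long progression P with |L₂A + P| small. Passing back and forth between L₁A and L₂A by
-- the triangle inequality turns the direction of P into d such directions, independent because
-- L₁, L₂ are irreducible. In the coordinates they define, L₂A lies on few lines parallel to each
-- axis, so a Brunn–Minkowski inequality proved layer by layer holds for all L₁X + L₂Y with
-- X, Y ⊆ A up to an error of lower order.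
--
-- Coprimality enters through lattices: if Λ ⊆ ℤᵈ has full rank, then L₁Λ has index at least
-- |det L₁| in L₁Λ + L₂Λ, and L₂Λ index at least |det L₂|. By induction on |A|, unless splitting
-- off a class already gains a fixed proportion of |A|, there is a large P ⊆ A for which, with Λ
-- generated by P − P, the set L₂P meets |det L₁| cosets of L₁Λ and L₁P meets |det L₂| cosets of
-- L₂Λ. Either all classes have nearly the extremal size, and summing Brunn–Minkowski over pairs of
-- classes gives the constant, or removing the smallest class is again a gain. For s large the error
-- |A|^(1 - 1/s) is additive up to a factor close to 1, so the gain pays for the splittings.

module Submission where

open import Defs
open import Relation.Nullary using (Dec)

-- Brunn-Minkowski for A as a whole gives only the constant 2^d. The right one comes from cutting:
-- if L₂A splits into m = |det L₁| equal classes modulo L₁Δ, and L₁A into n = |det L₂| equal classes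
-- modulo L₂Δ, where Δ is generated by A - A, then the m n pairs of classes have disjoint sums, and
-- m n ((|A|/n)^(1/d) + (|A|/m)^(1/d))^d = H|A| with H = (m^(1/d) + n^(1/d))^d. The obstacle is that
-- classes may be too few or unequal. In the critical cases two estimates compete, and combining
-- them with weights H and 1 leaves a surplus with factor κ = 1/(1 + H). But a splitting replaces
-- the granted error E(a + b) by E(a) + E(b), which for E(n) = D n^(1 - 1/s) costs a factor up to 1
-- + 1/s. At most three parts arise, so an s large in terms of κ makes the surplus prevail. The same
-- s must suit the geometry: for |A| about r^(2τ) the number of lines is smaller than |A| by a
-- factor of order 2^τ, a fixed power of |A|, since iterated sums grow only polynomially in τ while
-- the progression has length 2^(2τ).

-- Cardinalities of lists up to repetition.

module Counting where
  open import Data.Nat.Base hiding (_⊔_)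
  open import Data.Nat.Properties
  open import Data.List.Base using (List; []; _∷_; _++_; map; length; filter; concatMap; cartesianProduct; [_])
  open import Data.List.Properties using (length-++; length-map)
  open import Data.List.Membership.Propositional public using (_∈_)
  open import Data.List.Membership.Propositional.Properties
  open import Data.List.Relation.Unary.Any using (here; there)
  open import Data.List.Relation.Unary.All using (All; []; _∷_)
  import Data.List.Relation.Unary.All as All
  import Data.List.Relation.Unary.All.Properties as All
  open import Data.List.Relation.Unary.AllPairs using (AllPairs; []; _∷_)
  open import Data.List.Relation.Unary.Unique.Propositional using (Unique)
  import Data.List.Relation.Unary.Unique.Propositional.Properties as Unique
  open import Data.Nat.ListAction public using (sum)
  open import Data.Product.Base using (∃-syntax; _×_; _,_; proj₁; proj₂)
  open import Data.Sum.Base using (_⊎_; inj₁; inj₂)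
  open import Data.Empty using (⊥; ⊥-elim)
  open import Relation.Nullary using (Dec; yes; no; ¬_)
  open import Relation.Binary.PropositionalEquality hiding ([_])
  open import Function.Base using (_∘_)

  ∈-++-middle : ∀ {a} {A : Set a} {z y : A} as {bs} → z ∈ as ++ y ∷ bs → z ≡ y ⊎ z ∈ as ++ bs
  ∈-++-middle []       (here z≡y)  = inj₁ z≡y
  ∈-++-middle []       (there z∈)  = inj₂ z∈
  ∈-++-middle (a ∷ as) (here z≡a)  = inj₂ (here z≡a)
  ∈-++-middle (a ∷ as) (there z∈) with ∈-++-middle as z∈
  ... | inj₁ z≡y = inj₁ z≡y
  ... | inj₂ z∈′ = inj₂ (there z∈′)

  -- Stated for a relation and an arbitrary apartness `_#_`: besides inequality it is applied to
  -- points of real space, distinct up to pointwise equality, and to representatives of different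
  -- classes. The element found for the head of `xs` is deleted from `ys`; no later element can need
  -- it.
  pigeonhole : ∀ {a b r p} {A : Set a} {B : Set b} (_#_ : A → A → Set p) (R : A → B → Set r) xs ys →
    AllPairs _#_ xs → (∀ {x} → x ∈ xs → ∃[ y ] y ∈ ys × R x y) →
    (∀ {x x′ y} → R x y → R x′ y → ¬ x # x′) → length xs ≤ length ys
  pigeonhole _#_ R []       ys _        _     _   = z≤n
  pigeonhole _#_ R (x ∷ xs) ys (apart ∷ aparts) total inj with total (here refl)
  ... | y , y∈ys , Rxy with ∈-∃++ y∈ys
  ... | as , bs , refl = begin
    suc (length xs)               ≤⟨ s≤s (pigeonhole _#_ R xs (as ++ bs) aparts total′ inj) ⟩
    suc (length (as ++ bs))       ≡⟨ cong suc (length-++ as) ⟩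
    suc (length as + length bs)   ≡⟨ +-suc (length as) (length bs) ⟨
    length as + suc (length bs)   ≡⟨ length-++ as ⟨
    length (as ++ y ∷ bs)         ∎
    where
    open ≤-Reasoning
    total′ : ∀ {x′} → x′ ∈ xs → ∃[ y′ ] y′ ∈ as ++ bs × R x′ y′
    total′ x′∈ with total (there x′∈)
    ... | y′ , y′∈ , Rx′y′ with ∈-++-middle as y′∈
    ... | inj₂ y′∈″ = y′ , y′∈″ , Rx′y′
    ... | inj₁ refl = ⊥-elim (inj Rxy Rx′y′ (All.lookup apart x′∈))

  argmin : {A : Set} (f : A → ℕ) {x : A} (xs : List A) → x ∈ xs → ∃[ m ] m ∈ xs × (∀ {y} → y ∈ xs → f m ≤ f y)
  argmin f (x ∷ []) _ = x , here refl , λ { (here refl) → ≤-refl }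
  argmin f (x ∷ y ∷ ys) _ with argmin f (y ∷ ys) (here refl)
  ... | m , m∈ , min with ≤-total (f x) (f m)
  ... | inj₁ x≤m = x , here refl , λ { (here refl) → ≤-refl ; (there z∈) → ≤-trans x≤m (min z∈) }
  ... | inj₂ m≤x = m , there m∈ , λ { (here refl) → m≤x ; (there z∈) → min z∈ }

  argmax : {A : Set} (f : A → ℕ) {x : A} (xs : List A) → x ∈ xs → ∃[ m ] m ∈ xs × (∀ {y} → y ∈ xs → f y ≤ f m)
  argmax f (x ∷ []) _ = x , here refl , λ { (here refl) → ≤-refl }
  argmax f (x ∷ y ∷ ys) _ with argmax f (y ∷ ys) (here refl)
  ... | m , m∈ , max with ≤-total (f x) (f m)
  ... | inj₂ m≤x = x , here refl , λ { (here refl) → ≤-refl ; (there z∈) → ≤-trans (max z∈) m≤x }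
  ... | inj₁ x≤m = m , there m∈ , λ { (here refl) → x≤m ; (there z∈) → max z∈ }

  sum-map-≥ : {A : Set} (f : A → ℕ) (c : ℕ) (rs : List A) → (∀ {r} → r ∈ rs → c ≤ f r) → length rs * c ≤ sum (map f rs)
  sum-map-≥ f c [] _ = z≤n
  sum-map-≥ f c (r ∷ rs) p = +-mono-≤ (p (here refl)) (sum-map-≥ f c rs (p ∘ there))

  sum-map-≤ : {A : Set} (f : A → ℕ) (c : ℕ) (rs : List A) → (∀ {r} → r ∈ rs → f r ≤ c) → sum (map f rs) ≤ length rs * c
  sum-map-≤ f c [] _ = z≤n
  sum-map-≤ f c (r ∷ rs) p = +-mono-≤ (p (here refl)) (sum-map-≤ f c rs (p ∘ there))

  length-cartesianProduct : {A B : Set} (X : List A) (Y : List B) → length (cartesianProduct X Y) ≡ length X * length Y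
  length-cartesianProduct [] Y = refl
  length-cartesianProduct (x ∷ X) Y = trans (length-++ (map (x ,_) Y)) (cong₂ _+_ (length-map (x ,_) Y) (length-cartesianProduct X Y))

  module WithEM (em : ∀ (P : Set) → Dec P) where

    abstract
      uniq : {A : Set} → List A → List A
      uniq [] = []
      uniq (x ∷ xs) with em (x ∈ xs)
      ... | yes _ = uniq xs
      ... | no _  = x ∷ uniq xs

      card : {A : Set} → List A → ℕ
      card xs = length (uniq xs)

      ∈-uniq⁻ : {A : Set} {x : A} (xs : List A) → x ∈ uniq xs → x ∈ xs
      ∈-uniq⁻ (x ∷ xs) x∈ with em (x ∈ xs)
      ∈-uniq⁻ (x ∷ xs) x∈         | yes _ = there (∈-uniq⁻ xs x∈)
      ∈-uniq⁻ (x ∷ xs) (here p)   | no _  = here p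
      ∈-uniq⁻ (x ∷ xs) (there x∈) | no _  = there (∈-uniq⁻ xs x∈)

      ∈-uniq⁺ : {A : Set} {x : A} (xs : List A) → x ∈ xs → x ∈ uniq xs
      ∈-uniq⁺ (y ∷ xs) x∈ with em (y ∈ xs)
      ∈-uniq⁺ (y ∷ xs) (here refl) | yes p = ∈-uniq⁺ xs p
      ∈-uniq⁺ (y ∷ xs) (there x∈)  | yes p = ∈-uniq⁺ xs x∈
      ∈-uniq⁺ (y ∷ xs) (here refl) | no _  = here refl
      ∈-uniq⁺ (y ∷ xs) (there x∈)  | no _  = there (∈-uniq⁺ xs x∈)

      uniq-unique : {A : Set} (xs : List A) → Unique (uniq xs)
      uniq-unique [] = []
      uniq-unique (x ∷ xs) with em (x ∈ xs)
      ... | yes _  = uniq-unique xs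
      ... | no x∉ = All.tabulate (λ y∈ x≡y → x∉ (subst (_∈ xs) (sym x≡y) (∈-uniq⁻ xs y∈))) ∷ uniq-unique xs

      card-rel : {A B : Set} (R : A → B → Set) {X : List A} {Y : List B} →
        (∀ {x} → x ∈ X → ∃[ y ] y ∈ Y × R x y) → (∀ {x x′ y} → R x y → R x′ y → x ≡ x′) → card X ≤ card Y
      card-rel R {X} {Y} total inj = pigeonhole _≢_ R (uniq X) (uniq Y) (uniq-unique X)
        (λ x∈ → let y , y∈ , r = total (∈-uniq⁻ X x∈) in y , ∈-uniq⁺ Y y∈ , r)
        (λ r r′ x≢ → x≢ (inj r r′))

      card-⊆ : {A : Set} {X Y : List A} → (∀ {x} → x ∈ X → x ∈ Y) → card X ≤ card Y
      card-⊆ sub = card-rel _≡_ (λ x∈ → _ , sub x∈ , refl) (λ { refl refl → refl })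

      card-inj : {A B : Set} (f : A → B) {X : List A} {Y : List B} → (∀ {x} → x ∈ X → f x ∈ Y) →
        (∀ {x x′} → f x ≡ f x′ → x ≡ x′) → card X ≤ card Y
      card-inj f into inj = card-rel (λ x y → f x ≡ y) (λ x∈ → _ , into x∈ , refl) (λ p q → inj (trans p (sym q)))

      card-surj : {A B : Set} (f : A → B) {X : List A} {Y : List B} →
        (∀ {y} → y ∈ Y → ∃[ x ] x ∈ X × y ≡ f x) → card Y ≤ card X
      card-surj f sur = card-rel (λ y x → y ≡ f x) sur (λ { refl refl → refl })

      card-unique : {A : Set} {X : List A} → Unique X → card X ≡ length X
      card-unique {X = X} u = ≤-antisym
        (pigeonhole _≢_ _≡_ (uniq X) X (uniq-unique X) (λ x∈ → _ , ∈-uniq⁻ X x∈ , refl) (λ { refl refl n → n refl }))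
        (pigeonhole _≢_ _≡_ X (uniq X) u (λ x∈ → _ , ∈-uniq⁺ X x∈ , refl) (λ { refl refl n → n refl }))

      card≤length : {A : Set} (X : List A) → card X ≤ length X
      card≤length X = pigeonhole _≢_ _≡_ (uniq X) X (uniq-unique X) (λ x∈ → _ , ∈-uniq⁻ X x∈ , refl) (λ { refl refl n → n refl })

      card-map : {A B : Set} (f : A → B) → (∀ {x x′} → f x ≡ f x′ → x ≡ x′) → (X : List A) → card (map f X) ≡ card X
      card-map f inj X = ≤-antisym
        (card-surj f {X} {map f X} (λ y∈ → let x , x∈ , e = ∈-map⁻ f y∈ in x , x∈ , e))
        (card-inj f {X} {map f X} (∈-map⁺ f) inj)

      card-pos : {A : Set} {X : List A} {x : A} → x ∈ X → 1 ≤ card X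
      card-pos {X = X} x∈ with uniq X | ∈-uniq⁺ X x∈
      ... | _ ∷ _ | _ = s≤s z≤n

      card≡length-uniq : {A : Set} (X : List A) → card X ≡ length (uniq X)
      card≡length-uniq X = refl

      card-[] : {A : Set} → card {A} [] ≡ 0
      card-[] = refl

      card-nonempty : {A : Set} (X : List A) → 1 ≤ card X → ∃[ x ] x ∈ X
      card-nonempty (x ∷ X) _ = x , here refl

      card-product : {A B : Set} (X : List A) (Y : List B) → card (cartesianProduct X Y) ≡ card X * card Y
      card-product X Y = begin
        card (cartesianProduct X Y)               ≡⟨ ≤-antisym (card-⊆ to) (card-⊆ from) ⟩
        card (cartesianProduct (uniq X) (uniq Y)) ≡⟨ card-unique (Unique.cartesianProduct⁺ (uniq-unique X) (uniq-unique Y)) ⟩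
        length (cartesianProduct (uniq X) (uniq Y)) ≡⟨ length-cartesianProduct (uniq X) (uniq Y) ⟩
        card X * card Y                           ∎
        where
        open ≡-Reasoning
        to : ∀ {z} → z ∈ cartesianProduct X Y → z ∈ cartesianProduct (uniq X) (uniq Y)
        to z∈ = let p , q = ∈-cartesianProduct⁻ X Y z∈ in ∈-cartesianProduct⁺ (∈-uniq⁺ X p) (∈-uniq⁺ Y q)
        from : ∀ {z} → z ∈ cartesianProduct (uniq X) (uniq Y) → z ∈ cartesianProduct X Y
        from z∈ = let p , q = ∈-cartesianProduct⁻ (uniq X) (uniq Y) z∈ in ∈-cartesianProduct⁺ (∈-uniq⁻ X p) (∈-uniq⁻ Y q)

      card-×-≤ : {A B C : Set} (R : A × B → C → Set) {X : List A} {Y : List B} {Z : List C} →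
        (∀ {x y} → x ∈ X → y ∈ Y → ∃[ z ] z ∈ Z × R (x , y) z) → (∀ {p p′ z} → R p z → R p′ z → p ≡ p′) →
        card X * card Y ≤ card Z
      card-×-≤ R {X} {Y} {Z} total inj = subst (_≤ card Z) (card-product X Y)
        (card-rel R (λ p∈ → let x∈ , y∈ = ∈-cartesianProduct⁻ X Y p∈ in total x∈ y∈) inj)

      card-≤-× : {A B C : Set} (f : A → B → C) {X : List A} {Y : List B} {Z : List C} →
        (∀ {z} → z ∈ Z → ∃[ x ] ∃[ y ] x ∈ X × y ∈ Y × z ≡ f x y) → card Z ≤ card X * card Y
      card-≤-× f {X} {Y} {Z} sur = subst (card Z ≤_) (card-product X Y)
        (card-surj (λ p → f (proj₁ p) (proj₂ p)) (λ z∈ → let x , y , x∈ , y∈ , e = sur z∈ in (x , y) , ∈-cartesianProduct⁺ x∈ y∈ , e))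

      card-++-≤ : {A : Set} (X Y : List A) → card (X ++ Y) ≤ card X + card Y
      card-++-≤ X Y = begin
        card (X ++ Y)                ≤⟨ card-⊆ (λ z∈ → sub (∈-++⁻ X z∈)) ⟩
        card (uniq X ++ uniq Y)      ≤⟨ card≤length (uniq X ++ uniq Y) ⟩
        length (uniq X ++ uniq Y)    ≡⟨ length-++ (uniq X) ⟩
        card X + card Y              ∎
        where
        open ≤-Reasoning
        sub : ∀ {z} → z ∈ X ⊎ z ∈ Y → z ∈ uniq X ++ uniq Y
        sub (inj₁ p) = ∈-++⁺ˡ (∈-uniq⁺ X p)
        sub (inj₂ q) = ∈-++⁺ʳ (uniq X) (∈-uniq⁺ Y q)

    Disjoint : {A : Set} → List A → List A → Set
    Disjoint X Y = ∀ {z} → z ∈ X → z ∈ Y → ⊥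

    abstract
      card-++-disjoint : {A : Set} (X Y : List A) → Disjoint X Y → card X + card Y ≤ card (X ++ Y)
      card-++-disjoint X Y dis = begin
        card X + card Y              ≡⟨ length-++ (uniq X) ⟨
        length (uniq X ++ uniq Y)    ≡⟨ card-unique (Unique.++⁺ (uniq-unique X) (uniq-unique Y) (λ (p , q) → dis (∈-uniq⁻ X p) (∈-uniq⁻ Y q))) ⟨
        card (uniq X ++ uniq Y)      ≤⟨ card-⊆ (λ z∈ → sub (∈-++⁻ (uniq X) z∈)) ⟩
        card (X ++ Y)                ∎
        where
        open ≤-Reasoning
        sub : ∀ {z} → z ∈ uniq X ⊎ z ∈ uniq Y → z ∈ X ++ Y
        sub (inj₁ p) = ∈-++⁺ˡ (∈-uniq⁻ X p)
        sub (inj₂ q) = ∈-++⁺ʳ X (∈-uniq⁻ Y q)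

    card-disjoint : {A : Set} (X Y : List A) {Z : List A} → Disjoint X Y →
      (∀ {z} → z ∈ X → z ∈ Z) → (∀ {z} → z ∈ Y → z ∈ Z) → card X + card Y ≤ card Z
    card-disjoint X Y {Z} dis p q = ≤-trans (card-++-disjoint X Y dis) (card-⊆ (λ z∈ → sub (∈-++⁻ X z∈)))
      where
      sub : ∀ {z} → z ∈ X ⊎ z ∈ Y → z ∈ Z
      sub (inj₁ r) = p r
      sub (inj₂ r) = q r

    Σcard : {A B : Set} → (A → List B) → List A → ℕ
    Σcard F rs = sum (map (λ r → card (F r)) rs)

    Σcard-≤ : {A B : Set} (F : A → List B) (rs : List A) {Z : List B} →
      AllPairs (λ r r′ → Disjoint (F r) (F r′)) rs → (∀ {r z} → r ∈ rs → z ∈ F r → z ∈ Z) → Σcard F rs ≤ card Z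
    Σcard-≤ F [] _ _ = z≤n
    Σcard-≤ {B = B} F (r ∷ rs) {Z} (d ∷ ds) sub = ≤-trans
      (+-monoʳ-≤ (card (F r)) (Σcard-≤ F rs {concatMap F rs} ds (λ r∈ z∈ → ∈-concatMap⁺ F (go r∈ z∈))))
      (card-disjoint (F r) (concatMap F rs) dis (sub (here refl)) (λ z∈ → let r′ , r′∈ , z∈′ = back (∈-concatMap⁻ F z∈) in sub (there r′∈) z∈′))
      where
      open import Data.List.Relation.Unary.Any using (Any)
      go : ∀ {r′ z rs} → r′ ∈ rs → z ∈ F r′ → Any (λ x → z ∈ F x) rs
      go (here refl) z∈ = here z∈
      go (there p) z∈ = there (go p z∈)
      back : ∀ {z rs} → Any (λ x → z ∈ F x) rs → ∃[ r′ ] r′ ∈ rs × z ∈ F r′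
      back (here p) = _ , here refl , p
      back (there p) = let r′ , q , s = back p in r′ , there q , s
      dis : Disjoint (F r) (concatMap F rs)
      dis z∈ z∈′ = let r′ , r′∈ , q = back (∈-concatMap⁻ F z∈′) in All.lookup d r′∈ z∈ q

    Σcard-≥ : {A B : Set} (F : A → List B) (rs : List A) {Z : List B} →
      (∀ {z} → z ∈ Z → ∃[ r ] r ∈ rs × z ∈ F r) → card Z ≤ Σcard F rs
    Σcard-≥ F [] {[]} cov = ≤-reflexive card-[]
    Σcard-≥ F [] {z ∷ Z} cov with cov (here refl)
    ... | _ , () , _
    Σcard-≥ F (r ∷ rs) {Z} cov = begin
      card Z                          ≤⟨ card-⊆ split ⟩
      card (F r ++ filter rest? Z)    ≤⟨ card-++-≤ (F r) (filter rest? Z) ⟩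
      card (F r) + card (filter rest? Z) ≤⟨ +-monoʳ-≤ (card (F r)) (Σcard-≥ F rs (λ z∈ → proj₂ (∈-filter⁻ rest? {xs = Z} z∈))) ⟩
      Σcard F (r ∷ rs)                ∎
      where
      open ≤-Reasoning
      rest? = λ z → em (∃[ r′ ] r′ ∈ rs × z ∈ F r′)
      split : ∀ {z} → z ∈ Z → z ∈ F r ++ filter rest? Z
      split z∈ with cov z∈
      ... | _ , here refl , q = ∈-++⁺ˡ q
      ... | r′ , there r′∈ , q = ∈-++⁺ʳ (F r) (∈-filter⁺ rest? z∈ (r′ , r′∈ , q))

    sub : {A : Set} → (A → Set) → List A → List A
    sub P = filter (λ x → em (P x))

    ∈-sub⁺ : {A : Set} (P : A → Set) {X : List A} {x : A} → x ∈ X → P x → x ∈ sub P X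
    ∈-sub⁺ P = ∈-filter⁺ (λ x → em (P x))

    ∈-sub⁻ : {A : Set} (P : A → Set) {X : List A} {x : A} → x ∈ sub P X → x ∈ X × P x
    ∈-sub⁻ P {X} = ∈-filter⁻ (λ x → em (P x)) {xs = X}

    card-sub : {A : Set} (P : A → Set) (X : List A) → card X ≡ card (sub P X) + card (sub (λ x → ¬ P x) X)
    card-sub P X = ≤-antisym
      (≤-trans (card-⊆ split) (card-++-≤ (sub P X) (sub (λ x → ¬ P x) X)))
      (card-disjoint (sub P X) (sub (λ x → ¬ P x) X)
        (λ p q → proj₂ (∈-sub⁻ (λ x → ¬ P x) {X} q) (proj₂ (∈-sub⁻ P {X} p)))
        (λ p → proj₁ (∈-sub⁻ P {X} p)) (λ q → proj₁ (∈-sub⁻ (λ x → ¬ P x) {X} q)))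
      where
      split : ∀ {z} → z ∈ X → z ∈ sub P X ++ sub (λ x → ¬ P x) X
      split {z} z∈ with em (P z)
      ... | yes p = ∈-++⁺ˡ (∈-sub⁺ P z∈ p)
      ... | no ¬p = ∈-++⁺ʳ (sub P X) (∈-sub⁺ (λ x → ¬ P x) z∈ ¬p)

    collision-rel : {A B : Set} (R : A → B → Set) {X : List A} {Y : List B} → (∀ {x} → x ∈ X → ∃[ y ] y ∈ Y × R x y) →
      card Y < card X → ∃[ x ] ∃[ x′ ] ∃[ y ] (x ∈ X × x′ ∈ X × x ≢ x′ × R x y × R x′ y)
    collision-rel R {X} {Y} total lt with em (∃[ x ] ∃[ x′ ] ∃[ y ] (x ∈ X × x′ ∈ X × x ≢ x′ × R x y × R x′ y))
    ... | yes p = p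
    ... | no ¬p = ⊥-elim (<⇒≱ lt (card-rel (λ x y → x ∈ X × R x y) (λ x∈ → let y , y∈ , r = total x∈ in y , y∈ , x∈ , r) inj))
      where
      inj : ∀ {x x′ y} → x ∈ X × R x y → x′ ∈ X × R x′ y → x ≡ x′
      inj {x} {x′} (p , e) (p′ , e′) with em (x ≡ x′)
      ... | yes q = q
      ... | no q = ⊥-elim (¬p (x , x′ , _ , p , p′ , q , e , e′))

    ⊆-card-≥ : {A : Set} {X Y : List A} → (∀ {x} → x ∈ X → x ∈ Y) → card Y ≤ card X → ∀ {y} → y ∈ Y → y ∈ X
    ⊆-card-≥ {X = X} {Y} s le {y} y∈ with em (y ∈ X)
    ... | yes p = p
    ... | no y∉ = ⊥-elim (<⇒≱ (≤-trans (+-monoˡ-≤ (card X) (card-pos {X = [ y ]} (here refl)))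
      (card-disjoint [ y ] X {Y} (λ { (here refl) q → y∉ q }) (λ { (here refl) → y∈ }) s)) le)

    -- Excluded middle decides whether a witness exists, and the function is defined from that
    -- decision; `default` is its value where there is none.
    choice : {A B : Set} (P : A → B → Set) → B → ∃[ f ] (∀ a b → P a b → P a (f a))
    choice {A} {B} P default = f , f-spec
      where
      f : A → B
      f a with em (∃[ b ] P a b)
      ... | yes (b , _) = b
      ... | no _ = default
      f-spec : ∀ a b → P a b → P a (f a)
      f-spec a b p with em (∃[ b ] P a b)
      ... | yes (_ , q) = q
      ... | no ¬p = ⊥-elim (¬p (b , p))

    -- A maximal pairwise separated family. No transitivity is asked of the relation: in
    -- `ruzsa-covering` it says that two translates of a set meet.
    record Transversal {A : Set} (_~_ : A → A → Set) (X : List A) : Set where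
      field
        reps     : List A
        reps⊆    : ∀ {r} → r ∈ reps → r ∈ X
        separate : AllPairs (λ r r′ → ¬ r ~ r′) reps
        covers   : ∀ {x} → x ∈ X → ∃[ r ] r ∈ reps × x ~ r

    transversal : {A : Set} (_~_ : A → A → Set) → (∀ {x} → x ~ x) → (∀ {x y} → x ~ y → y ~ x) →
      (X : List A) → Transversal _~_ X
    transversal _~_ ~refl ~sym [] = record { reps = [] ; reps⊆ = λ () ; separate = [] ; covers = λ () }
    transversal _~_ ~refl ~sym (x ∷ X) with transversal _~_ ~refl ~sym X
    ... | T with em (∃[ r ] r ∈ Transversal.reps T × x ~ r)
    ... | yes (r , r∈ , x~r) = record
      { reps = reps ; reps⊆ = there ∘ reps⊆ ; separate = separate
      ; covers = λ { (here refl) → r , r∈ , x~r ; (there y∈) → covers y∈ } }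
      where open Transversal T
    ... | no none = record
      { reps = x ∷ reps
      ; reps⊆ = λ { (here refl) → here refl ; (there r∈) → there (reps⊆ r∈) }
      ; separate = All.tabulate (λ r∈ x~r → none (_ , r∈ , x~r)) ∷ separate
      ; covers = λ { (here refl) → x , here refl , ~refl ; (there y∈) → let r , r∈ , y~r = covers y∈ in r , there r∈ , y~r } }
      where open Transversal T

-- Integer vectors and the verification of linear identities.

module Vectors where
  open import Data.Nat.Base using (ℕ; zero; suc)
  open import Data.Integer.Base as ℤ using (ℤ; +_; 0ℤ; 1ℤ; -1ℤ)
  import Data.Integer.Properties as ℤ
  open import Data.Fin.Base using (Fin; zero; suc)
  open import Data.Vec.Base using (Vec; []; _∷_; zipWith; map; replicate; lookup)
  open import Relation.Binary.PropositionalEquality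

  V : ℕ → Set
  V d = Vec ℤ d

  infixl 6 _⊕_ _⊖_
  infixr 7 _⋆_

  _⊕_ : ∀ {d} → V d → V d → V d
  _⊕_ = zipWith ℤ._+_

  _⋆_ : ∀ {d} → ℤ → V d → V d
  k ⋆ v = map (k ℤ.*_) v

  ⊝_ : ∀ {d} → V d → V d
  ⊝ v = map ℤ.-_ v

  _⊖_ : ∀ {d} → V d → V d → V d
  u ⊖ v = u ⊕ ⊝ v

  0v : ∀ {d} → V d
  0v = replicate _ 0ℤ

  ⊕-comm : ∀ {d} (u v : V d) → u ⊕ v ≡ v ⊕ u
  ⊕-comm [] [] = refl
  ⊕-comm (x ∷ u) (y ∷ v) = cong₂ _∷_ (ℤ.+-comm x y) (⊕-comm u v)

  ⊕-assoc : ∀ {d} (u v w : V d) → (u ⊕ v) ⊕ w ≡ u ⊕ (v ⊕ w)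
  ⊕-assoc [] [] [] = refl
  ⊕-assoc (x ∷ u) (y ∷ v) (z ∷ w) = cong₂ _∷_ (ℤ.+-assoc x y z) (⊕-assoc u v w)

  ⊕-identityʳ : ∀ {d} (u : V d) → u ⊕ 0v ≡ u
  ⊕-identityʳ [] = refl
  ⊕-identityʳ (x ∷ u) = cong₂ _∷_ (ℤ.+-identityʳ x) (⊕-identityʳ u)

  ⊕-identityˡ : ∀ {d} (u : V d) → 0v ⊕ u ≡ u
  ⊕-identityˡ u = trans (⊕-comm 0v u) (⊕-identityʳ u)

  ⋆-distribˡ : ∀ {d} k (u v : V d) → k ⋆ (u ⊕ v) ≡ k ⋆ u ⊕ k ⋆ v
  ⋆-distribˡ k [] [] = refl
  ⋆-distribˡ k (x ∷ u) (y ∷ v) = cong₂ _∷_ (ℤ.*-distribˡ-+ k x y) (⋆-distribˡ k u v)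

  ⋆-distribʳ : ∀ {d} j k (u : V d) → (j ℤ.+ k) ⋆ u ≡ j ⋆ u ⊕ k ⋆ u
  ⋆-distribʳ j k [] = refl
  ⋆-distribʳ j k (x ∷ u) = cong₂ _∷_ (ℤ.*-distribʳ-+ x j k) (⋆-distribʳ j k u)

  ⋆-assoc : ∀ {d} j k (u : V d) → (j ℤ.* k) ⋆ u ≡ j ⋆ k ⋆ u
  ⋆-assoc j k [] = refl
  ⋆-assoc j k (x ∷ u) = cong₂ _∷_ (ℤ.*-assoc j k x) (⋆-assoc j k u)

  1⋆ : ∀ {d} (u : V d) → 1ℤ ⋆ u ≡ u
  1⋆ [] = refl
  1⋆ (x ∷ u) = cong₂ _∷_ (ℤ.*-identityˡ x) (1⋆ u)

  0⋆ : ∀ {d} (u : V d) → 0ℤ ⋆ u ≡ 0v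
  0⋆ [] = refl
  0⋆ (x ∷ u) = cong₂ _∷_ refl (0⋆ u)

  ⋆0 : ∀ {d} k → k ⋆ 0v {d} ≡ 0v
  ⋆0 {zero} k = refl
  ⋆0 {suc d} k = cong₂ _∷_ (ℤ.*-zeroʳ k) (⋆0 k)

  -1⋆ : ∀ {d} (u : V d) → -1ℤ ⋆ u ≡ ⊝ u
  -1⋆ [] = refl
  -1⋆ (x ∷ u) = cong₂ _∷_ (ℤ.-1*i≡-i x) (-1⋆ u)

  combination : ∀ {d n} → Vec ℤ n → Vec (V d) n → V d
  combination [] [] = 0v
  combination (k ∷ ks) (v ∷ vs) = k ⋆ v ⊕ combination ks vs

  private
    interchange : ∀ {d} (a b c e : V d) → (a ⊕ b) ⊕ (c ⊕ e) ≡ (a ⊕ c) ⊕ (b ⊕ e)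
    interchange a b c e = begin
      (a ⊕ b) ⊕ (c ⊕ e) ≡⟨ ⊕-assoc a b (c ⊕ e) ⟩
      a ⊕ (b ⊕ (c ⊕ e)) ≡⟨ cong (a ⊕_) (⊕-assoc b c e) ⟨
      a ⊕ ((b ⊕ c) ⊕ e) ≡⟨ cong (λ z → a ⊕ (z ⊕ e)) (⊕-comm b c) ⟩
      a ⊕ ((c ⊕ b) ⊕ e) ≡⟨ cong (a ⊕_) (⊕-assoc c b e) ⟩
      a ⊕ (c ⊕ (b ⊕ e)) ≡⟨ ⊕-assoc a c (b ⊕ e) ⟨
      (a ⊕ c) ⊕ (b ⊕ e) ∎
      where open ≡-Reasoning

  combination-⊕ : ∀ {d n} (a b : Vec ℤ n) (vs : Vec (V d) n) → combination (a ⊕ b) vs ≡ combination a vs ⊕ combination b vs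
  combination-⊕ [] [] [] = sym (⊕-identityʳ 0v)
  combination-⊕ (x ∷ a) (y ∷ b) (v ∷ vs) = trans (cong₂ _⊕_ (⋆-distribʳ x y v) (combination-⊕ a b vs))
    (interchange (x ⋆ v) (y ⋆ v) (combination a vs) (combination b vs))

  combination-⋆ : ∀ {d n} k (a : Vec ℤ n) (vs : Vec (V d) n) → combination (k ⋆ a) vs ≡ k ⋆ combination a vs
  combination-⋆ k [] [] = sym (⋆0 k)
  combination-⋆ k (x ∷ a) (v ∷ vs) = trans (cong₂ _⊕_ (⋆-assoc k x v) (combination-⋆ k a vs))
    (sym (⋆-distribˡ k (x ⋆ v) (combination a vs)))

  combination-0 : ∀ {d n} (vs : Vec (V d) n) → combination 0v vs ≡ 0v
  combination-0 [] = refl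
  combination-0 (v ∷ vs) = trans (cong₂ _⊕_ (0⋆ v) (combination-0 vs)) (⊕-identityʳ 0v)

  unit : ∀ {n} → Fin n → V n
  unit zero = 1ℤ ∷ 0v
  unit (suc i) = 0ℤ ∷ unit i

  combination-unit : ∀ {d n} (i : Fin n) (vs : Vec (V d) n) → combination (unit i) vs ≡ lookup vs i
  combination-unit zero (v ∷ vs) = trans (cong₂ _⊕_ (1⋆ v) (combination-0 vs)) (⊕-identityʳ v)
  combination-unit (suc i) (v ∷ vs) = trans (cong₂ _⊕_ (0⋆ v) (combination-unit i vs)) (⊕-identityˡ (lookup vs i))

  infixl 6 _:+_ _:-_
  infixr 7 _:*_

  data Expr (n : ℕ) : Set where
    var       : Fin n → Expr n
    _:+_ _:-_ : Expr n → Expr n → Expr n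
    :-_       : Expr n → Expr n
    _:*_      : ℤ → Expr n → Expr n
    :0        : Expr n

  ⟦_⟧ : ∀ {d n} → Expr n → Vec (V d) n → V d
  ⟦ var i ⟧ ρ   = lookup ρ i
  ⟦ a :+ b ⟧ ρ  = ⟦ a ⟧ ρ ⊕ ⟦ b ⟧ ρ
  ⟦ a :- b ⟧ ρ  = ⟦ a ⟧ ρ ⊖ ⟦ b ⟧ ρ
  ⟦ :- a ⟧ ρ    = ⊝ ⟦ a ⟧ ρ
  ⟦ k :* a ⟧ ρ  = k ⋆ ⟦ a ⟧ ρ
  ⟦ :0 ⟧ ρ      = 0v

  coefficients : ∀ {n} → Expr n → V n
  coefficients (var i)  = unit i
  coefficients (a :+ b) = coefficients a ⊕ coefficients b
  coefficients (a :- b) = coefficients a ⊕ -1ℤ ⋆ coefficients b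
  coefficients (:- a)   = -1ℤ ⋆ coefficients a
  coefficients (k :* a) = k ⋆ coefficients a
  coefficients :0       = 0v

  ⟦⟧-combination : ∀ {d n} (e : Expr n) (ρ : Vec (V d) n) → ⟦ e ⟧ ρ ≡ combination (coefficients e) ρ
  ⟦⟧-combination (var i) ρ = sym (combination-unit i ρ)
  ⟦⟧-combination (a :+ b) ρ = trans (cong₂ _⊕_ (⟦⟧-combination a ρ) (⟦⟧-combination b ρ))
    (sym (combination-⊕ (coefficients a) (coefficients b) ρ))
  ⟦⟧-combination (a :- b) ρ = trans (cong₂ _⊕_ (⟦⟧-combination a ρ) (trans (cong ⊝_ (⟦⟧-combination b ρ))
      (trans (sym (-1⋆ _)) (sym (combination-⋆ -1ℤ (coefficients b) ρ)))))
    (sym (combination-⊕ (coefficients a) (-1ℤ ⋆ coefficients b) ρ))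
  ⟦⟧-combination (:- a) ρ = trans (cong ⊝_ (⟦⟧-combination a ρ))
    (trans (sym (-1⋆ _)) (sym (combination-⋆ -1ℤ (coefficients a) ρ)))
  ⟦⟧-combination (k :* a) ρ = trans (cong (k ⋆_) (⟦⟧-combination a ρ)) (sym (combination-⋆ k (coefficients a) ρ))
  ⟦⟧-combination :0 ρ = sym (combination-0 ρ)

  -- Identities between ℤ-linear expressions are decided by comparing coefficients.
  linear : ∀ {d n} (a b : Expr n) → coefficients a ≡ coefficients b → (ρ : Vec (V d) n) → ⟦ a ⟧ ρ ≡ ⟦ b ⟧ ρ
  linear a b eq ρ = trans (⟦⟧-combination a ρ) (trans (cong (λ c → combination c ρ) eq) (sym (⟦⟧-combination b ρ)))

  x₀ : ∀ {n} → Expr (suc n)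
  x₀ = var zero
  x₁ : ∀ {n} → Expr (suc (suc n))
  x₁ = var (suc zero)
  x₂ : ∀ {n} → Expr (suc (suc (suc n)))
  x₂ = var (suc (suc zero))
  x₃ : ∀ {n} → Expr (suc (suc (suc (suc n))))
  x₃ = var (suc (suc (suc zero)))
  x₄ : ∀ {n} → Expr (suc (suc (suc (suc (suc n)))))
  x₄ = var (suc (suc (suc (suc zero))))
  x₅ : ∀ {n} → Expr (suc (suc (suc (suc (suc (suc n))))))
  x₅ = var (suc (suc (suc (suc (suc zero)))))

  ⊕-cancelʳ : ∀ {d} (u v w : V d) → u ⊕ w ≡ v ⊕ w → u ≡ v
  ⊕-cancelʳ u v w eq = trans (linear x₀ (x₀ :+ x₁ :- x₁) refl (u ∷ w ∷ []))
    (trans (cong (_⊖ w) eq) (linear (x₀ :+ x₁ :- x₁) x₀ refl (v ∷ w ∷ [])))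

  ⊕-cancelˡ : ∀ {d} (w u v : V d) → w ⊕ u ≡ w ⊕ v → u ≡ v
  ⊕-cancelˡ w u v eq = ⊕-cancelʳ u v w (trans (⊕-comm u w) (trans eq (⊕-comm w v)))

  ⊖≡0 : ∀ {d} (u v : V d) → u ⊖ v ≡ 0v → u ≡ v
  ⊖≡0 u v eq = trans (linear x₀ ((x₀ :- x₁) :+ x₁) refl (u ∷ v ∷ [])) (trans (cong (_⊕ v) eq) (⊕-identityˡ v))

-- Sumset inequalities and a long progression along which a set barely grows.

module Sumsets (em : ∀ (P : Set) → Dec P) where
  open Counting
  open WithEM em
  open Vectors
  open import Data.Nat.Base hiding (_⊔_)
  open import Data.Nat.Properties
  open import Data.Integer.Base as ℤ using (ℤ) renaming (+_ to pos)
  open import Data.List.Base using (List; []; _∷_; _++_; map; length; cartesianProductWith; cartesianProduct; upTo; [_])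
  open import Data.List.Properties using (length-applyUpTo)
  open import Data.List.Membership.Propositional.Properties
  open import Data.List.Relation.Unary.Any using (here; there)
  open import Data.List.Relation.Unary.AllPairs using (AllPairs; []; _∷_)
  import Data.List.Relation.Unary.AllPairs as AllPairs
  open import Data.Vec.Base as Vec using ([]; _∷_)
  open import Data.Product.Base using (∃; ∃-syntax; _×_; _,_; proj₁; proj₂)
  open import Data.Empty using (⊥-elim)
  open import Relation.Nullary using (yes; no; ¬_)
  open import Relation.Binary.PropositionalEquality hiding ([_])
  open import Function.Base using (id; case_of_)

  infixl 6 _⊞_ _⊟_

  abstract
    _⊞_ : ∀ {d} → List (V d) → List (V d) → List (V d)
    _⊞_ = cartesianProductWith _⊕_

    _⊟_ : ∀ {d} → List (V d) → List (V d) → List (V d)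
    _⊟_ = cartesianProductWith _⊖_

    ∈-⊞⁺ : ∀ {d} {X Y : List (V d)} {x y} → x ∈ X → y ∈ Y → x ⊕ y ∈ X ⊞ Y
    ∈-⊞⁺ = ∈-cartesianProductWith⁺ _⊕_

    ∈-⊞⁻ : ∀ {d} {X Y : List (V d)} {z} → z ∈ X ⊞ Y → ∃[ x ] ∃[ y ] (x ∈ X × y ∈ Y × z ≡ x ⊕ y)
    ∈-⊞⁻ {X = X} {Y} = ∈-cartesianProductWith⁻ _⊕_ X Y

    ∈-⊟⁺ : ∀ {d} {X Y : List (V d)} {x y} → x ∈ X → y ∈ Y → x ⊖ y ∈ X ⊟ Y
    ∈-⊟⁺ = ∈-cartesianProductWith⁺ _⊖_

    ∈-⊟⁻ : ∀ {d} {X Y : List (V d)} {z} → z ∈ X ⊟ Y → ∃[ x ] ∃[ y ] (x ∈ X × y ∈ Y × z ≡ x ⊖ y)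
    ∈-⊟⁻ {X = X} {Y} = ∈-cartesianProductWith⁻ _⊖_ X Y

    progression : ∀ {d} → V d → ℕ → List (V d)
    progression v n = map (λ j → pos j ⋆ v) (upTo n)

    ∈-progression⁺ : ∀ {d} {v : V d} {n j} → j < n → pos j ⋆ v ∈ progression v n
    ∈-progression⁺ {v = v} j<n = ∈-map⁺ (λ j → pos j ⋆ v) (∈-upTo⁺ j<n)

    ∈-progression⁻ : ∀ {d} {v : V d} {n z} → z ∈ progression v n → ∃[ j ] j < n × z ≡ pos j ⋆ v
    ∈-progression⁻ {v = v} z∈ = let j , j∈ , e = ∈-map⁻ (λ j → pos j ⋆ v) z∈ in j , ∈-upTo⁻ j∈ , e

  ⊞-mono : ∀ {d} {X X′ Y Y′ : List (V d)} → (∀ {x} → x ∈ X → x ∈ X′) → (∀ {y} → y ∈ Y → y ∈ Y′) → ∀ {z} → z ∈ X ⊞ Y → z ∈ X′ ⊞ Y′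
  ⊞-mono f g z∈ with ∈-⊞⁻ z∈
  ... | x , y , x∈ , y∈ , refl = ∈-⊞⁺ (f x∈) (g y∈)

  card-⊞≥ˡ : ∀ {d} (X Y : List (V d)) {y} → y ∈ Y → card X ≤ card (X ⊞ Y)
  card-⊞≥ˡ X Y {y} y∈ = card-inj (_⊕ y) (λ x∈ → ∈-⊞⁺ x∈ y∈) (⊕-cancelʳ _ _ y)

  card-⊞≥ʳ : ∀ {d} (X Y : List (V d)) {x} → x ∈ X → card Y ≤ card (X ⊞ Y)
  card-⊞≥ʳ X Y {x} x∈ = card-inj (x ⊕_) (λ y∈ → ∈-⊞⁺ x∈ y∈) (⊕-cancelˡ x _ _)

  -- Ruzsa's triangle inequality. One representation z = b - c is fixed for every difference; then
  -- (x, z) is recovered from (x + b, x + c), whose difference gives z, hence b, hence x.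
  triangle : ∀ {d} (X B C : List (V d)) → card X * card (B ⊟ C) ≤ card (X ⊞ B) * card (X ⊞ C)
  triangle {d} X B C = ≤-trans
    (card-×-≤ R {X} {B ⊟ C} {cartesianProduct (X ⊞ B) (X ⊞ C)} total inj)
    (≤-reflexive (card-product (X ⊞ B) (X ⊞ C)))
    where
    P : V d → Set
    P z = ∃[ b ] ∃[ c ] (b ∈ B × c ∈ C × z ≡ b ⊖ c)
    choose : V d → V d × V d
    choose z with em (P z)
    ... | yes (b , c , _) = b , c
    ... | no _ = 0v , 0v
    chosen : ∀ z → P z → proj₁ (choose z) ∈ B × proj₂ (choose z) ∈ C × z ≡ proj₁ (choose z) ⊖ proj₂ (choose z)
    chosen z p with em (P z)
    ... | yes (b , c , q) = q
    ... | no ¬p = ⊥-elim (¬p p)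
    R : V d × V d → V d × V d → Set
    R (x , z) pq = (z ≡ proj₁ (choose z) ⊖ proj₂ (choose z)) × pq ≡ (x ⊕ proj₁ (choose z) , x ⊕ proj₂ (choose z))
    total : ∀ {x z} → x ∈ X → z ∈ B ⊟ C → ∃[ w ] w ∈ cartesianProduct (X ⊞ B) (X ⊞ C) × R (x , z) w
    total {x} {z} x∈ z∈ = let b∈ , c∈ , e = chosen z (∈-⊟⁻ z∈) in
      _ , ∈-cartesianProduct⁺ (∈-⊞⁺ x∈ b∈) (∈-⊞⁺ x∈ c∈) , e , refl
    inj : ∀ {p p′ w} → R p w → R p′ w → p ≡ p′
    inj {x , z} {x′ , z′} {p , q} (e , f) (e′ , f′) = cong₂ _,_ x≡ z≡
      where
      difference : ∀ {x z} → z ≡ proj₁ (choose z) ⊖ proj₂ (choose z) → (p , q) ≡ (x ⊕ proj₁ (choose z) , x ⊕ proj₂ (choose z)) → z ≡ p ⊖ q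
      difference {x} {z} e f = trans e (trans (linear (x₀ :- x₁) ((x₂ :+ x₀) :- (x₂ :+ x₁)) refl (proj₁ (choose z) ∷ proj₂ (choose z) ∷ x ∷ []))
        (sym (cong₂ _⊖_ (cong proj₁ f) (cong proj₂ f))))
      z≡ : z ≡ z′
      z≡ = trans (difference e f) (sym (difference e′ f′))
      x≡ : x ≡ x′
      x≡ = ⊕-cancelʳ x x′ (proj₁ (choose z)) (trans (sym (cong proj₁ f)) (trans (cong proj₁ f′) (cong (λ t → x′ ⊕ proj₁ (choose t)) (sym z≡))))

  -- The ratio |X + Y| / |X| is least among all subsets, cleared of denominators so that the empty
  -- `Z` needs no exception.
  Minimal : ∀ {d} → List (V d) → List (V d) → Set
  Minimal X Y = ∀ Z → (∀ {z} → z ∈ Z → z ∈ X) → card (X ⊞ Y) * card Z ≤ card (Z ⊞ Y) * card X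

  -- Descent: a subset that violates minimality has a strictly smaller ratio, hence is proper,
  -- nonempty and still within the bound `h`. The number `k` measures the descent.
  minimal : ∀ {d} (Y : List (V d)) k h (X : List (V d)) {x} → x ∈ X → card X ≤ k → card (X ⊞ Y) ≤ h * card X →
    ∃[ X′ ] (∀ {z} → z ∈ X′ → z ∈ X) × ∃ (_∈ X′) × card (X′ ⊞ Y) ≤ h * card X′ × Minimal X′ Y
  minimal Y zero h X x∈ X≤k le = ⊥-elim (<⇒≱ (card-pos x∈) X≤k)
  minimal Y (suc k) h X {x} x∈ X≤k le
    with em (∃[ Z ] (∀ {z} → z ∈ Z → z ∈ X) × card (Z ⊞ Y) * card X < card (X ⊞ Y) * card Z)
  ... | no none = X , id , (x , x∈) , le , λ Z Z⊆X → ≮⇒≥ (λ lt → none (Z , Z⊆X , lt))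
  ... | yes (Z , Z⊆X , lt) = case minimal Y k h Z (proj₂ Z-nonempty) (s≤s⁻¹ (≤-trans Z<X X≤k)) Z-le of λ where
      (X′ , X′⊆Z , ne , le′ , min) → X′ , (λ {z} z∈ → Z⊆X (X′⊆Z z∈)) , ne , le′ , min
    where
    Z<X : card Z < card X
    Z<X with card X ≤? card Z
    ... | no X≰Z = ≰⇒> X≰Z
    ... | yes X≤Z = ⊥-elim (<⇒≱ lt (≤-trans (*-monoʳ-≤ (card (X ⊞ Y)) (card-⊆ Z⊆X))
      (*-monoˡ-≤ (card X) (card-⊆ (⊞-mono (⊆-card-≥ Z⊆X X≤Z) id)))))
    Z-nonempty : ∃ (_∈ Z)
    Z-nonempty = card-nonempty Z (n≢0⇒n>0 λ Z≡0 → n≮0 (subst (card (Z ⊞ Y) * card X <_)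
      (trans (cong (card (X ⊞ Y) *_) Z≡0) (*-zeroʳ (card (X ⊞ Y)))) lt))
    Z-le : card (Z ⊞ Y) ≤ h * card Z
    Z-le = *-cancelʳ-≤ (card (Z ⊞ Y)) (h * card Z) (card X) {{>-nonZero (card-pos x∈)}} (begin
      card (Z ⊞ Y) * card X   ≤⟨ <⇒≤ lt ⟩
      card (X ⊞ Y) * card Z   ≤⟨ *-monoˡ-≤ (card Z) le ⟩
      (h * card X) * card Z   ≡⟨ *-assoc h (card X) (card Z) ⟩
      h * (card X * card Z)   ≡⟨ cong (h *_) (*-comm (card X) (card Z)) ⟩
      h * (card Z * card X)   ≡⟨ *-assoc h (card Z) (card X) ⟨
      (h * card Z) * card X   ∎)
      where open ≤-Reasoning

  -- Petridis: a subset minimising the ratio |X + Y| / |X| keeps it after adding any C.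
  petridis : ∀ {d} (X Y : List (V d)) → Minimal X Y → ∀ C → card (X ⊞ (Y ⊞ C)) * card X ≤ card (X ⊞ Y) * card (X ⊞ C)
  petridis X Y min [] = ≤-trans (*-monoˡ-≤ (card X) (≤-trans (card-⊆ {Y = []} empty) (≤-reflexive card-[]))) z≤n
    where
    empty : ∀ {z} → z ∈ X ⊞ (Y ⊞ []) → z ∈ []
    empty z∈ with ∈-⊞⁻ z∈
    ... | _ , _ , _ , w∈ , _ with ∈-⊞⁻ w∈
    ... | _ , _ , _ , () , _
  petridis {d} X Y min (c ∷ C) = +-cancelʳ-≤ (card (Z ⊞ Y) * N) (a′ * N) (K * b′) (begin
      a′ * N + z′ * N                  ≤⟨ +-monoˡ-≤ (z′ * N) (*-monoˡ-≤ N a′≤) ⟩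
      (a + q) * N + z′ * N             ≡⟨ cong (_+ z′ * N) (*-distribʳ-+ N a q) ⟩
      (a * N + q * N) + z′ * N         ≡⟨ +-assoc (a * N) (q * N) (z′ * N) ⟩
      a * N + (q * N + z′ * N)         ≡⟨ cong (a * N +_) (*-distribʳ-+ N q z′) ⟨
      a * N + (q + z′) * N             ≤⟨ +-mono-≤ (petridis X Y min C) (*-monoˡ-≤ N q+z′≤K) ⟩
      K * b + K * N                    ≡⟨ cong (λ n → K * b + K * n) (card-sub InZ X) ⟩
      K * b + K * (card Z + m)         ≡⟨ cong (K * b +_) (*-distribˡ-+ K (card Z) m) ⟩
      K * b + (K * card Z + K * m)     ≤⟨ +-monoʳ-≤ (K * b) (+-monoˡ-≤ (K * m) (min Z Z⊆X)) ⟩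
      K * b + (z′ * N + K * m)         ≡⟨ cong (K * b +_) (+-comm (z′ * N) (K * m)) ⟩
      K * b + (K * m + z′ * N)         ≡⟨ +-assoc (K * b) (K * m) (z′ * N) ⟨
      K * b + K * m + z′ * N           ≡⟨ cong (_+ z′ * N) (*-distribˡ-+ K b m) ⟨
      K * (b + m) + z′ * N             ≤⟨ +-monoˡ-≤ (z′ * N) (*-monoʳ-≤ K b+m≤b′) ⟩
      K * b′ + z′ * N                  ∎)
    where
    open ≤-Reasoning
    -- `Z` collects the x for which x + c already lies in X + C, so exactly the others enlarge X +
    -- C. A sum x + y + c can be new only if x + y lies outside Z + Y. Minimality applied to `Z`
    -- compares the two effects.
    InZ : V d → Set
    InZ x = x ⊕ c ∈ X ⊞ C
    Z X∖Z : List (V d)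
    Z = sub InZ X
    X∖Z = sub (λ x → ¬ InZ x) X
    Z⊆X : ∀ {z} → z ∈ Z → z ∈ X
    Z⊆X z∈ = proj₁ (∈-sub⁻ InZ {X} z∈)
    InZY : V d → Set
    InZY w = w ∈ Z ⊞ Y
    N = card X
    K = card (X ⊞ Y)
    a = card (X ⊞ (Y ⊞ C))
    a′ = card (X ⊞ (Y ⊞ (c ∷ C)))
    b = card (X ⊞ C)
    b′ = card (X ⊞ (c ∷ C))
    z′ = card (Z ⊞ Y)
    m = card X∖Z
    Q = sub (λ w → ¬ InZY w) (X ⊞ Y)
    q = card Q
    shift : List (V d) → List (V d)
    shift = map (_⊕ c)
    shift-card : ∀ L → card (shift L) ≡ card L
    shift-card L = card-map (_⊕ c) (⊕-cancelʳ _ _ c) L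
    b+m≤b′ : b + m ≤ b′
    b+m≤b′ = subst (λ t → b + t ≤ b′) (shift-card X∖Z)
      (card-disjoint (X ⊞ C) (shift X∖Z) dis (⊞-mono id there) into)
      where
      dis : Disjoint (X ⊞ C) (shift X∖Z)
      dis p q with ∈-map⁻ (_⊕ c) q
      ... | x , x∈ , refl = proj₂ (∈-sub⁻ (λ x → ¬ InZ x) {X} x∈) p
      into : ∀ {z} → z ∈ shift X∖Z → z ∈ X ⊞ (c ∷ C)
      into q with ∈-map⁻ (_⊕ c) q
      ... | x , x∈ , refl = ∈-⊞⁺ (proj₁ (∈-sub⁻ (λ x → ¬ InZ x) {X} x∈)) (here refl)
    q+z′≤K : q + z′ ≤ K
    q+z′≤K = card-disjoint Q (Z ⊞ Y) (λ p → proj₂ (∈-sub⁻ (λ w → ¬ InZY w) {X ⊞ Y} p))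
      (λ p → proj₁ (∈-sub⁻ (λ w → ¬ InZY w) {X ⊞ Y} p)) (⊞-mono Z⊆X id)
    a′≤ : a′ ≤ a + q
    a′≤ = ≤-trans (card-⊆ cover) (≤-trans (card-++-≤ (X ⊞ (Y ⊞ C)) (shift Q)) (≤-reflexive (cong (λ t → a + t) (shift-card Q))))
      where
      swap : ∀ x y → x ⊕ (y ⊕ c) ≡ (x ⊕ y) ⊕ c
      swap x y = sym (⊕-assoc x y c)
      old : ∀ {z y} → z ∈ Z → y ∈ Y → (z ⊕ y) ⊕ c ∈ X ⊞ (Y ⊞ C)
      old {z} {y} z∈ y∈ with ∈-⊞⁻ (proj₂ (∈-sub⁻ InZ {X} z∈))
      ... | x , c′ , x∈ , c′∈ , e = subst (_∈ X ⊞ (Y ⊞ C)) eq (∈-⊞⁺ x∈ (∈-⊞⁺ y∈ c′∈))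
        where
        eq : x ⊕ (y ⊕ c′) ≡ (z ⊕ y) ⊕ c
        eq = trans (linear (x₀ :+ (x₁ :+ x₂)) ((x₀ :+ x₂) :+ x₁) refl (x ∷ y ∷ c′ ∷ []))
          (trans (cong (_⊕ y) (sym e)) (linear ((x₀ :+ x₁) :+ x₂) ((x₀ :+ x₂) :+ x₁) refl (z ∷ c ∷ y ∷ [])))
      cover : ∀ {w} → w ∈ X ⊞ (Y ⊞ (c ∷ C)) → w ∈ X ⊞ (Y ⊞ C) ++ shift Q
      cover w∈ with ∈-⊞⁻ w∈
      ... | x , u , x∈ , u∈ , refl with ∈-⊞⁻ u∈
      ... | y , c′ , y∈ , there c′∈ , refl = ∈-++⁺ˡ (∈-⊞⁺ x∈ (∈-⊞⁺ y∈ c′∈))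
      ... | y , _ , y∈ , here refl , refl with em (InZY (x ⊕ y))
      ... | no ¬p = ∈-++⁺ʳ (X ⊞ (Y ⊞ C)) (subst (_∈ shift Q) (sym (swap x y))
        (∈-map⁺ (_⊕ c) (∈-sub⁺ (λ w → ¬ InZY w) (∈-⊞⁺ x∈ y∈) ¬p)))
      ... | yes p with ∈-⊞⁻ p
      ... | z , y′ , z∈ , y′∈ , e = ∈-++⁺ˡ (subst (_∈ X ⊞ (Y ⊞ C)) (sym (trans (swap x y) (cong (_⊕ c) e))) (old z∈ y′∈))

  fold : ∀ {d} → List (V d) → ℕ → List (V d)
  fold Y zero = [ 0v ]
  fold Y (suc k) = Y ⊞ fold Y k

  plünnecke : ∀ {d} (X Y : List (V d)) h {x} → x ∈ X → Minimal X Y → card (X ⊞ Y) ≤ h * card X → ∀ k → card (X ⊞ fold Y k) ≤ h ^ k * card X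
  plünnecke X Y h x∈ min le zero = ≤-trans (card-⊆ sub0) (≤-reflexive (sym (+-identityʳ (card X))))
    where
    sub0 : ∀ {z} → z ∈ X ⊞ [ 0v ] → z ∈ X
    sub0 z∈ with ∈-⊞⁻ z∈
    ... | x , _ , x∈ , here refl , refl = subst (_∈ X) (sym (⊕-identityʳ x)) x∈
  plünnecke X Y h x∈ min le (suc k) = *-cancelʳ-≤ _ _ (card X) {{>-nonZero (card-pos x∈)}} (begin
      card (X ⊞ (Y ⊞ fold Y k)) * card X    ≤⟨ petridis X Y min (fold Y k) ⟩
      card (X ⊞ Y) * card (X ⊞ fold Y k)    ≤⟨ *-mono-≤ le (plünnecke X Y h x∈ min le k) ⟩
      (h * card X) * (h ^ k * card X)       ≡⟨ cong (λ t → t * (h ^ k * card X)) (*-comm h (card X)) ⟩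
      (card X * h) * (h ^ k * card X)       ≡⟨ *-assoc (card X) h (h ^ k * card X) ⟩
      card X * (h * (h ^ k * card X))       ≡⟨ *-comm (card X) _ ⟩
      (h * (h ^ k * card X)) * card X       ≡⟨ cong (_* card X) (*-assoc h (h ^ k) (card X)) ⟨
      (h ^ suc k * card X) * card X         ∎)
    where open ≤-Reasoning

  AllTranslates : ∀ {d} → List (V d) → List (V d) → List (V d) → Set
  AllTranslates T R D = ∀ {z} → z ∈ T → ∃[ r ] ∃[ s ] (r ∈ R × s ∈ D × z ≡ r ⊕ s)

  -- A maximal family of disjoint translates r + Y with r in T fits into T + Y; the translate of any
  -- other z in T meets one of them, which puts z into r + (Y - Y).
  ruzsa-covering : ∀ {d} (T Y : List (V d)) {y} → y ∈ Y → ∃[ R ] (length R * card Y ≤ card (T ⊞ Y) × AllTranslates T R (Y ⊟ Y))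
  ruzsa-covering {d} T Y {y₀} y₀∈ = reps , bound , cover
    where
    _~_ : V d → V d → Set
    z ~ z′ = ∃[ y ] ∃[ y′ ] (y ∈ Y × y′ ∈ Y × z ⊕ y ≡ z′ ⊕ y′)
    open Transversal (transversal _~_ (y₀ , y₀ , y₀∈ , y₀∈ , refl) (λ (y , y′ , p , q , e) → y′ , y , q , p , sym e) T)
    translate : V d → List (V d)
    translate r = map (r ⊕_) Y
    disjoint : ∀ {r r′} → ¬ r ~ r′ → Disjoint (translate r) (translate r′)
    disjoint {r} {r′} n p q with ∈-map⁻ (r ⊕_) p | ∈-map⁻ (r′ ⊕_) q
    ... | y , y∈ , refl | y′ , y′∈ , e = n (y , y′ , y∈ , y′∈ , e)
    into : ∀ {r z} → r ∈ reps → z ∈ translate r → z ∈ T ⊞ Y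
    into {r} r∈ p with ∈-map⁻ (r ⊕_) p
    ... | y , y∈ , refl = ∈-⊞⁺ (reps⊆ r∈) y∈
    bound : length reps * card Y ≤ card (T ⊞ Y)
    bound = ≤-trans
      (sum-map-≥ (λ r → card (translate r)) (card Y) reps (λ {r} _ → ≤-reflexive (sym (card-map (r ⊕_) (⊕-cancelˡ r _ _) Y))))
      (Σcard-≤ translate reps (AllPairs.map disjoint separate) into)
    cover : AllTranslates T reps (Y ⊟ Y)
    cover {z} z∈ with covers z∈
    ... | r , r∈ , y , y′ , y∈ , y′∈ , e = r , y′ ⊖ y , r∈ , ∈-⊟⁺ y′∈ y∈ , (begin
      z                 ≡⟨ linear x₀ ((x₀ :+ x₁) :- x₁) refl (z ∷ y ∷ []) ⟩
      (z ⊕ y) ⊖ y       ≡⟨ cong (_⊖ y) e ⟩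
      (r ⊕ y′) ⊖ y      ≡⟨ ⊕-assoc r y′ (⊝ y) ⟩
      r ⊕ (y′ ⊖ y)      ∎)
      where open ≡-Reasoning

  -- Every coefficient runs up to k independently. This is more than the k-fold sums require, but
  -- the count (k + 1)^|ys| is immediate and polynomial in k.
  combinations : ∀ {d} → List (V d) → ℕ → List (V d)
  combinations []       k = [ 0v ]
  combinations (y ∷ ys) k = cartesianProductWith (λ j w → pos j ⋆ y ⊕ w) (upTo (suc k)) (combinations ys k)

  card-combinations : ∀ {d} (ys : List (V d)) k → card (combinations ys k) ≤ suc k ^ length ys
  card-combinations []       k = card≤length [ 0v ]
  card-combinations (y ∷ ys) k = begin
    card (combinations (y ∷ ys) k)                   ≤⟨ card-≤-× (λ j w → pos j ⋆ y ⊕ w) (∈-cartesianProductWith⁻ _ (upTo (suc k)) (combinations ys k)) ⟩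
    card (upTo (suc k)) * card (combinations ys k)   ≤⟨ *-mono-≤ (card≤length (upTo (suc k))) (card-combinations ys k) ⟩
    length (upTo (suc k)) * suc k ^ length ys        ≡⟨ cong (_* suc k ^ length ys) (length-applyUpTo id (suc k)) ⟩
    suc k ^ length (y ∷ ys)                          ∎
    where open ≤-Reasoning

  combinations-0 : ∀ {d} (ys : List (V d)) k → 0v ∈ combinations ys k
  combinations-0 [] k = here refl
  combinations-0 (y ∷ ys) k = subst (_∈ combinations (y ∷ ys) k) (trans (⊕-identityʳ (pos 0 ⋆ y)) (0⋆ y))
    (∈-cartesianProductWith⁺ (λ j w → pos j ⋆ y ⊕ w) {xs = upTo (suc k)} (∈-upTo⁺ (s≤s z≤n)) (combinations-0 ys k))

  combinations-mono : ∀ {d} (ys : List (V d)) k {w} → w ∈ combinations ys k → w ∈ combinations ys (suc k)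
  combinations-mono [] k w∈ = w∈
  combinations-mono (y ∷ ys) k w∈ with ∈-cartesianProductWith⁻ (λ j w → pos j ⋆ y ⊕ w) (upTo (suc k)) (combinations ys k) w∈
  ... | j , w , j∈ , w∈ , refl = ∈-cartesianProductWith⁺ (λ j w → pos j ⋆ y ⊕ w) {xs = upTo (suc (suc k))} (∈-upTo⁺ (m<n⇒m<1+n (∈-upTo⁻ j∈))) (combinations-mono ys k w∈)

  combinations-suc : ∀ {d} (ys : List (V d)) k {w y} → y ∈ ys → w ∈ combinations ys k → y ⊕ w ∈ combinations ys (suc k)
  combinations-suc (y ∷ ys) k (here refl) w∈ with ∈-cartesianProductWith⁻ (λ j w → pos j ⋆ y ⊕ w) (upTo (suc k)) (combinations ys k) w∈
  ... | j , w , j∈ , w∈ , refl = subst (_∈ combinations (y ∷ ys) (suc k)) eq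
    (∈-cartesianProductWith⁺ (λ j w → pos j ⋆ y ⊕ w) {xs = upTo (suc (suc k))} (∈-upTo⁺ (s≤s (∈-upTo⁻ j∈))) (combinations-mono ys k w∈))
    where
    eq : pos (suc j) ⋆ y ⊕ w ≡ y ⊕ (pos j ⋆ y ⊕ w)
    eq = trans (cong (_⊕ w) (trans (⋆-distribʳ (pos 1) (pos j) y) (cong (_⊕ pos j ⋆ y) (1⋆ y)))) (⊕-assoc y (pos j ⋆ y) w)
  combinations-suc (y ∷ ys) k {y = y′} (there y′∈) w∈ with ∈-cartesianProductWith⁻ (λ j w → pos j ⋆ y ⊕ w) (upTo (suc k)) (combinations ys k) w∈
  ... | j , w , j∈ , w∈ , refl = subst (_∈ combinations (y ∷ ys) (suc k)) (linear (x₀ :+ (x₁ :+ x₂)) (x₁ :+ (x₀ :+ x₂)) refl ((pos j ⋆ y) ∷ y′ ∷ w ∷ []))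
    (∈-cartesianProductWith⁺ (λ j w → pos j ⋆ y ⊕ w) {xs = upTo (suc (suc k))} (∈-upTo⁺ (m<n⇒m<1+n (∈-upTo⁻ j∈))) (combinations-suc ys k y′∈ w∈))

  -- Once D + D lies in R + D, each further summand costs one more translation by an element of R.
  -- The order of these translations is irrelevant, so the k-fold sums of D grow only polynomially
  -- in k.
  fold-cover : ∀ {d} (D R : List (V d)) → 0v ∈ D → AllTranslates (D ⊞ D) R D → ∀ k → AllTranslates (fold D k) (combinations R k) D
  fold-cover D R 0∈ cov zero (here refl) = 0v , 0v , combinations-0 R 0 , 0∈ , sym (⊕-identityʳ 0v)
  fold-cover D R 0∈ cov (suc k) z∈ with ∈-⊞⁻ z∈
  ... | s , z , s∈ , z∈ , refl with fold-cover D R 0∈ cov k z∈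
  ... | w , s′ , w∈ , s′∈ , refl with cov (∈-⊞⁺ s∈ s′∈)
  ... | r , s″ , r∈ , s″∈ , e = r ⊕ w , s″ , combinations-suc R k r∈ w∈ , s″∈ ,
    trans (linear (x₀ :+ (x₁ :+ x₂)) ((x₀ :+ x₂) :+ x₁) refl (s ∷ w ∷ s′ ∷ [])) (trans (cong (_⊕ w) e)
      (linear ((x₀ :+ x₁) :+ x₂) ((x₀ :+ x₂) :+ x₁) refl (r ∷ s″ ∷ w ∷ [])))

  card-fold : ∀ {d} (D R : List (V d)) → 0v ∈ D → AllTranslates (D ⊞ D) R D → ∀ k → card (fold D k) ≤ suc k ^ length R * card D
  card-fold D R 0∈ cov k = ≤-trans (card-≤-× _⊕_ (fold-cover D R 0∈ cov k)) (*-monoˡ-≤ (card D) (card-combinations R k))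

  -- The binary digits of s relative to R: 2 s = r₁ + s₁, 2 s₁ = r₂ + s₂, …, with every sᵢ in D.
  Digits : ∀ {d} → List (V d) → V d → List (V d) → Set
  Digits D s []       = s ∈ D
  Digits D s (r ∷ rs) = s ∈ D × (∃[ s′ ] (s ⊕ s ≡ r ⊕ s′ × Digits D s′ rs))

  words : ∀ {d} → List (V d) → ℕ → List (List (V d))
  words R zero    = [ [] ]
  words R (suc t) = cartesianProductWith _∷_ R (words R t)

  card-words : ∀ {d} (R : List (V d)) t → card (words R t) ≤ length R ^ t
  card-words R zero    = card≤length [ [] ]
  card-words R (suc t) = ≤-trans (card-≤-× _∷_ (∈-cartesianProductWith⁻ _∷_ R (words R t)))
    (*-mono-≤ (card≤length R) (card-words R t))

  digits : ∀ {d} (D R : List (V d)) → AllTranslates (D ⊞ D) R D → ∀ t {s} → s ∈ D → ∃[ w ] w ∈ words R t × Digits D s w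
  digits D R cov zero s∈ = [] , here refl , s∈
  digits D R cov (suc t) s∈ with cov (∈-⊞⁺ s∈ s∈)
  ... | r , s′ , r∈ , s′∈ , e with digits D R cov t s′∈
  ... | w , w∈ , ds = r ∷ w , ∈-cartesianProductWith⁺ _∷_ r∈ w∈ , s∈ , s′ , e , ds

  Digits⇒∈ : ∀ {d} (D : List (V d)) {s} w → Digits D s w → s ∈ D
  Digits⇒∈ D []      ds = ds
  Digits⇒∈ D (_ ∷ _) ds = proj₁ ds

  words-length : ∀ {d} (R : List (V d)) t {w} → w ∈ words R t → length w ≡ t
  words-length R zero (here refl) = refl
  words-length R (suc t) w∈ with ∈-cartesianProductWith⁻ _∷_ R (words R t) w∈
  ... | _ , w , _ , w∈′ , refl = cong suc (words-length R t w∈′)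

  2^suc⋆ : ∀ {d} i (v : V d) → pos (2 ^ suc i) ⋆ v ≡ pos (2 ^ i) ⋆ (v ⊕ v)
  2^suc⋆ i v = begin
    pos (2 ^ i + (2 ^ i + 0)) ⋆ v        ≡⟨ cong (λ n → pos (2 ^ i + n) ⋆ v) (+-identityʳ (2 ^ i)) ⟩
    pos (2 ^ i + 2 ^ i) ⋆ v              ≡⟨ ⋆-distribʳ (pos (2 ^ i)) (pos (2 ^ i)) v ⟩
    pos (2 ^ i) ⋆ v ⊕ pos (2 ^ i) ⋆ v    ≡⟨ ⋆-distribˡ (pos (2 ^ i)) v v ⟨
    pos (2 ^ i) ⋆ (v ⊕ v)                ∎
    where open ≡-Reasoning

  -- After i doublings equal digits cancel in the difference, and 2^i (s - s′) is left as the
  -- difference of two remainders, both in D.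
  same-digits : ∀ {d} (D : List (V d)) {s s′} w → Digits D s w → Digits D s′ w → ∀ i → i ≤ length w → pos (2 ^ i) ⋆ (s ⊖ s′) ∈ D ⊟ D
  same-digits D {s} {s′} w ds ds′ zero _ = subst (_∈ D ⊟ D) (sym (1⋆ (s ⊖ s′))) (∈-⊟⁺ (Digits⇒∈ D w ds) (Digits⇒∈ D w ds′))
  same-digits D {s} {s′} (r ∷ w) (_ , s₁ , e , ds) (_ , s₁′ , e′ , ds′) (suc i) (s≤s i≤) =
    subst (_∈ D ⊟ D) (sym (trans (2^suc⋆ i (s ⊖ s′)) (cong (pos (2 ^ i) ⋆_) (begin
      (s ⊖ s′) ⊕ (s ⊖ s′)       ≡⟨ linear ((x₀ :- x₁) :+ (x₀ :- x₁)) ((x₀ :+ x₀) :- (x₁ :+ x₁)) refl (s ∷ s′ ∷ []) ⟩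
      (s ⊕ s) ⊖ (s′ ⊕ s′)       ≡⟨ cong₂ _⊖_ e e′ ⟩
      (r ⊕ s₁) ⊖ (r ⊕ s₁′)      ≡⟨ linear ((x₀ :+ x₁) :- (x₀ :+ x₂)) (x₁ :- x₂) refl (r ∷ s₁ ∷ s₁′ ∷ []) ⟩
      s₁ ⊖ s₁′                  ∎)))) (same-digits D w ds ds′ i i≤)
    where open ≡-Reasoning

  fold-pad : ∀ {d} (D : List (V d)) → 0v ∈ D → ∀ k {z} → z ∈ fold D k → z ∈ fold D (suc k)
  fold-pad D 0∈ k {z} z∈ = subst (_∈ fold D (suc k)) (⊕-identityˡ z) (∈-⊞⁺ 0∈ z∈)

  -- The binary expansion of j: each power of two contributes an element of D - D, which is a sum of
  -- two elements of D because D = Y - Y is symmetric. Hence the 2t summands.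
  multiples∈fold : ∀ {d} (Y : List (V d)) {v y} → y ∈ Y → let D = Y ⊟ Y in ∀ t → (∀ i → i < t → pos (2 ^ i) ⋆ v ∈ D ⊟ D) →
    ∀ j → j < 2 ^ t → pos j ⋆ v ∈ fold D (t + t)
  multiples∈fold Y {v} y∈ zero _ zero _ = here (0⋆ v)
  multiples∈fold Y y∈ zero _ (suc j) (s≤s ())
  multiples∈fold Y {v} {y} y∈ (suc t) small j j< = subst (λ n → pos j ⋆ v ∈ fold D (suc n)) (sym (+-suc t t)) two-more
    where
    D = Y ⊟ Y
    0∈ : 0v ∈ D
    0∈ = subst (_∈ D) (linear (x₀ :- x₀) :0 refl (y ∷ [])) (∈-⊟⁺ y∈ y∈)
    ⊝∈ : ∀ {z} → z ∈ D → ⊝ z ∈ D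
    ⊝∈ z∈ with ∈-⊟⁻ z∈
    ... | a , b , a∈ , b∈ , refl = subst (_∈ D) (linear (x₁ :- x₀) (:- (x₀ :- x₁)) refl (a ∷ b ∷ [])) (∈-⊟⁺ b∈ a∈)
    ih = multiples∈fold Y y∈ t (λ i i<t → small i (m<n⇒m<1+n i<t))
    two-more : pos j ⋆ v ∈ fold D (suc (suc (t + t)))
    two-more with j <? 2 ^ t
    ... | yes j<2^t = fold-pad D 0∈ (suc (t + t)) (fold-pad D 0∈ (t + t) (ih j j<2^t))
    ... | no j≮2^t with ∈-⊟⁻ (small t ≤-refl)
    ... | a , b , a∈ , b∈ , e = subst (_∈ fold D (suc (suc (t + t)))) eq (∈-⊞⁺ a∈ (∈-⊞⁺ (⊝∈ b∈) (ih i i<)))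
      where
      2^t≤j = ≮⇒≥ j≮2^t
      i = j ∸ 2 ^ t
      j≡ : 2 ^ t + i ≡ j
      j≡ = m+[n∸m]≡n 2^t≤j
      i< : i < 2 ^ t
      i< = +-cancelˡ-< (2 ^ t) i (2 ^ t) (subst₂ _<_ (sym j≡) (cong (2 ^ t +_) (+-identityʳ (2 ^ t))) j<)
      eq : a ⊕ (⊝ b ⊕ pos i ⋆ v) ≡ pos j ⋆ v
      eq = trans (sym (⊕-assoc a (⊝ b) (pos i ⋆ v))) (trans (cong (_⊕ pos i ⋆ v) (sym e))
        (trans (sym (⋆-distribʳ (pos (2 ^ t)) (pos i) v)) (cong (λ n → pos n ⋆ v) j≡)))

  ^-monoʳ-base : ∀ b {m n} → m ≤ n → suc b ^ m ≤ suc b ^ n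
  ^-monoʳ-base b = ^-monoʳ-≤ (suc b)

  -- There are at most (h^5)^t words of digits, so two elements of Y share all their digits; their
  -- difference v has 2^i v in D - D for all i < t. The progression then lies in the 2t-fold sum of
  -- D, and one more summand accounts for Y itself.
  good-direction : ∀ {d} (X Y : List (V d)) h t {x} → x ∈ X → card Y ≡ card X → card (X ⊞ Y) ≤ h * card X → (h ^ 5) ^ t < card Y →
    ∃[ v ] (v ≢ 0v × card (Y ⊞ progression v (2 ^ t)) ≤ suc (suc (t + t)) ^ (h ^ 5) * (h * h * card X))
  good-direction {d} X Y h t {x} x∈ Y≡X le lt
    with card-nonempty Y (≤-trans (s≤s z≤n) lt)
  ... | y₀ , y₀∈ with minimal Y (card X) h X x∈ ≤-refl le
  ... | X′ , X′⊆X , (x′ , x′∈) , le′ , min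
    with ruzsa-covering (fold Y 2 ⊟ fold Y 2) Y y₀∈
  ... | R , bound , cov = finish
    where
    open ≤-Reasoning
    D = Y ⊟ Y
    F = fold Y
    -- Covering 2Y - 2Y by translates of Y - Y takes at most |3Y - 2Y| / |Y| of them. The triangle
    -- inequality through X′, with Plünnecke for three and for two summands, gives h^3 h^2.
    R≤ : length R ≤ h ^ 5
    R≤ = *-cancelʳ-≤ _ _ (card Y) {{>-nonZero (card-pos y₀∈)}} (begin
      length R * card Y                ≤⟨ bound ⟩
      card ((F 2 ⊟ F 2) ⊞ Y)           ≤⟨ card-⊆ regroup ⟩
      card (F 3 ⊟ F 2)                 ≤⟨ *-cancelˡ-≤ (card X′) {{>-nonZero (card-pos x′∈)}} (begin
        card X′ * card (F 3 ⊟ F 2)                 ≤⟨ triangle X′ (F 3) (F 2) ⟩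
        card (X′ ⊞ F 3) * card (X′ ⊞ F 2)          ≤⟨ *-mono-≤ (plünnecke X′ Y h x′∈ min le′ 3) (plünnecke X′ Y h x′∈ min le′ 2) ⟩
        (h ^ 3 * card X′) * (h ^ 2 * card X′)      ≡⟨ arrange (h ^ 3) (h ^ 2) (card X′) ⟩
        card X′ * ((h ^ 3 * h ^ 2) * card X′)      ≡⟨ cong (λ e → card X′ * (e * card X′)) (^-distribˡ-+-* h 3 2) ⟨
        card X′ * (h ^ 5 * card X′)                ∎) ⟩
      h ^ 5 * card X′                  ≤⟨ *-monoʳ-≤ (h ^ 5) (card-⊆ X′⊆X) ⟩
      h ^ 5 * card X                   ≡⟨ cong (h ^ 5 *_) Y≡X ⟨
      h ^ 5 * card Y                   ∎)
      where
      arrange : ∀ a b c → (a * c) * (b * c) ≡ c * ((a * b) * c)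
      arrange a b c = trans ([m*n]*[o*p]≡[m*o]*[n*p] a c b c) (trans (sym (*-assoc (a * b) c c)) (*-comm (a * b * c) c))
      regroup : ∀ {z} → z ∈ (F 2 ⊟ F 2) ⊞ Y → z ∈ F 3 ⊟ F 2
      regroup z∈ with ∈-⊞⁻ z∈
      ... | w , y , w∈ , y∈ , refl with ∈-⊟⁻ w∈
      ... | p , q , p∈ , q∈ , refl = subst (_∈ F 3 ⊟ F 2) (linear ((x₀ :+ x₁) :- x₂) ((x₁ :- x₂) :+ x₀) refl (y ∷ p ∷ q ∷ []))
        (∈-⊟⁺ (∈-⊞⁺ y∈ p∈) q∈)
    0∈ : 0v ∈ D
    0∈ = subst (_∈ D) (linear (x₀ :- x₀) :0 refl (y₀ ∷ [])) (∈-⊟⁺ y₀∈ y₀∈)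
    cov′ : AllTranslates (D ⊞ D) R D
    cov′ z∈ with ∈-⊞⁻ z∈
    ... | s , s′ , s∈ , s′∈ , refl with ∈-⊟⁻ s∈ | ∈-⊟⁻ s′∈
    ... | a , b , a∈ , b∈ , refl | a′ , b′ , a′∈ , b′∈ , refl =
      cov (subst (_∈ F 2 ⊟ F 2) (linear ((x₀ :+ (x₂ :+ :0)) :- (x₁ :+ (x₃ :+ :0))) ((x₀ :- x₁) :+ (x₂ :- x₃)) refl (a ∷ b ∷ a′ ∷ b′ ∷ []))
        (∈-⊟⁺ (∈-⊞⁺ a∈ (∈-⊞⁺ a′∈ (here refl))) (∈-⊞⁺ b∈ (∈-⊞⁺ b′∈ (here refl)))))
    D≤ : card D ≤ h * h * card X
    D≤ = *-cancelˡ-≤ (card X) {{>-nonZero (card-pos x∈)}} (begin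
      card X * card D                    ≤⟨ triangle X Y Y ⟩
      card (X ⊞ Y) * card (X ⊞ Y)        ≤⟨ *-mono-≤ le le ⟩
      (h * card X) * (h * card X)        ≡⟨ [m*n]*[o*p]≡[m*o]*[n*p] h (card X) h (card X) ⟩
      (h * h) * (card X * card X)        ≡⟨ *-assoc (h * h) (card X) (card X) ⟨
      (h * h * card X) * card X          ≡⟨ *-comm _ (card X) ⟩
      card X * (h * h * card X)          ∎)
    coded : ∀ {y} → y ∈ Y → ∃[ w ] w ∈ words R t × (w ∈ words R t × Digits D (y ⊖ y₀) w)
    coded y∈ with digits D R cov′ t (∈-⊟⁺ y∈ y₀∈)
    ... | w , w∈ , ds = w , w∈ , w∈ , ds
    few : card (words R t) < card Y
    few = ≤-trans (s≤s (≤-trans (card-words R t) (^-monoˡ-≤ t R≤))) lt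
    finish : ∃[ v ] (v ≢ 0v × card (Y ⊞ progression v (2 ^ t)) ≤ suc (suc (t + t)) ^ (h ^ 5) * (h * h * card X))
    finish with collision-rel (λ y w → w ∈ words R t × Digits D (y ⊖ y₀) w) coded few
    ... | y , y′ , w , y∈ , y′∈ , y≢ , (w∈ , ds) , (_ , ds′) = v , (λ v≡0 → y≢ (⊖≡0 y y′ v≡0)) , (begin
      card (Y ⊞ progression v (2 ^ t))                 ≤⟨ card-inj (_⊖ y₀) into (⊕-cancelʳ _ _ (⊝ y₀)) ⟩
      card (fold D (suc (t + t)))                      ≤⟨ card-fold D R 0∈ cov′ (suc (t + t)) ⟩
      suc (suc (t + t)) ^ length R * card D            ≤⟨ *-mono-≤ (^-monoʳ-base (suc (t + t)) R≤) D≤ ⟩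
      suc (suc (t + t)) ^ (h ^ 5) * (h * h * card X)   ∎)
      where
      v = y ⊖ y′
      small : ∀ i → i < t → pos (2 ^ i) ⋆ v ∈ D ⊟ D
      small i i<t = subst (λ u → pos (2 ^ i) ⋆ u ∈ D ⊟ D) (linear ((x₀ :- x₂) :- (x₁ :- x₂)) (x₀ :- x₁) refl (y ∷ y′ ∷ y₀ ∷ []))
        (same-digits D w ds ds′ i (≤-trans (<⇒≤ i<t) (≤-reflexive (sym (words-length R t w∈)))))
      into : ∀ {z} → z ∈ Y ⊞ progression v (2 ^ t) → z ⊖ y₀ ∈ fold D (suc (t + t))
      into z∈ with ∈-⊞⁻ z∈
      ... | b , p , b∈ , p∈ , refl with ∈-progression⁻ p∈
      ... | j , j< , refl = subst (_∈ fold D (suc (t + t))) (linear ((x₀ :- x₁) :+ x₂) ((x₀ :+ x₂) :- x₁) refl (b ∷ y₀ ∷ (pos j ⋆ v) ∷ []))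
        (∈-⊞⁺ (∈-⊟⁺ b∈ y₀∈) (multiples∈fold Y y₀∈ t small j j<))

-- Linear algebra over the integers without division.

module IntegerLinear where
  open Vectors
  open import Data.Nat.Base as ℕ using (ℕ; zero; suc)
  import Data.Nat.Properties as ℕ
  open import Data.Integer.Base as ℤ using (ℤ; 0ℤ; 1ℤ; -[1+_]) renaming (+_ to pos)
  import Data.Integer.Properties as ℤ
  open import Data.Fin.Base using (Fin; zero; suc)
  open import Data.Vec.Base using (Vec; []; _∷_; head; tail; lookup; tabulate; map)
  open import Data.Vec.Properties using (∷-injectiveˡ; ∷-injectiveʳ)
  open import Data.Product.Base using (∃-syntax; _×_; _,_; proj₁; proj₂)
  open import Data.Sum.Base using (_⊎_; inj₁; inj₂)
  open import Data.Empty using (⊥-elim)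
  open import Relation.Nullary using (yes; no)
  open import Relation.Binary.PropositionalEquality hiding ([_])
  open import Function.Base using (_∘_)

  ⋆-cancel : ∀ {d} {k : ℤ} (v : V d) → k ≢ 0ℤ → k ⋆ v ≡ 0v → v ≡ 0v
  ⋆-cancel [] _ _ = refl
  ⋆-cancel {k = k} (x ∷ v) k≢0 eq = cong₂ _∷_ x≡0 (⋆-cancel v k≢0 (∷-injectiveʳ eq))
    where
    x≡0 : x ≡ 0ℤ
    x≡0 with ℤ.i*j≡0⇒i≡0∨j≡0 k (∷-injectiveˡ eq)
    ... | inj₁ k≡0 = ⊥-elim (k≢0 k≡0)
    ... | inj₂ p = p

  -- Eliminating the first coordinate from a family: either it vanishes throughout, or one
  -- vector is used up.
  Eliminated : ∀ {m n} → Vec (V (suc m)) (suc n) → Set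
  Eliminated {m} {n} vs = ∃[ us ] ((c : V n) → ∃[ c′ ] (combination c′ vs ≡ 0ℤ ∷ combination {m} c us × (c′ ≡ 0v → c ≡ 0v)))

  AllHeadsZero : ∀ {m n} → Vec (V (suc m)) n → Set
  AllHeadsZero {m} {n} vs = (c : V n) → combination c vs ≡ 0ℤ ∷ combination {m} c (map tail vs)

  -- Fraction-free elimination: with a pivot p ≠ 0 in the vector (p, v), a vector r becomes p (tail
  -- r) - (head r) v. A combination of the new vectors lifts to the old ones with all coefficients
  -- multiplied by p and the pivot's coefficient cancelling the first coordinate.
  eliminate : ∀ {m n} (vs : Vec (V (suc m)) (suc n)) → AllHeadsZero vs ⊎ Eliminated vs
  eliminate ((p ∷ v) ∷ vs) with p ℤ.≟ 0ℤ
  ... | no p≢0 = inj₂ (us vs , λ c → ℤ.- dot c vs ∷ p ⋆ c , solved c , λ eq → ⋆-cancel c p≢0 (∷-injectiveʳ eq))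
    where
    us : ∀ {m} → Vec (V (suc _)) m → Vec (V _) m
    us = map (λ r → p ⋆ tail r ⊖ head r ⋆ v)
    dot : ∀ {m n} → V n → Vec (V (suc m)) n → ℤ
    dot [] [] = 0ℤ
    dot (c ∷ cs) (r ∷ rs) = c ℤ.* head r ℤ.+ dot cs rs
    main : ∀ {n} (c : V n) rs → combination (p ⋆ c) rs ≡ p ℤ.* dot c rs ∷ combination c (us rs) ⊕ dot c rs ⋆ v
    main [] [] = cong₂ _∷_ (sym (ℤ.*-zeroʳ p)) (sym (trans (⊕-identityˡ _) (0⋆ v)))
    main (c ∷ cs) ((h ∷ t) ∷ rs) = trans (cong ((p ℤ.* c) ⋆ (h ∷ t) ⊕_) (main cs rs)) (cong₂ _∷_
      (trans (cong (ℤ._+ p ℤ.* dot cs rs) (ℤ.*-assoc p c h)) (sym (ℤ.*-distribˡ-+ p (c ℤ.* h) (dot cs rs))))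
      (begin
        (p ℤ.* c) ⋆ t ⊕ (R ⊕ D ⋆ v)                              ≡⟨ linear (x₀ :+ (x₁ :+ x₂)) ((x₀ :+ x₁) :+ x₂) refl ((p ℤ.* c) ⋆ t ∷ R ∷ D ⋆ v ∷ []) ⟩
        ((p ℤ.* c) ⋆ t ⊕ R) ⊕ D ⋆ v                              ≡⟨ linear ((x₀ :+ x₁) :+ x₂) (((x₀ :- x₃) :+ x₁) :+ (x₃ :+ x₂)) refl ((p ℤ.* c) ⋆ t ∷ R ∷ D ⋆ v ∷ (c ℤ.* h) ⋆ v ∷ []) ⟩
        (((p ℤ.* c) ⋆ t ⊖ (c ℤ.* h) ⋆ v) ⊕ R) ⊕ ((c ℤ.* h) ⋆ v ⊕ D ⋆ v) ≡⟨ cong₂ (λ a b → (a ⊕ R) ⊕ b) expand (⋆-distribʳ (c ℤ.* h) D v) ⟨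
        (c ⋆ (p ⋆ t ⊖ h ⋆ v) ⊕ R) ⊕ (c ℤ.* h ℤ.+ D) ⋆ v          ∎))
      where
      open ≡-Reasoning
      D = dot cs rs
      R = combination cs (us rs)
      expand : c ⋆ (p ⋆ t ⊖ h ⋆ v) ≡ (p ℤ.* c) ⋆ t ⊖ (c ℤ.* h) ⋆ v
      expand = trans (⋆-distribˡ c (p ⋆ t) (⊝ (h ⋆ v))) (cong₂ _⊕_
        (trans (sym (⋆-assoc c p t)) (cong (_⋆ t) (ℤ.*-comm c p)))
        (trans (cong (c ⋆_) (sym (-1⋆ (h ⋆ v)))) (trans (sym (⋆-assoc c ℤ.-1ℤ (h ⋆ v))) (trans (cong (_⋆ (h ⋆ v)) (ℤ.*-comm c ℤ.-1ℤ))
          (trans (⋆-assoc ℤ.-1ℤ c (h ⋆ v)) (trans (-1⋆ (c ⋆ h ⋆ v)) (cong ⊝_ (sym (⋆-assoc c h v)))))))))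
    solved : ∀ c → combination (ℤ.- dot c vs ∷ p ⋆ c) ((p ∷ v) ∷ vs) ≡ 0ℤ ∷ combination c (us vs)
    solved c = trans (cong ((ℤ.- dot c vs) ⋆ (p ∷ v) ⊕_) (main c vs)) (cong₂ _∷_
      (trans (cong (ℤ._+ p ℤ.* dot c vs) (trans (sym (ℤ.neg-distribˡ-* (dot c vs) p)) (cong ℤ.-_ (ℤ.*-comm (dot c vs) p)))) (ℤ.+-inverseˡ (p ℤ.* dot c vs)))
      (trans (cong (_⊕ (combination c (us vs) ⊕ dot c vs ⋆ v)) negate) (linear (:- x₀ :+ (x₁ :+ x₀)) x₁ refl (dot c vs ⋆ v ∷ combination c (us vs) ∷ []))))
      where
      negate : (ℤ.- dot c vs) ⋆ v ≡ ⊝ (dot c vs ⋆ v)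
      negate = trans (cong (_⋆ v) (sym (ℤ.-1*i≡-i (dot c vs)))) (trans (⋆-assoc ℤ.-1ℤ (dot c vs) v) (-1⋆ _))
  eliminate ((p ∷ v) ∷ []) | yes refl = inj₁ λ { (c ∷ []) → cong₂ _∷_ (trans (ℤ.+-identityʳ (c ℤ.* 0ℤ)) (ℤ.*-zeroʳ c)) refl }
  eliminate ((p ∷ v) ∷ vs@(_ ∷ _)) | yes refl with eliminate vs
  ... | inj₁ all = inj₁ λ { (c ∷ cs) → trans (cong (c ⋆ (0ℤ ∷ v) ⊕_) (all cs)) (cong₂ _∷_ (trans (ℤ.+-identityʳ (c ℤ.* 0ℤ)) (ℤ.*-zeroʳ c)) refl) }
  ... | inj₂ (us , lift) = inj₂ (v ∷ us , λ { (c ∷ cs) → let c′ , e , z = lift cs in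
    c ∷ c′ , trans (cong (c ⋆ (0ℤ ∷ v) ⊕_) e) (cong₂ _∷_ (trans (ℤ.+-identityʳ (c ℤ.* 0ℤ)) (ℤ.*-zeroʳ c)) refl)
    , λ eq → cong₂ _∷_ (∷-injectiveˡ eq) (z (∷-injectiveʳ eq)) })

  abstract
    dependent : ∀ {m n} (vs : Vec (V m) n) → m ℕ.< n → ∃[ c ] (c ≢ 0v × combination c vs ≡ 0v)
    dependent {zero} {suc n} vs _ = 1ℤ ∷ 0v , (λ ()) , trivial _ _
      where
      trivial : (a b : V 0) → a ≡ b
      trivial [] [] = refl
    dependent {suc m} {suc n} vs (ℕ.s≤s m<n) with eliminate vs
    ... | inj₁ all = let c , c≢0 , e = dependent (map tail vs) (ℕ.m<n⇒m<1+n m<n) in c , c≢0 , trans (all c) (cong (0ℤ ∷_) e)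
    ... | inj₂ (us , lift) = let c , c≢0 , e = dependent us m<n
                                 c′ , e′ , z = lift c
                             in c′ , (λ eq → c≢0 (z eq)) , trans e′ (cong (0ℤ ∷_) e)

  Additive : ∀ {m n} → (V m → V n) → Set
  Additive f = ∀ u v → f (u ⊕ v) ≡ f u ⊕ f v

  Injective : ∀ {m n} → (V m → V n) → Set
  Injective f = ∀ v → f v ≡ 0v → v ≡ 0v

  module _ {m n} {f : V m → V n} (f-+ : Additive f) where

    additive-0 : f 0v ≡ 0v
    additive-0 = ⊕-cancelʳ (f 0v) 0v (f 0v) (trans (sym (f-+ 0v 0v)) (trans (cong f (⊕-identityʳ 0v)) (sym (⊕-identityˡ (f 0v)))))

    additive-⊝ : ∀ v → f (⊝ v) ≡ ⊝ f v
    additive-⊝ v = ⊕-cancelʳ (f (⊝ v)) (⊝ f v) (f v) (trans (sym (f-+ (⊝ v) v))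
      (trans (cong f (linear (:- x₀ :+ x₀) :0 refl (v ∷ []))) (trans additive-0 (linear :0 (:- x₀ :+ x₀) refl (f v ∷ [])))))

    additive-⊖ : ∀ u v → f (u ⊖ v) ≡ f u ⊖ f v
    additive-⊖ u v = trans (f-+ u (⊝ v)) (cong (f u ⊕_) (additive-⊝ v))

    injective⇒cancel : Injective f → ∀ {u v} → f u ≡ f v → u ≡ v
    injective⇒cancel inj {u} {v} eq = ⊖≡0 u v (inj (u ⊖ v) (trans (additive-⊖ u v) (trans (cong (_⊖ f v) eq) (linear (x₀ :- x₀) :0 refl (f v ∷ [])))))

    additive-⋆ : ∀ k v → f (k ⋆ v) ≡ k ⋆ f v
    additive-⋆ (pos k) v = natural k
      where
      natural : ∀ k → f (pos k ⋆ v) ≡ pos k ⋆ f v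
      natural zero = trans (cong f (0⋆ v)) (trans additive-0 (sym (0⋆ (f v))))
      natural (suc k) = trans (cong f (⋆-distribʳ (pos 1) (pos k) v)) (trans (f-+ _ _)
        (trans (cong₂ _⊕_ (trans (cong f (1⋆ v)) (sym (1⋆ (f v)))) (natural k)) (sym (⋆-distribʳ (pos 1) (pos k) (f v)))))
    additive-⋆ -[1+ k ] v = trans (cong f (neg v)) (trans (additive-⊝ _) (trans (cong ⊝_ (additive-⋆ (pos (suc k)) v)) (sym (neg (f v)))))
      where
      neg : ∀ {d} (w : V d) → -[1+ k ] ⋆ w ≡ ⊝ (pos (suc k) ⋆ w)
      neg w = trans (cong (_⋆ w) (sym (ℤ.-1*i≡-i (pos (suc k))))) (trans (⋆-assoc ℤ.-1ℤ (pos (suc k)) w) (-1⋆ _))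

    additive-combination : ∀ {k} (c : V k) vs → f (combination c vs) ≡ combination c (map f vs)
    additive-combination [] [] = additive-0
    additive-combination (c ∷ cs) (v ∷ vs) = trans (f-+ _ _) (cong₂ _⊕_ (additive-⋆ c v) (additive-combination cs vs))

  units : ∀ {n} → Vec (V n) n
  units {zero} = []
  units {suc n} = (1ℤ ∷ 0v) ∷ map (0ℤ ∷_) units

  combination-0∷ : ∀ {m k} (c : V k) (vs : Vec (V m) k) → combination c (map (0ℤ ∷_) vs) ≡ 0ℤ ∷ combination c vs
  combination-0∷ [] [] = refl
  combination-0∷ (c ∷ cs) (v ∷ vs) = trans (cong (c ⋆ (0ℤ ∷ v) ⊕_) (combination-0∷ cs vs))
    (cong₂ _∷_ (trans (ℤ.+-identityʳ (c ℤ.* 0ℤ)) (ℤ.*-zeroʳ c)) refl)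

  combination-units : ∀ {n} (v : V n) → combination v units ≡ v
  combination-units [] = refl
  combination-units (x ∷ v) = trans (cong₂ _⊕_ refl (combination-0∷ v units))
    (cong₂ _∷_ (trans (ℤ.+-identityʳ (x ℤ.* 1ℤ)) (ℤ.*-identityʳ x))
      (trans (cong₂ _⊕_ (⋆0 x) (combination-units v)) (⊕-identityˡ v)))

  lookup-units : ∀ {n} (i : Fin n) → lookup units i ≡ unit i
  lookup-units zero = refl
  lookup-units {suc n} (suc i) = trans (lookup-map i (0ℤ ∷_) units) (cong (0ℤ ∷_) (lookup-units i))
    where open import Data.Vec.Properties using (lookup-map)

  ℤ-abs : ∀ (a : ℤ) → a ≢ 0ℤ → ∃[ k ] (a ≡ pos (suc k) ⊎ a ≡ ℤ.- pos (suc k))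
  ℤ-abs (pos zero) a≢0 = ⊥-elim (a≢0 refl)
  ℤ-abs (pos (suc k)) _ = k , inj₁ refl
  ℤ-abs -[1+ k ] _ = k , inj₂ refl

  abstract
    common-multiple : ∀ {d} (P : Fin d → ℕ → Set) → (∀ {i c} k → P i c → P i (k ℕ.* c)) → (∀ i → ∃[ c ] (1 ℕ.≤ c × P i c)) →
      ∃[ C ] (1 ℕ.≤ C × ∀ i → P i C)
    common-multiple {zero} P scale each = 1 , ℕ.≤-refl , λ ()
    common-multiple {suc d} P scale each with each zero | common-multiple (P ∘ suc) scale (each ∘ suc)
    ... | c , c≥1 , p | C , C≥1 , ps = C ℕ.* c , ℕ.*-mono-≤ C≥1 c≥1 , λ { zero → scale C p ; (suc i) → subst (P (suc i)) (ℕ.*-comm c C) (scale c (ps i)) }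

  -- An inverse up to a positive integer factor, so that all maps stay integral.
  record ScaledInverse {d} (f : V d → V d) : Set where
    field
      inv     : V d → V d
      inv-+   : Additive inv
      scale   : ℕ
      scale≥1 : 1 ℕ.≤ scale
      f-inv   : ∀ v → f (inv v) ≡ pos scale ⋆ v

  abstract
    -- The d + 1 vectors e_i, f(e_1), ..., f(e_d) are dependent, and injectivity forces a nonzero
    -- coefficient at e_i. So a positive multiple of each unit vector has a preimage, and a common
    -- multiple serves them all.
    scaled-inverse : ∀ {d} {f : V d → V d} → Additive f → Injective f → ScaledInverse f
    scaled-inverse {d} {f} f-+ f-inj = record
      { inv = λ v → combination v ys
      ; inv-+ = λ u v → combination-⊕ u v ys
      ; scale = C ; scale≥1 = C≥1
      ; f-inv = λ v → trans (additive-combination f-+ v ys) (trans (cong (combination v) f-ys) (trans (scaled v units) (cong (pos C ⋆_) (combination-units v))))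
      }
      where
      open import Data.Vec.Properties using (tabulate∘lookup; tabulate-∘; tabulate-cong)
      P : Fin d → ℕ → Set
      P i c = ∃[ x ] f x ≡ pos c ⋆ unit i
      each : ∀ i → ∃[ c ] (1 ℕ.≤ c × P i c)
      each i with dependent (unit i ∷ map f units) ℕ.≤-refl
      ... | a ∷ b , ab≢0 , eq with a ℤ.≟ 0ℤ
      ... | yes refl = ⊥-elim (ab≢0 (cong (0ℤ ∷_) (f-inj b (trans (sym fb) (trans (sym (⊕-identityˡ _)) (trans (cong (_⊕ combination b (map f units)) (sym (0⋆ (unit i)))) eq))))))
        where
        fb : combination b (map f units) ≡ f b
        fb = trans (sym (additive-combination f-+ b units)) (cong f (combination-units b))
      ... | no a≢0 with ℤ-abs a a≢0
      ... | k , inj₁ refl = suc k , ℕ.s≤s ℕ.z≤n , ⊝ b , (begin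
        f (⊝ b)                                          ≡⟨ additive-⊝ f-+ b ⟩
        ⊝ f b                                            ≡⟨ cong (λ z → ⊝ f z) (combination-units b) ⟨
        ⊝ f (combination b units)                        ≡⟨ cong ⊝_ (additive-combination f-+ b units) ⟩
        ⊝ combination b (map f units)                    ≡⟨ linear (:- x₁) (x₀ :- (x₀ :+ x₁)) refl (a ⋆ unit i ∷ combination b (map f units) ∷ []) ⟩
        a ⋆ unit i ⊖ (a ⋆ unit i ⊕ combination b (map f units)) ≡⟨ cong (a ⋆ unit i ⊖_) eq ⟩
        a ⋆ unit i ⊖ 0v                                  ≡⟨ linear (x₀ :- :0) x₀ refl (a ⋆ unit i ∷ []) ⟩
        a ⋆ unit i                                       ∎)
        where open ≡-Reasoning
      ... | k , inj₂ refl = suc k , ℕ.s≤s ℕ.z≤n , b , (begin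
        f b                                              ≡⟨ cong f (combination-units b) ⟨
        f (combination b units)                          ≡⟨ additive-combination f-+ b units ⟩
        combination b (map f units)                      ≡⟨ linear x₁ ((x₀ :+ x₁) :- x₀) refl (a ⋆ unit i ∷ combination b (map f units) ∷ []) ⟩
        (a ⋆ unit i ⊕ combination b (map f units)) ⊖ a ⋆ unit i ≡⟨ cong (_⊖ a ⋆ unit i) eq ⟩
        0v ⊖ a ⋆ unit i                                  ≡⟨ ⊕-identityˡ _ ⟩
        ⊝ (a ⋆ unit i)                                   ≡⟨ -1⋆ (a ⋆ unit i) ⟨
        ℤ.-1ℤ ⋆ a ⋆ unit i                               ≡⟨ ⋆-assoc ℤ.-1ℤ a (unit i) ⟨
        (ℤ.-1ℤ ℤ.* a) ⋆ unit i                           ≡⟨ cong (_⋆ unit i) (trans (ℤ.-1*i≡-i a) (ℤ.neg-involutive (pos (suc k)))) ⟩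
        pos (suc k) ⋆ unit i                             ∎)
        where open ≡-Reasoning
      scaleP : ∀ {i c} k → P i c → P i (k ℕ.* c)
      scaleP {i} {c} k (x , e) = pos k ⋆ x , trans (additive-⋆ f-+ (pos k) x) (trans (cong (pos k ⋆_) e)
        (trans (sym (⋆-assoc (pos k) (pos c) (unit i))) (cong (_⋆ unit i) (sym (ℤ.pos-* k c)))))
      common : ∃[ C ] (1 ℕ.≤ C × ∀ i → P i C)
      common = common-multiple P scaleP each
      C : ℕ
      C = proj₁ common
      C≥1 : 1 ℕ.≤ C
      C≥1 = proj₁ (proj₂ common)
      preimage : ∀ i → P i C
      preimage = proj₂ (proj₂ common)
      ys : Vec (V d) d
      ys = tabulate (λ i → proj₁ (preimage i))
      f-ys : map f ys ≡ map (pos C ⋆_) units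
      f-ys = trans (sym (tabulate-∘ f (λ i → proj₁ (preimage i)))) (trans (tabulate-cong (λ i → trans (proj₂ (preimage i)) (cong (pos C ⋆_) (sym (lookup-units i)))))
        (trans (tabulate-∘ (pos C ⋆_) (lookup units)) (cong (map (pos C ⋆_)) (tabulate∘lookup units))))
      scaled : ∀ {k} (v : V k) (vs : Vec (V d) k) → combination v (map (pos C ⋆_) vs) ≡ pos C ⋆ combination v vs
      scaled [] [] = sym (⋆0 (pos C))
      scaled (x ∷ v) (w ∷ vs) = trans (cong₂ _⊕_ swap (scaled v vs)) (sym (⋆-distribˡ (pos C) (x ⋆ w) (combination v vs)))
        where
        swap : x ⋆ pos C ⋆ w ≡ pos C ⋆ x ⋆ w
        swap = trans (sym (⋆-assoc x (pos C) w)) (trans (cong (_⋆ w) (ℤ.*-comm x (pos C))) (⋆-assoc (pos C) x w))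

-- Passage to rational subspaces, where irreducibility is stated.

module RationalLinear where
  open Vectors
  open IntegerLinear
  open import Algebra.Bundles using (CommutativeRing)
  import Algebra.Properties.Semiring.Sum as SemiringSum
  open import Data.Nat.Base as ℕ using (ℕ; zero; suc)
  import Data.Nat.Properties as ℕ
  open import Data.Integer.Base as ℤ using (ℤ; 0ℤ) renaming (+_ to pos)
  import Data.Integer.Properties as ℤ
  open import Data.Rational.Base as ℚ using (ℚ; 0ℚ; 1ℚ; mkℚ; toℚᵘ)
  import Data.Rational.Properties as ℚ
  open import Data.Rational.Unnormalised.Base as ℚᵘ using (mkℚᵘ; *≡*; _≃_)
  import Data.Rational.Unnormalised.Properties as ℚᵘ
  open import Data.Fin.Base using (Fin; zero; suc)
  open import Data.Vec.Base using (Vec; []; _∷_; lookup; tabulate)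
  open import Data.Vec.Properties using (lookup-zipWith; lookup-map; lookup∘tabulate; tabulate∘lookup; tabulate-cong)
  open import Data.Vec.Functional using (Vector)
  open import Data.Product.Base using (∃-syntax; _×_; _,_; proj₁; proj₂)
  open import Data.Sum.Base using (inj₁; inj₂)
  open import Data.Empty using (⊥; ⊥-elim)
  open import Level using (0ℓ)
  open import Relation.Nullary using (¬_)
  open import Relation.Unary using (Pred)
  open import Relation.Binary.PropositionalEquality hiding ([_])
  open import Function.Base using (_∘_)

  module Σℤ = SemiringSum (CommutativeRing.semiring ℤ.+-*-commutativeRing)
  module Σℚ = SemiringSum (CommutativeRing.semiring ℚ.+-*-commutativeRing)
  module Lℤ = LinearAlgebra ℤ.+-*-commutativeRing
  module Lℚ = LinearAlgebra ℚ.+-*-commutativeRing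

  private
    toℚᵘ-toℚ : ∀ z → toℚᵘ (toℚ z) ≃ mkℚᵘ z 0
    toℚᵘ-toℚ z = ℚ.toℚᵘ-fromℚᵘ (mkℚᵘ z 0)

  abstract
    toℚ-+ : ∀ a b → toℚ (a ℤ.+ b) ≡ toℚ a ℚ.+ toℚ b
    toℚ-+ a b = ℚ.toℚᵘ-injective (ℚᵘ.≃-trans (toℚᵘ-toℚ (a ℤ.+ b)) (ℚᵘ.≃-trans
      (*≡* (cong₂ ℤ._*_ (sym (cong₂ ℤ._+_ (ℤ.*-identityʳ a) (ℤ.*-identityʳ b))) refl))
      (ℚᵘ.≃-sym (ℚᵘ.≃-trans (ℚ.toℚᵘ-homo-+ (toℚ a) (toℚ b)) (ℚᵘ.+-cong (toℚᵘ-toℚ a) (toℚᵘ-toℚ b))))))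

  abstract
    toℚ-* : ∀ a b → toℚ (a ℤ.* b) ≡ toℚ a ℚ.* toℚ b
    toℚ-* a b = ℚ.toℚᵘ-injective (ℚᵘ.≃-trans (toℚᵘ-toℚ (a ℤ.* b)) (ℚᵘ.≃-trans (*≡* refl)
      (ℚᵘ.≃-sym (ℚᵘ.≃-trans (ℚ.toℚᵘ-homo-* (toℚ a) (toℚ b)) (ℚᵘ.*-cong (toℚᵘ-toℚ a) (toℚᵘ-toℚ b))))))

  toℚ-injective : ∀ {a b} → toℚ a ≡ toℚ b → a ≡ b
  toℚ-injective {a} {b} eq with ℚᵘ.≃-trans (ℚᵘ.≃-sym (toℚᵘ-toℚ a)) (ℚᵘ.≃-trans (ℚᵘ.≃-reflexive (cong toℚᵘ eq)) (toℚᵘ-toℚ b))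
  ... | *≡* e = trans (sym (ℤ.*-identityʳ a)) (trans e (ℤ.*-identityʳ b))

  toℚ-sum : ∀ {n} (t : Vector ℤ n) → toℚ (Σℤ.sum t) ≡ Σℚ.sum (toℚ ∘ t)
  toℚ-sum {zero} t = refl
  toℚ-sum {suc n} t = trans (toℚ-+ (t zero) (Σℤ.sum (t ∘ suc))) (cong (toℚ (t zero) ℚ.+_) (toℚ-sum (t ∘ suc)))

  denominator-clears : ∀ q → toℚ (pos (ℚ.denominatorℕ q)) ℚ.* q ≡ toℚ (ℚ.numerator q)
  denominator-clears q@(mkℚ n d _) = ℚ.toℚᵘ-injective (ℚᵘ.≃-trans (ℚ.toℚᵘ-homo-* (toℚ (pos (suc d))) q)
    (ℚᵘ.≃-trans (ℚᵘ.*-congʳ (toℚᵘ-toℚ (pos (suc d)))) (ℚᵘ.≃-trans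
      (*≡* (trans (ℤ.*-identityʳ _) (trans (ℤ.*-comm (pos (suc d)) n) (cong (n ℤ.*_) (cong (pos ∘ suc) (sym (ℕ.+-identityʳ d)))))))
      (ℚᵘ.≃-sym (toℚᵘ-toℚ n)))))

  toℚ-cancel : ∀ c q → c ≢ 0ℤ → toℚ c ℚ.* q ≡ 0ℚ → q ≡ 0ℚ
  toℚ-cancel c q c≢0 eq = trans (sym (ℚ.*-identityˡ q)) (trans (cong (ℚ._* q) (sym (ℚ.*-inverseˡ (toℚ c))))
    (trans (ℚ.*-assoc (ℚ.1/ toℚ c) (toℚ c) q) (trans (cong ((ℚ.1/ toℚ c) ℚ.*_) eq) (ℚ.*-zeroʳ (ℚ.1/ toℚ c)))))
    where
    instance
      nz : ℚ.NonZero (toℚ c)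
      nz = ℚ.≢-nonZero (λ e → c≢0 (toℚ-injective {c} {0ℤ} e))

  pos-≢0 : ∀ {n} → 1 ℕ.≤ n → pos n ≢ 0ℤ
  pos-≢0 (ℕ.s≤s _) ()

  abstract
    clear-denominators : ∀ {k} (a : Vector ℚ k) → ∃[ C ] (1 ℕ.≤ C × (∃[ z ] ∀ i → toℚ (pos C) ℚ.* a i ≡ toℚ (lookup {n = k} z i)))
    clear-denominators {k} a = C , C≥1 , tabulate (proj₁ ∘ integral) , λ i → trans (proj₂ (integral i)) (cong toℚ (sym (lookup∘tabulate _ i)))
      where
      P : Fin k → ℕ → Set
      P i c = ∃[ z ] toℚ (pos c) ℚ.* a i ≡ toℚ z
      common : ∃[ C ] (1 ℕ.≤ C × ∀ i → P i C)
      common = common-multiple P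
        (λ {i} {c} m (z , e) → pos m ℤ.* z , trans (cong (λ t → t ℚ.* a i) (trans (cong toℚ (ℤ.pos-* m c)) (toℚ-* (pos m) (pos c))))
          (trans (ℚ.*-assoc (toℚ (pos m)) (toℚ (pos c)) (a i)) (trans (cong (toℚ (pos m) ℚ.*_) e) (sym (toℚ-* (pos m) z)))))
        (λ i → ℚ.denominatorℕ (a i) , ℕ.s≤s ℕ.z≤n , ℚ.numerator (a i) , denominator-clears (a i))
      C : ℕ
      C = proj₁ common
      C≥1 : 1 ℕ.≤ C
      C≥1 = proj₁ (proj₂ common)
      integral : ∀ i → P i C
      integral = proj₂ (proj₂ common)

  embed : ∀ {d} → V d → Vector ℚ d
  embed v = toℚ ∘ lookup v

  embed-⊕ : ∀ {d} (u v : V d) → embed (u ⊕ v) ≗ λ i → embed u i ℚ.+ embed v i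
  embed-⊕ u v i = trans (cong toℚ (lookup-zipWith ℤ._+_ i u v)) (toℚ-+ (lookup u i) (lookup v i))

  embed-⋆ : ∀ {d} k (v : V d) → embed (k ⋆ v) ≗ λ i → toℚ k ℚ.* embed v i
  embed-⋆ k v i = trans (cong toℚ (lookup-map i (k ℤ.*_) v)) (toℚ-* k (lookup v i))

  lookup-ext : {A : Set} → ∀ {d} {u v : Vec A d} → lookup u ≗ lookup v → u ≡ v
  lookup-ext {u = u} {v} eq = trans (sym (tabulate∘lookup u)) (trans (tabulate-cong eq) (tabulate∘lookup v))

  embed-injective : ∀ {d} {u v : V d} → embed u ≗ embed v → u ≡ v
  embed-injective eq = lookup-ext (λ i → toℚ-injective (eq i))

  embed-0 : ∀ {d} → embed (0v {d}) ≗ λ _ → 0ℚ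
  embed-0 {suc d} zero = refl
  embed-0 {suc d} (suc i) = embed-0 i

  embed-combination : ∀ {d k} (z : V k) (ws : Vec (V d) k) →
    embed (combination z ws) ≗ Lℚ.linearCombination (toℚ ∘ lookup z) (embed ∘ lookup ws)
  embed-combination [] [] j = embed-0 j
  embed-combination (x ∷ z) (w ∷ ws) j = trans (embed-⊕ (x ⋆ w) (combination z ws) j) (cong₂ ℚ._+_ (embed-⋆ x w j) (embed-combination z ws j))

  linearCombination-scale : ∀ {d k} c (a : Vector ℚ k) (b : Vector (Vector ℚ d) k) j →
    c ℚ.* Lℚ.linearCombination a b j ≡ Lℚ.linearCombination (λ i → c ℚ.* a i) b j
  linearCombination-scale c a b j = trans (Σℚ.*-distribˡ-sum c (λ i → a i ℚ.* b i j)) (Σℚ.sum-cong-≗ (λ i → sym (ℚ.*-assoc c (a i) (b i j))))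

  Independent : ∀ {d k} → Vec (V d) k → Set
  Independent ws = ∀ c → combination c ws ≡ 0v → c ≡ 0v

  Span : ∀ {d k} → Vector (Vector ℚ d) k → Pred (Vector ℚ d) 0ℓ
  Span b v = ∃[ a ] v ≗ Lℚ.linearCombination a b

  Span-isSubspace : ∀ {d k} (b : Vector (Vector ℚ d) k) → IsSubspace (Span b)
  Span-isSubspace {k = k} b = record
    { respects = λ u≗v (a , e) → a , λ j → trans (sym (u≗v j)) (e j)
    ; zero∈    = (λ _ → 0ℚ) , λ j → sym (trans (Σℚ.sum-cong-≗ (λ i → ℚ.*-zeroˡ (b i j))) (Σℚ.sum-replicate-zero k))
    ; +-closed = λ (a , e) (a′ , e′) → (λ i → a i ℚ.+ a′ i) , λ j → trans (cong₂ ℚ._+_ (e j) (e′ j))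
        (trans (sym (Σℚ.∑-distrib-+ (λ i → a i ℚ.* b i j) (λ i → a′ i ℚ.* b i j))) (Σℚ.sum-cong-≗ (λ i → sym (ℚ.*-distribʳ-+ (b i j) (a i) (a′ i)))))
    ; *-closed = λ c (a , e) → (λ i → c ℚ.* a i) , λ j → trans (cong (c ℚ.*_) (e j)) (linearCombination-scale c a b j)
    }

  linearCombination∈ : ∀ {d k} {U : Pred (Vector ℚ d) 0ℓ} → IsSubspace U → (a : Vector ℚ k) (b : Vector (Vector ℚ d) k) → (∀ i → U (b i)) → U (Lℚ.linearCombination a b)
  linearCombination∈ {k = zero} sub a b b∈ = IsSubspace.zero∈ sub
  linearCombination∈ {k = suc k} sub a b b∈ = IsSubspace.+-closed sub (IsSubspace.*-closed sub (a zero) (b∈ zero)) (linearCombination∈ sub (a ∘ suc) (b ∘ suc) (b∈ ∘ suc))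

  abstract
    embed∈Span : ∀ {d k} (ws : Vec (V d) k) v c → c ≢ 0ℤ → ∃[ z ] c ⋆ v ≡ combination z ws → Span (embed ∘ lookup ws) (embed v)
    embed∈Span ws v c c≢0 (z , e) = (λ i → (ℚ.1/ toℚ c) ℚ.* toℚ (lookup z i)) , λ j → (begin
      embed v j                                  ≡⟨ ℚ.*-identityˡ (embed v j) ⟨
      1ℚ ℚ.* embed v j                           ≡⟨ cong (ℚ._* embed v j) (ℚ.*-inverseˡ (toℚ c)) ⟨
      ((ℚ.1/ toℚ c) ℚ.* toℚ c) ℚ.* embed v j     ≡⟨ ℚ.*-assoc (ℚ.1/ toℚ c) (toℚ c) (embed v j) ⟩
      (ℚ.1/ toℚ c) ℚ.* (toℚ c ℚ.* embed v j)     ≡⟨ cong ((ℚ.1/ toℚ c) ℚ.*_) (trans (sym (embed-⋆ c v j)) (trans (cong (λ t → embed t j) e) (embed-combination z ws j))) ⟩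
      (ℚ.1/ toℚ c) ℚ.* Lℚ.linearCombination (toℚ ∘ lookup z) (embed ∘ lookup ws) j ≡⟨ linearCombination-scale (ℚ.1/ toℚ c) (toℚ ∘ lookup z) (embed ∘ lookup ws) j ⟩
      Lℚ.linearCombination (λ i → (ℚ.1/ toℚ c) ℚ.* toℚ (lookup z i)) (embed ∘ lookup ws) j ∎)
      where
      open ≡-Reasoning
      instance
        nz : ℚ.NonZero (toℚ c)
        nz = ℚ.≢-nonZero (λ eq → c≢0 (toℚ-injective {c} {0ℤ} eq))

  embed-member : ∀ {d k} (ws : Vec (V d) k) i → Span (embed ∘ lookup ws) (embed (lookup ws i))
  embed-member ws i = embed∈Span ws (lookup ws i) (pos 1) (λ ()) (unit i , trans (1⋆ (lookup ws i)) (sym (combination-unit i ws)))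

  -- Clearing denominators turns a rational relation into an integral one with the same zeros.
  basis-independent : ∀ {d k} (ws : Vec (V d) k) → Independent ws → ∀ a → Lℚ.linearCombination a (embed ∘ lookup ws) ≗ (λ _ → 0ℚ) → a ≗ (λ _ → 0ℚ)
  basis-independent {d} {k} ws ind a eq = conclude (clear-denominators a)
    where
    conclude : ∃[ C ] (1 ℕ.≤ C × (∃[ z ] ∀ i → toℚ (pos C) ℚ.* a i ≡ toℚ (lookup {n = k} z i))) → a ≗ (λ _ → 0ℚ)
    conclude (C , C≥1 , z , clears) = λ i → toℚ-cancel (pos C) (a i) (pos-≢0 C≥1) (trans (clears i) (trans (cong (λ t → embed t i) z≡0) (embed-0 i)))
      where
      open ≡-Reasoning
      scaled : ∀ j → embed (combination z ws) j ≡ embed 0v j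
      scaled j = begin
        embed (combination z ws) j                                                ≡⟨ embed-combination z ws j ⟩
        Lℚ.linearCombination (toℚ ∘ lookup z) (embed ∘ lookup ws) j               ≡⟨ Σℚ.sum-cong-≗ (λ i → cong (ℚ._* embed (lookup ws i) j) (clears i)) ⟨
        Lℚ.linearCombination (λ i → toℚ (pos C) ℚ.* a i) (embed ∘ lookup ws) j    ≡⟨ linearCombination-scale (toℚ (pos C)) a (embed ∘ lookup ws) j ⟨
        toℚ (pos C) ℚ.* Lℚ.linearCombination a (embed ∘ lookup ws) j              ≡⟨ cong (toℚ (pos C) ℚ.*_) (eq j) ⟩
        toℚ (pos C) ℚ.* 0ℚ                                                        ≡⟨ ℚ.*-zeroʳ (toℚ (pos C)) ⟩
        0ℚ                                                                        ≡⟨ embed-0 j ⟨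
        embed 0v j                                                                ∎
      z≡0 : z ≡ 0v
      z≡0 = ind z (embed-injective scaled)

  basis : ∀ {d k} (ws : Vec (V d) k) → Independent ws → HasDimension (Span (embed ∘ lookup ws)) k
  basis ws ind = embed ∘ lookup ws , record { members = embed-member ws ; independent = basis-independent ws ind ; spanning = λ u∈ → u∈ }

  lookup-0 : ∀ {n} (i : Fin n) → lookup (0v {n}) i ≡ 0ℤ
  lookup-0 zero = refl
  lookup-0 (suc i) = lookup-0 i

  -- The d coefficient rows z_i live in dimension k < d and satisfy a nontrivial relation c. Applied
  -- to the vectors C_i e_i it gives that the sum of the c_i C_i e_i is 0, which forces c = 0.
  few-vectors-do-not-span : ∀ {d k} (ws : Vec (V d) k) → k ℕ.< d → (C : Fin d → ℕ) → (∀ i → 1 ℕ.≤ C i) →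
    (z : Fin d → V k) → (∀ i → pos (C i) ⋆ unit i ≡ combination (z i) ws) → ⊥
  few-vectors-do-not-span {d} {k} ws k<d C C≥1 z eq = c≢0 (lookup-ext c≡0)
    where
    relation : ∃[ c ] (c ≢ 0v × combination c (tabulate z) ≡ 0v)
    relation = dependent (tabulate z) k<d
    c = proj₁ relation
    c≢0 = proj₁ (proj₂ relation)
    diagonal : ∀ {n} (c : V n) (ms : Fin n → ℤ) (us : Vec (V d) n) (zs : Vec (V k) n) →
      (∀ i → ms i ⋆ lookup us i ≡ combination (lookup zs i) ws) →
      combination (tabulate (λ i → lookup c i ℤ.* ms i)) us ≡ combination (combination c zs) ws
    diagonal [] ms [] [] eq = sym (combination-0 ws)
    diagonal (x ∷ c) ms (u ∷ us) (z ∷ zs) eq = trans (cong₂ _⊕_ (trans (⋆-assoc x (ms zero) u) (cong (x ⋆_) (eq zero))) (diagonal c (ms ∘ suc) us zs (eq ∘ suc)))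
      (trans (cong (_⊕ combination (combination c zs) ws) (sym (combination-⋆ x z ws))) (sym (combination-⊕ (x ⋆ z) (combination c zs) ws)))
    scaled≡0 : tabulate (λ i → lookup c i ℤ.* pos (C i)) ≡ 0v
    scaled≡0 = trans (sym (combination-units _)) (trans (diagonal c (λ i → pos (C i)) units (tabulate z)
      (λ i → trans (cong (pos (C i) ⋆_) (lookup-units i)) (trans (eq i) (cong (λ t → combination t ws) (sym (lookup∘tabulate z i))))))
      (trans (cong (λ t → combination t ws) (proj₂ (proj₂ relation))) (combination-0 ws)))
    c≡0 : lookup c ≗ lookup 0v
    c≡0 i with ℤ.i*j≡0⇒i≡0∨j≡0 (lookup c i) (trans (sym (lookup∘tabulate _ i)) (trans (cong (λ t → lookup t i) scaled≡0) (lookup-0 i)))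
    ... | inj₁ p = trans p (sym (lookup-0 i))
    ... | inj₂ q = ⊥-elim (pos-≢0 (C≥1 i) q)

  Span-nonTrivial : ∀ {d k} (ws : Vec (V d) (suc k)) → Independent ws → suc k ℕ.< d → NonTrivial (Span (embed ∘ lookup ws))
  Span-nonTrivial {d} {k} ws ind k<d = nonzero , proper
    where
    nonzero : ¬ (∀ {u} → Span (embed ∘ lookup ws) u → u ≗ (λ _ → 0ℚ))
    nonzero all with ind (unit zero) (trans (combination-unit zero ws) (embed-injective (λ j → trans (all (embed-member ws zero) j) (sym (embed-0 j)))))
    ... | ()
    Row : Fin d → Set
    Row i = ∃[ C ] (1 ℕ.≤ C × (∃[ z ] pos C ⋆ unit {d} i ≡ combination z ws))
    row : ∀ i → Span (embed ∘ lookup ws) (embed (unit i)) → Row i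
    row i (a , e) = conclude (clear-denominators a)
      where
      conclude : ∃[ C ] (1 ℕ.≤ C × (∃[ z ] ∀ i → toℚ (pos C) ℚ.* a i ≡ toℚ (lookup {n = suc k} z i))) → Row i
      conclude (C , C≥1 , z , clears) = C , C≥1 , z , embed-injective scaled
        where
        open ≡-Reasoning
        scaled : ∀ j → embed (pos C ⋆ unit i) j ≡ embed (combination z ws) j
        scaled j = begin
          embed (pos C ⋆ unit i) j                                                  ≡⟨ embed-⋆ (pos C) (unit i) j ⟩
          toℚ (pos C) ℚ.* embed (unit i) j                                          ≡⟨ cong (toℚ (pos C) ℚ.*_) (e j) ⟩
          toℚ (pos C) ℚ.* Lℚ.linearCombination a (embed ∘ lookup ws) j              ≡⟨ linearCombination-scale (toℚ (pos C)) a (embed ∘ lookup ws) j ⟩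
          Lℚ.linearCombination (λ i → toℚ (pos C) ℚ.* a i) (embed ∘ lookup ws) j    ≡⟨ Σℚ.sum-cong-≗ (λ l → cong (ℚ._* embed (lookup ws l) j) (clears l)) ⟩
          Lℚ.linearCombination (toℚ ∘ lookup z) (embed ∘ lookup ws) j               ≡⟨ embed-combination z ws j ⟨
          embed (combination z ws) j                                                ∎
    proper : ¬ (∀ u → Span (embed ∘ lookup ws) u)
    proper all = few-vectors-do-not-span ws k<d (λ i → proj₁ (rows i)) (λ i → proj₁ (proj₂ (rows i)))
      (λ i → proj₁ (proj₂ (proj₂ (rows i)))) (λ i → proj₂ (proj₂ (proj₂ (rows i))))
      where
      rows : ∀ i → Row i
      rows i = row i (all (embed (unit i)))

  act : ∀ {d} → Mat ℤ d → V d → V d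
  act L v = tabulate (L Lℤ.*ᵥ lookup v)

  act-+ : ∀ {d} (L : Mat ℤ d) → Additive (act L)
  act-+ L u v = lookup-ext (λ i → trans (lookup∘tabulate _ i) (trans
    (trans (Σℤ.sum-cong-≗ (λ j → trans (cong (L i j ℤ.*_) (lookup-zipWith ℤ._+_ j u v)) (ℤ.*-distribˡ-+ (L i j) (lookup u j) (lookup v j))))
      (Σℤ.∑-distrib-+ (λ j → L i j ℤ.* lookup u j) (λ j → L i j ℤ.* lookup v j)))
    (sym (trans (lookup-zipWith ℤ._+_ i (act L u) (act L v)) (cong₂ ℤ._+_ (lookup∘tabulate _ i) (lookup∘tabulate _ i))))))

  embed-act : ∀ {d} (L : Mat ℤ d) v → mapMat toℚ L Lℚ.*ᵥ embed v ≗ embed (act L v)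
  embed-act L v i = sym (trans (cong toℚ (lookup∘tabulate _ i)) (trans (toℚ-sum (λ j → L i j ℤ.* lookup v j)) (Σℚ.sum-cong-≗ (λ j → toℚ-* (L i j) (lookup v j)))))

  *ᵥ-linearCombination : ∀ {d k} (M : Mat ℚ d) (a : Vector ℚ k) (b : Vector (Vector ℚ d) k) →
    M Lℚ.*ᵥ Lℚ.linearCombination a b ≗ Lℚ.linearCombination a (λ i → M Lℚ.*ᵥ b i)
  *ᵥ-linearCombination {d} {k} M a b i = begin
    Σℚ.sum (λ j → M i j ℚ.* Σℚ.sum (λ l → a l ℚ.* b l j))     ≡⟨ Σℚ.sum-cong-≗ (λ j → Σℚ.*-distribˡ-sum (M i j) (λ l → a l ℚ.* b l j)) ⟩
    Σℚ.sum (λ j → Σℚ.sum (λ l → M i j ℚ.* (a l ℚ.* b l j)))   ≡⟨ Σℚ.∑-comm (λ j l → M i j ℚ.* (a l ℚ.* b l j)) ⟩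
    Σℚ.sum (λ l → Σℚ.sum (λ j → M i j ℚ.* (a l ℚ.* b l j)))   ≡⟨ Σℚ.sum-cong-≗ (λ l → trans (Σℚ.sum-cong-≗ (λ j → swap (M i j) (a l) (b l j))) (sym (Σℚ.*-distribˡ-sum (a l) (λ j → M i j ℚ.* b l j)))) ⟩
    Σℚ.sum (λ l → a l ℚ.* Σℚ.sum (λ j → M i j ℚ.* b l j))     ∎
    where
    open ≡-Reasoning
    swap : ∀ m a b → m ℚ.* (a ℚ.* b) ≡ a ℚ.* (m ℚ.* b)
    swap m a b = trans (sym (ℚ.*-assoc m a b)) (trans (cong (ℚ._* b) (ℚ.*-comm m a)) (ℚ.*-assoc a m b))

  maps-into : ∀ {d k} (L : Mat ℤ d) (xs us : Vec (V d) k) → (∀ i → ∃[ c ] (c ≢ 0ℤ × ∃[ z ] c ⋆ act L (lookup xs i) ≡ combination z us)) →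
    MapsInto L (Span (embed ∘ lookup xs)) (Span (embed ∘ lookup us))
  maps-into L xs us gen (a , e) = respects (λ j → sym (trans (Σℚ.sum-cong-≗ (λ l → cong (mapMat toℚ L j l ℚ.*_) (e l))) (*ᵥ-linearCombination (mapMat toℚ L) a (embed ∘ lookup xs) j)))
    (linearCombination∈ sub a _ (λ i → respects (λ j → sym (embed-act L (lookup xs i) j))
      (let c , c≢0 , z , eq = gen i in embed∈Span us (act L (lookup xs i)) c c≢0 (z , eq))))
    where
    sub = Span-isSubspace (embed ∘ lookup us)
    open IsSubspace sub

  -- The form in which irreducibility is contradicted. All vectors stay integral, and the nonzero
  -- factors `c` express membership in the rational span. The dimension `suc k`, positive and below
  -- d, makes both spans nontrivial.
  reducible : ∀ {d k} (L₁ L₂ : Mat ℤ d) (xs us : Vec (V d) (suc k)) → suc k ℕ.< d → Independent xs → Independent us →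
    (∀ i → ∃[ c ] (c ≢ 0ℤ × ∃[ z ] c ⋆ act L₁ (lookup xs i) ≡ combination z us)) →
    (∀ i → ∃[ c ] (c ≢ 0ℤ × ∃[ z ] c ⋆ act L₂ (lookup xs i) ≡ combination z us)) →
    ¬ Irreducible L₁ L₂
  reducible L₁ L₂ xs us k<d ind-xs ind-us into₁ into₂ irr = irr
    ( Span (embed ∘ lookup xs) , Span (embed ∘ lookup us) , Span-isSubspace (embed ∘ lookup xs) , Span-isSubspace (embed ∘ lookup us)
    , Span-nonTrivial xs ind-xs k<d , Span-nonTrivial us ind-us k<d , (_ , basis xs ind-xs , basis us ind-us)
    , maps-into L₁ xs us into₁ , maps-into L₂ xs us into₂)

-- Independent directions in which a set meets few lines.

module Directions (em : ∀ (P : Set) → Dec P) where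
  open Counting
  open WithEM em
  open Vectors
  open Sumsets em
  open IntegerLinear
  open RationalLinear using (act; act-+; Independent; reducible; pos-≢0)
  open import Data.Nat.Base hiding (_⊔_)
  open import Data.Nat.Properties
  open import Data.Nat.DivMod using (_/_; _%_; m≡m%n+[m/n]*n; m%n<n; m<n*o⇒m/o<n)
  open import Data.Integer.Base as ℤ using (ℤ; 0ℤ; 1ℤ) renaming (+_ to pos)
  import Data.Integer.Properties as ℤ
  open import Data.Fin.Base using (Fin; zero; suc; inject₁)
  open import Data.List.Base using (List; []; _∷_; map; upTo)
  open import Data.List.Properties using (length-applyUpTo)
  open import Data.List.Membership.Propositional.Properties
  open import Data.Vec.Base as Vec using (Vec; []; _∷_; lookup)
  open import Data.Vec.Properties using (∷-injectiveˡ; ∷-injectiveʳ)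
  open import Data.Product.Base using (∃-syntax; _×_; _,_; proj₁; proj₂)
  open import Data.Empty using (⊥-elim)
  open import Relation.Nullary using (yes; no)
  open import Relation.Binary.PropositionalEquality hiding ([_])
  open import Function.Base using (id)

  -- Two points have the same image exactly when they lie on one line parallel to the i-th axis, so
  -- the image of a set counts such lines.
  drop : ∀ {d} → Fin (suc d) → V (suc d) → V d
  drop zero (x ∷ v) = v
  drop {suc d} (suc i) (x ∷ v) = x ∷ drop i v

  drop-same : ∀ {d} (i : Fin (suc d)) u v → drop i u ≡ drop i v → ∃[ k ] u ≡ v ⊕ k ⋆ unit i
  drop-same zero (x ∷ u) (y ∷ v) refl = x ℤ.- y , cong₂ _∷_
    (trans (sym (trans (ℤ.+-comm y (x ℤ.- y)) (trans (ℤ.+-assoc x (ℤ.- y) y) (trans (cong (λ t → x ℤ.+ t) (ℤ.+-inverseˡ y)) (ℤ.+-identityʳ x)))))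
      (cong (λ t → y ℤ.+ t) (sym (ℤ.*-identityʳ (x ℤ.- y)))))
    (sym (trans (cong (u ⊕_) (⋆0 (x ℤ.- y))) (⊕-identityʳ u)))
  drop-same {suc d} (suc i) (x ∷ u) (y ∷ v) eq with drop-same i u v (∷-injectiveʳ eq)
  ... | k , e = k , cong₂ _∷_ (trans (∷-injectiveˡ eq) (sym (trans (cong (λ t → y ℤ.+ t) (ℤ.*-zeroʳ k)) (ℤ.+-identityʳ y)))) e

  drop-unit : ∀ {d} (i : Fin (suc d)) v k → drop i (v ⊕ k ⋆ unit i) ≡ drop i v
  drop-unit zero (x ∷ v) k = trans (cong (v ⊕_) (⋆0 k)) (⊕-identityʳ v)
  drop-unit {suc d} (suc i) (x ∷ v) k = cong₂ _∷_ (trans (cong (λ t → x ℤ.+ t) (ℤ.*-zeroʳ k)) (ℤ.+-identityʳ x)) (drop-unit i v k)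

  split-multiple : ∀ {d} (a u : V d) j c r q → j * c ≡ r + q → a ⊕ pos j ⋆ pos c ⋆ ⊝ u ≡ (a ⊖ pos r ⋆ u) ⊖ pos q ⋆ u
  split-multiple a u j c r q eq = begin
    a ⊕ pos j ⋆ pos c ⋆ ⊝ u                 ≡⟨ cong (a ⊕_) (trans (sym (⋆-assoc (pos j) (pos c) (⊝ u))) (cong (_⋆ ⊝ u) (sym (ℤ.pos-* j c)))) ⟩
    a ⊕ pos (j * c) ⋆ ⊝ u                   ≡⟨ cong (a ⊕_) (additive-⊝ {f = pos (j * c) ⋆_} (⋆-distribˡ (pos (j * c))) u) ⟩
    a ⊖ pos (j * c) ⋆ u                     ≡⟨ cong (λ n → a ⊖ pos n ⋆ u) eq ⟩
    a ⊖ pos (r + q) ⋆ u                     ≡⟨ cong (a ⊖_) (⋆-distribʳ (pos r) (pos q) u) ⟩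
    a ⊖ (pos r ⋆ u ⊕ pos q ⋆ u)             ≡⟨ linear (x₀ :- (x₁ :+ x₂)) ((x₀ :- x₁) :- x₂) refl (a ∷ pos r ⋆ u ∷ pos q ⋆ u ∷ []) ⟩
    (a ⊖ pos r ⋆ u) ⊖ pos q ⋆ u             ∎
    where open ≡-Reasoning

  module _ {d} (L₁ L₂ : Mat ℤ d) (irreducible : Irreducible L₁ L₂)
    (inj₁ : Injective (act L₁)) (S : ScaledInverse (act L₁)) where

    private
      l₁ l₂ : V d → V d
      l₁ = act L₁
      l₂ = act L₂
    open ScaledInverse S renaming (scale to c; scale≥1 to c≥1)

    preimage : V d → V d
    preimage u = inv (⊝ u)

    l₁-preimage : ∀ u → l₁ (preimage u) ≡ pos c ⋆ ⊝ u
    l₁-preimage u = f-inv (⊝ u)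

    -- Up to sign and scale, the orbit of v under L₂ L₁⁻¹.
    orbit : V d → ℕ → V d
    orbit v zero    = v
    orbit v (suc i) = l₂ (preimage (orbit v i))

    module _ (v : V d) (v≢0 : v ≢ 0v) where

      us xs : ∀ k → Vec (V d) k
      us zero = []
      us (suc k) = orbit v k ∷ us k
      xs zero = []
      xs (suc k) = preimage (orbit v k) ∷ xs k

      l₁-xs : ∀ k i → l₁ (lookup (xs k) i) ≡ pos c ⋆ ⊝ lookup (us k) i
      l₁-xs (suc k) zero = l₁-preimage (orbit v k)
      l₁-xs (suc k) (suc i) = l₁-xs k i

      l₂-xs : ∀ k i → l₂ (lookup (xs k) i) ≡ lookup (us (suc k)) (inject₁ i)
      l₂-xs (suc k) zero = refl
      l₂-xs (suc k) (suc i) = l₂-xs k i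

      l₁-combination : ∀ {k} (a : V k) → combination a (Vec.map l₁ (xs k)) ≡ ⊝ (pos c ⋆ combination a (us k))
      l₁-combination [] = sym (trans (cong ⊝_ (⋆0 (pos c))) (linear (:- :0) :0 refl []))
      l₁-combination {suc k} (a ∷ as) = trans (cong₂ _⊕_ (cong (a ⋆_) (l₁-preimage (orbit v k))) (l₁-combination as)) (begin
        a ⋆ pos c ⋆ ⊝ w ⊕ ⊝ (pos c ⋆ r)         ≡⟨ cong (_⊕ ⊝ (pos c ⋆ r)) swap ⟩
        ⊝ (pos c ⋆ a ⋆ w) ⊕ ⊝ (pos c ⋆ r)       ≡⟨ linear ((:- x₀) :+ (:- x₁)) (:- (x₀ :+ x₁)) refl (pos c ⋆ a ⋆ w ∷ pos c ⋆ r ∷ []) ⟩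
        ⊝ (pos c ⋆ a ⋆ w ⊕ pos c ⋆ r)           ≡⟨ cong ⊝_ (⋆-distribˡ (pos c) (a ⋆ w) r) ⟨
        ⊝ (pos c ⋆ (a ⋆ w ⊕ r))                 ∎)
        where
        open ≡-Reasoning
        w = orbit v k
        r = combination as (us k)
        swap : a ⋆ pos c ⋆ ⊝ w ≡ ⊝ (pos c ⋆ a ⋆ w)
        swap = trans (sym (⋆-assoc a (pos c) (⊝ w))) (trans (cong (_⋆ ⊝ w) (ℤ.*-comm a (pos c))) (trans (⋆-assoc (pos c) a (⊝ w))
          (additive-⊝ {f = λ z → pos c ⋆ a ⋆ z} (λ y z → trans (cong (pos c ⋆_) (⋆-distribˡ a y z)) (⋆-distribˡ (pos c) (a ⋆ y) (a ⋆ z))) w)))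

      xs-independent : ∀ k → Independent (us k) → Independent (xs k)
      xs-independent k ind a eq = ind a (⋆-cancel _ (pos-≢0 c≥1) (trans (linear x₀ (:- (:- x₀)) refl (pos c ⋆ combination a (us k) ∷ []))
        (trans (cong ⊝_ (trans (sym (l₁-combination a)) (trans (sym (additive-combination (act-+ L₁) a (xs k))) (trans (cong l₁ eq) (additive-0 (act-+ L₁))))))
          (linear (:- :0) :0 refl []))))

      -- Suppose the newest orbit vector depends on the earlier ones. L₁ sends each preimage in `xs`
      -- to a multiple of the corresponding orbit vector and L₂ sends it to the next orbit vector,
      -- so both map the span of `xs` into the span of the earlier orbit vectors. The two spans have
      -- equal dimension, positive and less than d, against irreducibility.
      us-independent : ∀ k → k ≤ d → Independent (us k)
      us-independent zero _ [] _ = refl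
      us-independent (suc k) k<d (a ∷ as) eq with em (a ≡ 0ℤ) | us-independent k (<⇒≤ k<d)
      ... | yes refl | ind = cong (0ℤ ∷_) (ind as (trans (sym (⊕-identityˡ _)) (trans (cong (_⊕ combination as (us k)) (sym (0⋆ (orbit v k)))) eq)))
      us-independent (suc zero) k<d (a ∷ []) eq | no a≢0 | _ = ⊥-elim (v≢0 (⋆-cancel v a≢0 (trans (sym (⊕-identityʳ (a ⋆ v))) eq)))
      us-independent (suc (suc k)) k<d (a ∷ as) eq | no a≢0 | ind =
        ⊥-elim (reducible L₁ L₂ (xs (suc k)) (us (suc k)) k<d (xs-independent (suc k) ind) ind into₁ into₂ irreducible)
        where
        into₁ : ∀ i → ∃[ e ] (e ≢ 0ℤ × ∃[ z ] e ⋆ l₁ (lookup (xs (suc k)) i) ≡ combination z (us (suc k)))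
        into₁ i = 1ℤ , (λ ()) , pos c ⋆ ⊝ unit i , trans (1⋆ _) (trans (l₁-xs (suc k) i) (trans
          (cong (λ z → pos c ⋆ z) (trans (cong ⊝_ (sym (combination-unit i (us (suc k))))) (sym (additive-⊝ {f = λ a → combination a (us (suc k))} (λ y z → combination-⊕ y z (us (suc k))) (unit i)))))
          (sym (combination-⋆ (pos c) (⊝ unit i) (us (suc k))))))
        into₂ : ∀ i → ∃[ e ] (e ≢ 0ℤ × ∃[ z ] e ⋆ l₂ (lookup (xs (suc k)) i) ≡ combination z (us (suc k)))
        into₂ zero = a , a≢0 , ⊝ as , (begin
          a ⋆ u                                 ≡⟨ linear x₀ ((x₀ :+ x₁) :- x₁) refl (a ⋆ u ∷ combination as (us (suc k)) ∷ []) ⟩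
          (a ⋆ u ⊕ combination as (us (suc k))) ⊖ combination as (us (suc k)) ≡⟨ cong (_⊖ combination as (us (suc k))) eq ⟩
          0v ⊖ combination as (us (suc k))      ≡⟨ ⊕-identityˡ _ ⟩
          ⊝ combination as (us (suc k))         ≡⟨ additive-⊝ {f = λ a → combination a (us (suc k))} (λ y z → combination-⊕ y z (us (suc k))) as ⟨
          combination (⊝ as) (us (suc k))       ∎)
          where
          open ≡-Reasoning
          u = orbit v (suc k)
        into₂ (suc i) = 1ℤ , (λ ()) , unit (inject₁ i) , trans (1⋆ _) (trans (l₂-xs k i) (sym (combination-unit (inject₁ i) (us (suc k)))))

    module _ (A : List (V d)) (h T : ℕ) (T≥1 : 1 ≤ T) {a₀ : V d} (a₀∈ : a₀ ∈ A) (inj₂ : Injective (act L₂))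
      (small : card (map l₁ A ⊞ map l₂ A) ≤ h * card A) where

      private
        X Y : List (V d)
        X = map l₁ A
        Y = map l₂ A
        cardX : card X ≡ card A
        cardX = card-map l₁ (injective⇒cancel (act-+ L₁) inj₁) A
        cardY : card Y ≡ card A
        cardY = card-map l₂ (injective⇒cancel (act-+ L₂) inj₂) A

      -- Write P(u) for the progression. The triangle inequality through Y turns the hypothesis into
      -- |X - P(u)| ≤ h g. For x = `preimage u`, L₁x = -c u, and each multiple j c with j < T is a
      -- remainder below T plus one of c multiples of T; so L₁(A + P(x)) is covered by c translates
      -- of X - P(u). Finally L₂ maps A + P(x) onto Y + P(L₂x).
      next-direction : ∀ u g → card (Y ⊞ progression u T) ≤ g → card (Y ⊞ progression (l₂ (preimage u)) T) ≤ c * (h * g)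
      next-direction u g good = begin
        card (Y ⊞ progression (l₂ x) T)   ≤⟨ card-surj l₂ pull ⟩
        card (A ⊞ progression x T)        ≤⟨ card-inj l₁ {A ⊞ progression x T} {map l₁ (A ⊞ progression x T)} (∈-map⁺ l₁) (injective⇒cancel (act-+ L₁) inj₁) ⟩
        card (map l₁ (A ⊞ progression x T)) ≤⟨ card-≤-× (λ q z → z ⊖ pos (q * T) ⋆ u) {X = upTo c} {Y = X ⊟ progression u T} cover ⟩
        card (upTo c) * card (X ⊟ progression u T) ≤⟨ *-mono-≤ (≤-trans (card≤length (upTo c)) (≤-reflexive (length-applyUpTo id c))) X⊟P≤ ⟩
        c * (h * g)                       ∎
        where
        open ≤-Reasoning
        x = preimage u
        instance
          T-nonZero : NonZero T
          T-nonZero = >-nonZero T≥1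
        X⊟P≤ : card (X ⊟ progression u T) ≤ h * g
        X⊟P≤ = *-cancelˡ-≤ (card Y) {{>-nonZero (card-pos (∈-map⁺ l₂ a₀∈))}} (begin
          card Y * card (X ⊟ progression u T)            ≤⟨ triangle Y X (progression u T) ⟩
          card (Y ⊞ X) * card (Y ⊞ progression u T)      ≤⟨ *-mono-≤ (≤-trans (card-⊆ swap) small) good ⟩
          (h * card A) * g                               ≡⟨ cong (λ n → (h * n) * g) cardY ⟨
          (h * card Y) * g                               ≡⟨ cong (_* g) (*-comm h (card Y)) ⟩
          (card Y * h) * g                               ≡⟨ *-assoc (card Y) h g ⟩
          card Y * (h * g)                               ∎)
          where
          swap : ∀ {z} → z ∈ Y ⊞ X → z ∈ X ⊞ Y
          swap z∈ with ∈-⊞⁻ z∈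
          ... | y , x , y∈ , x∈ , refl = subst (_∈ X ⊞ Y) (⊕-comm x y) (∈-⊞⁺ x∈ y∈)
        pull : ∀ {z} → z ∈ Y ⊞ progression (l₂ x) T → ∃[ w ] (w ∈ A ⊞ progression x T × z ≡ l₂ w)
        pull z∈ with ∈-⊞⁻ z∈
        ... | y , p , y∈ , p∈ , refl with ∈-map⁻ l₂ y∈ | ∈-progression⁻ p∈
        ... | a , a∈ , refl | j , j< , refl = a ⊕ pos j ⋆ x , ∈-⊞⁺ a∈ (∈-progression⁺ j<) ,
          sym (trans (act-+ L₂ a (pos j ⋆ x)) (cong (l₂ a ⊕_) (additive-⋆ (act-+ L₂) (pos j) x)))
        cover : ∀ {z} → z ∈ map l₁ (A ⊞ progression x T) → ∃[ q ] ∃[ w ] (q ∈ upTo c × w ∈ X ⊟ progression u T × z ≡ w ⊖ pos (q * T) ⋆ u)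
        cover z∈ with ∈-map⁻ l₁ z∈
        ... | b , b∈ , refl with ∈-⊞⁻ b∈
        ... | a , p , a∈ , p∈ , refl with ∈-progression⁻ p∈
        ... | j , j< , refl = q , l₁ a ⊖ pos r ⋆ u ,
          ∈-upTo⁺ (m<n*o⇒m/o<n (subst (j * c <_) (*-comm T c) (*-monoˡ-< c {{>-nonZero c≥1}} j<))) ,
          ∈-⊟⁺ (∈-map⁺ l₁ a∈) (∈-progression⁺ (m%n<n (j * c) T)) , trans (trans (act-+ L₁ a (pos j ⋆ x)) (cong (l₁ a ⊕_) (additive-⋆ (act-+ L₁) (pos j) x)))
            (trans (cong (λ z → l₁ a ⊕ pos j ⋆ z) (l₁-preimage u)) (split-multiple (l₁ a) u j c r (q * T) (m≡m%n+[m/n]*n (j * c) T)))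
          where
          q = j * c / T
          r = j * c % T

      orbit-good : ∀ v g → card (Y ⊞ progression v T) ≤ g → ∀ i → card (Y ⊞ progression (orbit v i) T) ≤ (c * h) ^ i * g
      orbit-good v g good zero = ≤-trans good (≤-reflexive (sym (+-identityʳ g)))
      orbit-good v g good (suc i) = ≤-trans (next-direction (orbit v i) ((c * h) ^ i * g) (orbit-good v g good i))
        (≤-reflexive (trans (sym (*-assoc c h _)) (sym (*-assoc (c * h) ((c * h) ^ i) g))))

  -- The directions become a common positive multiple of the unit vectors; making them the unit
  -- vectors themselves would require division.
  record Coordinates {d} (Y : List (V d)) (T G : ℕ) : Set where
    field
      coordinates           : V d → V d
      coordinates-+         : Additive coordinates
      coordinates-injective : Injective coordinates
      direction             : Fin d → V d
      multiple              : ℕ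
      multiple≥1            : 1 ≤ multiple
      coordinates-direction : ∀ i → coordinates (direction i) ≡ pos multiple ⋆ unit i
      good                  : ∀ i → card (Y ⊞ progression (direction i) T) ≤ G

  -- One point of Y is chosen on each line and moved by the T multiples of the direction. The
  -- results are distinct: `drop` recovers the line, then the displacement along it recovers the
  -- multiple.
  lines-bound : ∀ {d} (Y : List (V (suc d))) {T G} → (C : Coordinates Y T G) → let open Coordinates C in
    ∀ i → card (map (drop i) (map coordinates Y)) * T ≤ G
  lines-bound {d} Y {T} {G} C i = begin
    card lines * T                         ≡⟨ cong (card lines *_) cardT ⟨
    card lines * card (upTo T)             ≤⟨ card-×-≤ R total inj ⟩
    card (Y ⊞ progression (direction i) T) ≤⟨ good i ⟩
    G                                      ∎
    where
    open ≤-Reasoning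
    open Coordinates C
    open import Data.List.Relation.Unary.Unique.Propositional.Properties using (upTo⁺)
    lines = map (drop i) (map coordinates Y)
    cardT : card (upTo T) ≡ T
    cardT = trans (card-unique (upTo⁺ T)) (length-applyUpTo id T)
    OnLine : V d → V (suc d) → Set
    OnLine ℓ y = y ∈ Y × ℓ ≡ drop i (coordinates y)
    chosen = choice OnLine 0v
    f = proj₁ chosen
    R : V d × ℕ → V (suc d) → Set
    R (ℓ , j) z = OnLine ℓ (f ℓ) × z ≡ f ℓ ⊕ pos j ⋆ direction i
    total : ∀ {ℓ j} → ℓ ∈ lines → j ∈ upTo T → ∃[ z ] (z ∈ Y ⊞ progression (direction i) T × R (ℓ , j) z)
    total {ℓ} {j} ℓ∈ j∈ with ∈-map⁻ (drop i) ℓ∈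
    ... | p , p∈ , e with ∈-map⁻ coordinates p∈
    ... | y , y∈ , refl = f ℓ ⊕ pos j ⋆ direction i , ∈-⊞⁺ (proj₁ on) (∈-progression⁺ (∈-upTo⁻ j∈)) , on , refl
      where
      on : OnLine ℓ (f ℓ)
      on = proj₂ chosen ℓ y (y∈ , e)
    image : ∀ y j → coordinates (y ⊕ pos j ⋆ direction i) ≡ coordinates y ⊕ pos (j * multiple) ⋆ unit i
    image y j = trans (coordinates-+ y (pos j ⋆ direction i)) (cong (coordinates y ⊕_) (trans (additive-⋆ coordinates-+ (pos j) (direction i))
      (trans (cong (pos j ⋆_) (coordinates-direction i)) (trans (sym (⋆-assoc (pos j) (pos multiple) (unit i))) (cong (_⋆ unit i) (sym (ℤ.pos-* j multiple)))))))
    unit-cancel : ∀ {n} (i : Fin n) a b → a ⋆ unit i ≡ b ⋆ unit i → a ≡ b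
    unit-cancel zero a b eq = trans (sym (ℤ.*-identityʳ a)) (trans (∷-injectiveˡ eq) (ℤ.*-identityʳ b))
    unit-cancel (suc i) a b eq = unit-cancel i a b (∷-injectiveʳ eq)
    inj : ∀ {p p′ z} → R p z → R p′ z → p ≡ p′
    inj {ℓ , j} {ℓ′ , j′} ((_ , e) , z≡) ((_ , e′) , z≡′) = cong₂ _,_ ℓ≡ j≡
      where
      images : coordinates (f ℓ) ⊕ pos (j * multiple) ⋆ unit i ≡ coordinates (f ℓ′) ⊕ pos (j′ * multiple) ⋆ unit i
      images = trans (sym (image (f ℓ) j)) (trans (cong coordinates (trans (sym z≡) z≡′)) (image (f ℓ′) j′))
      ℓ≡ : ℓ ≡ ℓ′
      ℓ≡ = trans e (trans (sym (drop-unit i (coordinates (f ℓ)) (pos (j * multiple)))) (trans (cong (drop i) images)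
        (trans (drop-unit i (coordinates (f ℓ′)) (pos (j′ * multiple))) (sym e′))))
      j≡ : j ≡ j′
      j≡ = *-cancelʳ-≡ j j′ multiple {{>-nonZero multiple≥1}} (ℤ.+-injective (unit-cancel i (pos (j * multiple)) (pos (j′ * multiple))
        (⊕-cancelˡ (coordinates (f ℓ)) _ _ (trans images (cong (λ t → coordinates (f t) ⊕ pos (j′ * multiple) ⋆ unit i) (sym ℓ≡))))))

  -- The orbit of the direction found by `good-direction` is a rational basis, and the scaled
  -- inverse of the map with these columns gives the coordinates. Each step along the orbit costs a
  -- factor c h, hence the power d.
  coordinate-system : ∀ {d} (L₁ L₂ : Mat ℤ d) → Irreducible L₁ L₂ → Injective (act L₁) → Injective (act L₂) →
    (S : ScaledInverse (act L₁)) (A : List (V d)) (h t : ℕ) {a : V d} → a ∈ A → 1 ≤ h →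
    card (map (act L₁) A ⊞ map (act L₂) A) ≤ h * card A → (h ^ 5) ^ t < card A →
    Coordinates (map (act L₂) A) (2 ^ t) ((ScaledInverse.scale S * h) ^ d * (suc (suc (t + t)) ^ (h ^ 5) * (h * h * card A)))
  coordinate-system {d} L₁ L₂ irr inj₁ inj₂ S A h t {a} a∈ h≥1 small large = record
    { coordinates = inv
    ; coordinates-+ = inv-+
    ; coordinates-injective = λ w e → ⋆-cancel w (pos-≢0 scale≥1) (trans (sym (f-inv w)) (trans (cong W e) W0))
    ; direction = lookup basisV
    ; multiple = scale ; multiple≥1 = scale≥1
    ; coordinates-direction = λ i → injective⇒cancel W-+ independent (trans (f-inv (lookup basisV i))
        (trans (cong (pos scale ⋆_) (sym (combination-unit i basisV))) (sym (combination-⋆ (pos scale) (unit i) basisV))))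
    ; good = all-good d ≤-refl
    }
    where
    c = ScaledInverse.scale S
    X = map (act L₁) A
    Y = map (act L₂) A
    cardX : card X ≡ card A
    cardX = card-map (act L₁) (injective⇒cancel (act-+ L₁) inj₁) A
    cardY : card Y ≡ card A
    cardY = card-map (act L₂) (injective⇒cancel (act-+ L₂) inj₂) A
    found : ∃[ v ] (v ≢ 0v × card (Y ⊞ progression v (2 ^ t)) ≤ suc (suc (t + t)) ^ (h ^ 5) * (h * h * card X))
    found = good-direction X Y h t (∈-map⁺ (act L₁) a∈) (trans cardY (sym cardX)) (subst (λ n → card (X ⊞ Y) ≤ h * n) (sym cardX) small)
      (subst ((h ^ 5) ^ t <_) (sym cardY) large)
    v = proj₁ found
    g : ℕ
    g = suc (suc (t + t)) ^ (h ^ 5) * (h * h * card A)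
    v-good : card (Y ⊞ progression v (2 ^ t)) ≤ g
    v-good = subst (λ n → card (Y ⊞ progression v (2 ^ t)) ≤ suc (suc (t + t)) ^ (h ^ 5) * (h * h * n)) cardX (proj₂ (proj₂ found))
    basisV : Vec (V d) d
    basisV = us L₁ L₂ irr inj₁ S v (proj₁ (proj₂ found)) d
    W : V d → V d
    W a = combination a basisV
    W-+ : Additive W
    W-+ a b = combination-⊕ a b basisV
    W0 : W 0v ≡ 0v
    W0 = combination-0 basisV
    independent : Injective W
    independent = us-independent L₁ L₂ irr inj₁ S v (proj₁ (proj₂ found)) d ≤-refl
    open ScaledInverse (scaled-inverse W-+ independent)
    all-good : ∀ k → k ≤ d → ∀ (i : Fin k) →
      card (Y ⊞ progression (lookup (us L₁ L₂ irr inj₁ S v (proj₁ (proj₂ found)) k) i) (2 ^ t)) ≤ (c * h) ^ d * g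
    all-good (suc k) k<d zero = ≤-trans (orbit-good L₁ L₂ irr inj₁ S A h (2 ^ t) (m^n>0 2 t) a∈ inj₂ small v g v-good k)
      (*-monoˡ-≤ g (^-monoʳ-≤ (c * h) {{>-nonZero (*-mono-≤ (ScaledInverse.scale≥1 S) h≥1)}} (<⇒≤ k<d)))
    all-good (suc k) k<d (suc i) = all-good k (<⇒≤ k<d) i

-- Ordered-field arithmetic, roots and excluded middle from completeness.

module Reals {ℓ} (R : CompleteOrderedField ℓ) where
  open CompleteOrderedField R public hiding (refl; sym; trans)
  open Real R public using (fromℕ; fromℤ; _^_; _^ʳ_; AbovePower; archimedean)
  open CompleteOrderedField R using () renaming (refl to ≈-refl; sym to ≈-sym; trans to ≈-trans) public
  open import Relation.Binary.Structures using (IsDecTotalOrder)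
  open IsDecTotalOrder isDecTotalOrder public
    using (total; antisym; _≟_; _≤?_)
    renaming (refl to ≤-refl; reflexive to ≤-reflexive; trans to ≤-trans; ≤-respʳ-≈ to ≤-respʳ; ≤-respˡ-≈ to ≤-respˡ)
  open import Algebra.Bundles using (CommutativeRing)
  import Algebra.Properties.Ring as RingProperties
  open RingProperties ring public using (-‿distribʳ-*; -‿distribˡ-*; -‿involutive; -0#≈0#; -‿+-comm)
  import Algebra.Properties.Monoid.Mult as Mult
  import Algebra.Properties.Monoid.Mult.TCOptimised as Mult′
  import Algebra.Properties.Semiring.Mult as SMult
  import Algebra.Properties.Semiring.Exp as Exp
  import Algebra.Properties.CommutativeSemiring.Exp as CExp
  import Algebra.Definitions.RawMonoid as RawMonoidDefs
  open import Algebra.Solver.Ring.AlmostCommutativeRing using (fromCommutativeRing; _-Raw-AlmostCommutative⟶_)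
  open import Data.Nat.Base as ℕ using (ℕ; zero; suc)
  import Data.Nat.Properties as ℕ
  open import Data.Integer.Base as ℤ using (ℤ; 0ℤ; 1ℤ; -[1+_]) renaming (+_ to pos)
  import Data.Integer.Properties as ℤ
  open import Data.Product.Base using (∃; ∃-syntax; _×_; _,_; proj₁; proj₂)
  open import Data.Sum.Base using (_⊎_; inj₁; inj₂)
  open import Data.Vec.N-ary using (N-ary; N-ary-level; _$ⁿ_; curryⁿ; Eq; curryⁿ-cong)
  import Data.Vec.Base as Vec
  open import Data.Maybe.Base using (Maybe; just; nothing)
  open import Data.Empty using (⊥-elim)
  open import Level using (0ℓ; Lift; lift; lower)
  open import Relation.Nullary using (Dec; yes; no; ¬_)
  import Relation.Binary.PropositionalEquality as ≡
  open ≡ using (_≡_)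
  import Relation.Binary.Reasoning.Setoid as SetoidReasoning
  module ≈-Reasoning = SetoidReasoning setoid

  fromℕ-+ : ∀ m n → fromℕ (m ℕ.+ n) ≈ fromℕ m + fromℕ n
  fromℕ-+ m n = Mult.×-homo-+ +-monoid 1# m n

  fromℕ-* : ∀ m n → fromℕ (m ℕ.* n) ≈ fromℕ m * fromℕ n
  fromℕ-* m n = SMult.×1-homo-* semiring m n

  fromℕ-1 : fromℕ 1 ≈ 1#
  fromℕ-1 = +-identityʳ 1#

  private
    cancel-1 : ∀ a b → (1# + a) + - (1# + b) ≈ a + - b
    cancel-1 a b = begin
      (1# + a) + - (1# + b)      ≈⟨ +-cong (+-comm 1# a) (≈-sym (-‿+-comm 1# b)) ⟩
      (a + 1#) + (- 1# + - b)    ≈⟨ +-assoc a 1# _ ⟩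
      a + (1# + (- 1# + - b))    ≈⟨ +-congˡ (≈-sym (+-assoc 1# (- 1#) (- b))) ⟩
      a + ((1# + - 1#) + - b)    ≈⟨ +-congˡ (+-congʳ (-‿inverseʳ 1#)) ⟩
      a + (0# + - b)             ≈⟨ +-congˡ (+-identityˡ (- b)) ⟩
      a + - b                    ∎
      where open ≈-Reasoning

    fromℤ-⊖ : ∀ m n → fromℤ (m ℤ.⊖ n) ≈ fromℕ m + - fromℕ n
    fromℤ-⊖ m zero = ≈-sym (≈-trans (+-congˡ -0#≈0#) (+-identityʳ (fromℕ m)))
    fromℤ-⊖ zero (suc n) = ≈-sym (+-identityˡ _)
    fromℤ-⊖ (suc m) (suc n) = ≈-trans (reflexive (≡.cong fromℤ (ℤ.[1+m]⊖[1+n]≡m⊖n m n))) (≈-trans (fromℤ-⊖ m n) (≈-sym (cancel-1 (fromℕ m) (fromℕ n))))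

  fromℤ-+ : ∀ i j → fromℤ (i ℤ.+ j) ≈ fromℤ i + fromℤ j
  fromℤ-+ (pos m) (pos n) = fromℕ-+ m n
  fromℤ-+ (pos m) -[1+ n ] = fromℤ-⊖ m (suc n)
  fromℤ-+ -[1+ m ] (pos n) = ≈-trans (fromℤ-⊖ n (suc m)) (+-comm _ _)
  fromℤ-+ -[1+ m ] -[1+ n ] = ≈-trans (-‿cong (≈-trans (reflexive (≡.cong fromℕ (≡.sym (≡.cong suc (ℕ.+-suc m n))))) (fromℕ-+ (suc m) (suc n)))) (≈-sym (-‿+-comm _ _))

  fromℤ-neg : ∀ i → fromℤ (ℤ.- i) ≈ - fromℤ i
  fromℤ-neg (pos zero) = ≈-sym -0#≈0#
  fromℤ-neg (pos (suc n)) = ≈-refl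
  fromℤ-neg -[1+ n ] = ≈-sym (-‿involutive _)

  fromℤ-* : ∀ i j → fromℤ (i ℤ.* j) ≈ fromℤ i * fromℤ j
  fromℤ-* (pos m) j = natural m
    where
    natural : ∀ m → fromℤ (pos m ℤ.* j) ≈ fromℕ m * fromℤ j
    natural zero = ≈-trans (reflexive (≡.cong fromℤ (ℤ.*-zeroˡ j))) (≈-sym (zeroˡ (fromℤ j)))
    natural (suc m) = begin
      fromℤ (pos (suc m) ℤ.* j)          ≈⟨ reflexive (≡.cong fromℤ (ℤ.suc-* (pos m) j)) ⟩
      fromℤ (j ℤ.+ pos m ℤ.* j)          ≈⟨ fromℤ-+ j (pos m ℤ.* j) ⟩
      fromℤ j + fromℤ (pos m ℤ.* j)      ≈⟨ +-cong (≈-sym (*-identityˡ _)) (natural m) ⟩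
      1# * fromℤ j + fromℕ m * fromℤ j   ≈⟨ ≈-sym (distribʳ (fromℤ j) 1# (fromℕ m)) ⟩
      (1# + fromℕ m) * fromℤ j           ∎
      where open ≈-Reasoning
  fromℤ-* -[1+ m ] j = begin
    fromℤ (-[1+ m ] ℤ.* j)               ≈⟨ reflexive (≡.cong fromℤ (≡.sym (ℤ.neg-distribˡ-* (pos (suc m)) j))) ⟩
    fromℤ (ℤ.- (pos (suc m) ℤ.* j))      ≈⟨ fromℤ-neg (pos (suc m) ℤ.* j) ⟩
    - fromℤ (pos (suc m) ℤ.* j)          ≈⟨ -‿cong (fromℤ-* (pos (suc m)) j) ⟩
    - (fromℕ (suc m) * fromℤ j)          ≈⟨ -‿distribˡ-* _ _ ⟩
    - fromℕ (suc m) * fromℤ j            ∎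
    where open ≈-Reasoning

  private
    open RawMonoidDefs +-rawMonoid using (_×′_)

    coefficient : ℤ → ℝ
    coefficient (pos n)  = n ×′ 1#
    coefficient -[1+ n ] = - (suc n ×′ 1#)

    coefficient≈ : ∀ z → coefficient z ≈ fromℤ z
    coefficient≈ (pos n)  = ≈-sym (Mult′.×ᵤ≈× +-monoid n 1#)
    coefficient≈ -[1+ n ] = -‿cong (≈-sym (Mult′.×ᵤ≈× +-monoid (suc n) 1#))

    coefficient-homomorphism : CommutativeRing.rawRing ℤ.+-*-commutativeRing -Raw-AlmostCommutative⟶ fromCommutativeRing commutativeRing
    coefficient-homomorphism = record
      { ⟦_⟧    = coefficient
      ; +-homo = λ i j → ≈-trans (coefficient≈ (i ℤ.+ j)) (≈-trans (fromℤ-+ i j) (≈-sym (+-cong (coefficient≈ i) (coefficient≈ j))))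
      ; *-homo = λ i j → ≈-trans (coefficient≈ (i ℤ.* j)) (≈-trans (fromℤ-* i j) (≈-sym (*-cong (coefficient≈ i) (coefficient≈ j))))
      ; -‿homo = λ i → ≈-trans (coefficient≈ (ℤ.- i)) (≈-trans (fromℤ-neg i) (≈-sym (-‿cong (coefficient≈ i))))
      ; 0-homo = ≈-refl
      ; 1-homo = ≈-refl
      }

    coefficient-≟ : ∀ i j → Maybe (coefficient i ≈ coefficient j)
    coefficient-≟ i j with i ℤ.≟ j
    ... | yes ≡.refl = just ≈-refl
    ... | no _ = nothing

  import Algebra.Solver.Ring as RingSolver
  module Solver = RingSolver (CommutativeRing.rawRing ℤ.+-*-commutativeRing) (fromCommutativeRing commutativeRing) coefficient-homomorphism coefficient-≟
  open Solver public using (_:=_; _:+_; _:*_; :-_; _:-_; con; _:^_)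

  private
    Identity : (n : ℕ) → Set (N-ary-level 0ℓ 0ℓ n)
    Identity n = N-ary n (Solver.Polynomial n) (Solver.Polynomial n × Solver.Polynomial n)

    sides : ∀ n → Identity n → Solver.Polynomial n × Solver.Polynomial n
    sides n e = e $ⁿ Vec.tabulate Solver.var

  -- The library's ring solver, except that normal forms are compared as data and not by their values.
  solve : ∀ n (e : Identity n) → Solver.normalise (proj₁ (sides n e)) ≡ Solver.normalise (proj₂ (sides n e)) →
    Eq n _≈_ (curryⁿ Solver.⟦ proj₁ (sides n e) ⟧) (curryⁿ Solver.⟦ proj₂ (sides n e) ⟧)
  solve n e eq = curryⁿ-cong _≈_ Solver.⟦ proj₁ (sides n e) ⟧ Solver.⟦ proj₂ (sides n e) ⟧
    (λ ρ → Solver.prove ρ (proj₁ (sides n e)) (proj₂ (sides n e)) (reflexive (≡.cong (λ p → Solver.⟦ p ⟧N ρ) eq)))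

  :1 :0 : ∀ {n} → Solver.Polynomial n
  :1 = con 1ℤ
  :0 = con 0ℤ

  ≤-by : ∀ {x y} e → 0# ≤ e → y ≈ x + e → x ≤ y
  ≤-by {x} {y} e 0≤e eq = ≤-respˡ (≈-trans (+-comm 0# x) (+-identityʳ x)) (≤-respʳ (≈-sym (≈-trans eq (+-comm x e))) (+-monoˡ-≤ x 0≤e))

  difference : ∀ {x y} → x ≤ y → 0# ≤ y - x
  difference {x} {y} x≤y = ≤-respˡ (-‿inverseʳ x) (+-monoˡ-≤ (- x) x≤y)

  +-mono-≤ : ∀ {x x′ y y′} → x ≤ x′ → y ≤ y′ → x + y ≤ x′ + y′
  +-mono-≤ {x} {x′} {y} {y′} p q = ≤-trans (+-monoˡ-≤ y p) (≤-respˡ (+-comm y x′) (≤-respʳ (+-comm y′ x′) (+-monoˡ-≤ x′ q)))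

  +-monoʳ-≤ : ∀ z {x y} → x ≤ y → z + x ≤ z + y
  +-monoʳ-≤ z p = +-mono-≤ ≤-refl p

  +-nonNeg : ∀ {x y} → 0# ≤ x → 0# ≤ y → 0# ≤ x + y
  +-nonNeg p q = ≤-respˡ (+-identityˡ 0#) (+-mono-≤ p q)

  *-monoˡ-≤ : ∀ {x y} z → 0# ≤ z → x ≤ y → z * x ≤ z * y
  *-monoˡ-≤ {x} {y} z 0≤z p = ≤-by (z * (y - x)) (*-nonNegative 0≤z (difference p))
    (solve 3 (λ x y z → z :* y := z :* x :+ z :* (y :- x)) ≡.refl x y z)

  *-monoʳ-≤ : ∀ {x y} z → 0# ≤ z → x ≤ y → x * z ≤ y * z
  *-monoʳ-≤ z 0≤z p = ≤-respˡ (*-comm z _) (≤-respʳ (*-comm z _) (*-monoˡ-≤ z 0≤z p))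

  *-mono-≤ : ∀ {x x′ y y′} → 0# ≤ x → x ≤ x′ → 0# ≤ y → y ≤ y′ → x * y ≤ x′ * y′
  *-mono-≤ {x} {x′} {y} {y′} 0≤x p 0≤y q = ≤-trans (*-monoʳ-≤ y 0≤y p) (*-monoˡ-≤ x′ (≤-trans 0≤x p) q)

  square-nonNeg : ∀ x → 0# ≤ x * x
  square-nonNeg x with total 0# x
  ... | inj₁ p = *-nonNegative p p
  ... | inj₂ p = ≤-respʳ (solve 1 (λ x → (:0 :- x) :* (:0 :- x) := x :* x) ≡.refl x) (*-nonNegative (difference p) (difference p))

  0≤1 : 0# ≤ 1#
  0≤1 = ≤-respʳ (*-identityˡ 1#) (square-nonNeg 1#)

  0<1 : 0# < 1#
  0<1 = 0≤1 , 0≉1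

  ≰⇒≥ : ∀ {x y} → ¬ x ≤ y → y ≤ x
  ≰⇒≥ {x} {y} n with total x y
  ... | inj₁ p = ⊥-elim (n p)
  ... | inj₂ p = p

  ≰⇒> : ∀ {x y} → ¬ x ≤ y → y < x
  ≰⇒> n = ≰⇒≥ n , λ y≈x → n (≤-reflexive (≈-sym y≈x))

  <⇒≱ : ∀ {x y} → x < y → ¬ y ≤ x
  <⇒≱ (x≤y , x≉y) y≤x = x≉y (antisym x≤y y≤x)

  <-≤-trans : ∀ {x y z} → x < y → y ≤ z → x < z
  <-≤-trans (x≤y , x≉y) y≤z = ≤-trans x≤y y≤z , λ x≈z → x≉y (antisym x≤y (≤-respʳ (≈-sym x≈z) y≤z))

  ≤-<-trans : ∀ {x y z} → x ≤ y → y < z → x < z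
  ≤-<-trans x≤y (y≤z , y≉z) = ≤-trans x≤y y≤z , λ x≈z → y≉z (antisym y≤z (≤-respˡ x≈z x≤y))

  pos⇒≉0 : ∀ {x} → 0# < x → ¬ x ≈ 0#
  pos⇒≉0 (_ , n) e = n (≈-sym e)

  ⁻¹-pos : ∀ {x} → 0# < x → 0# < x ⁻¹
  ⁻¹-pos {x} 0<x = ≰⇒> λ x⁻¹≤0 → <⇒≱ 0<1 (≤-respˡ (*-inverseʳ x (pos⇒≉0 0<x)) (≤-respʳ (zeroʳ x) (*-monoˡ-≤ x (proj₁ 0<x) x⁻¹≤0)))

  *-cancelˡ-≤ : ∀ {x y} z → 0# < z → z * x ≤ z * y → x ≤ y
  *-cancelˡ-≤ {x} {y} z 0<z p = ≤-respˡ (undo x) (≤-respʳ (undo y) (*-monoˡ-≤ (z ⁻¹) (proj₁ (⁻¹-pos 0<z)) p))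
    where
    undo : ∀ w → z ⁻¹ * (z * w) ≈ w
    undo w = ≈-trans (≈-sym (*-assoc _ z w)) (≈-trans (*-congʳ (≈-trans (*-comm _ z) (*-inverseʳ z (pos⇒≉0 0<z)))) (*-identityˡ w))

  *-cancelˡ-≈ : ∀ {x y} z → 0# < z → z * x ≈ z * y → x ≈ y
  *-cancelˡ-≈ z 0<z p = antisym (*-cancelˡ-≤ z 0<z (≤-reflexive p)) (*-cancelˡ-≤ z 0<z (≤-reflexive (≈-sym p)))

  *-pos : ∀ {x y} → 0# < x → 0# < y → 0# < x * y
  *-pos {x} {y} 0<x 0<y = *-nonNegative (proj₁ 0<x) (proj₁ 0<y) , λ 0≈xy → proj₂ 0<y (≈-sym (*-cancelˡ-≈ x 0<x (≈-trans (≈-sym 0≈xy) (≈-sym (zeroʳ x)))))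

  *-strictˡ : ∀ {x y} z → 0# < z → x < y → z * x < z * y
  *-strictˡ z 0<z (x≤y , x≉y) = *-monoˡ-≤ z (proj₁ 0<z) x≤y , λ e → x≉y (*-cancelˡ-≈ z 0<z e)

  fromℕ-nonNeg : ∀ n → 0# ≤ fromℕ n
  fromℕ-nonNeg zero = ≤-refl
  fromℕ-nonNeg (suc n) = +-nonNeg 0≤1 (fromℕ-nonNeg n)

  fromℕ-mono : ∀ {m n} → m ℕ.≤ n → fromℕ m ≤ fromℕ n
  fromℕ-mono {n = n} ℕ.z≤n = fromℕ-nonNeg n
  fromℕ-mono (ℕ.s≤s p) = +-monoʳ-≤ 1# (fromℕ-mono p)

  fromℕ-≥1 : ∀ {n} → 1 ℕ.≤ n → 1# ≤ fromℕ n
  fromℕ-≥1 p = ≤-respˡ fromℕ-1 (fromℕ-mono p)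

  fromℕ-pos : ∀ {n} → 1 ℕ.≤ n → 0# < fromℕ n
  fromℕ-pos p = <-≤-trans 0<1 (fromℕ-≥1 p)

  fromℕ-cancel-≤ : ∀ {m n} → fromℕ m ≤ fromℕ n → m ℕ.≤ n
  fromℕ-cancel-≤ {m} {n} p with m ℕ.≤? n
  ... | yes q = q
  ... | no q = ⊥-elim (<⇒≱ 0<1 (≤-respˡ (solve 2 (λ u n → (u :+ n) :- n := u) ≡.refl 1# (fromℕ n))
    (≤-respʳ (-‿inverseʳ (fromℕ n)) (+-monoˡ-≤ (- fromℕ n) (≤-trans (fromℕ-mono (ℕ.≰⇒> q)) p)))))

  ^-nonNeg : ∀ {x} n → 0# ≤ x → 0# ≤ x ^ n
  ^-nonNeg zero _ = 0≤1
  ^-nonNeg (suc n) p = *-nonNegative p (^-nonNeg n p)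

  ^-pos : ∀ {x} n → 0# < x → 0# < x ^ n
  ^-pos zero _ = 0<1
  ^-pos (suc n) p = *-pos p (^-pos n p)

  ^-mono-≤ : ∀ {x y} n → 0# ≤ x → x ≤ y → x ^ n ≤ y ^ n
  ^-mono-≤ zero _ _ = ≤-refl
  ^-mono-≤ (suc n) 0≤x p = *-mono-≤ 0≤x p (^-nonNeg n 0≤x) (^-mono-≤ n 0≤x p)

  ^-≥1 : ∀ {x} n → 1# ≤ x → 1# ≤ x ^ n
  ^-≥1 zero _ = ≤-refl
  ^-≥1 (suc n) p = ≤-respˡ (*-identityˡ 1#) (*-mono-≤ 0≤1 p 0≤1 (^-≥1 n p))

  ^-strict : ∀ {x y} n → 0# ≤ x → x < y → x ^ suc n < y ^ suc n
  ^-strict {x} {y} n 0≤x x<y = ≤-<-trans (*-monoˡ-≤ x 0≤x (^-mono-≤ n 0≤x (proj₁ x<y)))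
    (let p , q = *-strictˡ (y ^ n) (^-pos n (≤-<-trans 0≤x x<y)) x<y in
      ≤-respˡ (*-comm (y ^ n) x) (≤-respʳ (*-comm (y ^ n) y) p) , λ e → q (≈-trans (*-comm (y ^ n) x) (≈-trans e (*-comm y (y ^ n)))))

  ^-cancel-≤ : ∀ {x y} n → 0# ≤ y → x ^ suc n ≤ y ^ suc n → x ≤ y
  ^-cancel-≤ {x} {y} n 0≤y p with x ≤? y
  ... | yes q = q
  ... | no q = ⊥-elim (<⇒≱ (^-strict n 0≤y (≰⇒> q)) p)

  ^-cong : ∀ {x y} n → x ≈ y → x ^ n ≈ y ^ n
  ^-cong n e = Exp.^-congˡ semiring n e

  ^-distrib-* : ∀ x y n → (x * y) ^ n ≈ x ^ n * y ^ n
  ^-distrib-* x y n = CExp.^-distrib-* commutativeSemiring x y n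

  ^-^ : ∀ x m n → (x ^ m) ^ n ≈ x ^ (m ℕ.* n)
  ^-^ x m n = Exp.^-assocʳ semiring x m n

  fromℕ-^ : ∀ m n → fromℕ (m ℕ.^ n) ≈ fromℕ m ^ n
  fromℕ-^ m zero = fromℕ-1
  fromℕ-^ m (suc n) = ≈-trans (fromℕ-* m (m ℕ.^ n)) (*-congˡ (fromℕ-^ m n))

  1^ : ∀ n → 1# ^ n ≈ 1#
  1^ zero = ≈-refl
  1^ (suc n) = ≈-trans (*-identityˡ _) (1^ n)

  -- The tangent of x^(n+1) at p lies below the curve on the whole half-line, also to the left of p,
  -- so q may be negative. The induction multiplies by p + q and leaves a surplus containing q².
  bernoulli : ∀ p q n → 0# ≤ p → 0# ≤ p + q → p ^ suc n + fromℕ (suc n) * (p ^ n * q) ≤ (p + q) ^ suc n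
  bernoulli p q zero 0≤p 0≤p+q = ≤-reflexive (solve 2 (λ p q → p :* :1 :+ (:1 :+ :0) :* (:1 :* q) := (p :+ q) :* :1) ≡.refl p q)
  bernoulli p q (suc n) 0≤p 0≤p+q = ≤-trans
    (≤-by (fromℕ (suc n) * (p ^ n * (q * q))) (*-nonNegative (fromℕ-nonNeg (suc n)) (*-nonNegative (^-nonNeg n 0≤p) (square-nonNeg q)))
      (solve 4 (λ p q m e → (p :+ q) :* (p :* e :+ (:1 :+ m) :* (e :* q)) :=
          (p :* (p :* e) :+ (:1 :+ (:1 :+ m)) :* ((p :* e) :* q)) :+ (:1 :+ m) :* (e :* (q :* q))) ≡.refl p q (fromℕ n) (p ^ n)))
    (*-monoˡ-≤ (p + q) 0≤p+q (bernoulli p q n 0≤p 0≤p+q))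

  power-difference : ∀ {x y} n → 0# ≤ x → 0# ≤ y → y ^ suc n ≤ x ^ suc n + fromℕ (suc n) * (y ^ n * (y - x))
  power-difference {x} {y} n 0≤x 0≤y = ≤-by _ (difference (bernoulli y (x - y) n 0≤y (≤-respʳ x≈ 0≤x)))
    (≈-trans (solve 5 (λ a c d e f → a :+ c :* (d :* (e :- f)) := (d :* e) :+ ((a :- (d :* e :+ c :* (d :* (f :- e)))))) ≡.refl (x ^ suc n) (fromℕ (suc n)) (y ^ n) y x)
      (+-cong (*-comm (y ^ n) y) (+-cong (^-cong (suc n) x≈) (-‿cong (+-congʳ (*-comm (y ^ n) y))))))
    where
    x≈ : x ≈ y + (x - y)
    x≈ = solve 2 (λ x y → x := y :+ (x :- y)) ≡.refl x y

  -- A positive gap δ = u - v is refuted by ε = δ / (C + δ + 1), which is at most 1 and makes C ε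
  -- smaller than δ.
  infinitesimal : ∀ u v C → 0# ≤ C → (∀ ε → 0# < ε → ε ≤ 1# → u ≤ v + C * ε) → u ≤ v
  infinitesimal u v C 0≤C bound with u ≤? v
  ... | yes p = p
  ... | no u≰v = ⊥-elim (<⇒≱ (*-pos 0<ε 0<δ+1) (≤-by (C * ε + v - u) (≤-respʳ (solve 3 (λ u v c → (v :+ c) :- u := c :+ v :- u) ≡.refl u v (C * ε)) (difference (bound ε 0<ε ε≤1)))
      (≈-trans (≈-sym (-‿inverseʳ δ)) (≈-trans (+-congʳ δ≈) (solve 5 (λ e d c u v → e :* (c :+ (d :+ :1)) :- (u :- v) := e :* (d :+ :1) :+ (c :* e :+ v :- u)) ≡.refl ε δ C u v)))))
    where
    v<u = ≰⇒> u≰v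
    δ = u - v
    0<δ : 0# < δ
    0<δ = difference (proj₁ v<u) , λ e → proj₂ v<u (≈-trans (≈-trans (≈-sym (+-identityʳ v)) (+-congˡ e)) (solve 2 (λ u v → v :+ (u :- v) := u) ≡.refl u v))
    0<δ+1 : 0# < δ + 1#
    0<δ+1 = <-≤-trans 0<1 (≤-by δ (proj₁ 0<δ) (+-comm δ 1#))
    W = C + (δ + 1#)
    0<W : 0# < W
    0<W = <-≤-trans 0<δ+1 (≤-by C 0≤C (+-comm C _))
    ε = δ * W ⁻¹
    0<ε : 0# < ε
    0<ε = *-pos 0<δ (⁻¹-pos 0<W)
    δ≈ : δ ≈ ε * W
    δ≈ = ≈-sym (≈-trans (*-assoc δ (W ⁻¹) W) (≈-trans (*-congˡ (≈-trans (*-comm _ W) (*-inverseʳ W (pos⇒≉0 0<W)))) (*-identityʳ δ)))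
    ε≤1 : ε ≤ 1#
    ε≤1 = *-cancelˡ-≤ W 0<W (≤-respˡ (≈-trans δ≈ (*-comm ε W)) (≤-respʳ (≈-sym (*-identityʳ W))
      (≤-by (C + 1#) (+-nonNeg 0≤C 0≤1) (solve 2 (λ c d → c :+ (d :+ :1) := d :+ (c :+ :1)) ≡.refl C δ))))

  abstract
    -- The root is the supremum of the x ≥ 0 with x^(k+1) ≤ a. Moving it by ε in either direction
    -- changes its power by at most a constant times ε, so `infinitesimal` gives both inequalities.
    root : ∀ k a → 0# ≤ a → ∃[ ρ ] (0# ≤ ρ × ρ ^ suc k ≈ a)
    root k a 0≤a = ρ , 0≤ρ , antisym above below
      where
      InS : ℝ → Set ℓ
      InS x = 0# ≤ x × x ^ suc k ≤ a
      bounded : ∀ {x} → InS x → x ≤ a + 1#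
      bounded {x} (0≤x , le) with x ≤? 1#
      ... | yes x≤1 = ≤-trans x≤1 (≤-by a 0≤a (+-comm a 1#))
      ... | no x≰1 = ≤-trans (≤-trans (≤-respˡ (*-identityʳ x) (*-monoˡ-≤ x 0≤x (^-≥1 k (≰⇒≥ x≰1)))) le) (≤-by 1# 0≤1 ≈-refl)
      sup : ∃ (IsSupremum InS)
      sup = complete InS (0# , ≤-refl , ≤-respˡ (≈-sym (zeroˡ _)) 0≤a) (a + 1# , bounded)
      ρ : ℝ
      ρ = proj₁ sup
      isSup : IsSupremum InS ρ
      isSup = proj₂ sup
      0≤ρ : 0# ≤ ρ
      0≤ρ = proj₁ isSup (≤-refl , ≤-respˡ (≈-sym (zeroˡ _)) 0≤a)
      K : ℝ
      K = fromℕ (suc k)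
      above : ρ ^ suc k ≤ a
      above = infinitesimal _ _ (K * ρ ^ k) (*-nonNegative (fromℕ-nonNeg (suc k)) (^-nonNeg k 0≤ρ)) λ ε 0<ε _ →
        let x , (0≤x , le) , (ρ-ε≤x , _) = proj₂ isSup (ρ-ε<ρ ε 0<ε) in
        ≤-trans (power-difference k 0≤x 0≤ρ) (+-mono-≤ le (≤-respʳ (≈-sym (*-assoc K (ρ ^ k) ε))
          (*-monoˡ-≤ K (fromℕ-nonNeg (suc k)) (*-monoˡ-≤ (ρ ^ k) (^-nonNeg k 0≤ρ)
            (≤-by (x - (ρ - ε)) (difference ρ-ε≤x) (solve 3 (λ e r x → e := (r :- x) :+ (x :- (r :- e))) ≡.refl ε ρ x))))))
        where
        ρ-ε<ρ : ∀ ε → 0# < ε → ρ - ε < ρ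
        ρ-ε<ρ ε (0≤ε , 0≉ε) = ≤-by ε 0≤ε (solve 2 (λ r e → r := (r :- e) :+ e) ≡.refl ρ ε) ,
          λ e → 0≉ε (≈-trans (≈-sym (-‿inverseʳ ρ)) (≈-trans (+-congˡ (-‿cong (≈-sym e))) (solve 2 (λ r e → r :- (r :- e) := e) ≡.refl ρ ε)))
      below : a ≤ ρ ^ suc k
      below = infinitesimal _ _ (K * (ρ + 1#) ^ k) (*-nonNegative (fromℕ-nonNeg (suc k)) (^-nonNeg k (+-nonNeg 0≤ρ 0≤1))) λ ε 0<ε ε≤1 →
        ≤-trans (a≤ ε 0<ε) (≤-trans (power-difference k 0≤ρ (+-nonNeg 0≤ρ (proj₁ 0<ε))) (+-monoʳ-≤ _ (≤-respʳ (≈-sym (*-assoc K _ ε))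
          (*-monoˡ-≤ K (fromℕ-nonNeg (suc k)) (*-mono-≤ (^-nonNeg k (+-nonNeg 0≤ρ (proj₁ 0<ε))) (^-mono-≤ k (+-nonNeg 0≤ρ (proj₁ 0<ε)) (+-monoʳ-≤ ρ ε≤1))
            (≤-respʳ (solve 2 (λ r e → e := (r :+ e) :- r) ≡.refl ρ ε) (proj₁ 0<ε)) (≤-reflexive (solve 2 (λ r e → (r :+ e) :- r := e) ≡.refl ρ ε)))))))
        where
        a≤ : ∀ ε → 0# < ε → a ≤ (ρ + ε) ^ suc k
        a≤ ε 0<ε = ≰⇒≥ λ le → <⇒≱ 0<ε (≤-respˡ (solve 2 (λ r e → (r :+ e) :- r := e) ≡.refl ρ ε) (≤-respʳ (-‿inverseʳ ρ)
          (+-monoˡ-≤ (- ρ) (proj₁ isSup (+-nonNeg 0≤ρ (proj₁ 0<ε) , le)))))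

    -- Completeness decides P: compare with 0 the supremum of {0} ∪ {1 | P}.
    em-ℓ : (P : Set ℓ) → Dec P
    em-ℓ P = decide (complete InS (0# , inj₁ ≈-refl) (1# , bounded))
      where
      InS : ℝ → Set ℓ
      InS x = x ≈ 0# ⊎ (x ≈ 1# × P)
      bounded : ∀ {x} → InS x → x ≤ 1#
      bounded (inj₁ e) = ≤-respˡ (≈-sym e) 0≤1
      bounded (inj₂ (e , _)) = ≤-reflexive e
      decide : ∃ (IsSupremum InS) → Dec P
      decide (s , up , approx) with s ≤? 0#
      ... | yes s≤0 = no λ p → <⇒≱ 0<1 (≤-trans (up (inj₂ (≈-refl , p))) s≤0)
      ... | no s≰0 with approx (≰⇒> s≰0)
      ... | x , inj₁ e , 0<x = ⊥-elim (pos⇒≉0 0<x e)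
      ... | x , inj₂ (_ , p) , _ = yes p

    em : (P : Set) → Dec P
    em P with em-ℓ (Lift ℓ P)
    ... | yes p = yes (lower p)
    ... | no n = no λ p → n (lift p)

-- Layers of a set over its projection along the first axis.

module LayerCake (em : ∀ (P : Set) → Dec P) where
  open Counting
  open WithEM em
  open Vectors
  open Sumsets em
  open Directions em using (drop)
  open import Data.Nat.Base
  open import Data.Nat.Properties
  open import Data.Integer.Base as ℤ using (ℤ)
  import Data.Integer.Properties as ℤ
  open import Algebra.Properties.AbelianGroup ℤ.+-0-abelianGroup using (∙-cancelˡ; ∙-cancelʳ)
  open import Algebra.Properties.CommutativeSemigroup +-commutativeSemigroup using (interchange)
  open import Data.Fin.Base using (Fin; zero; suc)
  open import Data.List.Base using (List; []; _∷_; _++_; map; length; [_])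
  open import Data.List.Membership.Propositional.Properties
  open import Data.List.Relation.Unary.Any using (here; there)
  open import Data.List.Relation.Unary.AllPairs using ([]; _∷_)
  import Data.List.Relation.Unary.All as All
  open import Data.List.Relation.Unary.Unique.Propositional using (Unique)
  open import Data.Maybe.Base using (Maybe; just; nothing)
  open import Data.Maybe.Properties using (just-injective)
  open import Data.Vec.Base as Vec using (Vec; []; _∷_; head; tail)
  open import Data.Vec.Properties using (∷-injectiveˡ)
  open import Data.Product.Base using (∃-syntax; _×_; _,_; proj₁; proj₂)
  open import Data.Sum.Base using (_⊎_; inj₁; inj₂)
  open import Data.Empty using (⊥-elim)
  open import Relation.Nullary using (yes; no)
  open import Relation.Binary.PropositionalEquality hiding ([_])
  open import Function.Base using (_∘_)

  extremum : (_≼_ : ℤ → ℤ → Set) → (∀ {a} → a ≼ a) → (∀ a b → a ≼ b ⊎ b ≼ a) → (∀ {a b c} → a ≼ b → b ≼ c → a ≼ c) →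
    (xs : List ℤ) {x : ℤ} → x ∈ xs → ∃[ m ] (m ∈ xs × (∀ {y} → y ∈ xs → m ≼ y))
  extremum _≼_ rf tot tr (x ∷ []) _ = x , here refl , λ { (here refl) → rf }
  extremum _≼_ rf tot tr (x ∷ y ∷ ys) _ with extremum _≼_ rf tot tr (y ∷ ys) (here refl)
  ... | m , m∈ , min with tot x m
  ... | inj₂ m≼x = m , there m∈ , λ { (here refl) → m≼x ; (there z∈) → min z∈ }
  ... | inj₁ x≼m = x , here refl , λ { (here refl) → rf ; (there z∈) → tr x≼m (min z∈) }

  -- Over ℤ, F + min G and max F + G share one point only.
  integer-sumset : (F G H : List ℤ) {x y : ℤ} → x ∈ F → y ∈ G → (∀ {x y} → x ∈ F → y ∈ G → x ℤ.+ y ∈ H) → card F + card G ≤ suc (card H)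
  integer-sumset F G H x∈ y∈ into with extremum (λ a b → b ℤ.≤ a) ℤ.≤-refl (λ a b → ℤ.≤-total b a) (λ p q → ℤ.≤-trans q p) F x∈
    | extremum ℤ._≤_ ℤ.≤-refl ℤ.≤-total ℤ.≤-trans G y∈
  ... | f , f∈ , f-max | g , g∈ , g-min = begin
    card F + card G                ≤⟨ +-monoʳ-≤ (card F) G≤ ⟩
    card F + suc (card G′)         ≡⟨ +-suc (card F) (card G′) ⟩
    suc (card F + card G′)         ≤⟨ s≤s (subst₂ (λ m n → m + n ≤ card H) (card-map (ℤ._+ g) (λ {a} {b} → cancelʳ a b) F) (card-map (λ y → f ℤ.+ y) (λ {a} {b} → ∙-cancelˡ f a b) G′)
      (card-disjoint (map (ℤ._+ g) F) (map (λ y → f ℤ.+ y) G′) disjoint intoF intoG)) ⟩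
    suc (card H)                   ∎
    where
    open ≤-Reasoning
    G′ = sub (_≢ g) G
    cancelʳ : ∀ a b → a ℤ.+ g ≡ b ℤ.+ g → a ≡ b
    cancelʳ a b e = ∙-cancelʳ g a b e
    G≤ : card G ≤ suc (card G′)
    G≤ = ≤-trans (≤-reflexive (card-sub (_≡ g) G)) (+-monoˡ-≤ (card G′) (≤-trans
      (card-⊆ {Y = [ g ]} (λ p → here (proj₂ (∈-sub⁻ (_≡ g) {G} p)))) (card≤length [ g ])))
    disjoint : Disjoint (map (ℤ._+ g) F) (map (λ y → f ℤ.+ y) G′)
    disjoint p q with ∈-map⁻ (ℤ._+ g) p | ∈-map⁻ (λ y → f ℤ.+ y) q
    ... | x , x∈ , refl | y , y∈ , e with ∈-sub⁻ (_≢ g) {G} y∈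
    ... | y∈G , y≢g = ℤ.<⇒≱ (ℤ.+-monoʳ-< f (ℤ.≤∧≢⇒< (g-min y∈G) (y≢g ∘ sym))) (subst (ℤ._≤ f ℤ.+ g) e (ℤ.+-monoˡ-≤ g (f-max x∈)))
    intoF : ∀ {z} → z ∈ map (ℤ._+ g) F → z ∈ H
    intoF p with ∈-map⁻ (ℤ._+ g) p
    ... | x , x∈ , refl = into x∈ g∈
    intoG : ∀ {z} → z ∈ map (λ y → f ℤ.+ y) G′ → z ∈ H
    intoG p with ∈-map⁻ (λ y → f ℤ.+ y) p
    ... | y , y∈ , refl = into f∈ (proj₁ (∈-sub⁻ (_≢ g) {G} y∈))

  fiber : ∀ {d} → List (V (suc d)) → V d → List ℤ
  fiber X w = map head (sub (λ v → tail v ≡ w) X)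

  ∈-fiber⁺ : ∀ {d} {X : List (V (suc d))} {x w} → x ∷ w ∈ X → x ∈ fiber X w
  ∈-fiber⁺ {w = w} p = ∈-map⁺ head (∈-sub⁺ (λ v → tail v ≡ w) p refl)

  ∈-fiber⁻ : ∀ {d} {X : List (V (suc d))} {x w} → x ∈ fiber X w → x ∷ w ∈ X
  ∈-fiber⁻ {X = X} {w = w} p with ∈-map⁻ head p
  ... | y ∷ v , v∈ , refl with ∈-sub⁻ (λ v → tail v ≡ w) {X} v∈
  ... | q , refl = q

  size : ∀ {d} → List (V (suc d)) → V d → ℕ
  size X w = card (fiber X w)

  -- The s-th layer of X once the points over each w have been pushed together to the heights 1, 2,
  -- ...; the layers decrease in s and their sizes add up to |X|.
  level : ∀ {d} → List (V (suc d)) → ℕ → List (V d)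
  level X s = sub (λ w → s ≤ size X w) (map tail X)

  ∈-level⁺ : ∀ {d} {X : List (V (suc d))} {s w} → 1 ≤ s → s ≤ size X w → w ∈ level X s
  ∈-level⁺ {X = X} {s} {w} 1≤s s≤ with card-nonempty (fiber X w) (≤-trans 1≤s s≤)
  ... | x , x∈ = ∈-sub⁺ (λ w → s ≤ size X w) (∈-map⁺ tail (∈-fiber⁻ {X = X} x∈)) s≤

  ∈-level⁻ : ∀ {d} {X : List (V (suc d))} {s w} → w ∈ level X s → s ≤ size X w
  ∈-level⁻ {X = X} {s} p = proj₂ (∈-sub⁻ (λ w → s ≤ size X w) {map tail X} p)

  total : (ℕ → ℕ) → ℕ → ℕ
  total f zero    = 0
  total f (suc T) = f (suc T) + total f T

  nth : {A : Set} → List A → ℕ → Maybe A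
  nth []       _       = nothing
  nth (x ∷ xs) zero    = just x
  nth (x ∷ xs) (suc i) = nth xs i

  nth-∈ : {A : Set} (xs : List A) {i : ℕ} {x : A} → nth xs i ≡ just x → x ∈ xs
  nth-∈ (y ∷ xs) {zero} refl = here refl
  nth-∈ (y ∷ xs) {suc i} e = there (nth-∈ xs e)

  nth-exists : {A : Set} (xs : List A) {i : ℕ} → i < length xs → ∃[ x ] nth xs i ≡ just x
  nth-exists (x ∷ xs) {zero} _ = x , refl
  nth-exists (x ∷ xs) {suc i} (s≤s p) = nth-exists xs p

  ∈-nth : {A : Set} (xs : List A) {x : A} → x ∈ xs → ∃[ i ] (i < length xs × nth xs i ≡ just x)
  ∈-nth (x ∷ xs) (here refl) = 0 , s≤s z≤n , refl
  ∈-nth (x ∷ xs) (there p) = let i , i< , e = ∈-nth xs p in suc i , s≤s i< , e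

  nth-unique : {A : Set} {xs : List A} → Unique xs → ∀ i j {x} → nth xs i ≡ just x → nth xs j ≡ just x → i ≡ j
  nth-unique (_ ∷ _) zero zero _ _ = refl
  nth-unique {xs = y ∷ xs} (a ∷ u) zero (suc j) refl e = ⊥-elim (All.lookup a (nth-∈ xs e) refl)
  nth-unique {xs = y ∷ xs} (a ∷ u) (suc i) zero e refl = ⊥-elim (All.lookup a (nth-∈ xs e) refl)
  nth-unique (_ ∷ u) (suc i) (suc j) e e′ = cong suc (nth-unique u i j e e′)

  module _ {d} (X : List (V (suc d))) where

    private
      cells : ℕ → List (ℕ × V d)
      cells zero    = []
      cells (suc T) = map (suc T ,_) (level X (suc T)) ++ cells T

      cells-≤ : ∀ T {s w} → (s , w) ∈ cells T → s ≤ T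
      cells-≤ (suc T) p with ∈-++⁻ (map (suc T ,_) (level X (suc T))) p
      ... | inj₁ q with ∈-map⁻ (suc T ,_) q
      ... | _ , _ , refl = ≤-refl
      cells-≤ (suc T) p | inj₂ q = m≤n⇒m≤1+n (cells-≤ T q)

      cells-size : ∀ T {s w} → (s , w) ∈ cells T → 1 ≤ s × s ≤ size X w
      cells-size (suc T) p with ∈-++⁻ (map (suc T ,_) (level X (suc T))) p
      ... | inj₁ q with ∈-map⁻ (suc T ,_) q
      ... | _ , w∈ , refl = s≤s z≤n , ∈-level⁻ {X = X} w∈
      cells-size (suc T) p | inj₂ q = cells-size T q

      ∈-cells : ∀ T {s w} → 1 ≤ s → s ≤ T → s ≤ size X w → (s , w) ∈ cells T
      ∈-cells zero (s≤s _) ()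
      ∈-cells (suc T) {s} 1≤s s≤T s≤size with s ≟ suc T
      ... | yes refl = ∈-++⁺ˡ (∈-map⁺ (suc T ,_) (∈-level⁺ {X = X} 1≤s s≤size))
      ... | no s≢ = ∈-++⁺ʳ (map (suc T ,_) (level X (suc T))) (∈-cells T 1≤s (s≤s⁻¹ (≤∧≢⇒< s≤T s≢)) s≤size)

      card-cells : ∀ T → card (cells T) ≡ total (λ s → card (level X s)) T
      card-cells zero = card-[]
      card-cells (suc T) = trans (≤-antisym (card-++-≤ row (cells T)) (card-++-disjoint row (cells T) disjoint))
        (cong₂ _+_ (card-map (suc T ,_) (cong proj₂) (level X (suc T))) (card-cells T))
        where
        row = map (suc T ,_) (level X (suc T))
        disjoint : Disjoint row (cells T)
        disjoint p q with ∈-map⁻ (suc T ,_) p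
        ... | _ , _ , refl = <⇒≱ ≤-refl (cells-≤ T q)

      -- Pairs the cell (s, w) with the entry at position s - 1 in an arbitrary enumeration of the
      -- fiber over w, so that cells and points are counted against each other.
      Rank : V (suc d) → ℕ × V d → Set
      Rank v (s , w) = tail v ≡ w × (∃[ i ] (s ≡ suc i × nth (uniq (fiber X w)) i ≡ just (head v)))

    layers≤card : ∀ T → total (λ s → card (level X s)) T ≤ card X
    layers≤card T = subst (_≤ card X) (card-cells T) (card-rel (λ c v → Rank v c) {cells T} {X} find (λ {c} {c′} {v} → unique {c} {c′} {v}))
      where
      find : ∀ {c} → c ∈ cells T → ∃[ v ] (v ∈ X × Rank v c)
      find {s , w} c∈ with cells-size T c∈
      find {suc i , w} c∈ | _ , s≤ with nth-exists (uniq (fiber X w)) {i} (subst (i <_) (card≡length-uniq (fiber X w)) s≤)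
      ... | x , e = x ∷ w , ∈-fiber⁻ {X = X} (∈-uniq⁻ (fiber X w) (nth-∈ (uniq (fiber X w)) e)) , refl , i , refl , e
      unique : ∀ {c c′ v} → Rank v c → Rank v c′ → c ≡ c′
      unique {s , w} (refl , i , refl , e) (refl , j , refl , e′) = cong (λ k → suc k , w) (nth-unique (uniq-unique (fiber X w)) i j e e′)

    card≤layers : ∀ T → (∀ w → size X w ≤ T) → card X ≤ total (λ s → card (level X s)) T
    card≤layers T bounded = subst (card X ≤_) (card-cells T) (card-rel Rank {X} {cells T} find (λ {v} {v′} {c} → unique {v} {v′} {c}))
      where
      find : ∀ {v} → v ∈ X → ∃[ c ] (c ∈ cells T × Rank v c)
      find {x ∷ w} v∈ with ∈-nth (uniq (fiber X w)) (∈-uniq⁺ (fiber X w) (∈-fiber⁺ {X = X} v∈))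
      ... | i , i< , e = (suc i , w) , ∈-cells T (s≤s z≤n) (≤-trans i<′ (bounded w)) i<′ , refl , i , refl , e
        where
        i<′ = subst (i <_) (sym (card≡length-uniq (fiber X w))) i<
      unique : ∀ {v v′ c} → Rank v c → Rank v′ c → v ≡ v′
      unique {x ∷ w} {x′ ∷ w′} {suc i , .w} (refl , .i , refl , e) (refl , .i , refl , e′) = cong (_∷ w) (just-injective (trans (sym e) e′))

    size≤card : ∀ w → size X w ≤ card X
    size≤card w = card-inj (_∷ w) (∈-fiber⁻ {X = X}) ∷-injectiveˡ

  -- Fibers with s and t + 1 points have a sum with at least s + t points. This defect of one is the
  -- reason why the layers of Y enter shifted.
  level-⊞ : ∀ {d} (X Y : List (V (suc d))) s t → 1 ≤ s → ∀ {w} → w ∈ level X s ⊞ level Y (suc t) → w ∈ level (X ⊞ Y) (s + t)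
  level-⊞ X Y s t 1≤s w∈ with ∈-⊞⁻ w∈
  ... | u , v , u∈ , v∈ , refl = ∈-level⁺ {X = X ⊞ Y} (≤-trans 1≤s (m≤m+n s t)) (s≤s⁻¹ (begin
    suc (s + t)                      ≡⟨ +-suc s t ⟨
    s + suc t                        ≤⟨ +-mono-≤ (∈-level⁻ {X = X} u∈) (∈-level⁻ {X = Y} v∈) ⟩
    size X u + size Y v              ≤⟨ integer-sumset (fiber X u) (fiber Y v) (fiber (X ⊞ Y) (u ⊕ v))
      (proj₂ (card-nonempty (fiber X u) (≤-trans 1≤s (∈-level⁻ {X = X} u∈)))) (proj₂ (card-nonempty (fiber Y v) (≤-trans (s≤s z≤n) (∈-level⁻ {X = Y} v∈))))
      (λ p q → ∈-fiber⁺ {X = X ⊞ Y} (∈-⊞⁺ (∈-fiber⁻ {X = X} p) (∈-fiber⁻ {X = Y} q))) ⟩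
    suc (size (X ⊞ Y) (u ⊕ v))       ∎))
    where open ≤-Reasoning

  level-anti : ∀ {d} (X : List (V (suc d))) s {w} → w ∈ level X (suc s) → w ∈ level X s
  level-anti X s p = let q , r = ∈-sub⁻ (λ w → suc s ≤ size X w) {map tail X} p in ∈-sub⁺ (λ w → s ≤ size X w) q (<⇒≤ r)

  sumFin : ∀ {n} → (Fin n → ℕ) → ℕ
  sumFin {zero} f = 0
  sumFin {suc n} f = f zero + sumFin (f ∘ suc)

  sumFin-mono : ∀ {n} {f g : Fin n → ℕ} → (∀ i → f i ≤ g i) → sumFin f ≤ sumFin g
  sumFin-mono {zero} _ = z≤n
  sumFin-mono {suc n} p = +-mono-≤ (p zero) (sumFin-mono (p ∘ suc))

  sumFin-+ : ∀ {n} (f g : Fin n → ℕ) → sumFin (λ i → f i + g i) ≡ sumFin f + sumFin g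
  sumFin-+ {zero} f g = refl
  sumFin-+ {suc n} f g = trans (cong (f zero + g zero +_) (sumFin-+ (f ∘ suc) (g ∘ suc)))
    (interchange (f zero) (g zero) (sumFin (f ∘ suc)) (sumFin (g ∘ suc)))

  total-sumFin : ∀ {n} (f : ℕ → Fin n → ℕ) T → total (λ t → sumFin (f t)) T ≡ sumFin (λ i → total (λ t → f t i) T)
  total-sumFin {n} f zero = sym (zeros n)
    where
    zeros : ∀ n → sumFin {n} (λ _ → 0) ≡ 0
    zeros zero = refl
    zeros (suc n) = zeros n
  total-sumFin f (suc T) = trans (cong (sumFin (f (suc T)) +_) (total-sumFin f T)) (sym (sumFin-+ (f (suc T)) _))

  total-mono : ∀ {f g : ℕ → ℕ} T → (∀ t → 1 ≤ t → f t ≤ g t) → total f T ≤ total g T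
  total-mono zero p = z≤n
  total-mono (suc T) p = +-mono-≤ (p (suc T) (s≤s z≤n)) (total-mono T p)

  -- The number of lines in each coordinate direction that meet Y.
  loss : ∀ {d} → List (V d) → ℕ
  loss {zero} Y  = 0
  loss {suc d} Y = sumFin (λ i → card (map (drop i) Y))

  -- The first layer of Y counts the lines along the first axis. A line along axis i of the layer t
  -- is a point of the layer t of Y projected along axis i + 1; summed over t, these are at most the
  -- lines along axis i + 1.
  loss-levels : ∀ {d} (Y : List (V (suc d))) T → card (level Y 1) + total (λ t → loss (level Y t)) T ≤ loss Y
  loss-levels {zero} Y T = +-mono-≤ (card-⊆ base) (≤-reflexive (zeros T))
    where
    base : ∀ {w} → w ∈ level Y 1 → w ∈ map (drop zero) Y
    base p with ∈-map⁻ tail (proj₁ (∈-sub⁻ (λ w → 1 ≤ size Y w) {map tail Y} p))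
    ... | (y ∷ w) , y∈ , refl = ∈-map⁺ (drop zero) y∈
    zeros : ∀ T → total (λ _ → 0) T ≡ 0
    zeros zero = refl
    zeros (suc T) = zeros T
  loss-levels {suc d} Y T = +-mono-≤ (card-⊆ base) (≤-trans (≤-reflexive (total-sumFin (λ t i → card (map (drop i) (level Y t))) T))
    (sumFin-mono λ i → ≤-trans (total-mono T λ t 1≤t → card-⊆ (shadow i t 1≤t)) (layers≤card (map (drop (suc i)) Y) T)))
    where
    base : ∀ {w} → w ∈ level Y 1 → w ∈ map (drop zero) Y
    base p with ∈-map⁻ tail (proj₁ (∈-sub⁻ (λ w → 1 ≤ size Y w) {map tail Y} p))
    ... | (y ∷ w) , y∈ , refl = ∈-map⁺ (drop zero) y∈
    shadow : ∀ i t → 1 ≤ t → ∀ {u} → u ∈ map (drop i) (level Y t) → u ∈ level (map (drop (suc i)) Y) t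
    shadow i t 1≤t u∈ with ∈-map⁻ (drop i) u∈
    ... | w , w∈ , refl = ∈-level⁺ {X = map (drop (suc i)) Y} 1≤t (≤-trans (∈-level⁻ {X = Y} w∈)
      (card-⊆ λ x∈ → ∈-fiber⁺ {X = map (drop (suc i)) Y} (∈-map⁺ (drop (suc i)) (∈-fiber⁻ {X = Y} x∈))))

-- A discrete Brunn-Minkowski inequality with a correction for lines.

module BrunnMinkowski {ℓ} (R : CompleteOrderedField ℓ) where
  open Reals R hiding (total)
  open Counting
  open WithEM em
  open Vectors using (V)
  open Sumsets em
  open LayerCake em
  open Reals R using () renaming (total to ≤-total)
  open import Data.Nat.Base as ℕ using (ℕ; zero; suc; s≤s; z≤n)
  import Data.Nat.Properties as ℕ
  open import Data.List.Base using (List; []; _∷_; upTo)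
  open import Data.List.Membership.Propositional.Properties
  open import Data.List.Relation.Unary.Any using (here)
  open import Data.Product.Base using (∃-syntax; _×_; _,_; proj₁; proj₂)
  open import Data.Sum.Base using (inj₁; inj₂)
  open import Relation.Nullary using (yes; no)
  import Relation.Binary.PropositionalEquality as ≡
  open ≡ using (_≡_)

  -- In dimension 0 a nonempty set is a single point, and the 0-th root is set to 1 to fit it.
  nthRoot : ℕ → ℕ → ℝ
  nthRoot zero    n = 1#
  nthRoot (suc k) n = proj₁ (root k (fromℕ n) (fromℕ-nonNeg n))

  nthRoot-nonNeg : ∀ k n → 0# ≤ nthRoot k n
  nthRoot-nonNeg zero n = 0≤1
  nthRoot-nonNeg (suc k) n = proj₁ (proj₂ (root k (fromℕ n) (fromℕ-nonNeg n)))

  nthRoot-^ : ∀ k n → (k ≡ 0 → n ≡ 1) → nthRoot k n ^ k ≈ fromℕ n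
  nthRoot-^ zero n p = ≈-trans (≈-sym fromℕ-1) (reflexive (≡.cong fromℕ (≡.sym (p ≡.refl))))
  nthRoot-^ (suc k) n _ = proj₂ (proj₂ (root k (fromℕ n) (fromℕ-nonNeg n)))

  nthRoot-suc : ∀ k n → nthRoot (suc k) n ^ suc k ≈ fromℕ n
  nthRoot-suc k n = nthRoot-^ (suc k) n λ ()

  nthRoot-mono : ∀ k {m n} → m ℕ.≤ n → nthRoot k m ≤ nthRoot k n
  nthRoot-mono zero _ = ≤-refl
  nthRoot-mono (suc k) {m} {n} p = ^-cancel-≤ k (nthRoot-nonNeg (suc k) n)
    (≤-respˡ (≈-sym (nthRoot-suc k m)) (≤-respʳ (≈-sym (nthRoot-suc k n)) (fromℕ-mono p)))

  nthRoot-≥1 : ∀ k {n} → 1 ℕ.≤ n → 1# ≤ nthRoot k n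
  nthRoot-≥1 zero _ = ≤-refl
  nthRoot-≥1 (suc k) {n} p = ^-cancel-≤ k (nthRoot-nonNeg (suc k) n)
    (≤-respˡ (≈-sym (1^ (suc k))) (≤-respʳ (≈-sym (nthRoot-suc k n)) (fromℕ-≥1 p)))

  -- With 1/P + 1/Q = 1, tangent lines of x ↦ x^(k+1) at the points τ/P and τ/Q.
  hölder : ∀ k {α β P Q p q} → 0# ≤ α → 0# ≤ β → 0# ≤ p → 0# ≤ q → 0# ≤ P → 0# ≤ Q → p + q ≈ 1# → P * p ≈ 1# → Q * q ≈ 1# →
    (α + β) ^ suc k ≤ P ^ k * α ^ suc k + Q ^ k * β ^ suc k
  hölder k {α} {β} {P} {Q} {p} {q} 0≤α 0≤β 0≤p 0≤q 0≤P 0≤Q p+q≈1 Pp≈1 Qq≈1 =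
    ≤-respˡ combine (+-mono-≤ (tangent 0≤α 0≤p 0≤P Pp≈1) (tangent 0≤β 0≤q 0≤Q Qq≈1))
    where
    τ = α + β
    0≤τ = +-nonNeg 0≤α 0≤β
    K = fromℕ (suc k)
    tangent : ∀ {γ r S} → 0# ≤ γ → 0# ≤ r → 0# ≤ S → S * r ≈ 1# → r * τ ^ suc k + K * (τ ^ k * (γ - r * τ)) ≤ S ^ k * γ ^ suc k
    tangent {γ} {r} {S} 0≤γ 0≤r 0≤S Sr≈1 = ≤-respˡ expand (≤-respʳ (*-congˡ (^-cong (suc k) sum≈))
      (*-monoˡ-≤ (S ^ k) (^-nonNeg k 0≤S) (bernoulli (r * τ) (γ - r * τ) k (*-nonNegative 0≤r 0≤τ) (≤-respʳ (≈-sym sum≈) 0≤γ))))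
      where
      sum≈ : r * τ + (γ - r * τ) ≈ γ
      sum≈ = solve 2 (λ g e → e :+ (g :- e) := g) ≡.refl γ (r * τ)
      power : S ^ k * (r * τ) ^ k ≈ τ ^ k
      power = ≈-trans (≈-sym (^-distrib-* S (r * τ) k)) (^-cong k (≈-trans (≈-sym (*-assoc S r τ)) (≈-trans (*-congʳ Sr≈1) (*-identityˡ τ))))
      expand : S ^ k * ((r * τ) ^ suc k + K * ((r * τ) ^ k * (γ - r * τ))) ≈ r * τ ^ suc k + K * (τ ^ k * (γ - r * τ))
      expand = ≈-trans (solve 5 (λ s r t e c → s :* ((r :* t) :* e :+ c) := (r :* t) :* (s :* e) :+ s :* c) ≡.refl (S ^ k) r τ ((r * τ) ^ k) _)
        (+-cong (≈-trans (*-congˡ power) (*-assoc r τ (τ ^ k)))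
          (≈-trans (solve 4 (λ s c e g → s :* (c :* (e :* g)) := c :* ((s :* e) :* g)) ≡.refl (S ^ k) K ((r * τ) ^ k) (γ - r * τ)) (*-congˡ (*-congʳ power))))
    combine : (p * τ ^ suc k + K * (τ ^ k * (α - p * τ))) + (q * τ ^ suc k + K * (τ ^ k * (β - q * τ))) ≈ τ ^ suc k
    combine = ≈-trans (solve 6 (λ p q a b t e → (p :* (t :* e) :+ a) :+ (q :* (t :* e) :+ b) := (p :+ q) :* (t :* e) :+ (a :+ b)) ≡.refl p q
        (K * (τ ^ k * (α - p * τ))) (K * (τ ^ k * (β - q * τ))) τ (τ ^ k))
      (≈-trans (+-cong (≈-trans (*-congʳ p+q≈1) (*-identityˡ _)) zero-part) (+-identityʳ _))
      where
      zero-part : K * (τ ^ k * (α - p * τ)) + K * (τ ^ k * (β - q * τ)) ≈ 0#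
      zero-part = ≈-trans (solve 6 (λ c e a b p q → c :* (e :* (a :- p :* (a :+ b))) :+ c :* (e :* (b :- q :* (a :+ b))) :=
          c :* (e :* ((a :+ b) :- (p :+ q) :* (a :+ b)))) ≡.refl K (τ ^ k) α β p q)
        (≈-trans (*-congˡ (*-congˡ (≈-trans (+-congˡ (-‿cong (≈-trans (*-congʳ p+q≈1) (*-identityˡ _)))) (-‿inverseʳ τ)))) (≈-trans (*-congˡ (zeroʳ _)) (zeroʳ K)))

  -- The layers of X and Y are matched by the relative k-th roots of their sizes: consuming the
  -- relatively smallest remaining layer first, each layer of X or Y accounts for one layer of Z.
  module Matching (k : ℕ) (a b c : ℕ → ℕ) (â b̂ : ℕ → ℝ)
    (â-nonNeg : ∀ s → 0# ≤ â s) (b̂-nonNeg : ∀ t → 0# ≤ b̂ t)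
    (â-^ : ∀ s → 1 ℕ.≤ s → 1 ℕ.≤ a s → â s ^ k ≈ fromℕ (a s)) (b̂-^ : ∀ t → 1 ℕ.≤ t → 1 ℕ.≤ b t → b̂ t ^ k ≈ fromℕ (b t))
    (c-anti : ∀ u → c (suc u) ℕ.≤ c u)
    (sums : ∀ s t → 1 ℕ.≤ s → 1 ℕ.≤ t → 1 ℕ.≤ a s → 1 ℕ.≤ b t → (â s + b̂ t) ^ k ≤ fromℕ (c (s ℕ.+ t)))
    (M N P Q : ℝ) (0<M : 0# < M) (0<N : 0# < N) (MP : M * P ≈ M + N) (NQ : N * Q ≈ M + N) (0≤P : 0# ≤ P) (0≤Q : 0# ≤ Q)
    (s₁ t₁ : ℕ) (1≤s₁ : 1 ℕ.≤ s₁) (1≤t₁ : 1 ℕ.≤ t₁) (as₁ : 1 ℕ.≤ a s₁) (bt₁ : 1 ℕ.≤ b t₁) (M≈ : â s₁ ≈ M) (N≈ : b̂ t₁ ≈ N)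
    (T₀ : ℕ) (â≤M : ∀ s → 1 ℕ.≤ s → â s ≤ M) (b̂≤N : ∀ t → 1 ℕ.≤ t → t ℕ.≤ T₀ → b̂ t ≤ N)
    where

    c-anti-+ : ∀ m u → c (m ℕ.+ u) ℕ.≤ c u
    c-anti-+ zero u = ℕ.≤-refl
    c-anti-+ (suc m) u = ℕ.≤-trans (c-anti (m ℕ.+ u)) (c-anti-+ m u)

    -- As P - 1 = N / M, the hypothesis N â ≤ M y says that y is at least (P - 1) â, so that â + y
    -- is at least P â.
    take-a : ∀ s y u → 1 ℕ.≤ s → 1 ℕ.≤ a s → N * â s ≤ M * y → (â s + y) ^ k ≤ fromℕ (c u) → P ^ k * fromℕ (a s) ≤ fromℕ (c u)
    take-a s y u 1≤s as le bound = ≤-trans (≤-respˡ (≈-trans (^-distrib-* P (â s) k) (*-congˡ (â-^ s 1≤s as)))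
      (^-mono-≤ k (*-nonNegative 0≤P (â-nonNeg s)) (*-cancelˡ-≤ M 0<M (≤-respˡ (≈-sym left) (≤-respʳ (≈-sym (distribˡ M (â s) y)) (+-monoʳ-≤ (M * â s) le)))))) bound
      where
      left : M * (P * â s) ≈ M * â s + N * â s
      left = ≈-trans (≈-sym (*-assoc M P (â s))) (≈-trans (*-congʳ MP) (distribʳ (â s) M N))

    take-b : ∀ t x u → 1 ℕ.≤ t → 1 ℕ.≤ b t → M * b̂ t ≤ N * x → (x + b̂ t) ^ k ≤ fromℕ (c u) → Q ^ k * fromℕ (b t) ≤ fromℕ (c u)
    take-b t x u 1≤t bt le bound = ≤-trans (≤-respˡ (≈-trans (^-distrib-* Q (b̂ t) k) (*-congˡ (b̂-^ t 1≤t bt)))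
      (^-mono-≤ k (*-nonNegative 0≤Q (b̂-nonNeg t)) (*-cancelˡ-≤ N 0<N (≤-respˡ (≈-sym left) (≤-respʳ (≈-sym (distribˡ N x (b̂ t))) (+-mono-≤ le ≤-refl)))))) bound
      where
      left : N * (Q * b̂ t) ≈ M * b̂ t + N * b̂ t
      left = ≈-trans (≈-sym (*-assoc N Q (b̂ t))) (≈-trans (*-congʳ NQ) (distribʳ (b̂ t) M N))

    weight : ℕ → ℕ → ℝ
    weight S T = P ^ k * fromℕ (total a S) + Q ^ k * fromℕ (total b T)

    add-a : ∀ S T {u} → weight S T ≤ fromℕ (total c u) → P ^ k * fromℕ (a (suc S)) ≤ fromℕ (c (suc u)) → weight (suc S) T ≤ fromℕ (total c (suc u))
    add-a S T {u} ih p = ≤-respˡ (≈-sym (≈-trans (+-congʳ (≈-trans (*-congˡ (fromℕ-+ (a (suc S)) (total a S))) (distribˡ (P ^ k) _ _))) (+-assoc _ _ _)))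
      (≤-respʳ (≈-sym (fromℕ-+ (c (suc u)) (total c u))) (+-mono-≤ p ih))

    add-b : ∀ S T {u} → weight S T ≤ fromℕ (total c u) → Q ^ k * fromℕ (b (suc T)) ≤ fromℕ (c (suc u)) → weight S (suc T) ≤ fromℕ (total c (suc u))
    add-b S T {u} ih p = ≤-respˡ (≈-sym (≈-trans (+-congˡ (≈-trans (*-congˡ (fromℕ-+ (b (suc T)) (total b T))) (distribˡ (Q ^ k) _ _)))
        (solve 3 (λ x y z → x :+ (y :+ z) := y :+ (x :+ z)) ≡.refl (P ^ k * fromℕ (total a S)) (Q ^ k * fromℕ (b (suc T))) (Q ^ k * fromℕ (total b T)))))
      (≤-respʳ (≈-sym (fromℕ-+ (c (suc u)) (total c u))) (+-mono-≤ p ih))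

    zero≤ : ∀ {z n} m → n ≡ 0 → z * fromℕ n ≤ fromℕ m
    zero≤ {z} m ≡.refl = ≤-respˡ (≈-sym (zeroʳ z)) (fromℕ-nonNeg m)

    -- With no layer of X left, the largest layer `s₁` is used again: every remaining b̂ is at most
    -- N, so the layer of Y is the relatively smaller one. The layer of Z obtained has a higher
    -- index than required, which is harmless because `c` decreases.
    step-b : ∀ T → suc T ℕ.≤ T₀ → weight zero T ≤ fromℕ (total c T) → weight zero (suc T) ≤ fromℕ (total c (suc T))
    step-b T T≤ ih with b (suc T) ℕ.≟ 0
    ... | yes b≡0 = add-b zero T ih (zero≤ (c (suc T)) b≡0)
    ... | no b≢0 = add-b zero T ih (≤-trans
      (take-b (suc T) (â s₁) (s₁ ℕ.+ suc T) (s≤s z≤n) (ℕ.n≢0⇒n>0 b≢0) (≤-respʳ (≈-trans (*-comm M N) (*-congˡ (≈-sym M≈))) (*-monoˡ-≤ M (proj₁ 0<M) (b̂≤N (suc T) (s≤s z≤n) T≤)))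
        (sums s₁ (suc T) 1≤s₁ (s≤s z≤n) as₁ (ℕ.n≢0⇒n>0 b≢0)))
      (fromℕ-mono (c-anti-+ s₁ (suc T))))

    step-a : ∀ S → weight S zero ≤ fromℕ (total c (S ℕ.+ 0)) → weight (suc S) zero ≤ fromℕ (total c (suc S ℕ.+ 0))
    step-a S ih with a (suc S) ℕ.≟ 0
    ... | yes a≡0 = add-a S zero ih (zero≤ (c (suc (S ℕ.+ 0))) a≡0)
    ... | no a≢0 = add-a S zero ih (≤-trans
      (take-a (suc S) (b̂ t₁) (t₁ ℕ.+ suc S) (s≤s z≤n) (ℕ.n≢0⇒n>0 a≢0) (≤-respʳ (≈-trans (*-comm N M) (*-congˡ (≈-sym N≈))) (*-monoˡ-≤ N (proj₁ 0<N) (â≤M (suc S) (s≤s z≤n))))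
        (≡.subst (λ u → (â (suc S) + b̂ t₁) ^ k ≤ fromℕ (c u)) (ℕ.+-comm (suc S) t₁) (sums (suc S) t₁ (s≤s z≤n) 1≤t₁ (ℕ.n≢0⇒n>0 a≢0) bt₁)))
      (fromℕ-mono (≡.subst (λ u → c (t₁ ℕ.+ suc S) ℕ.≤ c (suc u)) (≡.sym (ℕ.+-identityʳ S)) (c-anti-+ t₁ (suc S)))))

    step-ab : ∀ S T → weight S (suc T) ≤ fromℕ (total c (S ℕ.+ suc T)) → weight (suc S) T ≤ fromℕ (total c (suc S ℕ.+ T)) →
      weight (suc S) (suc T) ≤ fromℕ (total c (suc S ℕ.+ suc T))
    step-ab S T ih-a ih-b with a (suc S) ℕ.≟ 0 | b (suc T) ℕ.≟ 0
    ... | yes a≡0 | _ = add-a S (suc T) ih-a (zero≤ (c (suc (S ℕ.+ suc T))) a≡0)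
    ... | no _ | yes b≡0 = ≡.subst (λ u → weight (suc S) (suc T) ≤ fromℕ (total c (suc u))) (≡.sym (ℕ.+-suc S T))
      (add-b (suc S) T ih-b (zero≤ (c (suc (suc S ℕ.+ T))) b≡0))
    ... | no a≢0 | no b≢0 with ≤-total (N * â (suc S)) (M * b̂ (suc T))
    ... | inj₁ le = add-a S (suc T) ih-a (take-a (suc S) (b̂ (suc T)) (suc S ℕ.+ suc T) (s≤s z≤n) (ℕ.n≢0⇒n>0 a≢0) le
      (sums (suc S) (suc T) (s≤s z≤n) (s≤s z≤n) (ℕ.n≢0⇒n>0 a≢0) (ℕ.n≢0⇒n>0 b≢0)))
    ... | inj₂ ge = ≡.subst (λ u → weight (suc S) (suc T) ≤ fromℕ (total c (suc u))) (≡.sym (ℕ.+-suc S T))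
      (add-b (suc S) T ih-b (≡.subst (λ u → Q ^ k * fromℕ (b (suc T)) ≤ fromℕ (c u)) (≡.cong suc (ℕ.+-suc S T))
        (take-b (suc T) (â (suc S)) (suc S ℕ.+ suc T) (s≤s z≤n) (ℕ.n≢0⇒n>0 b≢0) ge
          (sums (suc S) (suc T) (s≤s z≤n) (s≤s z≤n) (ℕ.n≢0⇒n>0 a≢0) (ℕ.n≢0⇒n>0 b≢0)))))

    matching : ∀ S T → T ℕ.≤ T₀ → weight S T ≤ fromℕ (total c (S ℕ.+ T))
    matching zero zero _ = ≤-reflexive (≈-trans (+-cong (zeroʳ _) (zeroʳ _)) (+-identityˡ 0#))
    matching zero (suc T) T≤ = step-b T T≤ (matching zero T (ℕ.<⇒≤ T≤))
    matching (suc S) zero T≤ = step-a S (matching S zero T≤)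
    matching (suc S) (suc T) T≤ = step-ab S T (matching S (suc T) T≤) (matching (suc S) T (ℕ.<⇒≤ T≤))

  trivial-bound : ∀ {α β} d → 0# ≤ α → 0# ≤ β → β ^ suc d ≤ 0# → ∀ {n} → α ^ suc d ≤ n → (α + β) ^ suc d ≤ n
  trivial-bound {α} {β} d 0≤α 0≤β β≤ α≤ = ≤-trans (^-mono-≤ (suc d) (+-nonNeg 0≤α 0≤β) (≤-respʳ (+-identityʳ α) (+-monoʳ-≤ α β≤0))) α≤
    where
    β≤0 : β ≤ 0#
    β≤0 = ^-cancel-≤ d ≤-refl (≤-respʳ (≈-sym (zeroˡ _)) β≤)

  -- The loss counts the points of Y that are last on their line.
  brunn-minkowski : ∀ d (X Y : List (V d)) {x y α β} → x ∈ X → y ∈ Y → 0# ≤ α → 0# ≤ β →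
    α ^ d ≤ fromℕ (card X) → β ^ d ≤ fromℕ (card Y ℕ.∸ loss Y) → (α + β) ^ d ≤ fromℕ (card (X ⊞ Y))
  brunn-minkowski zero X Y x∈ y∈ _ _ _ _ = fromℕ-≥1 (card-pos (∈-⊞⁺ x∈ y∈))
  brunn-minkowski (suc k) X Y {x} {y} {α} {β} x∈ y∈ 0≤α 0≤β α≤ β≤ = conclude
    where
    S₀ T₀ : ℕ
    S₀ = card X
    T₀ = card Y
    a b c : ℕ → ℕ
    a s = card (level X s)
    -- The layer t + 1 of Y counts as number t since the sum of two fibers loses one point; the
    -- first layer is charged to the loss. Subtracting the losses can destroy monotonicity in t, so
    -- the maximum of `b` is searched for.
    b t = card (level Y (suc t)) ℕ.∸ loss (level Y (suc t))
    c u = card (level (X ⊞ Y) u)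
    â b̂ : ℕ → ℝ
    â s = nthRoot k (a s)
    b̂ t = nthRoot k (b t)
    point : k ≡ 0 → ∀ (L : List (V k)) → 1 ℕ.≤ card L → card L ≡ 1
    point ≡.refl L 1≤ = ℕ.≤-antisym (ℕ.≤-trans (card-⊆ {Y = Vec.[] ∷ []} λ { {Vec.[]} _ → here ≡.refl }) (card≤length (Vec.[] ∷ []))) 1≤
      where import Data.Vec.Base as Vec
    â-^ : ∀ s → 1 ℕ.≤ s → 1 ℕ.≤ a s → â s ^ k ≈ fromℕ (a s)
    â-^ s _ as = nthRoot-^ k (a s) (λ k≡0 → point k≡0 (level X s) as)
    b≤card : ∀ t → b t ℕ.≤ card (level Y (suc t))
    b≤card t = ℕ.m∸n≤m _ (loss (level Y (suc t)))
    b̂-^ : ∀ t → 1 ℕ.≤ t → 1 ℕ.≤ b t → b̂ t ^ k ≈ fromℕ (b t)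
    b̂-^ t _ bt = nthRoot-^ k (b t) (λ k≡0 → ℕ.≤-antisym (ℕ.≤-trans (b≤card t) (ℕ.≤-reflexive (point k≡0 (level Y (suc t)) (ℕ.≤-trans bt (b≤card t))))) bt)
    sums : ∀ s t → 1 ℕ.≤ s → 1 ℕ.≤ t → 1 ℕ.≤ a s → 1 ℕ.≤ b t → (â s + b̂ t) ^ k ≤ fromℕ (c (s ℕ.+ t))
    sums s t 1≤s 1≤t as bt = ≤-trans
      (brunn-minkowski k (level X s) (level Y (suc t)) (proj₂ (card-nonempty (level X s) as)) (proj₂ (card-nonempty (level Y (suc t)) (ℕ.≤-trans bt (b≤card t))))
        (nthRoot-nonNeg k (a s)) (nthRoot-nonNeg k (b t)) (≤-reflexive (â-^ s 1≤s as)) (≤-reflexive (b̂-^ t 1≤t bt)))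
      (fromℕ-mono (card-⊆ (level-⊞ X Y s t 1≤s)))
    c-anti : ∀ u → c (suc u) ℕ.≤ c u
    c-anti u = card-⊆ (level-anti (X ⊞ Y) u)
    1≤S₀ = card-pos x∈
    a1 : 1 ℕ.≤ a 1
    a1 = nonempty x x∈
      where
      open import Data.Vec.Base using (_∷_)
      nonempty : ∀ x → x ∈ X → 1 ℕ.≤ a 1
      nonempty (h ∷ w) x∈ = card-pos (∈-level⁺ {X = X} {1} {w} (s≤s z≤n) (card-pos (∈-fiber⁺ {X = X} x∈)))
    a≤a1 : ∀ s → 1 ℕ.≤ s → a s ℕ.≤ a 1
    a≤a1 (suc zero) _ = ℕ.≤-refl
    a≤a1 (suc (suc s)) _ = ℕ.≤-trans (card-⊆ (level-anti X (suc s))) (a≤a1 (suc s) (s≤s z≤n))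
    total-b : ∀ T → total (λ t → card (level Y (suc t))) T ℕ.≤ total b T ℕ.+ total (λ t → loss (level Y (suc t))) T
    total-b zero = z≤n
    total-b (suc T) = ℕ.≤-trans (ℕ.+-mono-≤ (ℕ.m≤n+m∸n (card (level Y (suc (suc T)))) (loss (level Y (suc (suc T))))) (total-b T))
      (ℕ.≤-reflexive (≡.trans (≡.cong (ℕ._+ (total b T ℕ.+ Λ)) (ℕ.+-comm l (b (suc T)))) (interchange (b (suc T)) l (total b T) Λ)))
      where
      open import Algebra.Properties.CommutativeSemigroup ℕ.+-commutativeSemigroup using (interchange)
      l = loss (level Y (suc (suc T)))
      Λ = total (λ t → loss (level Y (suc t))) T
    shift-total : ∀ (f : ℕ → ℕ) T → total f (suc T) ≡ f 1 ℕ.+ total (λ t → f (suc t)) T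
    shift-total f zero = ≡.refl
    shift-total f (suc T) = ≡.trans (≡.cong (f (suc (suc T)) ℕ.+_) (shift-total f T))
      (≡.trans (≡.sym (ℕ.+-assoc (f (suc (suc T))) (f 1) _)) (≡.trans (≡.cong (ℕ._+ total (λ t → f (suc t)) T) (ℕ.+-comm (f (suc (suc T))) (f 1)))
        (ℕ.+-assoc (f 1) (f (suc (suc T))) _)))
    -- Summing `b` discards the first layer and the losses of all later ones; `loss-levels` bounds
    -- their sum by the loss of Y.
    B≤ : card Y ℕ.∸ loss Y ℕ.≤ total b T₀
    B≤ = ℕ.m≤n+o⇒m∸n≤o (card Y) (loss Y) (begin
      card Y                                                             ≤⟨ card≤layers Y (suc T₀) (λ w → ℕ.m≤n⇒m≤1+n (size≤card Y w)) ⟩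
      total (λ t → card (level Y t)) (suc T₀)                            ≡⟨ shift-total (λ t → card (level Y t)) T₀ ⟩
      card (level Y 1) ℕ.+ total (λ t → card (level Y (suc t))) T₀       ≤⟨ ℕ.+-monoʳ-≤ (card (level Y 1)) (total-b T₀) ⟩
      card (level Y 1) ℕ.+ (total b T₀ ℕ.+ Λ)                            ≡⟨ ≡.cong (card (level Y 1) ℕ.+_) (ℕ.+-comm (total b T₀) Λ) ⟩
      card (level Y 1) ℕ.+ (Λ ℕ.+ total b T₀)                            ≡⟨ ℕ.+-assoc (card (level Y 1)) Λ (total b T₀) ⟨
      card (level Y 1) ℕ.+ Λ ℕ.+ total b T₀                              ≤⟨ ℕ.+-monoˡ-≤ (total b T₀) (ℕ.+-monoʳ-≤ (card (level Y 1)) (ℕ.≤-trans (ℕ.m≤n+m Λ (loss (level Y 1))) (ℕ.≤-reflexive (≡.sym (shift-total (λ t → loss (level Y t)) T₀))))) ⟩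
      card (level Y 1) ℕ.+ total (λ t → loss (level Y t)) (suc T₀) ℕ.+ total b T₀ ≤⟨ ℕ.+-monoˡ-≤ (total b T₀) (loss-levels Y (suc T₀)) ⟩
      loss Y ℕ.+ total b T₀                                              ∎)
      where
      open ℕ.≤-Reasoning
      Λ = total (λ t → loss (level Y (suc t))) T₀
    conclude : (α + β) ^ suc k ≤ fromℕ (card (X ⊞ Y))
    conclude with total b T₀ ℕ.≟ 0
    -- Every layer is consumed by its loss, so β = 0 and |X + Y| ≥ |X| is enough.
    ... | yes B≡0 = trivial-bound k 0≤α 0≤β (≤-trans β≤ (fromℕ-mono (ℕ.≤-trans B≤ (ℕ.≤-reflexive B≡0)))) (≤-trans α≤ (fromℕ-mono (card-⊞≥ˡ X Y y∈)))
    ... | no B≢0 = ≤-trans (hölder k 0≤α 0≤β 0≤p 0≤q 0≤P 0≤Q p+q≈1 Pp≈1 Qq≈1) (≤-trans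
        (+-mono-≤ (*-monoˡ-≤ (P ^ k) (^-nonNeg k 0≤P) (≤-trans α≤ (fromℕ-mono (card≤layers X S₀ (size≤card X)))))
                  (*-monoˡ-≤ (Q ^ k) (^-nonNeg k 0≤Q) (≤-trans β≤ (fromℕ-mono B≤))))
        (≤-trans (matching S₀ T₀ ℕ.≤-refl) (fromℕ-mono (layers≤card (X ⊞ Y) (S₀ ℕ.+ T₀)))))
      where
      choose : ∀ T → 1 ℕ.≤ total b T → ∃[ t ] (1 ℕ.≤ t × t ℕ.≤ T × 1 ℕ.≤ b t)
      choose (suc T) p with b (suc T) ℕ.≟ 0
      ... | no b≢0 = suc T , s≤s z≤n , ℕ.≤-refl , ℕ.n≢0⇒n>0 b≢0
      ... | yes b≡0 = let t , 1≤t , t≤T , bt = choose T (≡.subst (1 ℕ.≤_) (≡.cong (ℕ._+ total b T) b≡0) p) in t , 1≤t , ℕ.m≤n⇒m≤1+n t≤T , bt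
      best : ∃[ t ] (1 ℕ.≤ t × 1 ℕ.≤ b t × (∀ t′ → 1 ℕ.≤ t′ → t′ ℕ.≤ T₀ → b t′ ℕ.≤ b t))
      best with choose T₀ (ℕ.n≢0⇒n>0 B≢0)
      ... | t , 1≤t , t≤ , bt with argmax (λ i → b (suc i)) (upTo T₀) (∈-upTo⁺ (ℕ.≤-trans 1≤t t≤))
      ... | i , i∈ , i-max = suc i , s≤s z≤n , ℕ.≤-trans bt (i-max′ t 1≤t t≤) , i-max′
        where
        i-max′ : ∀ t′ → 1 ℕ.≤ t′ → t′ ℕ.≤ T₀ → b t′ ℕ.≤ b (suc i)
        i-max′ (suc t′) _ t′< = i-max (∈-upTo⁺ t′<)
      t₁ = proj₁ best
      bt₁ = proj₁ (proj₂ (proj₂ best))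
      M N W P Q p q : ℝ
      M = â 1
      N = b̂ t₁
      0<M : 0# < M
      0<M = <-≤-trans 0<1 (nthRoot-≥1 k a1)
      0<N : 0# < N
      0<N = <-≤-trans 0<1 (nthRoot-≥1 k bt₁)
      W = M + N
      0<W : 0# < W
      0<W = <-≤-trans 0<M (≤-by N (proj₁ 0<N) ≈-refl)
      P = W * M ⁻¹
      Q = W * N ⁻¹
      p = M * W ⁻¹
      q = N * W ⁻¹
      0≤P = *-nonNegative (proj₁ 0<W) (proj₁ (⁻¹-pos 0<M))
      0≤Q = *-nonNegative (proj₁ 0<W) (proj₁ (⁻¹-pos 0<N))
      0≤p = *-nonNegative (proj₁ 0<M) (proj₁ (⁻¹-pos 0<W))
      0≤q = *-nonNegative (proj₁ 0<N) (proj₁ (⁻¹-pos 0<W))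
      scaled : ∀ {U} → 0# < U → U * (W * U ⁻¹) ≈ W
      scaled {U} 0<U = ≈-trans (solve 3 (λ u w v → u :* (w :* v) := w :* (u :* v)) ≡.refl U W (U ⁻¹)) (≈-trans (*-congˡ (*-inverseʳ U (pos⇒≉0 0<U))) (*-identityʳ W))
      unit : ∀ {U} → 0# < U → (W * U ⁻¹) * (U * W ⁻¹) ≈ 1#
      unit {U} 0<U = ≈-trans (solve 4 (λ w v u z → (w :* v) :* (u :* z) := (u :* v) :* (w :* z)) ≡.refl W (U ⁻¹) U (W ⁻¹))
        (≈-trans (*-cong (*-inverseʳ U (pos⇒≉0 0<U)) (*-inverseʳ W (pos⇒≉0 0<W))) (*-identityˡ 1#))
      Pp≈1 : P * p ≈ 1#
      Pp≈1 = unit 0<M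
      Qq≈1 : Q * q ≈ 1#
      Qq≈1 = unit 0<N
      p+q≈1 : p + q ≈ 1#
      p+q≈1 = ≈-trans (≈-sym (distribʳ (W ⁻¹) M N)) (*-inverseʳ W (pos⇒≉0 0<W))
      â≤M : ∀ s → 1 ℕ.≤ s → â s ≤ M
      â≤M s 1≤s = nthRoot-mono k (a≤a1 s 1≤s)
      open Matching k a b c â b̂ (λ s → nthRoot-nonNeg k (a s)) (λ t → nthRoot-nonNeg k (b t)) â-^ b̂-^ c-anti sums
        M N P Q 0<M 0<N (scaled 0<M) (scaled 0<N) 0≤P 0≤Q 1 t₁ (s≤s z≤n) (proj₁ (proj₂ best)) a1 bt₁ ≈-refl ≈-refl
        T₀ â≤M (λ t 1≤t t≤ → nthRoot-mono k (proj₂ (proj₂ (proj₂ best)) t 1≤t t≤))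

-- Determinants under column shears and Euclidean column reduction.

module Determinants where
  open Vectors hiding (_:+_; _:*_; :-_; _:-_)
  open IntegerLinear
  open RationalLinear using (module Σℤ)
  open import Algebra.Bundles using (CommutativeRing)
  open import Algebra.Bundles using (Semiring)
  import Algebra.Definitions.RawSemiring as RawSemiringDefs
  open import Data.Nat.Base as ℕ using (ℕ; zero; suc)
  import Data.Nat.Properties as ℕ
  open import Data.Nat.Induction using (<-wellFounded)
  open import Induction.WellFounded using (Acc; acc)
  open import Data.Integer.Base as ℤ using (ℤ; 0ℤ; 1ℤ; -1ℤ; ∣_∣; _+_; _*_; _-_; -_; NonZero) renaming (+_ to pos)
  import Data.Integer.Properties as ℤ
  open import Data.Integer.DivMod using (_/_; _%_; a≡a%n+[a/n]*n; n%d<d)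
  open import Data.Integer.Solver using (module +-*-Solver)
  open +-*-Solver using (solve; _:=_; _:+_; _:*_; :-_; _:-_)
  open import Data.Fin.Base using (Fin; zero; suc; toℕ; punchIn)
  open import Data.Vec.Base using (Vec; []; _∷_; head; tail; tabulate; map)
  open import Data.Vec.Properties using (tabulate-∘; map-∘; map-cong; map-id)
  open import Data.Product.Base using (∃-syntax; _×_; _,_)
  open import Data.Unit.Base using (⊤; tt)
  open import Relation.Nullary using (yes; no)
  open import Relation.Binary.PropositionalEquality hiding ([_])
  open import Function.Base using (_∘_)

  open RawSemiringDefs (Semiring.rawSemiring (CommutativeRing.semiring ℤ.+-*-commutativeRing)) using () renaming (_^_ to _^ℤ_)

  -- Laplace expansion along the first coordinate of a family of columns.
  expand : ∀ {d n} → (Vec (V d) n → ℤ) → Vec (V (suc d)) (suc n) → ℤ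
  expand f (c ∷ [])          = head c * f []
  expand f (c ∷ cs@(_ ∷ _)) = head c * f (map tail cs) - expand (λ ts → f (tail c ∷ ts)) cs

  determinant : ∀ {d} → Vec (V d) d → ℤ
  determinant {zero}  [] = 1ℤ
  determinant {suc d} cs = expand determinant cs

  expand-cong : ∀ {d n} {f g : Vec (V d) n → ℤ} → (∀ v → f v ≡ g v) → ∀ cs → expand f cs ≡ expand g cs
  expand-cong e (c ∷ []) = cong (head c *_) (e [])
  expand-cong e (c ∷ cs@(_ ∷ _)) = cong₂ (λ a b → head c * a - b) (e (map tail cs)) (expand-cong (λ ts → e (tail c ∷ ts)) cs)

  expand-linear : ∀ {d n} (f g : Vec (V d) n → ℤ) k cs → expand (λ v → f v + k * g v) cs ≡ expand f cs + k * expand g cs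
  expand-linear f g k (c ∷ []) = solve 4 (λ h k a b → h :* (a :+ k :* b) := h :* a :+ k :* (h :* b)) refl (head c) k (f []) (g [])
  expand-linear f g k (c ∷ cs@(_ ∷ _)) = trans (cong (λ z → head c * (f (map tail cs) + k * g (map tail cs)) - z) (expand-linear (λ ts → f (tail c ∷ ts)) (λ ts → g (tail c ∷ ts)) k cs))
    (solve 6 (λ h k a b x y → h :* (a :+ k :* b) :- (x :+ k :* y) := (h :* a :- x) :+ k :* (h :* b :- y)) refl (head c) k (f (map tail cs)) (g (map tail cs))
      (expand (λ ts → f (tail c ∷ ts)) cs) (expand (λ ts → g (tail c ∷ ts)) cs))

  Multilinear : ∀ {d n} → (Vec (V d) n → ℤ) → Set
  Multilinear {d} {zero} f = ⊤
  Multilinear {d} {suc n} f = (∀ a b k r → f (a ⊕ k ⋆ b ∷ r) ≡ f (a ∷ r) + k * f (b ∷ r)) × (∀ a → Multilinear (λ r → f (a ∷ r)))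

  multilinear-combine : ∀ {d n} {f g : Vec (V d) n → ℤ} h → Multilinear f → Multilinear g → Multilinear (λ v → h * f v - g v)
  multilinear-combine {n = zero} h _ _ = tt
  multilinear-combine {n = suc n} {f} {g} h (f₁ , f₂) (g₁ , g₂) =
    (λ a b k r → trans (cong₂ (λ x y → h * x - y) (f₁ a b k r) (g₁ a b k r))
      (solve 6 (λ h k x y z w → h :* (x :+ k :* y) :- (z :+ k :* w) := (h :* x :- z) :+ k :* (h :* y :- w)) refl h k (f (a ∷ r)) (f (b ∷ r)) (g (a ∷ r)) (g (b ∷ r)))) ,
    λ a → multilinear-combine h (f₂ a) (g₂ a)

  tail-shear : ∀ {d} (a b : V (suc d)) k → tail (a ⊕ k ⋆ b) ≡ tail a ⊕ k ⋆ tail b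
  tail-shear (_ ∷ _) (_ ∷ _) k = refl

  head-shear : ∀ {d} (a b : V (suc d)) k → head (a ⊕ k ⋆ b) ≡ head a + k * head b
  head-shear (_ ∷ _) (_ ∷ _) k = refl

  multilinear-tails : ∀ {d n} {f : Vec (V d) n → ℤ} → Multilinear f → Multilinear (λ (v : Vec (V (suc d)) n) → f (map tail v))
  multilinear-tails {n = zero} _ = tt
  multilinear-tails {n = suc n} {f} (f₁ , f₂) =
    (λ a b k r → trans (cong (λ t → f (t ∷ map tail r)) (tail-shear a b k)) (f₁ (tail a) (tail b) k (map tail r))) , λ a → multilinear-tails (f₂ (tail a))

  expand-multilinear : ∀ {d n} {f : Vec (V d) n → ℤ} → Multilinear f → Multilinear (expand f)
  expand-multilinear {n = zero} {f} _ = (λ { a b k [] → trans (cong (_* f []) (head-shear a b k))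
    (solve 4 (λ x k y e → (x :+ k :* y) :* e := x :* e :+ k :* (y :* e)) refl (head a) k (head b) (f [])) }) , λ _ → tt
  expand-multilinear {n = suc n} {f} (f₁ , f₂) = first , rest
    where
    first : ∀ a b k r → expand f (a ⊕ k ⋆ b ∷ r) ≡ expand f (a ∷ r) + k * expand f (b ∷ r)
    first a b k r@(_ ∷ _) = trans (cong₂ (λ h z → h * f (map tail r) - z) (head-shear a b k)
        (trans (expand-cong (λ v → trans (cong (λ t → f (t ∷ v)) (tail-shear a b k)) (f₁ (tail a) (tail b) k v)) r) (expand-linear (λ v → f (tail a ∷ v)) (λ v → f (tail b ∷ v)) k r)))
      (solve 6 (λ x k y e z w → (x :+ k :* y) :* e :- (z :+ k :* w) := (x :* e :- z) :+ k :* (y :* e :- w)) refl (head a) k (head b) (f (map tail r))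
        (expand (λ v → f (tail a ∷ v)) r) (expand (λ v → f (tail b ∷ v)) r))
    rest : ∀ a → Multilinear (λ r → expand f (a ∷ r))
    rest a = Multilinear-ext {f = λ v → head a * f (map tail v) - expand (λ ts → f (tail a ∷ ts)) v} {g = λ v → expand f (a ∷ v)} (λ { (_ ∷ _) → refl })
      (multilinear-combine {f = λ v → f (map tail v)} {g = expand (λ ts → f (tail a ∷ ts))} (head a) (multilinear-tails {f = f} (f₁ , f₂)) (expand-multilinear (f₂ (tail a))))
      where
      Multilinear-ext : ∀ {d n} {f g : Vec (V d) n → ℤ} → (∀ v → f v ≡ g v) → Multilinear f → Multilinear g
      Multilinear-ext {n = zero} e _ = tt
      Multilinear-ext {n = suc n} e (p , q) = (λ a b k r → trans (sym (e _)) (trans (p a b k r) (cong₂ (λ x y → x + k * y) (e _) (e _)))) , λ a → Multilinear-ext (λ v → e (a ∷ v)) (q a)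

  -- Only multiples of neighbouring columns are added. This takes the place of antisymmetry:
  -- Euclid's algorithm on adjacent columns then involves neither exchanges nor signs.
  ShearInvariant : ∀ {d n} → (Vec (V d) n → ℤ) → Set
  ShearInvariant {d} {zero} f = ⊤
  ShearInvariant {d} {suc zero} f = ⊤
  ShearInvariant {d} {suc (suc n)} f = (∀ a b k r → f (a ⊕ k ⋆ b ∷ b ∷ r) ≡ f (a ∷ b ∷ r)) × (∀ a b k r → f (a ∷ b ⊕ k ⋆ a ∷ r) ≡ f (a ∷ b ∷ r)) ×
    (∀ a → ShearInvariant (λ r → f (a ∷ r)))

  shear-combine : ∀ {d n} {f g : Vec (V d) n → ℤ} h → ShearInvariant f → ShearInvariant g → ShearInvariant (λ v → h * f v - g v)
  shear-combine {n = zero} h _ _ = tt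
  shear-combine {n = suc zero} h _ _ = tt
  shear-combine {n = suc (suc n)} h (f₁ , f₂ , f₃) (g₁ , g₂ , g₃) =
    (λ a b k r → cong₂ (λ x y → h * x - y) (f₁ a b k r) (g₁ a b k r)) , (λ a b k r → cong₂ (λ x y → h * x - y) (f₂ a b k r) (g₂ a b k r)) , λ a → shear-combine h (f₃ a) (g₃ a)

  shear-tails : ∀ {d n} {f : Vec (V d) n → ℤ} → ShearInvariant f → ShearInvariant (λ (v : Vec (V (suc d)) n) → f (map tail v))
  shear-tails {n = zero} _ = tt
  shear-tails {n = suc zero} _ = tt
  shear-tails {n = suc (suc n)} {f} (f₁ , f₂ , f₃) =
    (λ a b k r → trans (cong (λ t → f (t ∷ tail b ∷ map tail r)) (tail-shear a b k)) (f₁ (tail a) (tail b) k (map tail r))) ,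
    (λ a b k r → trans (cong (λ t → f (tail a ∷ t ∷ map tail r)) (tail-shear b a k)) (f₂ (tail a) (tail b) k (map tail r))) ,
    λ a → shear-tails (f₃ (tail a))

  shear-ext : ∀ {d n} {f g : Vec (V d) n → ℤ} → (∀ v → f v ≡ g v) → ShearInvariant f → ShearInvariant g
  shear-ext {n = zero} e _ = tt
  shear-ext {n = suc zero} e _ = tt
  shear-ext {n = suc (suc n)} e (p , q , s) = (λ a b k r → trans (sym (e _)) (trans (p a b k r) (e _))) , (λ a b k r → trans (sym (e _)) (trans (q a b k r) (e _))) ,
    λ a → shear-ext (λ v → e (a ∷ v)) (s a)

  -- When one of the two leading columns is sheared by the other, the two cofactor terms change by
  -- opposite amounts, by linearity of f. The remaining terms contain both columns and are handled
  -- by the shear invariance of f.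
  expand-shear : ∀ {d n} {f : Vec (V d) n → ℤ} → Multilinear f → ShearInvariant f → ShearInvariant (expand f)
  expand-shear {n = zero} _ _ = tt
  expand-shear {n = suc zero} {f} (f₁ , _) _ = first , second , λ _ → tt
    where
    first : ∀ a b k r → expand f (a ⊕ k ⋆ b ∷ b ∷ r) ≡ expand f (a ∷ b ∷ r)
    first a b k [] = trans (cong₂ (λ h z → h * f (tail b ∷ []) - head b * z) (head-shear a b k) (trans (cong (λ t → f (t ∷ [])) (tail-shear a b k)) (f₁ (tail a) (tail b) k [])))
      (solve 5 (λ x k y p q → (x :+ k :* y) :* q :- y :* (p :+ k :* q) := x :* q :- y :* p) refl (head a) k (head b) (f (tail a ∷ [])) (f (tail b ∷ [])))
    second : ∀ a b k r → expand f (a ∷ b ⊕ k ⋆ a ∷ r) ≡ expand f (a ∷ b ∷ r)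
    second a b k [] = trans (cong₂ (λ h z → head a * z - h * f (tail a ∷ [])) (head-shear b a k) (trans (cong (λ t → f (t ∷ [])) (tail-shear b a k)) (f₁ (tail b) (tail a) k [])))
      (solve 5 (λ x k y p q → x :* (q :+ k :* p) :- (y :+ k :* x) :* p := x :* q :- y :* p) refl (head a) k (head b) (f (tail a ∷ [])) (f (tail b ∷ [])))
  expand-shear {n = suc (suc n)} {f} ml@(f₁ , f₂) sh@(s₁ , s₂ , s₃) = first , second , λ a →
    shear-ext {f = λ v → head a * f (map tail v) - expand (λ ts → f (tail a ∷ ts)) v} {g = λ v → expand f (a ∷ v)} (λ { (_ ∷ _) → refl })
      (shear-combine {f = λ v → f (map tail v)} {g = expand (λ ts → f (tail a ∷ ts))} (head a) (shear-tails {f = f} sh) (expand-shear (f₂ (tail a)) (s₃ (tail a))))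
    where
    first : ∀ a b k r → expand f (a ⊕ k ⋆ b ∷ b ∷ r) ≡ expand f (a ∷ b ∷ r)
    first a b k r@(_ ∷ _) = trans
      (cong₂ (λ x y → x * f (tail b ∷ T) - (head b * y - expand (λ v → f (tail (a ⊕ k ⋆ b) ∷ tail b ∷ v)) r)) (head-shear a b k) (trans (cong (λ t → f (t ∷ T)) (tail-shear a b k)) (f₁ (tail a) (tail b) k T)))
      (trans (cong (λ z → (head a + k * head b) * f (tail b ∷ T) - (head b * (f (tail a ∷ T) + k * f (tail b ∷ T)) - z))
          (expand-cong (λ v → trans (cong (λ t → f (t ∷ tail b ∷ v)) (tail-shear a b k)) (s₁ (tail a) (tail b) k v)) r))
        (solve 6 (λ x k y p q e → (x :+ k :* y) :* q :- (y :* (p :+ k :* q) :- e) := x :* q :- (y :* p :- e)) refl (head a) k (head b) (f (tail a ∷ T)) (f (tail b ∷ T)) (expand (λ v → f (tail a ∷ tail b ∷ v)) r)))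
      where T = map tail r
    second : ∀ a b k r → expand f (a ∷ b ⊕ k ⋆ a ∷ r) ≡ expand f (a ∷ b ∷ r)
    second a b k r@(_ ∷ _) = trans
      (cong₂ (λ x y → head a * y - (x * f (tail a ∷ T) - expand (λ v → f (tail a ∷ tail (b ⊕ k ⋆ a) ∷ v)) r)) (head-shear b a k) (trans (cong (λ t → f (t ∷ T)) (tail-shear b a k)) (f₁ (tail b) (tail a) k T)))
      (trans (cong (λ z → head a * (f (tail b ∷ T) + k * f (tail a ∷ T)) - ((head b + k * head a) * f (tail a ∷ T) - z))
          (expand-cong (λ v → trans (cong (λ t → f (tail a ∷ t ∷ v)) (tail-shear b a k)) (s₂ (tail a) (tail b) k v)) r))
        (solve 6 (λ x k y p q e → x :* (q :+ k :* p) :- ((y :+ k :* x) :* p :- e) := x :* q :- (y :* p :- e)) refl (head a) k (head b) (f (tail a ∷ T)) (f (tail b ∷ T)) (expand (λ v → f (tail a ∷ tail b ∷ v)) r)))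
      where T = map tail r

  determinant-multilinear : ∀ {d} → Multilinear (determinant {d})
  determinant-multilinear {zero} = tt
  determinant-multilinear {suc d} = expand-multilinear determinant-multilinear

  determinant-shear : ∀ {d} → ShearInvariant (determinant {d})
  determinant-shear {zero} = tt
  determinant-shear {suc d} = expand-shear determinant-multilinear determinant-shear

  shift : ∀ a b h → a - b ≡ (a - h) - (b - h)
  shift = solve 3 (λ a b h → a :- b := (a :- h) :- (b :- h)) refl

  factor : ∀ k l g → k * g - l * g ≡ (k - l) * g
  factor = solve 3 (λ k l g → k :* g :- l :* g := (k :- l) :* g) refl

  infix 4 _⇝_

  data _⇝_ {d} : ∀ {n} → Vec (V d) n → Vec (V d) n → Set where
    done   : ∀ {n} {v : Vec (V d) n} → v ⇝ v
    _then_ : ∀ {n} {u v w : Vec (V d) n} → u ⇝ v → v ⇝ w → u ⇝ w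
    first  : ∀ {n} a b k (r : Vec (V d) n) → a ∷ b ∷ r ⇝ a ⊕ k ⋆ b ∷ b ∷ r
    second : ∀ {n} a b k (r : Vec (V d) n) → a ∷ b ∷ r ⇝ a ∷ b ⊕ k ⋆ a ∷ r
    under  : ∀ {n} a {r s : Vec (V d) n} → r ⇝ s → a ∷ r ⇝ a ∷ s

  ⇝-invariant : ∀ {d n} {u v : Vec (V d) n} → u ⇝ v → (f : Vec (V d) n → ℤ) → ShearInvariant f → f u ≡ f v
  ⇝-invariant done f s = refl
  ⇝-invariant (p then q) f s = trans (⇝-invariant p f s) (⇝-invariant q f s)
  ⇝-invariant (first a b k r) f (s₁ , _) = sym (s₁ a b k r)
  ⇝-invariant (second a b k r) f (_ , s₂ , _) = sym (s₂ a b k r)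
  ⇝-invariant {n = suc zero} (under a {[]} {[]} p) f s = refl
  ⇝-invariant {n = suc (suc n)} (under a p) f (_ , _ , s₃) = ⇝-invariant p (λ r → f (a ∷ r)) (s₃ a)

  -- This inclusion serves index bounds: a list that covers modulo the span of `u` also covers
  -- modulo the possibly larger span of `v`.
  ⇝-span : ∀ {d n} {u v : Vec (V d) n} → u ⇝ v → ∀ c → ∃[ c′ ] combination c u ≡ combination c′ v
  ⇝-span done c = c , refl
  ⇝-span (p then q) c = let c′ , e = ⇝-span p c ; c″ , e′ = ⇝-span q c′ in c″ , trans e e′
  ⇝-span (first a b k r) (x ∷ y ∷ c) = x ∷ (y - x * k) ∷ c , trans
    (linear (x₀ :+′ (x₁ :+′ x₂)) ((x₀ :+′ x₃) :+′ ((x₁ :-′ x₃) :+′ x₂)) refl (x ⋆ a ∷ y ⋆ b ∷ combination c r ∷ x ⋆ k ⋆ b ∷ []))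
    (cong₂ _⊕_ (sym (⋆-distribˡ x a (k ⋆ b))) (cong (_⊕ combination c r) (sym (minus b x y k))))
    where
    open Vectors using () renaming (_:+_ to _:+′_; _:-_ to _:-′_)
    minus : ∀ {d} (b : V d) x y k → (y - x * k) ⋆ b ≡ y ⋆ b ⊖ x ⋆ k ⋆ b
    minus b x y k = trans (⋆-distribʳ y (- (x * k)) b) (cong (y ⋆ b ⊕_) (trans (cong (_⋆ b) (sym (ℤ.-1*i≡-i (x * k)))) (trans (⋆-assoc -1ℤ (x * k) b) (trans (-1⋆ _) (cong ⊝_ (⋆-assoc x k b))))))
  ⇝-span (second a b k r) (x ∷ y ∷ c) = (x - y * k) ∷ y ∷ c , trans
    (linear (x₀ :+′ (x₁ :+′ x₂)) ((x₀ :-′ x₃) :+′ ((x₁ :+′ x₃) :+′ x₂)) refl (x ⋆ a ∷ y ⋆ b ∷ combination c r ∷ y ⋆ k ⋆ a ∷ []))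
    (cong₂ _⊕_ (sym (minus a y x k)) (cong (_⊕ combination c r) (sym (⋆-distribˡ y b (k ⋆ a)))))
    where
    open Vectors using () renaming (_:+_ to _:+′_; _:-_ to _:-′_)
    minus : ∀ {d} (b : V d) x y k → (y - x * k) ⋆ b ≡ y ⋆ b ⊖ x ⋆ k ⋆ b
    minus b x y k = trans (⋆-distribʳ y (- (x * k)) b) (cong (y ⋆ b ⊕_) (trans (cong (_⋆ b) (sym (ℤ.-1*i≡-i (x * k)))) (trans (⋆-assoc -1ℤ (x * k) b) (trans (-1⋆ _) (cong ⊝_ (⋆-assoc x k b))))))
  ⇝-span (under a p) (x ∷ c) = let c′ , e = ⇝-span p c in x ∷ c′ , cong (x ⋆ a ⊕_) e

  -- Euclid's algorithm on the first coordinates of two adjacent columns, by shears alone: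
  -- (h, g) ⇝ (r, g) ⇝ (r + g, g) ⇝ (r + g, - r) ⇝ (g, - r).
  euclid : ∀ {d n} (a b : V (suc d)) (r : Vec (V (suc d)) n) → Acc ℕ._<_ ∣ head b ∣ → ∃[ g ] ∃[ s ] ∃[ t ] (a ∷ b ∷ r ⇝ (g ∷ s) ∷ (0ℤ ∷ t) ∷ r)
  euclid (h ∷ u) (g ∷ v) r (acc rs) with g ℤ.≟ 0ℤ
  ... | yes refl = h , u , v , done
  ... | no g≢0 = let g′ , s , t , p = euclid a₃ b₂ r (rs smaller) in g′ , s , t ,
      (first a b (- q) r then (first a₁ b 1ℤ r then (second a₂ b -1ℤ r then (first a₂ b₂ 1ℤ r then p))))
    where
    instance
      g-nonZero : NonZero g
      g-nonZero = ℤ.≢-nonZero g≢0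
    q = h / g
    a = h ∷ u
    b = g ∷ v
    a₁ = a ⊕ (- q) ⋆ b
    a₂ = a₁ ⊕ 1ℤ ⋆ b
    b₂ = b ⊕ -1ℤ ⋆ a₂
    a₃ = a₂ ⊕ 1ℤ ⋆ b₂
    b₂-head : g + -1ℤ * (h + - q * g + 1ℤ * g) ≡ - pos (h % g)
    b₂-head = trans (solve 3 (λ g h q → g :+ (:- h :- (:- q :* g) :- g) := :- (h :- q :* g)) refl g h q ⟨≡ expandˡ ⟩) (cong -_ (trans (cong (_- q * g) (a≡a%n+[a/n]*n h g)) (solve 2 (λ a b → (a :+ b) :- b := a) refl (pos (h % g)) (q * g))))
      where
      expandˡ : g + -1ℤ * (h + - q * g + 1ℤ * g) ≡ g + (- h - (- q * g) - g)
      expandˡ = cong (λ z → g + z) (trans (ℤ.-1*i≡-i _) (trans (cong (λ z → - (h + - q * g + z)) (ℤ.*-identityˡ g)) (solve 3 (λ x y z → :- (x :+ y :+ z) := :- x :- y :- z) refl h (- q * g) g)))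
      _⟨≡_⟩ : ∀ {x y z : ℤ} → y ≡ z → x ≡ y → x ≡ z
      p ⟨≡ e ⟩ = trans e p
    smaller : ∣ g + -1ℤ * (h + - q * g + 1ℤ * g) ∣ ℕ.< ∣ g ∣
    smaller = subst (λ z → ∣ z ∣ ℕ.< ∣ g ∣) (sym b₂-head) (subst (ℕ._< ∣ g ∣) (sym (ℤ.∣-i∣≡∣i∣ (pos (h % g)))) (n%d<d h g))

  reduce : ∀ {d n} (cs : Vec (V (suc d)) (suc n)) → ∃[ g ] ∃[ t ] ∃[ r ] (cs ⇝ (g ∷ t) ∷ map (0ℤ ∷_) r)
  reduce ((h ∷ u) ∷ []) = h , u , [] , done
  reduce (c ∷ cs@(_ ∷ _)) = let g , t , r , p = reduce cs ; g′ , s , t′ , q = euclid c (g ∷ t) (map (0ℤ ∷_) r) (<-wellFounded _) in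
    g′ , s , t′ ∷ r , (under c p then q)

  expand-zeros : ∀ {d n} (f : Vec (V d) n → ℤ) (r : Vec (V d) (suc n)) → expand f (map (0ℤ ∷_) r) ≡ 0ℤ
  expand-zeros f (a ∷ []) = refl
  expand-zeros f (a ∷ r@(_ ∷ _)) = trans (cong (λ z → 0ℤ * f (map tail (map (0ℤ ∷_) r)) - z) (expand-zeros (λ ts → f (a ∷ ts)) r)) refl

  map-tail-0∷ : ∀ {d n} (r : Vec (V d) n) → map tail (map (0ℤ ∷_) r) ≡ r
  map-tail-0∷ r = trans (sym (map-∘ tail (0ℤ ∷_) r)) (trans (map-cong (λ _ → refl) r) (map-id r))

  determinant-block : ∀ {d} g (t : V d) (r : Vec (V d) d) → determinant ((g ∷ t) ∷ map (0ℤ ∷_) r) ≡ g * determinant r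
  determinant-block g t [] = refl
  determinant-block g t r@(_ ∷ _) = trans (cong₂ (λ x y → g * determinant x - y) (map-tail-0∷ r) (expand-zeros (λ ts → determinant (t ∷ ts)) r))
    (ℤ.+-identityʳ (g * determinant r))

  -- Identifies the recursive expansion with the signed Laplace sum: each column that the recursion
  -- passes contributes one factor -1.
  expand-sum : ∀ {d n} (f : Vec (V d) n → ℤ) (c : Fin (suc n) → V (suc d)) →
    expand f (tabulate c) ≡ Σℤ.sum (λ j → (- 1ℤ) ^ℤ toℕ j * (head (c j) * f (tabulate (λ k → tail (c (punchIn j k))))))
  expand-sum {n = zero} f c = trans (sym (ℤ.*-identityˡ (head (c zero) * f []))) (sym (ℤ.+-identityʳ _))
  expand-sum {n = suc n} f c = cong₂ _+_
    (trans (cong (λ z → head (c zero) * f z) (sym (tabulate-∘ tail (c ∘ suc)))) (sym (ℤ.*-identityˡ _)))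
    (begin
      - expand (λ ts → f (tail (c zero) ∷ ts)) (tabulate (c ∘ suc))    ≡⟨ cong -_ (expand-sum (λ ts → f (tail (c zero) ∷ ts)) (c ∘ suc)) ⟩
      - Σℤ.sum (λ j → sign j * term j)                                 ≡⟨ ℤ.-1*i≡-i _ ⟨
      -1ℤ * Σℤ.sum (λ j → sign j * term j)                             ≡⟨ Σℤ.*-distribˡ-sum -1ℤ (λ j → sign j * term j) ⟩
      Σℤ.sum (λ j → -1ℤ * (sign j * term j))                           ≡⟨ Σℤ.sum-cong-≗ (λ j → ℤ.*-assoc -1ℤ (sign j) (term j)) ⟨
      Σℤ.sum (λ j → (-1ℤ * sign j) * term j)                           ∎)
    where
    open ≡-Reasoning
    sign : Fin (suc n) → ℤ
    sign j = (- 1ℤ) ^ℤ toℕ j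
    term : Fin (suc n) → ℤ
    term j = head (c (suc j)) * f (tail (c zero) ∷ tabulate (λ k → tail (c (suc (punchIn j k)))))

  columns : ∀ {d} → Mat ℤ d → Vec (V d) d
  columns M = tabulate (λ j → tabulate (λ i → M i j))

  determinant-columns : ∀ {d} (M : Mat ℤ d) → determinant (columns M) ≡ detℤ M
  determinant-columns {zero} M = refl
  determinant-columns {suc d} M = trans (expand-sum determinant (λ j → tabulate (λ i → M i j)))
    (Σℤ.sum-cong-≗ (λ j → cong (λ z → (- 1ℤ) ^ℤ toℕ j * (M zero j * z)) (determinant-columns (λ i k → M (suc i) (punchIn j k)))))

-- Subgroups of the integer lattice and lower bounds for indices.

module Lattices (em : ∀ (P : Set) → Dec P) where
  open Counting
  open WithEM em
  open Vectors
  open IntegerLinear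
  open Determinants
  open import Data.Nat.Base as ℕ using (ℕ; zero; suc; z≤n)
  import Data.Nat.Properties as ℕ
  open import Data.Integer.Base as ℤ using (ℤ; 0ℤ; ∣_∣) renaming (+_ to pos)
  import Data.Integer.Properties as ℤ
  open import Data.Fin.Base using (zero; suc)
  open import Data.List.Base using (List; []; _∷_; length; upTo) renaming (map to lmap)
  open import Data.List.Properties using (length-applyUpTo)
  open import Data.List.Membership.Propositional.Properties
  import Data.List.Relation.Unary.AllPairs as AllPairs
  open import Data.Vec.Base using (Vec; []; _∷_; head; tail; lookup; map)
  open import Data.Vec.Properties using (∷-injectiveˡ; ∷-injectiveʳ)
  open import Data.Product.Base using (∃-syntax; _×_; _,_; proj₁; proj₂)
  open import Data.Sum.Base using (inj₁; inj₂)
  open import Data.Unit.Base using (⊤; tt)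
  open import Data.Empty using (⊥-elim)
  open import Relation.Nullary using (yes; no; ¬_)
  open import Relation.Binary.PropositionalEquality hiding ([_])
  open import Function.Base using (_∘_; id)

  record IsSubgroup {d} (Γ : V d → Set) : Set where
    field
      0∈ : Γ 0v
      ⊕∈ : ∀ {u v} → Γ u → Γ v → Γ (u ⊕ v)
      ⊝∈ : ∀ {u} → Γ u → Γ (⊝ u)

    ⊖∈ : ∀ {u v} → Γ u → Γ v → Γ (u ⊖ v)
    ⊖∈ p q = ⊕∈ p (⊝∈ q)

    ⋆∈ : ∀ k {u} → Γ u → Γ (k ⋆ u)
    ⋆∈ (pos n) {u} p = natural n
      where
      natural : ∀ n → Γ (pos n ⋆ u)
      natural zero = subst Γ (sym (0⋆ u)) 0∈
      natural (suc n) = subst Γ (sym (trans (⋆-distribʳ (pos 1) (pos n) u) (cong (_⊕ pos n ⋆ u) (1⋆ u)))) (⊕∈ p (natural n))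
    ⋆∈ ℤ.-[1+ n ] {u} p = subst Γ (sym (trans (cong (_⋆ u) (sym (ℤ.-1*i≡-i (pos (suc n))))) (trans (⋆-assoc ℤ.-1ℤ (pos (suc n)) u) (-1⋆ _)))) (⊝∈ (⋆∈ (pos (suc n)) p))

    combination∈ : ∀ {n} (c : V n) vs → (∀ i → Γ (lookup vs i)) → Γ (combination c vs)
    combination∈ [] [] _ = 0∈
    combination∈ (c ∷ cs) (v ∷ vs) p = ⊕∈ (⋆∈ c (p zero)) (combination∈ cs vs (p ∘ suc))

  -- Full rank, expressed by containing a positive multiple of the whole lattice.
  Full : ∀ {d} → (V d → Set) → Set
  Full Γ = ∃[ M ] (1 ℕ.≤ M × ∀ v → Γ (pos M ⋆ v))

  CoveredBy : ∀ {d} → (G Γ : V d → Set) → List (V d) → Set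
  CoveredBy G Γ ρ = ∀ z → G z → ∃[ r ] (r ∈ ρ × Γ (z ⊖ r))

  -- A lower bound for the index [G : Γ] without quotient groups: every list that represents all
  -- cosets is this long. The list may contain elements outside G, which only makes the bound
  -- stronger.
  IndexAtLeast : ∀ {d} → (G Γ : V d → Set) → ℕ → Set
  IndexAtLeast G Γ n = ∀ ρ → CoveredBy G Γ ρ → n ℕ.≤ card ρ

  -- The members of ρ that lie in one coset of Λ, shifted into Λ, cover Λ modulo Γ, so there are at
  -- least n of them; and at least m cosets of Λ are represented.
  index-tower : ∀ {d} {G Λ Γ : V d → Set} {m n} → IsSubgroup G → IsSubgroup Λ → (∀ {v} → Γ v → Λ v) → (∀ {v} → Λ v → G v) →
    IndexAtLeast G Λ m → IndexAtLeast Λ Γ n → IndexAtLeast G Γ (m ℕ.* n)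
  index-tower {d} {G} {Λ} {Γ} {m} {n} subG subΛ Γ⊆Λ Λ⊆G m≤ n≤ ρ cov = begin
    m ℕ.* n                                      ≤⟨ ℕ.*-monoˡ-≤ n (ℕ.≤-trans (m≤ reps reps-cover) (card≤length reps)) ⟩
    length reps ℕ.* n                            ≤⟨ sum-map-≥ (λ s → card (class s)) n reps class-big ⟩
    Σcard class reps                             ≤⟨ Σcard-≤ class reps (AllPairs.map disjoint separate) (λ {s} _ z∈ → proj₁ (∈-sub⁻ (Same s) {ρ} z∈)) ⟩
    card ρ                                       ∎
    where
    open ℕ.≤-Reasoning
    module G = IsSubgroup subG
    module Λ = IsSubgroup subΛ
    _~_ : V d → V d → Set
    r ~ s = Λ (r ⊖ s)
    Same : V d → V d → Set
    Same s r = Λ (r ⊖ s)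
    flip~ : ∀ {r s} → r ~ s → s ~ r
    flip~ {r} {s} p = subst Λ (linear (:- (x₀ :- x₁)) (x₁ :- x₀) refl (r ∷ s ∷ [])) (Λ.⊝∈ p)
    open Transversal (transversal _~_ (λ {x} → subst Λ (linear :0 (x₀ :- x₀) refl (x ∷ [])) Λ.0∈) flip~ (sub G ρ))
    class : V d → List (V d)
    class s = sub (Same s) ρ
    disjoint : ∀ {s s′} → ¬ s ~ s′ → Disjoint (class s) (class s′)
    disjoint {s} {s′} s≁s′ {z} p q = s≁s′ (subst Λ (linear ((x₂ :- x₁) :- (x₂ :- x₀)) (x₀ :- x₁) refl (s ∷ s′ ∷ z ∷ []))
      (Λ.⊖∈ (proj₂ (∈-sub⁻ (Same s′) {ρ} q)) (proj₂ (∈-sub⁻ (Same s) {ρ} p))))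
    reps-cover : CoveredBy G Λ reps
    reps-cover z z∈ with cov z z∈
    ... | r , r∈ , z-r with covers (∈-sub⁺ G r∈ (subst G (linear (x₀ :- (x₀ :- x₁)) x₁ refl (z ∷ r ∷ [])) (G.⊖∈ z∈ (Λ⊆G (Γ⊆Λ z-r)))))
    ... | s , s∈ , r-s = s , s∈ , subst Λ (linear ((x₀ :- x₁) :+ (x₁ :- x₂)) (x₀ :- x₂) refl (z ∷ r ∷ s ∷ [])) (Λ.⊕∈ (Γ⊆Λ z-r) r-s)
    class-big : ∀ {s} → s ∈ reps → n ℕ.≤ card (class s)
    class-big {s} s∈ = subst (n ℕ.≤_) (card-map (_⊖ s) (⊕-cancelʳ _ _ (⊝ s)) (class s)) (n≤ (lmap (_⊖ s) (class s)) shifted)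
      where
      Gs : G s
      Gs = proj₂ (∈-sub⁻ G {ρ} (reps⊆ s∈))
      shifted : CoveredBy Λ Γ (lmap (_⊖ s) (class s))
      shifted y y∈ with cov (s ⊕ y) (G.⊕∈ Gs (Λ⊆G y∈))
      ... | r , r∈ , γ = r ⊖ s , ∈-map⁺ (_⊖ s) (∈-sub⁺ (Same s) r∈ (subst Λ (linear (x₁ :- ((x₀ :+ x₁) :- x₂)) (x₂ :- x₀) refl (s ∷ y ∷ r ∷ [])) (Λ.⊖∈ y∈ (Γ⊆Λ γ)))) ,
        subst Γ (linear ((x₀ :+ x₁) :- x₂) (x₁ :- (x₂ :- x₀)) refl (s ∷ y ∷ r ∷ [])) γ

  Everything : ∀ {d} → V d → Set
  Everything _ = ⊤

  everything-subgroup : ∀ {d} → IsSubgroup (Everything {d})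
  everything-subgroup = record { 0∈ = tt ; ⊕∈ = λ _ _ → tt ; ⊝∈ = λ _ → tt }

  SpanOf : ∀ {d n} → Vec (V d) n → V d → Set
  SpanOf cs v = ∃[ c ] v ≡ combination c cs

  -- Column reduction turns ℤᵈ/M ℤᵈ into a tower of cyclic quotients.
  determinant-index : ∀ {d} (cs : Vec (V d) d) → IndexAtLeast Everything (SpanOf cs) ∣ determinant cs ∣
  determinant-index {zero} [] ρ cov with cov [] tt
  ... | r , r∈ , _ = card-pos r∈
  determinant-index {suc d} cs with reduce cs
  ... | g , t , r , p with g ℤ.≟ 0ℤ
  ... | yes refl = λ ρ _ → subst (ℕ._≤ card ρ) (sym (cong ∣_∣ (trans (⇝-invariant p determinant determinant-shear) (determinant-block 0ℤ t r)))) z≤n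
  ... | no g≢0 = subst (λ n → IndexAtLeast Everything (SpanOf cs) n) (sym det≡) (weaken tower)
    where
    det≡ : ∣ determinant cs ∣ ≡ ∣ g ∣ ℕ.* ∣ determinant r ∣
    det≡ = trans (cong ∣_∣ (trans (⇝-invariant p determinant determinant-shear) (determinant-block g t r))) (ℤ.abs-* g (determinant r))
    block : Vec (V (suc d)) (suc d)
    block = (g ∷ t) ∷ map (0ℤ ∷_) r
    weaken : ∀ {n} → IndexAtLeast Everything (SpanOf block) n → IndexAtLeast Everything (SpanOf cs) n
    weaken idx ρ cov = idx ρ λ z z∈ → let s , s∈ , c , e = cov z z∈ ; c′ , e′ = ⇝-span p c in s , s∈ , c′ , trans e e′
    -- The intermediate lattice of vectors whose first coordinate is divisible by g. The quotient by
    -- it is cyclic of order |g|; inside it the first coordinate can be cleared with the first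
    -- column, which leaves the columns `r` in one dimension less.
    Λ : V (suc d) → Set
    Λ v = ∃[ k ] head v ≡ k ℤ.* g
    subΛ : IsSubgroup Λ
    subΛ = record
      { 0∈ = 0ℤ , refl
      ; ⊕∈ = λ { {_ ∷ _} {_ ∷ _} (k , e) (k′ , e′) → k ℤ.+ k′ , trans (cong₂ ℤ._+_ e e′) (sym (ℤ.*-distribʳ-+ g k k′)) }
      ; ⊝∈ = λ { {_ ∷ _} (k , e) → ℤ.- k , trans (cong ℤ.-_ e) (ℤ.neg-distribˡ-* k g) } }
    block-combination : ∀ c₀ c → combination (c₀ ∷ c) block ≡ c₀ ℤ.* g ∷ c₀ ⋆ t ⊕ combination c r
    block-combination c₀ c = trans (cong (c₀ ⋆ (g ∷ t) ⊕_) (combination-0∷ c r)) (cong (_∷ c₀ ⋆ t ⊕ combination c r) (ℤ.+-identityʳ (c₀ ℤ.* g)))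
    tower : IndexAtLeast Everything (SpanOf block) (∣ g ∣ ℕ.* ∣ determinant r ∣)
    tower = index-tower {G = Everything} {Λ} {SpanOf block} everything-subgroup subΛ (λ { {v} (c₀ ∷ c , e) → c₀ , trans (cong head e) (cong head (block-combination c₀ c)) }) (λ _ → tt) cyclic below
      where
      cyclic : IndexAtLeast Everything Λ ∣ g ∣
      cyclic ρ cov = subst (ℕ._≤ card ρ) (trans (card-unique (upTo⁺ ∣ g ∣)) (length-applyUpTo id ∣ g ∣)) (card-rel R total (λ {j} {j′} {r} → inj {j} {j′} {r}))
        where
        open import Data.List.Relation.Unary.Unique.Propositional.Properties using (upTo⁺)
        R : ℕ → V (suc d) → Set
        R j r = j ℕ.< ∣ g ∣ × (∃[ k ] pos j ℤ.- head r ≡ k ℤ.* g)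
        total : ∀ {j} → j ∈ upTo ∣ g ∣ → ∃[ r ] (r ∈ ρ × R j r)
        total {j} j∈ with cov (pos j ∷ 0v) tt
        ... | r@(h ∷ _) , r∈ , k , e = r , r∈ , ∈-upTo⁻ j∈ , k , e
        inj : ∀ {j j′ r} → R j r → R j′ r → j ≡ j′
        inj {j} {j′} {r} (j< , k , e) (j′< , k′ , e′) = close j j′ j< j′< (k ℤ.- k′) (trans (shift (pos j) (pos j′) (head r)) (trans (cong₂ ℤ._-_ e e′) (factor k k′ g)))
          where
          close : ∀ j j′ → j ℕ.< ∣ g ∣ → j′ ℕ.< ∣ g ∣ → ∀ k → pos j ℤ.- pos j′ ≡ k ℤ.* g → j ≡ j′
          close j j′ j< j′< k e with k ℤ.≟ 0ℤ
          ... | yes refl = ℤ.+-injective (ℤ.i-j≡0⇒i≡j (pos j) (pos j′) e)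
          ... | no k≢0 = ⊥-elim (ℕ.<⇒≱ far (ℕ.≤-trans (ℕ.m≤n*m ∣ g ∣ ∣ k ∣ {{ℕ.≢-nonZero (k≢0 ∘ ℤ.∣i∣≡0⇒i≡0)}}) (ℕ.≤-reflexive (trans (sym (ℤ.abs-* k g)) (cong ∣_∣ (sym e))))))
            where
            far : ∣ pos j ℤ.- pos j′ ∣ ℕ.< ∣ g ∣
            far with ℕ.≤-total j j′
            ... | inj₁ j≤j′ = ℕ.≤-<-trans (subst (ℕ._≤ j′) (sym (trans (cong ∣_∣ (ℤ.m-n≡m⊖n j j′)) (ℤ.∣⊖∣-≤ j≤j′))) (ℕ.m∸n≤m j′ j)) j′<
            ... | inj₂ j′≤j = ℕ.≤-<-trans (subst (ℕ._≤ j) (sym (trans (cong ∣_∣ (ℤ.m-n≡m⊖n j j′)) (trans (ℤ.∣m⊖n∣≡∣n⊖m∣ j j′) (ℤ.∣⊖∣-≤ j′≤j)))) (ℕ.m∸n≤m j j′)) j<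
      below : IndexAtLeast Λ (SpanOf block) ∣ determinant r ∣
      below ρ cov = ℕ.≤-trans (determinant-index r (lmap φ ρ) cov′) (card-surj φ (λ y∈ → let x , x∈ , e = ∈-map⁻ φ y∈ in x , x∈ , e))
        where
        -- Says that s plus c₀ times the first column (g, t) is (0, w).
        Lift : V (suc d) → V d → Set
        Lift s w = ∃[ c₀ ] (w ≡ tail s ⊕ c₀ ⋆ t × 0ℤ ℤ.- head s ≡ c₀ ℤ.* g)
        chosen = choice Lift 0v
        φ : V (suc d) → V d
        φ = proj₁ chosen
        cov′ : CoveredBy Everything (SpanOf r) (lmap φ ρ)
        cov′ w _ with cov (0ℤ ∷ w) (0ℤ , refl)
        ... | s@(h ∷ v) , s∈ , c₀ ∷ c , e with trans e (block-combination c₀ c)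
        ... | e′ with proj₂ chosen s (v ⊕ c₀ ⋆ t) (c₀ , refl , ∷-injectiveˡ e′)
        ... | c₁ , φ≡ , h≡ = φ s , ∈-map⁺ φ s∈ , c , (begin
          w ⊖ φ s                        ≡⟨ cong (w ⊖_) (trans φ≡ (cong (λ k → v ⊕ k ⋆ t) c₁≡c₀)) ⟩
          w ⊖ (v ⊕ c₀ ⋆ t)               ≡⟨ linear (x₀ :- (x₁ :+ x₂)) ((x₀ :- x₁) :- x₂) refl (w ∷ v ∷ c₀ ⋆ t ∷ []) ⟩
          (w ⊖ v) ⊖ c₀ ⋆ t               ≡⟨ cong (_⊖ c₀ ⋆ t) (∷-injectiveʳ e′) ⟩
          (c₀ ⋆ t ⊕ combination c r) ⊖ c₀ ⋆ t ≡⟨ linear ((x₀ :+ x₁) :- x₀) x₁ refl (c₀ ⋆ t ∷ combination c r ∷ []) ⟩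
          combination c r                ∎)
          where
          open ≡-Reasoning
          c₁≡c₀ : c₁ ≡ c₀
          c₁≡c₀ = ℤ.*-cancelʳ-≡ c₁ c₀ g {{ℤ.≢-nonZero g≢0}} (trans (sym h≡) (∷-injectiveˡ e′))

-- Triangular lattice bases and the index bound that coprimality gives.

module Coprimality (em : ∀ (P : Set) → Dec P) where
  open Counting
  open WithEM em
  open Vectors
  open IntegerLinear
  open Determinants using (columns; determinant-columns)
  open Lattices em
  open RationalLinear
  open import Algebra.Bundles using (CommutativeRing)
  import Algebra.Properties.Semiring.Sum as SemiringSum
  open import Data.Nat.Base as ℕ using (ℕ; zero; suc; s≤s; z≤n)
  import Data.Nat.Properties as ℕ
  open import Data.Integer.Base as ℤ using (ℤ; 0ℤ; 1ℤ; ∣_∣) renaming (+_ to pos)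
  import Data.Integer.Properties as ℤ
  open import Data.Integer.DivMod using (_/_; _%_; a≡a%n+[a/n]*n; n%d<d)
  open import Data.Rational.Base as ℚ using (ℚ; 0ℚ; 1ℚ)
  import Data.Rational.Properties as ℚ
  open import Data.Rational.Unnormalised.Base as ℚᵘ using (mkℚᵘ; *<*)
  import Data.Rational.Unnormalised.Properties as ℚᵘ
  open import Data.Fin.Base using (Fin; zero; suc)
  open import Data.List.Base using (List; []; _∷_; upTo; cartesianProductWith; [_]) renaming (map to lmap)
  open import Data.List.Properties using (length-applyUpTo)
  open import Data.List.Membership.Propositional.Properties
  open import Data.List.Relation.Unary.Any using (here)
  open import Data.Vec.Base using (Vec; []; _∷_; lookup; tabulate; map)
  open import Data.Vec.Properties using (lookup∘tabulate; lookup-zipWith; lookup-map)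
  open import Data.Product.Base using (∃-syntax; _×_; _,_; proj₁; proj₂)
  open import Data.Sum.Base using (inj₁; inj₂)
  open import Data.Unit.Base using (tt)
  open import Data.Empty using (⊥-elim)
  open import Relation.Nullary using (yes; no; ¬_)
  open import Relation.Binary.PropositionalEquality hiding ([_])
  open import Function.Base using (_∘_; id)

  module LowerTriangular {c ℓ} (R : CommutativeRing c ℓ) where
    open CommutativeRing R using (Carrier; _≈_; _*_; 0#; semiring; +-cong; *-congˡ; *-congʳ; *-identityˡ; +-identityʳ; zeroˡ; zeroʳ) renaming (trans to ≈-trans)
    open LinearAlgebra R using (det)
    module Σ = SemiringSum semiring

    det-lower : ∀ {d} (M : Mat Carrier (suc d)) → (∀ j → M zero (suc j) ≈ 0#) → det M ≈ M zero zero * det (λ i k → M (suc i) (suc k))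
    det-lower {d} M zeros = ≈-trans (+-cong (*-identityˡ _) (≈-trans
      (Σ.sum-cong-≋ (λ j → ≈-trans (*-congˡ (≈-trans (*-congʳ (zeros j)) (zeroˡ _))) (zeroʳ _))) (Σ.sum-replicate-zero d))) (+-identityʳ _)

  -- Lower triangular column bases with positive diagonal, as in Hermite's normal form but with
  -- unreduced entries. Determinant, coset representatives and rational inverse are explicit by
  -- recursion.
  data Triangular : ℕ → Set where
    []    : Triangular 0
    block : ∀ {d} (g : ℕ) → 1 ℕ.≤ g → V d → Triangular d → Triangular (suc d)

  volume : ∀ {d} → Triangular d → ℕ
  volume []              = 1
  volume (block g _ t T) = g ℕ.* volume T

  volume≥1 : ∀ {d} (T : Triangular d) → 1 ℕ.≤ volume T
  volume≥1 []                = ℕ.≤-refl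
  volume≥1 (block g g≥1 t T) = ℕ.*-mono-≤ g≥1 (volume≥1 T)

  matrix : ∀ {d} → Triangular d → Mat ℤ d
  matrix (block g _ t T) zero    zero    = pos g
  matrix (block g _ t T) zero    (suc j) = 0ℤ
  matrix (block g _ t T) (suc i) zero    = lookup t i
  matrix (block g _ t T) (suc i) (suc j) = matrix T i j

  Generates : ∀ {d} → Triangular d → V d → Set
  Generates T v = ∃[ c ] act (matrix T) c ≡ v

  act-block : ∀ {d} g g≥1 t (T : Triangular d) k c → act (matrix (block g g≥1 t T)) (k ∷ c) ≡ k ℤ.* pos g ∷ k ⋆ t ⊕ act (matrix T) c
  act-block {d} g g≥1 t T k c = cong₂ _∷_
    (trans (cong₂ ℤ._+_ (ℤ.*-comm (pos g) k) (trans (Σℤ.sum-cong-≗ {d} (λ j → ℤ.*-zeroˡ (lookup c j))) (Σℤ.sum-replicate-zero d))) (ℤ.+-identityʳ (k ℤ.* pos g)))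
    (lookup-ext λ i → trans (lookup∘tabulate _ i) (sym (trans (lookup-zipWith ℤ._+_ i (k ⋆ t) (act (matrix T) c))
      (cong₂ ℤ._+_ (trans (lookup-map i (k ℤ.*_) t) (ℤ.*-comm k (lookup t i))) (lookup∘tabulate _ i)))))

  least : (P : ℕ → Set) → ∀ n → P n → ∃[ m ] (P m × (∀ j → j ℕ.< m → ¬ P j))
  least P n p = search n 0 (λ _ ()) (subst P (sym (ℕ.+-identityʳ n)) p)
    where
    search : ∀ k m → (∀ j → j ℕ.< m → ¬ P j) → P (k ℕ.+ m) → ∃[ m ] (P m × (∀ j → j ℕ.< m → ¬ P j))
    search zero m below p = m , p , below
    search (suc k) m below p with em (P m)
    ... | yes q = m , q , below
    ... | no ¬q = search k (suc m) below′ (subst P (sym (ℕ.+-suc k m)) p)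
      where
      below′ : ∀ j → j ℕ.< suc m → ¬ P j
      below′ j j<1+m with ℕ.m≤n⇒m<n∨m≡n (ℕ.s≤s⁻¹ j<1+m)
      ... | inj₁ j<m = below j j<m
      ... | inj₂ refl = ¬q

  Basis : ∀ {d} → (V d → Set) → Set
  Basis {d} Γ = ∃[ T ] ((∀ v → Γ v → Generates {d} T v) × (∀ v → Generates T v → Γ v))

  -- The entry g is the least positive first coordinate occurring in Γ. By division with remainder
  -- all first coordinates are multiples of g, and the vectors with first coordinate 0 form a full
  -- lattice in one dimension less.
  triangular-basis : ∀ {d} (Γ : V d → Set) → IsSubgroup Γ → Full Γ → Basis Γ
  triangular-basis {zero} Γ subΓ _ = [] , (λ { [] _ → [] , refl }) , λ { [] _ → IsSubgroup.0∈ subΓ }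
  triangular-basis {suc d} Γ subΓ (M , M≥1 , full) = assemble (least Leading (ℕ.pred M) leadingM) (triangular-basis Γ′ subΓ′ (M , M≥1 , full′))
    where
    open IsSubgroup subΓ
    Γ′ : V d → Set
    Γ′ v = Γ (0ℤ ∷ v)
    subΓ′ : IsSubgroup Γ′
    subΓ′ = record { 0∈ = 0∈ ; ⊕∈ = ⊕∈ ; ⊝∈ = ⊝∈ }
    full′ : ∀ v → Γ′ (pos M ⋆ v)
    full′ v = subst (λ z → Γ (z ∷ pos M ⋆ v)) (ℤ.*-zeroʳ (pos M)) (full (0ℤ ∷ v))
    -- The index n stands for the coordinate n + 1, so that the least index gives the least positive
    -- coordinate.
    Leading : ℕ → Set
    Leading n = ∃[ t ] Γ (pos (suc n) ∷ t)
    leadingM : Leading (ℕ.pred M)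
    leadingM = pos M ⋆ 0v , subst (λ z → Γ (z ∷ pos M ⋆ 0v)) (trans (ℤ.*-identityʳ (pos M)) (cong pos (sym (ℕ.suc-pred M {{ℕ.>-nonZero M≥1}})))) (full (1ℤ ∷ 0v))
    assemble : ∃[ m ] (Leading m × (∀ j → j ℕ.< m → ¬ Leading j)) → Basis Γ′ → Basis Γ
    assemble (m , (t , gt∈) , minimal) (T , to , from) = block (suc m) (s≤s z≤n) t T , to′ , from′
      where
      g = suc m
      from′ : ∀ v → Generates (block g (s≤s z≤n) t T) v → Γ v
      from′ v (k ∷ c , e) = subst Γ (trans (trans (linear-block k c) (sym (act-block g (s≤s z≤n) t T k c))) e)
        (⊕∈ (⋆∈ k gt∈) (from (act (matrix T) c) (c , refl)))
        where
        linear-block : ∀ k c → k ⋆ (pos g ∷ t) ⊕ (0ℤ ∷ act (matrix T) c) ≡ k ℤ.* pos g ∷ k ⋆ t ⊕ act (matrix T) c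
        linear-block k c = cong (_∷ k ⋆ t ⊕ act (matrix T) c) (ℤ.+-identityʳ (k ℤ.* pos g))
      to′ : ∀ v → Γ v → Generates (block g (s≤s z≤n) t T) v
      to′ (x ∷ v) xv∈ = q ∷ c , trans (act-block g (s≤s z≤n) t T q c) (cong₂ _∷_ (sym x≡) (trans (cong (q ⋆ t ⊕_) e) (linear (x₁ :+ (x₀ :- x₁)) x₀ refl (v ∷ q ⋆ t ∷ []))))
        where
        q = x / pos g
        r = x % pos g
        difference∈ : Γ (x ℤ.- q ℤ.* pos g ∷ v ⊖ q ⋆ t)
        difference∈ = ⊖∈ xv∈ (⋆∈ q gt∈)
        x-qg≡r : x ℤ.- q ℤ.* pos g ≡ pos r
        x-qg≡r = trans (cong (ℤ._- q ℤ.* pos g) (a≡a%n+[a/n]*n x (pos g))) (trans (ℤ.+-assoc (pos r) (q ℤ.* pos g) _) (trans (cong (λ z → pos r ℤ.+ z) (ℤ.+-inverseʳ (q ℤ.* pos g))) (ℤ.+-identityʳ (pos r))))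
        r∈ : Γ (pos r ∷ v ⊖ q ⋆ t)
        r∈ = subst (λ z → Γ (z ∷ v ⊖ q ⋆ t)) x-qg≡r difference∈
        r≡0 : r ≡ 0
        r≡0 = vanish r refl
          where
          vanish : ∀ r′ → r ≡ r′ → r ≡ 0
          vanish zero e = e
          vanish (suc r′) e = ⊥-elim (minimal r′ (ℕ.s≤s⁻¹ (subst (ℕ._< g) e (n%d<d x (pos g)))) (v ⊖ q ⋆ t , subst (λ n → Γ (pos n ∷ v ⊖ q ⋆ t)) e r∈))
        x≡ : x ≡ q ℤ.* pos g
        x≡ = trans (a≡a%n+[a/n]*n x (pos g)) (trans (cong (λ n → pos n ℤ.+ q ℤ.* pos g) r≡0) (ℤ.+-identityˡ (q ℤ.* pos g)))
        generated : Generates T (v ⊖ q ⋆ t)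
        generated = to (v ⊖ q ⋆ t) (subst (λ n → Γ (pos n ∷ v ⊖ q ⋆ t)) r≡0 r∈)
        c = proj₁ generated
        e = proj₂ generated

  representatives : ∀ {d} → Triangular d → List (V d)
  representatives []              = [ [] ]
  representatives (block g _ t T) = cartesianProductWith (λ j w → pos j ∷ w) (upTo g) (representatives T)

  card-representatives : ∀ {d} (T : Triangular d) → card (representatives T) ℕ.≤ volume T
  card-representatives [] = card≤length ([] ∷ [])
  card-representatives (block g _ t T) = ℕ.≤-trans (card-≤-× (λ j w → pos j ∷ w) (∈-cartesianProductWith⁻ _ (upTo g) (representatives T)))
    (ℕ.*-mono-≤ (ℕ.≤-trans (card≤length (upTo g)) (ℕ.≤-reflexive (length-applyUpTo id g))) (card-representatives T))

  representatives-cover : ∀ {d} (T : Triangular d) → CoveredBy Everything (Generates T) (representatives T)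
  representatives-cover [] [] _ = [] , here refl , [] , refl
  representatives-cover (block (suc m) g≥1 t T) (x ∷ v) _ with representatives-cover T (v ⊖ (x / pos (suc m)) ⋆ t) tt
  ... | w , w∈ , c , e = pos r ∷ w , ∈-cartesianProductWith⁺ (λ j w → pos j ∷ w) {xs = upTo g} (∈-upTo⁺ (n%d<d x (pos g))) w∈ , q ∷ c ,
    trans (act-block g g≥1 t T q c) (cong₂ _∷_ qg≡ (trans (cong (q ⋆ t ⊕_) e) (linear (x₁ :+ ((x₀ :- x₁) :- x₂)) (x₀ :- x₂) refl (v ∷ q ⋆ t ∷ w ∷ []))))
    where
    g = suc m
    q = x / pos g
    r = x % pos g
    qg≡ : q ℤ.* pos g ≡ x ℤ.+ ℤ.- pos r
    qg≡ = trans (sym (ℤ.+-identityʳ _)) (trans (cong (λ z → q ℤ.* pos g ℤ.+ z) (sym (ℤ.+-inverseʳ (pos r)))) (trans (sym (ℤ.+-assoc (q ℤ.* pos g) (pos r) _))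
      (cong (λ z → z ℤ.- pos r) (trans (ℤ.+-comm (q ℤ.* pos g) (pos r)) (sym (a≡a%n+[a/n]*n x (pos g)))))))

  lookup-combination : ∀ {d n} (c : V n) (vs : Vec (V d) n) i → lookup (combination c vs) i ≡ Σℤ.sum (λ j → lookup c j ℤ.* lookup (lookup vs j) i)
  lookup-combination [] [] i = lookup-0 i
  lookup-combination (c ∷ cs) (v ∷ vs) i = trans (lookup-zipWith ℤ._+_ i (c ⋆ v) (combination cs vs)) (cong₂ ℤ._+_ (lookup-map i (c ℤ.*_) v) (lookup-combination cs vs i))

  act-columns : ∀ {d} (M : Mat ℤ d) c → act M c ≡ combination c (columns M)
  act-columns M c = lookup-ext λ i → trans (lookup∘tabulate _ i) (sym (trans (lookup-combination c (columns M) i)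
    (Σℤ.sum-cong-≗ λ j → trans (ℤ.*-comm (lookup c j) _) (cong (ℤ._* lookup c j) (trans (cong (λ w → lookup w i) (lookup∘tabulate (λ j → tabulate (λ i → M i j)) j)) (lookup∘tabulate (λ i → M i j) i))))))

  Image : ∀ {d} → (V d → V d) → V d → Set
  Image f v = ∃[ c ] v ≡ f c

  image-index : ∀ {d} (M : Mat ℤ d) → IndexAtLeast Everything (Image (act M)) ∣ detℤ M ∣
  image-index M ρ cov = subst (ℕ._≤ card ρ) (cong ∣_∣ (determinant-columns M))
    (determinant-index (columns M) ρ λ z z∈ → let r , r∈ , c , e = cov z z∈ in r , r∈ , c , trans e (act-columns M c))

  det-matrix : ∀ {d} (T : Triangular d) → detℤ (matrix T) ≡ pos (volume T)
  det-matrix [] = refl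
  det-matrix (block g g≥1 t T) = trans (LowerTriangular.det-lower ℤ.+-*-commutativeRing (matrix (block g g≥1 t T)) (λ _ → refl))
    (trans (cong (pos g ℤ.*_) (det-matrix T)) (sym (ℤ.pos-* g (volume T))))

  det-matrixℚ : ∀ {d} (T : Triangular d) → Lℚ.det (mapMat toℚ (matrix T)) ≡ toℚ (pos (volume T))
  det-matrixℚ [] = refl
  det-matrixℚ (block g _ t T) = trans (LowerTriangular.det-lower ℚ.+-*-commutativeRing (mapMat toℚ (matrix (block g _ t T))) (λ _ → refl))
    (trans (cong (toℚ (pos g) ℚ.*_) (det-matrixℚ T)) (trans (sym (toℚ-* (pos g) (pos (volume T)))) (cong toℚ (sym (ℤ.pos-* g (volume T))))))

  volume-index : ∀ {d} (T : Triangular d) → IndexAtLeast Everything (Generates T) (volume T)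
  volume-index T ρ cov = subst (ℕ._≤ card ρ) (cong ∣_∣ (det-matrix T)) (image-index (matrix T) ρ λ z z∈ → let r , r∈ , c , e = cov z z∈ in r , r∈ , c , sym e)

  abstract
    reciprocal : ∀ g → 1 ℕ.≤ g → ∃[ r ] r ℚ.* toℚ (pos g) ≡ 1ℚ
    reciprocal g g≥1 = ℚ.1/ toℚ (pos g) , ℚ.*-inverseˡ (toℚ (pos g))
      where
      instance
        nz : ℚ.NonZero (toℚ (pos g))
        nz = ℚ.≢-nonZero (λ e → pos-≢0 g≥1 (toℚ-injective {pos g} {0ℤ} e))

  -- Block inversion: the matrix with blocks g, 0, t, T has the inverse with blocks 1/g, 0, -T⁻¹t/g,
  -- T⁻¹.
  inverse : ∀ {d} → Triangular d → Mat ℚ d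
  inverse (block g g≥1 t T) zero    zero    = proj₁ (reciprocal g g≥1)
  inverse (block g g≥1 t T) zero    (suc j) = 0ℚ
  inverse (block g g≥1 t T) (suc i) zero    = ℚ.- (Σℚ.sum (λ j → inverse T i j ℚ.* toℚ (lookup t j)) ℚ.* proj₁ (reciprocal g g≥1))
  inverse (block g g≥1 t T) (suc i) (suc j) = inverse T i j

  Σ0* : ∀ {n} (f : Fin n → ℚ) → Σℚ.sum (λ j → 0ℚ ℚ.* f j) ≡ 0ℚ
  Σ0* {n} f = trans (Σℚ.sum-cong-≗ (λ j → ℚ.*-zeroˡ (f j))) (Σℚ.sum-replicate-zero n)

  Σ-identity : ∀ {n} (i : Fin n) (f : Fin n → ℚ) → Σℚ.sum (λ j → Lℚ.identity i j ℚ.* f j) ≡ f i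
  Σ-identity zero f = trans (cong₂ ℚ._+_ (ℚ.*-identityˡ (f zero)) (Σ0* (f ∘ suc))) (ℚ.+-identityʳ (f zero))
  Σ-identity (suc i) f = trans (cong₂ ℚ._+_ (ℚ.*-zeroˡ (f zero)) (Σ-identity i (f ∘ suc))) (ℚ.+-identityˡ (f (suc i)))

  inverse-left : ∀ {d} (T : Triangular d) i j → (inverse T Lℚ.*ₘ mapMat toℚ (matrix T)) i j ≡ Lℚ.identity i j
  inverse-left (block g g≥1 t T) zero zero = trans (cong₂ ℚ._+_ (proj₂ (reciprocal g g≥1)) (Σ0* (λ k → toℚ (lookup t k)))) (ℚ.+-identityʳ 1ℚ)
  inverse-left (block g g≥1 t T) zero (suc j) = trans (cong₂ ℚ._+_ (ℚ.*-zeroʳ (proj₁ (reciprocal g g≥1))) (Σ0* (λ k → toℚ (matrix T k j)))) refl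
  inverse-left (block g g≥1 t T) (suc i) zero = trans (cong (ℚ._+ s) (trans (sym (ℚ.neg-distribˡ-* (s ℚ.* r) (toℚ (pos g))))
      (cong ℚ.-_ (trans (ℚ.*-assoc s r (toℚ (pos g))) (trans (cong (s ℚ.*_) (proj₂ (reciprocal g g≥1))) (ℚ.*-identityʳ s)))))) (ℚ.+-inverseˡ s)
    where
    s = Σℚ.sum (λ j → inverse T i j ℚ.* toℚ (lookup t j))
    r = proj₁ (reciprocal g g≥1)
  inverse-left (block g g≥1 t T) (suc i) (suc j) = trans (cong₂ ℚ._+_ (ℚ.*-zeroʳ (inverse (block g g≥1 t T) (suc i) zero)) (inverse-left T i j)) (ℚ.+-identityˡ (Lℚ.identity i j))

  inverse-right : ∀ {d} (T : Triangular d) i j → (mapMat toℚ (matrix T) Lℚ.*ₘ inverse T) i j ≡ Lℚ.identity i j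
  inverse-right (block g g≥1 t T) zero zero = trans (cong₂ ℚ._+_ (trans (ℚ.*-comm (toℚ (pos g)) (proj₁ (reciprocal g g≥1))) (proj₂ (reciprocal g g≥1))) (Σ0* (λ k → inverse (block g g≥1 t T) (suc k) zero))) (ℚ.+-identityʳ 1ℚ)
  inverse-right (block g g≥1 t T) zero (suc j) = trans (cong₂ ℚ._+_ (ℚ.*-zeroʳ (toℚ (pos g))) (Σ0* (λ k → inverse T k j))) refl
  inverse-right {suc d} (block g g≥1 t T) (suc i) zero = trans (cong (x ℚ.* r ℚ.+_) (begin
      Σℚ.sum (λ k → m k ℚ.* (ℚ.- (s k ℚ.* r)))       ≡⟨ Σℚ.sum-cong-≗ (λ k → move (m k) (s k)) ⟩
      Σℚ.sum (λ k → (m k ℚ.* s k) ℚ.* (ℚ.- r))       ≡⟨ Σℚ.*-distribʳ-sum (ℚ.- r) (λ k → m k ℚ.* s k) ⟨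
      Σℚ.sum (λ k → m k ℚ.* s k) ℚ.* (ℚ.- r)         ≡⟨ cong (ℚ._* (ℚ.- r)) product ⟩
      x ℚ.* (ℚ.- r)                                  ≡⟨ ℚ.neg-distribʳ-* x r ⟨
      ℚ.- (x ℚ.* r)                                  ∎)) (ℚ.+-inverseʳ (x ℚ.* r))
    where
    open ≡-Reasoning
    x = toℚ (lookup t i)
    r = proj₁ (reciprocal g g≥1)
    m : Fin d → ℚ
    m k = toℚ (matrix T i k)
    s : Fin d → ℚ
    s k = Σℚ.sum (λ j → inverse T k j ℚ.* toℚ (lookup t j))
    move : ∀ a b → a ℚ.* (ℚ.- (b ℚ.* r)) ≡ (a ℚ.* b) ℚ.* (ℚ.- r)
    move a b = trans (cong (a ℚ.*_) (ℚ.neg-distribʳ-* b r)) (sym (ℚ.*-assoc a b (ℚ.- r)))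
    product : Σℚ.sum (λ k → m k ℚ.* s k) ≡ x
    product = begin
      Σℚ.sum (λ k → m k ℚ.* s k)                                                        ≡⟨ Σℚ.sum-cong-≗ (λ k → Σℚ.*-distribˡ-sum (m k) (λ j → inverse T k j ℚ.* toℚ (lookup t j))) ⟩
      Σℚ.sum (λ k → Σℚ.sum (λ j → m k ℚ.* (inverse T k j ℚ.* toℚ (lookup t j))))        ≡⟨ Σℚ.∑-comm (λ k j → m k ℚ.* (inverse T k j ℚ.* toℚ (lookup t j))) ⟩
      Σℚ.sum (λ j → Σℚ.sum (λ k → m k ℚ.* (inverse T k j ℚ.* toℚ (lookup t j))))        ≡⟨ Σℚ.sum-cong-≗ (λ j → trans (Σℚ.sum-cong-≗ (λ k → sym (ℚ.*-assoc (m k) (inverse T k j) (toℚ (lookup t j)))))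
                                                                                             (trans (sym (Σℚ.*-distribʳ-sum (toℚ (lookup t j)) (λ k → m k ℚ.* inverse T k j))) (cong (ℚ._* toℚ (lookup t j)) (inverse-right T i j)))) ⟩
      Σℚ.sum (λ j → Lℚ.identity i j ℚ.* toℚ (lookup t j))                               ≡⟨ Σ-identity i (λ j → toℚ (lookup t j)) ⟩
      x                                                                                 ∎
  inverse-right (block g g≥1 t T) (suc i) (suc j) = trans (cong₂ ℚ._+_ (ℚ.*-zeroʳ (toℚ (lookup t i))) (inverse-right T i j)) (ℚ.+-identityˡ (Lℚ.identity i j))

  det-inverse : ∀ {d} (T : Triangular d) → Lℚ.det (inverse T) ℚ.* toℚ (pos (volume T)) ≡ 1ℚ
  det-inverse [] = refl
  det-inverse (block g g≥1 t T) = begin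
    Lℚ.det (inverse (block g g≥1 t T)) ℚ.* toℚ (pos (g ℕ.* volume T))  ≡⟨ cong₂ ℚ._*_ (LowerTriangular.det-lower ℚ.+-*-commutativeRing (inverse (block g g≥1 t T)) (λ _ → refl)) (trans (cong toℚ (ℤ.pos-* g (volume T))) (toℚ-* (pos g) (pos (volume T)))) ⟩
    (r ℚ.* D) ℚ.* (toℚ (pos g) ℚ.* w)                                  ≡⟨ ℚ.*-assoc r D (toℚ (pos g) ℚ.* w) ⟩
    r ℚ.* (D ℚ.* (toℚ (pos g) ℚ.* w))                                  ≡⟨ cong (r ℚ.*_) (trans (sym (ℚ.*-assoc D (toℚ (pos g)) w)) (trans (cong (ℚ._* w) (ℚ.*-comm D (toℚ (pos g)))) (ℚ.*-assoc (toℚ (pos g)) D w))) ⟩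
    r ℚ.* (toℚ (pos g) ℚ.* (D ℚ.* w))                                  ≡⟨ ℚ.*-assoc r (toℚ (pos g)) (D ℚ.* w) ⟨
    (r ℚ.* toℚ (pos g)) ℚ.* (D ℚ.* w)                                  ≡⟨ cong₂ ℚ._*_ (proj₂ (reciprocal g g≥1)) (det-inverse T) ⟩
    1ℚ ℚ.* 1ℚ                                                          ≡⟨⟩
    1ℚ                                                                 ∎
    where
    open ≡-Reasoning
    r = proj₁ (reciprocal g g≥1)
    D = Lℚ.det (inverse T)
    w = toℚ (pos (volume T))

  toℚ-mono-< : ∀ {m n} → m ℕ.< n → toℚ (pos m) ℚ.< toℚ (pos n)
  toℚ-mono-< {m} {n} m<n = ℚ.toℚᵘ-cancel-< (ℚᵘ.<-respˡ-≃ (ℚᵘ.≃-sym (ℚ.toℚᵘ-fromℚᵘ (mkℚᵘ (pos m) 0))) (ℚᵘ.<-respʳ-≃ (ℚᵘ.≃-sym (ℚ.toℚᵘ-fromℚᵘ (mkℚᵘ (pos n) 0)))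
    (*<* (subst₂ ℤ._<_ (sym (ℤ.*-identityʳ (pos m))) (sym (ℤ.*-identityʳ (pos n))) (ℤ.+<+ m<n)))))

  matrix-unit : ∀ {n} (f : Fin n → ℤ) j → Σℤ.sum (λ l → f l ℤ.* lookup (unit j) l) ≡ f j
  matrix-unit {suc n} f zero = trans (cong₂ ℤ._+_ (ℤ.*-identityʳ (f zero)) (trans (Σℤ.sum-cong-≗ (λ l → trans (cong (f (suc l) ℤ.*_) (lookup-0 l)) (ℤ.*-zeroʳ (f (suc l))))) (Σℤ.sum-replicate-zero n))) (ℤ.+-identityʳ (f zero))
  matrix-unit (f) (suc j) = trans (cong₂ ℤ._+_ (ℤ.*-zeroʳ (f zero)) (matrix-unit (f ∘ suc) j)) (ℤ.+-identityˡ (f (suc j)))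

  -- S⁻¹ L Q is integral as soon as L maps the lattice of Q into the lattice of S.
  conjugate-integral : ∀ {d} (L : Mat ℤ d) (S Q : Triangular d) → (∀ c → Generates S (act L (act (matrix Q) c))) →
    IsIntegral (inverse S Lℚ.*ₘ mapMat toℚ L Lℚ.*ₘ mapMat toℚ (matrix Q))
  conjugate-integral {d} L S Q into = N , λ i j → begin
    Σℚ.sum (λ k → P i k ℚ.* Σℚ.sum (λ l → toℚ (L k l) ℚ.* toℚ (matrix Q l j)))                       ≡⟨ Σℚ.sum-cong-≗ (λ k → cong (P i k ℚ.*_) (trans (product L (matrix Q) k j) (trans (cong toℚ (sym (integer-identity k j))) (sym (product (matrix S) N k j))))) ⟩
    Σℚ.sum (λ k → P i k ℚ.* Σℚ.sum (λ l → toℚ (matrix S k l) ℚ.* toℚ (N l j)))                       ≡⟨ Σℚ.sum-cong-≗ (λ k → Σℚ.*-distribˡ-sum (P i k) (λ l → toℚ (matrix S k l) ℚ.* toℚ (N l j))) ⟩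
    Σℚ.sum (λ k → Σℚ.sum (λ l → P i k ℚ.* (toℚ (matrix S k l) ℚ.* toℚ (N l j))))                     ≡⟨ Σℚ.∑-comm (λ k l → P i k ℚ.* (toℚ (matrix S k l) ℚ.* toℚ (N l j))) ⟩
    Σℚ.sum (λ l → Σℚ.sum (λ k → P i k ℚ.* (toℚ (matrix S k l) ℚ.* toℚ (N l j))))                     ≡⟨ Σℚ.sum-cong-≗ (λ l → trans (Σℚ.sum-cong-≗ (λ k → sym (ℚ.*-assoc (P i k) (toℚ (matrix S k l)) (toℚ (N l j)))))
                                                                                                          (trans (sym (Σℚ.*-distribʳ-sum (toℚ (N l j)) (λ k → P i k ℚ.* toℚ (matrix S k l)))) (cong (ℚ._* toℚ (N l j)) (inverse-left S i l)))) ⟩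
    Σℚ.sum (λ l → Lℚ.identity i l ℚ.* toℚ (N l j))                                                   ≡⟨ Σ-identity i (λ l → toℚ (N l j)) ⟩
    toℚ (N i j)                                                                                      ∎
    where
    open ≡-Reasoning
    P = inverse S
    N : Mat ℤ d
    N i j = lookup (proj₁ (into (unit j))) i
    product : ∀ (A B : Mat ℤ d) k j → Σℚ.sum (λ l → toℚ (A k l) ℚ.* toℚ (B l j)) ≡ toℚ (Σℤ.sum (λ l → A k l ℤ.* B l j))
    product A B k j = sym (trans (toℚ-sum (λ l → A k l ℤ.* B l j)) (Σℚ.sum-cong-≗ (λ l → toℚ-* (A k l) (B l j))))
    integer-identity : ∀ k j → Σℤ.sum (λ l → matrix S k l ℤ.* N l j) ≡ Σℤ.sum (λ l → L k l ℤ.* matrix Q l j)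
    integer-identity k j = trans (sym (lookup∘tabulate _ k)) (trans (cong (λ v → lookup v k) (proj₂ (into (unit j)))) (trans (lookup∘tabulate _ k)
      (Σℤ.sum-cong-≗ (λ l → cong (L k l ℤ.*_) (trans (lookup∘tabulate _ l) (matrix-unit (matrix Q l) j))))))

  -- If S had the larger volume, the inverse of S and the matrix of Q would form a pair with
  -- determinant product vol(Q) / vol(S) < 1, excluded by coprimality. Consequently L₁Γ + L₂Γ never
  -- has larger index than Γ.
  coprime-volumes : ∀ {d} (L₁ L₂ : Mat ℤ d) → Coprime L₁ L₂ → (S Q : Triangular d) →
    (∀ c → Generates S (act L₁ (act (matrix Q) c))) → (∀ c → Generates S (act L₂ (act (matrix Q) c))) → volume S ℕ.≤ volume Q
  coprime-volumes L₁ L₂ coprime S Q into₁ into₂ with volume S ℕ.≤? volume Q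
  ... | yes le = le
  ... | no ≰ = ⊥-elim (coprime (inverse S , mapMat toℚ (matrix Q) , (mapMat toℚ (matrix S) , inverse-left S , inverse-right S) ,
      (inverse Q , inverse-right Q , inverse-left Q) , subst (0ℚ ℚ.<_) (sym abs≡) xy>0 , subst (ℚ._< 1ℚ) (sym abs≡) xy<1 ,
      conjugate-integral L₁ S Q into₁ , conjugate-integral L₂ S Q into₂))
    where
    x = Lℚ.det (inverse S)
    y = Lℚ.det (mapMat toℚ (matrix Q))
    s = toℚ (pos (volume S))
    q = toℚ (pos (volume Q))
    q>0 : 0ℚ ℚ.< q
    q>0 = toℚ-mono-< (volume≥1 Q)
    s>0 : 0ℚ ℚ.< s
    s>0 = toℚ-mono-< (volume≥1 S)
    x>0 : 0ℚ ℚ.< x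
    x>0 = ℚ.*-cancelʳ-<-nonNeg s {{ℚ.nonNegative (ℚ.<⇒≤ s>0)}} (subst₂ ℚ._<_ (sym (ℚ.*-zeroˡ s)) (sym (det-inverse S)) (toℚ-mono-< {0} {1} (s≤s z≤n)))
    xy≡ : x ℚ.* y ≡ x ℚ.* q
    xy≡ = cong (x ℚ.*_) (det-matrixℚ Q)
    xy>0 : 0ℚ ℚ.< x ℚ.* y
    xy>0 = subst₂ ℚ._<_ (ℚ.*-zeroʳ x) (sym xy≡) (ℚ.*-monoʳ-<-pos x {{ℚ.positive x>0}} q>0)
    xy<1 : x ℚ.* y ℚ.< 1ℚ
    xy<1 = subst₂ ℚ._<_ (sym xy≡) (det-inverse S) (ℚ.*-monoʳ-<-pos x {{ℚ.positive x>0}} (toℚ-mono-< (ℕ.≰⇒> ≰)))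
    abs≡ : ℚ.∣ x ℚ.* y ∣ ≡ x ℚ.* y
    abs≡ = ℚ.0≤p⇒∣p∣≡p (ℚ.<⇒≤ xy>0)

  ImageOf : ∀ {d} → (V d → V d) → (V d → Set) → V d → Set
  ImageOf f Γ v = ∃[ γ ] (Γ γ × v ≡ f γ)

  SumOf : ∀ {d} → (V d → V d) → (V d → V d) → (V d → Set) → V d → Set
  SumOf f g Γ v = ∃[ γ ] ∃[ γ′ ] (Γ γ × Γ γ′ × v ≡ f γ ⊕ g γ′)

  -- A quotient of indices: [ℤᵈ : L₁Γ] is at least |det L₁| [ℤᵈ : Γ], while [ℤᵈ : L₁Γ + L₂Γ] is at
  -- most [ℤᵈ : Γ] by coprimality. Adding representatives for the latter to `ρ` gives a list that
  -- covers everything modulo L₁Γ.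
  coprime-index : ∀ {d} (L₁ L₂ : Mat ℤ d) → Coprime L₁ L₂ → ScaledInverse (act L₁) → Injective (act L₁) →
    (Γ : V d → Set) → IsSubgroup Γ → Full Γ → IndexAtLeast (SumOf (act L₁) (act L₂) Γ) (ImageOf (act L₁) Γ) ∣ detℤ L₁ ∣
  coprime-index {d} L₁ L₂ coprime inverse₁ injective₁ Γ subΓ fullΓ@(M , M≥1 , full) ρ cov = finish (triangular-basis Γ subΓ fullΓ) (triangular-basis Γ⁺ subΓ⁺ fullΓ⁺)
    where
    open ScaledInverse inverse₁ using (inv; scale; scale≥1; f-inv)
    open IsSubgroup subΓ
    l₁ l₂ : V d → V d
    l₁ = act L₁
    l₂ = act L₂
    Γ⁺ Γ₁ : V d → Set
    Γ⁺ = SumOf l₁ l₂ Γ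
    Γ₁ = ImageOf l₁ Γ
    subΓ⁺ : IsSubgroup Γ⁺
    subΓ⁺ = record
      { 0∈ = 0v , 0v , 0∈ , 0∈ , sym (trans (cong₂ _⊕_ (additive-0 (act-+ L₁)) (additive-0 (act-+ L₂))) (⊕-identityʳ 0v))
      ; ⊕∈ = λ { (a , b , a∈ , b∈ , refl) (a′ , b′ , a′∈ , b′∈ , refl) → a ⊕ a′ , b ⊕ b′ , ⊕∈ a∈ a′∈ , ⊕∈ b∈ b′∈ ,
          trans (linear ((x₀ :+ x₁) :+ (x₂ :+ x₃)) ((x₀ :+ x₂) :+ (x₁ :+ x₃)) refl (l₁ a ∷ l₂ b ∷ l₁ a′ ∷ l₂ b′ ∷ [])) (sym (cong₂ _⊕_ (act-+ L₁ a a′) (act-+ L₂ b b′))) }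
      ; ⊝∈ = λ { (a , b , a∈ , b∈ , refl) → ⊝ a , ⊝ b , ⊝∈ a∈ , ⊝∈ b∈ ,
          trans (linear (:- (x₀ :+ x₁)) ((:- x₀) :+ (:- x₁)) refl (l₁ a ∷ l₂ b ∷ [])) (sym (cong₂ _⊕_ (additive-⊝ (act-+ L₁) a) (additive-⊝ (act-+ L₂) b))) } }
    fullΓ⁺ : Full Γ⁺
    fullΓ⁺ = M ℕ.* scale , ℕ.*-mono-≤ M≥1 scale≥1 , λ v → pos M ⋆ inv v , 0v , full (inv v) , 0∈ , (begin
      pos (M ℕ.* scale) ⋆ v              ≡⟨ trans (cong (_⋆ v) (ℤ.pos-* M scale)) (⋆-assoc (pos M) (pos scale) v) ⟩
      pos M ⋆ pos scale ⋆ v              ≡⟨ cong (pos M ⋆_) (f-inv v) ⟨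
      pos M ⋆ l₁ (inv v)                 ≡⟨ additive-⋆ (act-+ L₁) (pos M) (inv v) ⟨
      l₁ (pos M ⋆ inv v)                 ≡⟨ ⊕-identityʳ _ ⟨
      l₁ (pos M ⋆ inv v) ⊕ 0v            ≡⟨ cong (l₁ (pos M ⋆ inv v) ⊕_) (additive-0 (act-+ L₂)) ⟨
      l₁ (pos M ⋆ inv v) ⊕ l₂ 0v         ∎)
      where open ≡-Reasoning
    finish : Basis Γ → Basis Γ⁺ → ∣ detℤ L₁ ∣ ℕ.≤ card ρ
    finish (Q , toQ , fromQ) (S , toS , fromS) = ℕ.*-cancelˡ-≤ (volume S) {{ℕ.>-nonZero (volume≥1 S)}} (begin
      volume S ℕ.* ∣ detℤ L₁ ∣                      ≤⟨ ℕ.*-monoˡ-≤ ∣ detℤ L₁ ∣ (coprime-volumes L₁ L₂ coprime S Q into₁ into₂) ⟩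
      volume Q ℕ.* ∣ detℤ L₁ ∣                      ≡⟨ ℕ.*-comm (volume Q) _ ⟩
      ∣ detℤ L₁ ∣ ℕ.* volume Q                      ≤⟨ index-tower {G = Everything} {Image l₁} {Γ₁} everything-subgroup subImage (λ (γ , _ , e) → γ , e) (λ _ → tt) (image-index L₁) pulled ρ⁺ cov⁺ ⟩
      card ρ⁺                                       ≤⟨ card-≤-× _⊕_ (∈-cartesianProductWith⁻ _⊕_ (representatives S) ρ) ⟩
      card (representatives S) ℕ.* card ρ           ≤⟨ ℕ.*-monoˡ-≤ (card ρ) (card-representatives S) ⟩
      volume S ℕ.* card ρ                           ∎)
      where
      open ℕ.≤-Reasoning
      into₁ : ∀ c → Generates S (l₁ (act (matrix Q) c))
      into₁ c = toS _ (act (matrix Q) c , 0v , fromQ _ (c , refl) , 0∈ , trans (sym (⊕-identityʳ _)) (cong (l₁ (act (matrix Q) c) ⊕_) (sym (additive-0 (act-+ L₂)))))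
      into₂ : ∀ c → Generates S (l₂ (act (matrix Q) c))
      into₂ c = toS _ (0v , act (matrix Q) c , 0∈ , fromQ _ (c , refl) , trans (sym (⊕-identityˡ _)) (cong (_⊕ l₂ (act (matrix Q) c)) (sym (additive-0 (act-+ L₁)))))
      subImage : IsSubgroup (Image l₁)
      subImage = record
        { 0∈ = 0v , sym (additive-0 (act-+ L₁))
        ; ⊕∈ = λ { (a , refl) (b , refl) → a ⊕ b , sym (act-+ L₁ a b) }
        ; ⊝∈ = λ { (a , refl) → ⊝ a , sym (additive-⊝ (act-+ L₁) a) } }
      pulled : IndexAtLeast (Image l₁) Γ₁ (volume Q)
      pulled σ covσ = ℕ.≤-trans (volume-index Q (lmap φ σ) back) (card-surj φ (λ y∈ → let x , x∈ , e = ∈-map⁻ φ y∈ in x , x∈ , e))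
        where
        chosen = choice (λ (s w : V d) → s ≡ l₁ w) 0v
        φ = proj₁ chosen
        back : CoveredBy Everything (Generates Q) (lmap φ σ)
        back z _ with covσ (l₁ z) (z , refl)
        ... | s , s∈ , γ , γ∈ , e = φ s , ∈-map⁺ φ s∈ , toQ _ (subst Γ γ≡ γ∈)
          where
          s≡ : s ≡ l₁ (φ s)
          s≡ = proj₂ chosen s (z ⊖ γ) (trans (linear x₁ (x₀ :- (x₀ :- x₁)) refl (l₁ z ∷ s ∷ [])) (trans (cong (l₁ z ⊖_) e) (sym (additive-⊖ (act-+ L₁) z γ))))
          γ≡ : γ ≡ z ⊖ φ s
          γ≡ = injective⇒cancel (act-+ L₁) injective₁ (trans (sym e) (trans (cong (l₁ z ⊖_) s≡) (sym (additive-⊖ (act-+ L₁) z (φ s)))))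
      ρ⁺ : List (V d)
      ρ⁺ = cartesianProductWith _⊕_ (representatives S) ρ
      cov⁺ : CoveredBy Everything Γ₁ ρ⁺
      cov⁺ z _ with representatives-cover S z tt
      ... | s , s∈ , gen with cov (z ⊖ s) (fromS _ gen)
      ... | r , r∈ , γ = s ⊕ r , ∈-cartesianProductWith⁺ _⊕_ s∈ r∈ , subst Γ₁ (linear ((x₀ :- x₁) :- x₂) (x₀ :- (x₁ :+ x₂)) refl (z ∷ s ∷ r ∷ [])) γ

-- The lattice generated by differences and the classes it cuts out.

module DifferenceLattices (em : ∀ (P : Set) → Dec P) where
  open Counting
  open WithEM em
  open Vectors
  open Sumsets em
  open IntegerLinear
  open Lattices em
  open Coprimality em using (ImageOf; SumOf)
  open import Data.Nat.Base as ℕ using (ℕ; zero; suc; _≤_; _+_; _*_)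
  open import Data.Nat.Properties
  open import Data.Integer.Base as ℤ using (ℤ) renaming (+_ to pos)
  open import Data.List.Base using (List; []; _∷_; map; length)
  open import Data.List.Properties using (length-map)
  open import Data.List.Membership.Propositional.Properties
  open import Data.List.Relation.Unary.Any using (here)
  import Data.List.Relation.Unary.AllPairs as AllPairs
  open import Data.Vec.Base using ([]; _∷_)
  open import Data.Product.Base using (∃-syntax; _×_; _,_; proj₁; proj₂)
  open import Relation.Nullary using (no; ¬_)
  open import Relation.Binary.PropositionalEquality hiding ([_])
  open import Function.Base using (id)

  infix 4 _⊆_
  _⊆_ : ∀ {d} → List (V d) → List (V d) → Set
  X ⊆ Y = ∀ z → z ∈ X → z ∈ Y

  -- The subgroup Δ(X) generated by X - X; exchanging x and y provides the inverses.
  data Differences {d} (X : List (V d)) : V d → Set where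
    none : Differences X 0v
    more : ∀ {g x y} → Differences X g → x ∈ X → y ∈ X → Differences X (g ⊕ (x ⊖ y))

  module _ {d} {X : List (V d)} where

    private
      add : ∀ {u v} → Differences X u → Differences X v → Differences X (u ⊕ v)
      add {u} p none = subst (Differences X) (sym (⊕-identityʳ u)) p
      add {u} p (more {g} {x} {y} q x∈ y∈) = subst (Differences X) (⊕-assoc u g (x ⊖ y)) (more (add p q) x∈ y∈)

    single : ∀ {x y} → x ∈ X → y ∈ X → Differences X (x ⊖ y)
    single {x} {y} x∈ y∈ = subst (Differences X) (⊕-identityˡ (x ⊖ y)) (more none x∈ y∈)

    private
      negate : ∀ {u} → Differences X u → Differences X (⊝ u)
      negate none = subst (Differences X) (linear :0 (:- :0) refl []) none
      negate (more {g} {x} {y} q x∈ y∈) = subst (Differences X) (linear ((:- x₀) :+ (x₂ :- x₁)) (:- (x₀ :+ (x₁ :- x₂))) refl (g ∷ x ∷ y ∷ [])) (add (negate q) (single y∈ x∈))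

    differences-subgroup : IsSubgroup (Differences X)
    differences-subgroup = record { 0∈ = none ; ⊕∈ = add ; ⊝∈ = negate }

  differences-mono : ∀ {d} {X Y : List (V d)} → X ⊆ Y → ∀ {g} → Differences X g → Differences Y g
  differences-mono s none = none
  differences-mono s (more p x∈ y∈) = more (differences-mono s p) (s _ x∈) (s _ y∈)

  module Classes {d} (f g : V d → V d) (f-+ : Additive f) (g-+ : Additive g) (f-inj : Injective f) (g-inj : Injective g) where

    fX+gY : List (V d) → List (V d) → List (V d)
    fX+gY X Y = map f X ⊞ map g Y

    sumset-mono : ∀ {X X′ Y Y′} → X ⊆ X′ → Y ⊆ Y′ → ∀ {z} → z ∈ fX+gY X Y → z ∈ fX+gY X′ Y′
    sumset-mono {X} {X′} {Y} {Y′} p q = ⊞-mono {X = map f X} {map f X′} {map g Y} {map g Y′} (lift f p) (lift g q)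
      where
      lift : ∀ (h : V d → V d) {L L′} → L ⊆ L′ → ∀ {z} → z ∈ map h L → z ∈ map h L′
      lift h s z∈ with ∈-map⁻ h z∈
      ... | x , x∈ , refl = ∈-map⁺ h (s x x∈)

    ∈-sumset⁻ : ∀ {X Y z} → z ∈ fX+gY X Y → ∃[ x ] ∃[ y ] (x ∈ X × y ∈ Y × z ≡ f x ⊕ g y)
    ∈-sumset⁻ z∈ with ∈-⊞⁻ z∈
    ... | u , v , u∈ , v∈ , refl with ∈-map⁻ f u∈ | ∈-map⁻ g v∈
    ... | x , x∈ , refl | y , y∈ , refl = x , y , x∈ , y∈ , refl

    sumset≥ˡ : ∀ {X Y y} → y ∈ Y → card X ≤ card (fX+gY X Y)
    sumset≥ˡ {X} {Y} y∈ = ≤-trans (≤-reflexive (sym (card-map f (injective⇒cancel f-+ f-inj) X))) (card-⊞≥ˡ (map f X) (map g Y) (∈-map⁺ g y∈))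

    sumset≥ʳ : ∀ {X Y x} → x ∈ X → card Y ≤ card (fX+gY X Y)
    sumset≥ʳ {X} {Y} x∈ = ≤-trans (≤-reflexive (sym (card-map g (injective⇒cancel g-+ g-inj) Y))) (card-⊞≥ʳ (map f X) (map g Y) (∈-map⁺ f x∈))

    fΔ : List (V d) → V d → Set
    fΔ X = ImageOf f (Differences X)

    fΔ-subgroup : ∀ X → IsSubgroup (fΔ X)
    fΔ-subgroup X = record
      { 0∈ = 0v , none , sym (additive-0 f-+)
      ; ⊕∈ = λ { (a , a∈ , refl) (b , b∈ , refl) → a ⊕ b , IsSubgroup.⊕∈ differences-subgroup a∈ b∈ , sym (f-+ a b) }
      ; ⊝∈ = λ { (a , a∈ , refl) → ⊝ a , IsSubgroup.⊝∈ differences-subgroup a∈ , sym (additive-⊝ f-+ a) } }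

    fΔ-difference : ∀ {X x y} → x ∈ X → y ∈ X → fΔ X (f x ⊖ f y)
    fΔ-difference {X} {x} {y} x∈ y∈ = x ⊖ y , single x∈ y∈ , sym (additive-⊖ f-+ x y)

    fΔ-mono : ∀ {X Y} → X ⊆ Y → ∀ {v} → fΔ X v → fΔ Y v
    fΔ-mono s (a , a∈ , e) = a , differences-mono s a∈ , e

    -- The classes of g X modulo f Δ(X); `Swapped` later gives those of f X modulo g Δ(X).
    Same : List (V d) → V d → V d → Set
    Same X x y = fΔ X (g x ⊖ g y)

    Same-refl : ∀ {X x} → Same X x x
    Same-refl {X} {x} = subst (fΔ X) (linear :0 (x₀ :- x₀) refl (g x ∷ [])) (IsSubgroup.0∈ (fΔ-subgroup X))

    Same-sym : ∀ {X x y} → Same X x y → Same X y x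
    Same-sym {X} {x} {y} p = subst (fΔ X) (linear (:- (x₀ :- x₁)) (x₁ :- x₀) refl (g x ∷ g y ∷ [])) (IsSubgroup.⊝∈ (fΔ-subgroup X) p)

    Same-trans : ∀ {X x y z} → Same X x y → Same X y z → Same X x z
    Same-trans {X} {x} {y} {z} p q = subst (fΔ X) (linear ((x₀ :- x₁) :+ (x₁ :- x₂)) (x₀ :- x₂) refl (g x ∷ g y ∷ g z ∷ [])) (IsSubgroup.⊕∈ (fΔ-subgroup X) p q)

    classes : ∀ X → Transversal (Same X) X
    classes X = transversal (Same X) (λ {x} → Same-refl {X} {x}) (λ {x} {y} → Same-sym {X} {x} {y}) X

    reps : List (V d) → List (V d)
    reps X = Transversal.reps (classes X)

    class rest : List (V d) → V d → List (V d)
    class X r = sub (λ y → Same X y r) X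
    rest X r = sub (λ y → ¬ Same X y r) X

    class⊆ : ∀ X r → class X r ⊆ X
    class⊆ X r z z∈ = proj₁ (∈-sub⁻ (λ y → Same X y r) {X} z∈)

    rest⊆ : ∀ X r → rest X r ⊆ X
    rest⊆ X r z z∈ = proj₁ (∈-sub⁻ (λ y → ¬ Same X y r) {X} z∈)

    class∋ : ∀ {X r} → r ∈ X → r ∈ class X r
    class∋ {X} {r} r∈ = ∈-sub⁺ (λ y → Same X y r) r∈ (Same-refl {X} {r})

    class-Same : ∀ {X r y} → y ∈ class X r → Same X y r
    class-Same {X} {r} y∈ = proj₂ (∈-sub⁻ (λ y → Same X y r) {X} y∈)

    card-class-rest : ∀ X r → card X ≡ card (class X r) + card (rest X r)
    card-class-rest X r = card-sub (λ y → Same X y r) X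

    -- All elements of f X are congruent modulo f Δ(X), so the coset of f x + g y determines that of
    -- g y.
    separated-sums : ∀ {X Y Y′} → (∀ {y y′} → y ∈ Y → y′ ∈ Y′ → ¬ Same X y y′) → Disjoint (fX+gY X Y) (fX+gY X Y′)
    separated-sums {X} apart p q with ∈-sumset⁻ p | ∈-sumset⁻ q
    ... | x , y , x∈ , y∈ , refl | x′ , y′ , x′∈ , y′∈ , e = apart y∈ y′∈ (subst (fΔ X) eq (fΔ-difference x′∈ x∈))
      where
      eq : f x′ ⊖ f x ≡ g y ⊖ g y′
      eq = trans (linear (x₀ :- x₁) (((x₀ :+ x₂) :- x₁) :- x₂) refl (f x′ ∷ f x ∷ g y′ ∷ [])) (trans (cong (λ z → (z ⊖ f x) ⊖ g y′) (sym e))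
        (linear (((x₀ :+ x₁) :- x₀) :- x₂) (x₁ :- x₂) refl (f x ∷ g y ∷ g y′ ∷ [])))

    split-sumset : ∀ X r → card (fX+gY X (class X r)) + card (fX+gY X (rest X r)) ≤ card (fX+gY X X)
    split-sumset X r = card-disjoint (fX+gY X (class X r)) (fX+gY X (rest X r))
      (separated-sums {X} (λ {y} {y′} y∈ y′∈ same → proj₂ (∈-sub⁻ (λ y → ¬ Same X y r) {X} y′∈) (Same-trans {X} {y′} {y} {r} (Same-sym {X} {y} {y′} same) (class-Same {X} y∈))))
      (sumset-mono {X} {X} (λ _ → id) (class⊆ X r)) (sumset-mono {X} {X} (λ _ → id) (rest⊆ X r))

    classes-sumset : ∀ X Y → X ⊆ Y → Σcard (λ r → fX+gY X (class Y r)) (reps Y) ≤ card (fX+gY X Y)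
    classes-sumset X Y X⊆Y = Σcard-≤ (λ r → fX+gY X (class Y r)) (reps Y) (AllPairs.map apart (Transversal.separate (classes Y)))
      (λ {r} _ → sumset-mono {X} {X} (λ _ → id) (class⊆ Y r))
      where
      apart : ∀ {r r′} → ¬ Same Y r r′ → Disjoint (fX+gY X (class Y r)) (fX+gY X (class Y r′))
      apart {r} {r′} n z∈ z∈′ = separated-sums {Y} {class Y r} {class Y r′}
        (λ {y} {y′} y∈ y′∈ same → n (Same-trans {Y} {r} {y} {r′} (Same-sym {Y} {y} {r} (class-Same {Y} y∈)) (Same-trans {Y} {y} {y′} {r′} same (class-Same {Y} y′∈))))
        (sumset-mono X⊆Y (λ _ → id) z∈) (sumset-mono X⊆Y (λ _ → id) z∈′)

    card≤classes : ∀ X → card X ≤ Σcard (class X) (reps X)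
    card≤classes X = Σcard-≥ (class X) (reps X) λ z∈ → let r , r∈ , same = Transversal.covers (classes X) z∈ in r , r∈ , ∈-sub⁺ (λ y → Same X y r) z∈ same

    largest-class : ∀ X {x} → x ∈ X → ∃[ r ] (r ∈ X × card X ≤ length (reps X) * card (class X r))
    largest-class X x∈ with Transversal.covers (classes X) x∈
    ... | r₀ , r₀∈ , _ with argmax (λ r → card (class X r)) (reps X) r₀∈
    ... | r , r∈ , max = r , Transversal.reps⊆ (classes X) r∈ , ≤-trans (card≤classes X) (sum-map-≤ (λ r → card (class X r)) (card (class X r)) (reps X) max)

    -- The modulus f Δ(C) is finer than f Δ(X). If every g x is congruent to an element of g C
    -- modulo the finer one, then different classes of X lead to different classes of C.
    meets⇒many : ∀ {X C} → C ⊆ X → (∀ {x} → x ∈ X → ∃[ c ] (c ∈ C × fΔ C (g x ⊖ g c))) → length (reps X) ≤ length (reps C)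
    meets⇒many {X} {C} C⊆X meets = pigeonhole (λ r r′ → ¬ Same X r r′) (λ r s → fΔ C (g r ⊖ g s)) (reps X) (reps C) (Transversal.separate (classes X)) total inj
      where
      total : ∀ {r} → r ∈ reps X → ∃[ s ] (s ∈ reps C × fΔ C (g r ⊖ g s))
      total {r} r∈ with meets (Transversal.reps⊆ (classes X) r∈)
      ... | c , c∈ , p with Transversal.covers (classes C) c∈
      ... | s , s∈ , q = s , s∈ , Same-trans {C} {r} {c} {s} p q
      inj : ∀ {r r′ s} → fΔ C (g r ⊖ g s) → fΔ C (g r′ ⊖ g s) → ¬ ¬ Same X r r′
      inj {r} {r′} {s} p q n = n (fΔ-mono C⊆X (Same-trans {C} {r} {s} {r′} p (Same-sym {C} {r′} {s} q)))

    -- As no coset of f Δ(C) is gained, the classes of C are a full coset of f Δ(X), hence of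
    -- f Δ(C) + g Δ(C).
    saturated : ∀ {X} c₀ → let C = class X c₀ in c₀ ∈ X → Full (Differences C) →
      (∀ {x b} → x ∈ X → b ∈ C → ∃[ b′ ] (b′ ∈ C × fΔ C ((f x ⊕ g b) ⊖ (f c₀ ⊕ g b′)))) →
      ∀ {m} → IndexAtLeast (SumOf f g (Differences C)) (fΔ C) m → m ≤ length (reps C)
    saturated {X} c₀ c₀∈X (M , M≥1 , full) closed {m} index = ≤-trans (index ρ covered) (≤-trans (card≤length ρ) (≤-reflexive (length-map (λ r → g r ⊖ g c₀) (reps C))))
      where
      C = class X c₀
      module F = IsSubgroup (fΔ-subgroup C)
      ρ = map (λ r → g r ⊖ g c₀) (reps C)
      -- Translation by f v maps the set of cosets of f Δ(C) met by g C into itself.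
      Shifts : V d → Set
      Shifts v = ∀ b → b ∈ C → ∃[ b′ ] (b′ ∈ C × fΔ C ((f v ⊕ g b) ⊖ g b′))
      shifts-Δ : ∀ {v} → Differences C v → Shifts v
      shifts-Δ {v} v∈ b b∈ = b , b∈ , v , v∈ , linear ((x₀ :+ x₁) :- x₁) x₀ refl (f v ∷ g b ∷ [])
      shifts-⊕ : ∀ {u v} → Shifts u → Shifts v → Shifts (u ⊕ v)
      shifts-⊕ {u} {v} p q b b∈ with p b b∈
      ... | b′ , b′∈ , s with q b′ b′∈
      ... | b″ , b″∈ , t = b″ , b″∈ , subst (fΔ C) (trans (linear (((x₀ :+ x₁) :- x₂) :+ ((x₃ :+ x₂) :- x₄)) (((x₀ :+ x₃) :+ x₁) :- x₄) refl (f u ∷ g b ∷ g b′ ∷ f v ∷ g b″ ∷ []))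
        (cong (λ z → (z ⊕ g b) ⊖ g b″) (sym (f-+ u v)))) (F.⊕∈ s t)
      shifts-⋆ : ∀ n {v} → Shifts v → Shifts (pos n ⋆ v)
      shifts-⋆ zero {v} p = subst Shifts (sym (0⋆ v)) (shifts-Δ none)
      shifts-⋆ (suc n) {v} p = subst Shifts (sym (trans (⋆-distribʳ (pos 1) (pos n) v) (cong (_⊕ pos n ⋆ v) (1⋆ v)))) (shifts-⊕ p (shifts-⋆ n p))
      shifts-x : ∀ {x} → x ∈ X → Shifts (x ⊖ c₀)
      shifts-x {x} x∈ b b∈ with closed x∈ b∈
      ... | b′ , b′∈ , p = b′ , b′∈ , subst (fΔ C) (trans (linear ((x₀ :+ x₁) :- (x₂ :+ x₃)) (((x₀ :- x₂) :+ x₁) :- x₃) refl (f x ∷ g b ∷ f c₀ ∷ g b′ ∷ []))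
        (cong (λ z → (z ⊕ g b) ⊖ g b′) (sym (additive-⊖ f-+ x c₀)))) p
      -- Full rank makes -v accessible: M v lies in Δ(C), and -v = (M - 1) v - M v.
      shifts-⊝ : ∀ {v} → Shifts v → Shifts (⊝ v)
      shifts-⊝ {v} p = subst Shifts eq (shifts-⊕ (shifts-⋆ (ℕ.pred M) p) (shifts-Δ (IsSubgroup.⊝∈ differences-subgroup (full v))))
        where
        eq : pos (ℕ.pred M) ⋆ v ⊖ pos M ⋆ v ≡ ⊝ v
        eq = trans (cong (λ n → pos (ℕ.pred M) ⋆ v ⊖ pos n ⋆ v) (sym (suc-pred M {{ℕ.>-nonZero M≥1}}))) (trans (cong (λ z → pos (ℕ.pred M) ⋆ v ⊖ z) (⋆-distribʳ (pos 1) (pos (ℕ.pred M)) v))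
          (trans (linear (x₁ :- (x₀ :+ x₁)) (:- x₀) refl (pos 1 ⋆ v ∷ pos (ℕ.pred M) ⋆ v ∷ [])) (cong ⊝_ (1⋆ v))))
      shifts-X : ∀ {v} → Differences X v → Shifts v
      shifts-X none = shifts-Δ none
      shifts-X (more {u} {x} {y} p x∈ y∈) = subst Shifts (linear (x₀ :+ ((x₁ :- x₃) :+ (:- (x₂ :- x₃)))) (x₀ :+ (x₁ :- x₂)) refl (u ∷ x ∷ y ∷ c₀ ∷ []))
        (shifts-⊕ (shifts-X p) (shifts-⊕ (shifts-x x∈) (shifts-⊝ (shifts-x y∈))))
      -- C is a single class modulo f Δ(X), so g maps its differences into f Δ(X).
      g-into : ∀ {v} → Differences C v → fΔ X (g v)
      g-into none = subst (fΔ X) (sym (additive-0 g-+)) (IsSubgroup.0∈ (fΔ-subgroup X))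
      g-into (more {u} {x} {y} p x∈ y∈) = subst (fΔ X) (sym (trans (g-+ u (x ⊖ y)) (cong (g u ⊕_) (additive-⊖ g-+ x y))))
        (IsSubgroup.⊕∈ (fΔ-subgroup X) (g-into p) (Same-trans {X} {x} {c₀} {y} (class-Same {X} x∈) (Same-sym {X} {y} {c₀} (class-Same {X} y∈))))
      -- For γ′ in Δ(C) write g γ′ = f δ with δ in Δ(X), then translate g c₀ by f (γ + δ); the coset
      -- reached is again met by g C.
      covered : CoveredBy (SumOf f g (Differences C)) (fΔ C) ρ
      covered z (γ , γ′ , γ∈ , γ′∈ , refl) with g-into γ′∈
      ... | δ , δ∈ , gγ′≡ with shifts-X (IsSubgroup.⊕∈ differences-subgroup (differences-mono (class⊆ X c₀) γ∈) δ∈) c₀ (class∋ c₀∈X)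
      ... | b′ , b′∈ , p with Transversal.covers (classes C) b′∈
      ... | r , r∈ , q = g r ⊖ g c₀ , ∈-map⁺ (λ r → g r ⊖ g c₀) r∈ , subst (fΔ C) eq (F.⊕∈ p q)
        where
        eq : ((f (γ ⊕ δ) ⊕ g c₀) ⊖ g b′) ⊕ (g b′ ⊖ g r) ≡ (f γ ⊕ g γ′) ⊖ (g r ⊖ g c₀)
        eq = trans (cong (λ z → ((z ⊕ g c₀) ⊖ g b′) ⊕ (g b′ ⊖ g r)) (trans (f-+ γ δ) (cong (f γ ⊕_) (sym gγ′≡))))
          (linear (((x₀ :+ x₁) :- x₂) :+ (x₂ :- x₃)) (x₀ :- (x₃ :- x₁)) refl (f γ ⊕ g γ′ ∷ g c₀ ∷ g b′ ∷ g r ∷ []))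

    -- Modulo f Δ(C) every f c agrees with f c₀, so the coset of f x + g b is missed by all of f C +
    -- g C; yet it contains f x plus g of the whole class of b.
    new-translate : ∀ {X C} → C ⊆ X → ∀ {x b c₀} → x ∈ X → b ∈ C → c₀ ∈ C →
      (∀ b′ → b′ ∈ C → ¬ fΔ C ((f x ⊕ g b) ⊖ (f c₀ ⊕ g b′))) → card (fX+gY C C) + card (class C b) ≤ card (fX+gY X C)
    new-translate {X} {C} C⊆X {x} {b} {c₀} x∈ b∈ c₀∈ new = ≤-trans (+-monoʳ-≤ (card (fX+gY C C)) (sumset≥ʳ {x ∷ []} {class C b} (here refl)))
      (card-disjoint (fX+gY C C) (fX+gY (x ∷ []) (class C b)) disjoint (sumset-mono C⊆X (λ _ → id))
        (sumset-mono {x ∷ []} {X} (λ { _ (here refl) → x∈ }) (class⊆ C b)))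
      where
      disjoint : Disjoint (fX+gY C C) (fX+gY (x ∷ []) (class C b))
      disjoint p q with ∈-sumset⁻ p | ∈-sumset⁻ {x ∷ []} q
      ... | c , b′ , c∈ , b′∈ , refl | _ , y , here refl , y∈ , e = new b′ b′∈ (subst (fΔ C) eq
          (IsSubgroup.⊖∈ (fΔ-subgroup C) (fΔ-difference c∈ c₀∈) (class-Same {C} y∈)))
        where
        eq : (f c ⊖ f c₀) ⊖ (g y ⊖ g b) ≡ (f x ⊕ g b) ⊖ (f c₀ ⊕ g b′)
        eq = trans (linear ((x₀ :- x₁) :- (x₂ :- x₃)) ((((x₀ :+ x₄) :- x₂) :+ x₃) :- (x₁ :+ x₄)) refl (f c ∷ f c₀ ∷ g y ∷ g b ∷ g b′ ∷ []))
          (trans (cong (λ z → ((z ⊖ g y) ⊕ g b) ⊖ (f c₀ ⊕ g b′)) e) (linear ((((x₀ :+ x₂) :- x₂) :+ x₃) :- (x₁ :+ x₄)) ((x₀ :+ x₃) :- (x₁ :+ x₄)) refl (f x ∷ f c₀ ∷ g y ∷ g b ∷ g b′ ∷ [])))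

    -- Modulo g Δ(C) all elements of g C agree, so a common point of f x + g C and f C + g C would
    -- make f x congruent to some f c.
    new-coset : ∀ {X C} → C ⊆ X → ∀ {x c₀} → x ∈ X → c₀ ∈ C → (∀ c → c ∈ C → ¬ ImageOf g (Differences C) (f x ⊖ f c)) →
      card (fX+gY C C) + card C ≤ card (fX+gY X C)
    new-coset {X} {C} C⊆X {x} x∈ c₀∈ new = ≤-trans (+-monoʳ-≤ (card (fX+gY C C)) (sumset≥ʳ {x ∷ []} {C} (here refl)))
      (card-disjoint (fX+gY C C) (fX+gY (x ∷ []) C) disjoint (sumset-mono C⊆X (λ _ → id)) (sumset-mono {x ∷ []} {X} (λ { _ (here refl) → x∈ }) (λ _ → id)))
      where
      disjoint : Disjoint (fX+gY C C) (fX+gY (x ∷ []) C)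
      disjoint p q with ∈-sumset⁻ p | ∈-sumset⁻ {x ∷ []} q
      ... | c , b , c∈ , b∈ , refl | _ , y , here refl , y∈ , e = new c c∈ (b ⊖ y , single b∈ y∈ , trans
        (linear (x₀ :- x₁) (((x₀ :+ x₂) :- x₁) :- x₂) refl (f x ∷ f c ∷ g y ∷ [])) (trans (cong (λ z → (z ⊖ f c) ⊖ g y) (sym e))
          (trans (linear (((x₀ :+ x₁) :- x₀) :- x₂) (x₁ :- x₂) refl (f c ∷ g b ∷ g y ∷ [])) (sym (additive-⊖ g-+ b y)))))

-- The induction step: unequal or missing classes yield a surplus.

module Gains {ℓ} (R : CompleteOrderedField ℓ) where
  open Reals R hiding (total)
  open Reals R using () renaming (total to ≤-total)
  open BrunnMinkowski R using (nthRoot; nthRoot-nonNeg; nthRoot-suc)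
  open Counting
  open WithEM em
  open Vectors using (V; ⊕-comm)
  open Sumsets em
  open IntegerLinear using (Additive; Injective)
  open Lattices em using (Full; IndexAtLeast)
  open Coprimality em using (ImageOf; SumOf)
  open DifferenceLattices em
  open import Data.Nat.Base as ℕ using (ℕ; zero; suc; s≤s; z≤n)
  import Data.Nat.Properties as ℕ
  open import Data.List.Base using (List; []; _∷_; map; length; cartesianProduct)
  open import Data.List.Properties using (map-cong)
  open import Data.List.Membership.Propositional.Properties
  open import Data.List.Relation.Unary.Any using (here; there)
  open import Data.Product.Base using (∃-syntax; _×_; _,_; proj₁; proj₂)
  open import Data.Sum.Base using (_⊎_; inj₁; inj₂)
  open import Data.Empty using (⊥-elim)
  open import Relation.Nullary using (yes; no; ¬_)
  import Relation.Binary.PropositionalEquality as ≡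
  open ≡ using (_≡_)
  open import Function.Base using (_∘_; id)

  by-cases : ∀ {p q} {P : Set p} {Q : Set q} → Dec P → (P → Q) → (¬ P → Q) → Q
  by-cases (yes p) f g = f p
  by-cases (no ¬p) f g = g ¬p

  -- Convexity: adding β raises the power at least as much at x as at the smaller α.
  power-increment : ∀ {α β x} n → 0# ≤ α → 0# ≤ β → α ≤ x → (α + β) ^ n + x ^ n ≤ (x + β) ^ n + α ^ n
  power-increment zero _ _ _ = ≤-refl
  power-increment {α} {β} {x} (suc n) 0≤α 0≤β α≤x = ≤-by
    (((x - α) * (u - v)) + (α * ((u + z) - (w + v))) + β * (u - w))
    (+-nonNeg (+-nonNeg (*-nonNegative (difference α≤x) (difference (^-mono-≤ n 0≤x (≤-by β 0≤β ≈-refl))))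
      (*-nonNegative 0≤α (difference (power-increment n 0≤α 0≤β α≤x)))) (*-nonNegative 0≤β (difference (^-mono-≤ n (+-nonNeg 0≤α 0≤β) (+-monoˡ-≤ β α≤x)))))
    (solve 7 (λ a b x u v w z → (x :+ b) :* u :+ a :* z := ((a :+ b) :* w :+ x :* v) :+ (((x :- a) :* (u :- v)) :+ (a :* ((u :+ z) :- (w :+ v))) :+ b :* (u :- w))) ≡.refl α β x u v w z)
    where
    0≤x = ≤-trans 0≤α α≤x
    u = (x + β) ^ n
    v = x ^ n
    w = (α + β) ^ n
    z = α ^ n

  -- Exactly m members of the list are credited with the gain c - t; the others contribute only
  -- `a l` ≤ `s l`. So the list may be longer than m even when c - t is positive or negative.
  sum-gain : {I : Set} (a s : I → ℕ) (c t : ℝ) (L : List I) (m : ℕ) → m ℕ.≤ length L → (∀ {l} → l ∈ L → c + fromℕ (a l) ≤ fromℕ (s l) + t) →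
    (∀ {l} → l ∈ L → a l ℕ.≤ s l) → fromℕ m * c + fromℕ (sum (map a L)) ≤ fromℕ (sum (map s L)) + fromℕ m * t
  sum-gain a s c t L zero _ _ a≤s = ≤-respˡ (≈-sym (≈-trans (+-congʳ (zeroˡ c)) (+-identityˡ _))) (≤-respʳ (≈-sym (≈-trans (+-congˡ (zeroˡ t)) (+-identityʳ _))) (fromℕ-mono (sums L a≤s)))
    where
    sums : ∀ L → (∀ {l} → l ∈ L → a l ℕ.≤ s l) → sum (map a L) ℕ.≤ sum (map s L)
    sums [] _ = z≤n
    sums (l ∷ L) p = ℕ.+-mono-≤ (p (here ≡.refl)) (sums L (p ∘ there))
  sum-gain a s c t (l ∷ L) (suc m) (s≤s m≤) gain a≤s = ≤-respˡ (≈-sym left) (≤-respʳ (≈-sym right)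
    (+-mono-≤ (gain (here ≡.refl)) (sum-gain a s c t L m m≤ (gain ∘ there) (a≤s ∘ there))))
    where
    left : fromℕ (suc m) * c + fromℕ (sum (map a (l ∷ L))) ≈ (c + fromℕ (a l)) + (fromℕ m * c + fromℕ (sum (map a L)))
    left = ≈-trans (+-congˡ (fromℕ-+ (a l) (sum (map a L)))) (solve 4 (λ m c x y → (:1 :+ m) :* c :+ (x :+ y) := (c :+ x) :+ (m :* c :+ y)) ≡.refl (fromℕ m) c (fromℕ (a l)) (fromℕ (sum (map a L))))
    right : fromℕ (sum (map s (l ∷ L))) + fromℕ (suc m) * t ≈ (fromℕ (s l) + t) + (fromℕ (sum (map s L)) + fromℕ m * t)
    right = ≈-trans (+-congʳ (fromℕ-+ (s l) (sum (map s L)))) (solve 4 (λ m t x y → (x :+ y) :+ (:1 :+ m) :* t := (x :+ t) :+ (y :+ m :* t)) ≡.refl (fromℕ m) t (fromℕ (s l)) (fromℕ (sum (map s L))))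

  sumset-comm : ∀ {d} (f g : V d → V d) X Y → card (map f X ⊞ map g Y) ≡ card (map g Y ⊞ map f X)
  sumset-comm f g X Y = ℕ.≤-antisym (card-⊆ (swap (map f X) (map g Y))) (card-⊆ (swap (map g Y) (map f X)))
    where
    swap : ∀ A B {z} → z ∈ A ⊞ B → z ∈ B ⊞ A
    swap A B z∈ with ∈-⊞⁻ z∈
    ... | a , b , a∈ , b∈ , ≡.refl = ≡.subst (_∈ B ⊞ A) (⊕-comm b a) (∈-⊞⁺ b∈ a∈)

  -- H times `gain` plus `direct` eliminates b; division by 1 + H leaves the surplus κ e. The
  -- estimate `direct` is good when the smallest class is large, `gain` when it is small.
  balance : ∀ {H κ err s e p b M n} → 0# ≤ H → 0# ≤ err → n ≤ M → (1# + H) * κ ≈ 1# →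
    H * b ≤ s + M * err → H * p + p ≤ s + (n * err + (e + b)) → H * p + κ * e ≤ s + (e + M * err)
  balance {H} {κ} {err} {s} {e} {p} {b} {M} {n} 0≤H 0≤err n≤M κ-inverse direct gain = *-cancelˡ-≤ (1# + H) (<-≤-trans 0<1 (≤-by H 0≤H ≈-refl)) (≤-by
    (H * (s + (n * err + (e + b)) - (H * p + p)) + (s + M * err - H * b) + (H * err) * (M - n))
    (+-nonNeg (+-nonNeg (*-nonNegative 0≤H (difference gain)) (difference direct)) (*-nonNegative (*-nonNegative 0≤H 0≤err) (difference n≤M)))
    (≈-trans (solve 8 (λ h s e er mm n p mb → (:1 :+ h) :* (s :+ (e :+ mm :* er)) :=
          ((:1 :+ h) :* (h :* p) :+ e) :+ (h :* ((s :+ (n :* er :+ (e :+ mb))) :- (h :* p :+ p)) :+ ((s :+ mm :* er) :- h :* mb) :+ (h :* er) :* (mm :- n))) ≡.refl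
          H s e err M n p b)
      (+-congʳ (≈-trans (+-congˡ (≈-sym (≈-trans (*-congʳ κ-inverse) (*-identityˡ e)))) (solve 4 (λ h p κ e → (:1 :+ h) :* (h :* p) :+ ((:1 :+ h) :* κ) :* e := (:1 :+ h) :* (h :* p :+ κ :* e)) ≡.refl H p κ e)))))

  remove-class : ∀ {H n c a er s s₀ s₁ e b r p m} → n * c ≈ H * b → n * a ≈ m → p ≈ b + r →
    n * c + p ≤ s₀ + n * (er + a) → H * r ≤ s₁ + e → s₀ + s₁ ≤ s → H * p + p ≤ s + (n * er + (e + m))
  remove-class {H} {n} {c} {a} {er} {s} {s₀} {s₁} {e} {b} {r} {p} {m} nc≈ na≈ p≈ le₀ le₁ le = ≤-by
    ((s₀ + n * (er + a) - (n * c + p)) + ((s₁ + e) - H * r) + (s - (s₀ + s₁)))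
    (+-nonNeg (+-nonNeg (difference le₀) (difference le₁)) (difference le))
    (≈-trans (+-congˡ (+-congˡ (+-congˡ (≈-sym na≈))))
      (≈-trans (solve 9 (λ s s₀ s₁ n er e a c p → s :+ (n :* er :+ (e :+ n :* a)) :=
          (n :* c :+ p) :+ (((s₀ :+ n :* (er :+ a)) :- (n :* c :+ p)) :+ (s₁ :+ e) :+ (s :- (s₀ :+ s₁)))) ≡.refl s s₀ s₁ n er e a c p)
        (≈-trans (+-congʳ (+-congʳ nc≈)) (≈-trans (solve 7 (λ h b r p x y z → (h :* b :+ p) :+ (x :+ y :+ z) := (h :* (b :+ r) :+ p) :+ (x :+ (y :- h :* r) :+ z)) ≡.refl
            H b r p (s₀ + n * (er + a) - (n * c + p)) (s₁ + e) (s - (s₀ + s₁)))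
          (+-congʳ (+-congʳ (*-congˡ (≈-sym p≈))))))))

  add-rest : ∀ {H c t x w u e s s₀ s₁} → x ≈ c + t → H * c + w ≤ s₀ + u → H * t ≤ s₁ + e → s₀ + s₁ ≤ s → H * x + w ≤ s + (u + e)
  add-rest {H} {c} {t} {x} {w} {u} {e} {s} {s₀} {s₁} x≈ le₀ le₁ le = ≤-by ((s₀ + u - (H * c + w)) + ((s₁ + e) - H * t) + (s - (s₀ + s₁)))
    (+-nonNeg (+-nonNeg (difference le₀) (difference le₁)) (difference le))
    (≈-trans (solve 9 (λ s s₀ s₁ u e h c t w → s :+ (u :+ e) := (h :* (c :+ t) :+ w) :+ (((s₀ :+ u) :- (h :* c :+ w)) :+ ((s₁ :+ e) :- h :* t) :+ (s :- (s₀ :+ s₁)))) ≡.refl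
        s s₀ s₁ u e H c t w)
      (+-congʳ (+-congʳ (*-congˡ (≈-sym x≈)))))

  coset-gain : ∀ {H κ c e n u} → 0# ≤ c → κ ≤ 1# → H * c ≤ n + e → n + c ≤ u → H * c + κ * c ≤ u + e
  coset-gain {H} {κ} {c} {e} {n} {u} 0≤c κ≤1 ih le = ≤-trans (+-mono-≤ ih (≤-respʳ (*-identityˡ c) (*-monoʳ-≤ c 0≤c κ≤1)))
    (≤-respˡ (solve 3 (λ a b e → (a :+ b) :+ e := (a :+ e) :+ b) ≡.refl n c e) (+-monoˡ-≤ e le))

  -- Here t is the size of the class K whose translate is new, and w that of the rest of C. A large
  -- K gains by its translate; a small one gains because f C + g K still has at least |C| elements.
  -- Adding H times the first estimate to the second gives κ c in every case.
  translate-gain : ∀ {H κ c t w e u n n′} → 0# ≤ H → (1# + H) * κ ≈ 1# → c ≈ t + w → 0# ≤ t →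
    H * c ≤ n + e → n + t ≤ u → c + n′ ≤ n → H * w ≤ n′ + e → H * c + κ * c ≤ u + e
  translate-gain {H} {κ} {c} {t} {w} {e} {u} {n} {n′} 0≤H κ-inverse c≈ 0≤t ih le le′ ih′ = *-cancelˡ-≤ (1# + H) (<-≤-trans 0<1 (≤-by H 0≤H ≈-refl)) (≤-by
    (H * ((n + e - H * c) + (u - (n + t))) + ((n - (c + n′)) + (n′ + e - H * w) + (u - (n + t)) + t))
    (+-nonNeg (*-nonNegative 0≤H (+-nonNeg (difference ih) (difference le))) (+-nonNeg (+-nonNeg (+-nonNeg (difference le′) (difference ih′)) (difference le)) 0≤t))
    (≈-trans (solve 7 (λ h u e c w n n′ → (:1 :+ h) :* (u :+ e) := ((:1 :+ h) :* (h :* c) :+ c) :+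
        (h :* ((n :+ e :- h :* c) :+ (u :- (n :+ (c :- w)))) :+ ((n :- (c :+ n′)) :+ (n′ :+ e :- h :* w) :+ (u :- (n :+ (c :- w))) :+ (c :- w)))) ≡.refl H u e c w n n′)
      (+-cong (≈-trans (+-congˡ (≈-sym (≈-trans (*-congʳ κ-inverse) (*-identityˡ c)))) (solve 3 (λ h k c → (:1 :+ h) :* (h :* c) :+ ((:1 :+ h) :* k) :* c := (:1 :+ h) :* (h :* c :+ k :* c)) ≡.refl H κ c))
        (+-cong (*-congˡ (+-congˡ (+-congˡ (-‿cong (+-congˡ t≈))))) (+-cong (+-congˡ (+-congˡ (-‿cong (+-congˡ t≈)))) t≈)))))
    where
    t≈ : c - w ≈ t
    t≈ = ≈-trans (+-congʳ c≈) (solve 2 (λ t w → (t :+ w) :- w := t) ≡.refl t w)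

  all-blocks : ∀ {m n ν s : ℕ} {c H b err} → fromℕ n * c ≈ H * b → c ≤ fromℕ ν + err → fromℕ (m ℕ.* n ℕ.* ν) ≤ fromℕ s →
    H * (fromℕ m * b) ≤ fromℕ s + fromℕ (m ℕ.* n) * err
  all-blocks {m} {n} {ν} {s} {c} {H} {b} {err} nc≈ le large = ≤-respˡ left (≤-trans (*-monoˡ-≤ (fromℕ (m ℕ.* n)) (fromℕ-nonNeg (m ℕ.* n)) le)
    (≤-respˡ (≈-sym (distribˡ (fromℕ (m ℕ.* n)) (fromℕ ν) err)) (+-monoˡ-≤ (fromℕ (m ℕ.* n) * err) (≤-respˡ (fromℕ-* (m ℕ.* n) ν) large))))
    where
    left : fromℕ (m ℕ.* n) * c ≈ H * (fromℕ m * b)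
    left = ≈-trans (*-congʳ (fromℕ-* m n)) (≈-trans (*-assoc (fromℕ m) (fromℕ n) c) (≈-trans (*-congˡ nc≈)
      (solve 3 (λ m h b → m :* (h :* b) := h :* (m :* b)) ≡.refl (fromℕ m) H b)))

  -- Arranged to be symmetric in f and g, apart from `index`, which `swap` receives anew, so that
  -- each argument serves both matrices. `err` is the additive error of Brunn-Minkowski for parts of
  -- A; `E` is the error granted by the induction.
  record Setup (k : ℕ) : Set ℓ where
    field
      f g         : V (suc k) → V (suc k)
      f-+         : Additive f
      g-+         : Additive g
      f-inj       : Injective f
      g-inj       : Injective g
      A           : List (V (suc k))
      H κ err     : ℝ
      E           : ℕ → ℝ
      m n         : ℕ
      m≥1         : 1 ℕ.≤ m
      n≥1         : 1 ℕ.≤ n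
      ρ σ         : ℝ
      0≤ρ         : 0# ≤ ρ
      0≤σ         : 0# ≤ σ
      ρ-^         : ρ ^ suc k ≈ fromℕ m
      σ-^         : σ ^ suc k ≈ fromℕ n
      H≈          : H ≈ (ρ + σ) ^ suc k
      κ-inverse   : (1# + H) * κ ≈ 1#
      0≤err       : 0# ≤ err
      E-mono      : ∀ {a b} → a ℕ.≤ b → E a ≤ E b
      0≤E         : ∀ a → 0# ≤ E a
      IH          : ∀ X → X ⊆ A → card X ℕ.< card A → H * fromℕ (card X) ≤ fromℕ (card (map f X ⊞ map g X)) + E (card X)
      bm          : ∀ X Y → X ⊆ A → Y ⊆ A → 1 ℕ.≤ card X → 1 ℕ.≤ card Y → ∀ α β → 0# ≤ α → 0# ≤ β →
        α ^ suc k ≤ fromℕ (card X) → β ^ suc k ≤ fromℕ (card Y) → (α + β) ^ suc k ≤ fromℕ (card (map f X ⊞ map g Y)) + err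
      index       : ∀ B → B ⊆ A → Full (Differences B) → IndexAtLeast (SumOf f g (Differences B)) (ImageOf f (Differences B)) m

  module Half {k} (S : Setup k) where
    open Setup S
    open Classes f g f-+ g-+ f-inj g-inj public
    module Swapped = Classes g f g-+ f-+ g-inj f-inj

    N : List (V (suc k)) → List (V (suc k)) → ℕ
    N X Y = card (fX+gY X Y)

    0≤H : 0# ≤ H
    0≤H = ≤-respʳ (≈-sym H≈) (^-nonNeg (suc k) (+-nonNeg 0≤ρ 0≤σ))

    0<1+H : 0# < 1# + H
    0<1+H = <-≤-trans 0<1 (≤-by H 0≤H ≈-refl)

    κ≤1 : κ ≤ 1#
    κ≤1 = *-cancelˡ-≤ (1# + H) 0<1+H (≤-respˡ (≈-sym κ-inverse) (≤-by H 0≤H (*-identityʳ _)))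

    -- If P has at least m classes modulo f Δ(P) and at least n modulo g Δ(P), then the smallest
    -- class is either almost as large as possible, and then all blocks are large, or removing it is a gain.
    balanced : ∀ P → P ⊆ A → m ℕ.≤ length (reps P) → n ℕ.≤ length (Swapped.reps P) → ∀ y₀ x₀ → y₀ ∈ reps P →
      (∀ {y} → y ∈ reps P → card (class P y₀) ℕ.≤ card (class P y)) → (∀ {x} → x ∈ Swapped.reps P → card (Swapped.class P x₀) ℕ.≤ card (Swapped.class P x)) →
      m ℕ.* card (class P y₀) ℕ.≤ n ℕ.* card (Swapped.class P x₀) →
      H * fromℕ (card P) + κ * E (card P) ≤ fromℕ (N P P) + (E (card P) + fromℕ (m ℕ.* n) * err)
    balanced P P⊆A m≤ n≤ y₀ x₀ y₀∈ y₀-min x₀-min mβ≤nα = balance 0≤H 0≤err (fromℕ-mono n≤M) κ-inverse direct gain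
      where
      p = card P
      s = fromℕ (N P P)
      M = m ℕ.* n
      P₀ = class P y₀
      Rst = rest P y₀
      b = card P₀
      e = E p
      b≥1 : 1 ℕ.≤ b
      b≥1 = card-pos (class∋ {P} (Transversal.reps⊆ (classes P) y₀∈))
      n≤M : n ℕ.≤ M
      n≤M = ℕ.≤-trans (ℕ.≤-reflexive (≡.sym (ℕ.+-identityʳ n))) (ℕ.*-monoˡ-≤ n m≥1)
      0<n : 0# < fromℕ n
      0<n = fromℕ-pos n≥1
      -- The ratio α : β = ρ : σ is the one at which Brunn-Minkowski yields the constant H. The
      -- scale θ is fixed by β^(k+1) = b, the size of the smallest class; then α^(k+1) = m b / n,
      -- which by the case assumption no class of the other kind falls below, and (α + β)^(k+1) = H
      -- b / n.
      q : ℝ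
      q = fromℕ b * (fromℕ n) ⁻¹
      nq≈b : fromℕ n * q ≈ fromℕ b
      nq≈b = ≈-trans (solve 3 (λ n b i → n :* (b :* i) := b :* (n :* i)) ≡.refl (fromℕ n) (fromℕ b) ((fromℕ n) ⁻¹)) (≈-trans (*-congˡ (*-inverseʳ _ (pos⇒≉0 0<n))) (*-identityʳ _))
      θ-root = root k q (*-nonNegative (fromℕ-nonNeg b) (proj₁ (⁻¹-pos 0<n)))
      θ α β c : ℝ
      θ = proj₁ θ-root
      0≤θ = proj₁ (proj₂ θ-root)
      θ-^ : θ ^ suc k ≈ q
      θ-^ = proj₂ (proj₂ θ-root)
      α = ρ * θ
      β = σ * θ
      0≤α = *-nonNegative 0≤ρ 0≤θ
      0≤β = *-nonNegative 0≤σ 0≤θ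
      c = (α + β) ^ suc k
      α-^ : α ^ suc k ≈ fromℕ m * q
      α-^ = ≈-trans (^-distrib-* ρ θ (suc k)) (*-cong ρ-^ θ-^)
      β-^ : β ^ suc k ≈ fromℕ b
      β-^ = ≈-trans (^-distrib-* σ θ (suc k)) (≈-trans (*-cong σ-^ θ-^) nq≈b)
      c≈ : c ≈ H * q
      c≈ = ≈-trans (^-cong (suc k) (≈-sym (distribʳ θ ρ σ))) (≈-trans (^-distrib-* (ρ + σ) θ (suc k)) (*-cong (≈-sym H≈) θ-^))
      nc≈ : fromℕ n * c ≈ H * fromℕ b
      nc≈ = ≈-trans (*-congˡ c≈) (≈-trans (solve 3 (λ n h q → n :* (h :* q) := h :* (n :* q)) ≡.refl (fromℕ n) H q) (*-congˡ nq≈b))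
      nα≈ : fromℕ n * α ^ suc k ≈ fromℕ m * fromℕ b
      nα≈ = ≈-trans (*-congˡ α-^) (≈-trans (solve 3 (λ n m q → n :* (m :* q) := m :* (n :* q)) ≡.refl (fromℕ n) (fromℕ m) q) (*-congˡ nq≈b))
      α≤class : ∀ {x} → x ∈ Swapped.reps P → α ^ suc k ≤ fromℕ (card (Swapped.class P x))
      α≤class x∈ = *-cancelˡ-≤ (fromℕ n) 0<n (≤-respˡ (≈-trans (fromℕ-* m b) (≈-sym nα≈)) (≤-respʳ (fromℕ-* n _)
        (fromℕ-mono (ℕ.≤-trans mβ≤nα (ℕ.*-monoʳ-≤ n (x₀-min x∈))))))
      inA : ∀ {Q} → Q ⊆ P → Q ⊆ A
      inA Q⊆P z z∈ = P⊆A z (Q⊆P z z∈)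
      class≥1 : ∀ {y} → y ∈ reps P → 1 ℕ.≤ card (class P y)
      class≥1 y∈ = card-pos (class∋ {P} (Transversal.reps⊆ (classes P) y∈))
      class′≥1 : ∀ {x} → x ∈ Swapped.reps P → 1 ℕ.≤ card (Swapped.class P x)
      class′≥1 x∈ = card-pos (Swapped.class∋ {P} (Transversal.reps⊆ (Swapped.classes P) x∈))
      -- f P + g Q is cut along the classes of f P modulo g Δ(P), which is the decomposition for
      -- exchanged roles.
      columns : ∀ Q → Q ⊆ P → Σcard (λ x → fX+gY (Swapped.class P x) Q) (Swapped.reps P) ℕ.≤ N P Q
      columns Q Q⊆P = ℕ.≤-trans (ℕ.≤-reflexive (≡.cong sum (map-cong (λ x → sumset-comm f g (Swapped.class P x) Q) (Swapped.reps P))))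
        (ℕ.≤-trans (Swapped.classes-sumset Q P Q⊆P) (ℕ.≤-reflexive (≡.sym (sumset-comm f g P Q))))
      some-x : ∃[ x ] x ∈ Swapped.reps P
      some-x = nonempty (Swapped.reps P) (ℕ.≤-trans n≥1 n≤)
        where
        nonempty : ∀ (L : List (V (suc k))) → 1 ℕ.≤ length L → ∃[ x ] x ∈ L
        nonempty (x ∷ L) _ = x , here ≡.refl
      block : V (suc k) × V (suc k) → ℕ
      block (y , x) = N (Swapped.class P x) (class P y)
      direct-at : ∀ y x → y ∈ reps P → x ∈ Swapped.reps P → (∀ {yx} → yx ∈ cartesianProduct (reps P) (Swapped.reps P) → block (y , x) ℕ.≤ block yx) →
        H * (fromℕ m * fromℕ b) ≤ s + fromℕ M * err
      direct-at y x y∈ x∈ min = all-blocks {m} {n} {ν} {N P P} nc≈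
        (bm (Swapped.class P x) (class P y) (inA (Swapped.class⊆ P x)) (inA (class⊆ P y)) (class′≥1 x∈) (class≥1 y∈) α β 0≤α 0≤β
            (α≤class x∈) (≤-respˡ (≈-sym β-^) (fromℕ-mono (y₀-min y∈))))
        (fromℕ-mono Mν≤)
        where
        ν = block (y , x)
        Mν≤ : M ℕ.* ν ℕ.≤ N P P
        Mν≤ = begin
          M ℕ.* ν                                    ≡⟨ ℕ.*-assoc m n ν ⟩
          m ℕ.* (n ℕ.* ν)                            ≤⟨ ℕ.*-monoˡ-≤ (n ℕ.* ν) m≤ ⟩
          length (reps P) ℕ.* (n ℕ.* ν)              ≤⟨ sum-map-≥ (λ y → N P (class P y)) (n ℕ.* ν) (reps P) (λ {y} y∈ → ℕ.≤-trans (ℕ.*-monoˡ-≤ ν n≤)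
            (ℕ.≤-trans (sum-map-≥ (λ x → N (Swapped.class P x) (class P y)) ν (Swapped.reps P) (λ x∈ → min (∈-cartesianProduct⁺ y∈ x∈))) (columns (class P y) (class⊆ P y)))) ⟩
          Σcard (λ y → fX+gY P (class P y)) (reps P) ≤⟨ classes-sumset P P (λ _ → id) ⟩
          N P P                                      ∎
          where open ℕ.≤-Reasoning
      -- Brunn-Minkowski is applied to the smallest block only; at least m n disjoint blocks are no
      -- smaller.
      direct : H * (fromℕ m * fromℕ b) ≤ s + fromℕ M * err
      direct = direct-at (proj₁ (proj₁ least)) (proj₂ (proj₁ least)) (proj₁ both) (proj₂ both) (proj₂ (proj₂ least))
        where
        least = argmin block (cartesianProduct (reps P) (Swapped.reps P)) (∈-cartesianProduct⁺ y₀∈ (proj₂ some-x))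
        both = ∈-cartesianProduct⁻ (reps P) (Swapped.reps P) (proj₁ (proj₂ least))
      -- In f P + g P₀ a class of f P with χ^(k+1) elements grows, up to `err`, by at least (χ +
      -- β)^(k+1) - χ^(k+1), which is at least the growth c - α^(k+1) at the smallest admissible
      -- size.
      first-class : fromℕ n * c + fromℕ p ≤ fromℕ (N P P₀) + fromℕ n * (err + α ^ suc k)
      first-class = ≤-trans (+-monoʳ-≤ _ (fromℕ-mono (Swapped.card≤classes P)))
        (≤-trans (sum-gain (λ x → card (Swapped.class P x)) (λ x → N (Swapped.class P x) P₀) c (err + α ^ suc k) (Swapped.reps P) n n≤ each
            (λ {x} x∈ → sumset≥ˡ {Swapped.class P x} {P₀} (class∋ {P} (Transversal.reps⊆ (classes P) y₀∈))))
          (+-monoˡ-≤ _ (fromℕ-mono (columns P₀ (class⊆ P y₀)))))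
        where
        each : ∀ {x} → x ∈ Swapped.reps P → c + fromℕ (card (Swapped.class P x)) ≤ fromℕ (N (Swapped.class P x) P₀) + (err + α ^ suc k)
        each {x} x∈ = ≤-respˡ (+-congˡ χ-^) (≤-respʳ (+-assoc _ err (α ^ suc k)) (≤-trans (power-increment (suc k) 0≤α 0≤β (^-cancel-≤ k 0≤χ (≤-respʳ (≈-sym χ-^) (α≤class x∈))))
          (+-monoˡ-≤ (α ^ suc k) (bm (Swapped.class P x) P₀ (inA (Swapped.class⊆ P x)) (inA (class⊆ P y₀)) (class′≥1 x∈) b≥1 χ β 0≤χ 0≤β (≤-reflexive χ-^) (≤-reflexive β-^)))))
          where
          χ = nthRoot (suc k) (card (Swapped.class P x))
          0≤χ = nthRoot-nonNeg (suc k) (card (Swapped.class P x))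
          χ-^ : χ ^ suc k ≈ fromℕ (card (Swapped.class P x))
          χ-^ = nthRoot-suc k (card (Swapped.class P x))
      p≡ : p ≡ b ℕ.+ card Rst
      p≡ = card-class-rest P y₀
      Rst<A : card Rst ℕ.< card A
      Rst<A = ℕ.≤-trans (ℕ.+-monoˡ-≤ (card Rst) b≥1) (ℕ.≤-trans (ℕ.≤-reflexive (≡.sym p≡)) (card-⊆ (λ {z} → P⊆A z)))
      gain : H * fromℕ p + fromℕ p ≤ s + (fromℕ n * err + (e + fromℕ m * fromℕ b))
      gain = remove-class nc≈ nα≈ (≈-trans (reflexive (≡.cong fromℕ p≡)) (fromℕ-+ b (card Rst))) first-class
        (≤-trans (IH Rst (inA (rest⊆ P y₀)) Rst<A) (+-monoʳ-≤ _ (E-mono (ℕ.≤-trans (ℕ.m≤n+m _ b) (ℕ.≤-reflexive (≡.sym p≡))))))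
        (≤-respˡ (fromℕ-+ (N P P₀) (N Rst Rst)) (fromℕ-mono (ℕ.≤-trans (ℕ.+-monoʳ-≤ (N P P₀) (card-⊆ (sumset-mono {Rst} {P} (rest⊆ P y₀) (λ _ → id)))) (split-sumset P y₀))))

    -- Result of one splitting: either X gains in proportion to C, or C has m classes of its own,
    -- keeps its number of classes of the other kind, and every bound for C passes to X at the cost
    -- of the error of `Rst`.
    record Step (X : List (V (suc k))) : Set ℓ where
      field
        C Rst   : List (V (suc k))
        C⊆X     : C ⊆ X
        Rst⊆X   : Rst ⊆ X
        parts   : card C ℕ.+ card Rst ≡ card X
        C≥1     : 1 ℕ.≤ card C
        large   : card X ℕ.≤ m ℕ.* card C
        outcome : H * fromℕ (card X) + κ * fromℕ (card C) ≤ fromℕ (N X X) + (E (card C) + E (card Rst)) ⊎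
          (m ℕ.≤ length (reps C) × length (Swapped.reps X) ℕ.≤ length (Swapped.reps C) ×
            (∀ q → H * fromℕ (card C) ≤ fromℕ (N C C) + q → H * fromℕ (card X) ≤ fromℕ (N X X) + (q + E (card Rst))))

    -- If X has fewer than m classes, its largest class C either is gained upon by f X + g C,
    -- or has m classes of its own.
    step-at : ∀ X → X ⊆ A → length (reps X) ℕ.≤ m → (∀ C → C ⊆ X → card X ℕ.≤ m ℕ.* card C → Full (Differences C)) →
      ∀ r → r ∈ X → card X ℕ.≤ length (reps X) ℕ.* card (class X r) → Step X
    step-at X X⊆A few full r r∈ big = record
      { C = C ; Rst = Rst ; C⊆X = class⊆ X r ; Rst⊆X = rest⊆ X r ; parts = ≡.sym (card-class-rest X r) ; C≥1 = C≥1 ; large = large ; outcome = outcome }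
      where
      C = class X r
      Rst = rest X r
      r∈C : r ∈ C
      r∈C = class∋ {X} r∈
      C≥1 : 1 ℕ.≤ card C
      C≥1 = card-pos r∈C
      C⊆A : C ⊆ A
      C⊆A z z∈ = X⊆A z (class⊆ X r z z∈)
      Rst⊆A : Rst ⊆ A
      Rst⊆A z z∈ = X⊆A z (rest⊆ X r z z∈)
      large : card X ℕ.≤ m ℕ.* card C
      large = ℕ.≤-trans big (ℕ.*-monoˡ-≤ (card C) few)
      X≤A : card C ℕ.+ card Rst ℕ.≤ card A
      X≤A = ℕ.≤-trans (ℕ.≤-reflexive (≡.sym (card-class-rest X r))) (card-⊆ (λ {z} → X⊆A z))
      extend : ∀ w u → H * fromℕ (card C) + w ≤ fromℕ (N X C) + u → H * fromℕ (card X) + w ≤ fromℕ (N X X) + (u + E (card Rst))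
      extend w u le = add-rest (≈-trans (reflexive (≡.cong fromℕ (card-class-rest X r))) (fromℕ-+ (card C) (card Rst))) le
        (IH Rst Rst⊆A (ℕ.≤-trans (ℕ.+-monoˡ-≤ (card Rst) C≥1) X≤A))
        (≤-respˡ (fromℕ-+ (N X C) (N Rst Rst)) (fromℕ-mono (ℕ.≤-trans (ℕ.+-monoʳ-≤ (N X C) (card-⊆ (sumset-mono {Rst} {X} (rest⊆ X r) (λ _ → id)))) (split-sumset X r))))
      smaller : ∀ {x} → x ∈ X → ¬ x ∈ C → card C ℕ.< card A
      smaller {x} x∈ x∉ = ℕ.≤-trans (ℕ.≤-reflexive (ℕ.+-comm 1 (card C))) (ℕ.≤-trans (ℕ.+-monoʳ-≤ (card C) (card-pos x∈Rst)) X≤A)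
        where
        x∈Rst : x ∈ Rst
        x∈Rst = ∈-sub⁺ (λ y → ¬ Same X y r) x∈ (λ same → x∉ (∈-sub⁺ (λ y → Same X y r) x∈ same))
      Gained : Set ℓ
      Gained = H * fromℕ (card C) + κ * fromℕ (card C) ≤ fromℕ (N X C) + E (card C)
      gained : Gained → H * fromℕ (card X) + κ * fromℕ (card C) ≤ fromℕ (N X X) + (E (card C) + E (card Rst))
      gained = extend (κ * fromℕ (card C)) (E (card C))
      by-coset : card C ℕ.< card A → N C C ℕ.+ card C ℕ.≤ N X C → Gained
      by-coset C<A le = coset-gain (fromℕ-nonNeg (card C)) κ≤1 (IH C C⊆A C<A) (≤-respˡ (fromℕ-+ (N C C) (card C)) (fromℕ-mono le))
      by-translate : ∀ {b} → b ∈ C → card C ℕ.< card A → N C C ℕ.+ card (class C b) ℕ.≤ N X C → Gained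
      by-translate {b} b∈ C<A le = translate-gain 0≤H κ-inverse (≈-trans (reflexive (≡.cong fromℕ (card-class-rest C b))) (fromℕ-+ (card K) (card W))) (fromℕ-nonNeg (card K))
        (IH C C⊆A C<A)
        (≤-respˡ (fromℕ-+ (N C C) (card K)) (fromℕ-mono le))
        (≤-respˡ (fromℕ-+ (card C) (N W W)) (fromℕ-mono (ℕ.≤-trans (ℕ.+-mono-≤ (sumset≥ˡ {C} {K} (class∋ {C} b∈)) (card-⊆ (sumset-mono {W} {C} (rest⊆ C b) (λ _ → id)))) (split-sumset C b))))
        (≤-trans (IH W (λ z z∈ → C⊆A z (rest⊆ C b z z∈)) (ℕ.≤-<-trans W≤C C<A)) (+-monoʳ-≤ (fromℕ (N W W)) (E-mono W≤C)))
        where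
        K = class C b
        W = rest C b
        W≤C : card W ℕ.≤ card C
        W≤C = card-⊆ (λ {z} → rest⊆ C b z)
      outcome : H * fromℕ (card X) + κ * fromℕ (card C) ≤ fromℕ (N X X) + (E (card C) + E (card Rst)) ⊎
          (m ℕ.≤ length (reps C) × length (Swapped.reps X) ℕ.≤ length (Swapped.reps C) ×
            (∀ q → H * fromℕ (card C) ≤ fromℕ (N C C) + q → H * fromℕ (card X) ≤ fromℕ (N X X) + (q + E (card Rst))))
      -- Two ways for f X + g C to exceed f C + g C: f X meets a new coset of g Δ(C), or some f x +
      -- g b meets a new coset of f Δ(C). If the first fails, C has lost none of the classes of the
      -- other kind; if the second fails too, `saturated` supplies the m classes.
      outcome = by-cases (em (∃[ x ] (x ∈ X × (∀ c → c ∈ C → ¬ ImageOf g (Differences C) (f x Vectors.⊖ f c)))))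
        (λ { (x , x∈ , new) → inj₁ (gained (by-coset (smaller x∈ (λ x∈C → new x x∈C (Swapped.Same-refl {C} {x}))) (new-coset (class⊆ X r) x∈ r∈C new))) })
        (λ meets → by-cases (em (∃[ x ] ∃[ b ] (x ∈ X × b ∈ C × (∀ b′ → b′ ∈ C → ¬ fΔ C ((f x Vectors.⊕ g b) Vectors.⊖ (f r Vectors.⊕ g b′))))))
          (λ { (x , b , x∈ , b∈ , new) → inj₁ (gained (by-translate b∈ (smaller x∈ (translated-outside b∈ new)) (new-translate (class⊆ X r) x∈ b∈ r∈C new))) })
          (λ closed → inj₂ (saturated {X} r r∈ (full C (class⊆ X r) large) (closed′ closed) (index C C⊆A (full C (class⊆ X r) large)) , Swapped.meets⇒many (class⊆ X r) (meets′ meets) , extended)))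
        where
        import Data.Vec.Base as Vec
        extended : ∀ q → H * fromℕ (card C) ≤ fromℕ (N C C) + q → H * fromℕ (card X) ≤ fromℕ (N X X) + (q + E (card Rst))
        extended q le = ≤-respˡ (+-identityʳ _) (extend 0# q (≤-respˡ (≈-sym (+-identityʳ _)) (≤-trans le (+-monoˡ-≤ q (fromℕ-mono (card-⊆ (sumset-mono {C} {X} (class⊆ X r) (λ _ → id))))))))
        translated-outside : ∀ {x b} → b ∈ C → (∀ b′ → b′ ∈ C → ¬ fΔ C ((f x Vectors.⊕ g b) Vectors.⊖ (f r Vectors.⊕ g b′))) → ¬ x ∈ C
        translated-outside {x} {b} b∈ new x∈C = new b b∈ (≡.subst (fΔ C) (Vectors.linear (Vectors.x₀ Vectors.:- Vectors.x₁) ((Vectors.x₀ Vectors.:+ Vectors.x₂) Vectors.:- (Vectors.x₁ Vectors.:+ Vectors.x₂)) ≡.refl (f x Vec.∷ f r Vec.∷ g b Vec.∷ Vec.[]))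
          (fΔ-difference x∈C r∈C))
        meets′ : ¬ (∃[ x ] (x ∈ X × (∀ c → c ∈ C → ¬ ImageOf g (Differences C) (f x Vectors.⊖ f c)))) → ∀ {x} → x ∈ X → ∃[ c ] (c ∈ C × ImageOf g (Differences C) (f x Vectors.⊖ f c))
        meets′ meets {x} x∈ = by-cases (em (∃[ c ] (c ∈ C × ImageOf g (Differences C) (f x Vectors.⊖ f c)))) id
          (λ n → ⊥-elim (meets (x , x∈ , λ c c∈ q → n (c , c∈ , q))))
        closed′ : ¬ (∃[ x ] ∃[ b ] (x ∈ X × b ∈ C × (∀ b′ → b′ ∈ C → ¬ fΔ C ((f x Vectors.⊕ g b) Vectors.⊖ (f r Vectors.⊕ g b′))))) →
          ∀ {x b} → x ∈ X → b ∈ C → ∃[ b′ ] (b′ ∈ C × fΔ C ((f x Vectors.⊕ g b) Vectors.⊖ (f r Vectors.⊕ g b′)))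
        closed′ closed {x} {b} x∈ b∈ = by-cases (em (∃[ b′ ] (b′ ∈ C × fΔ C ((f x Vectors.⊕ g b) Vectors.⊖ (f r Vectors.⊕ g b′))))) id
          (λ n → ⊥-elim (closed (x , b , x∈ , b∈ , λ b′ b′∈ q → n (b′ , b′∈ , q))))

    step : ∀ X → X ⊆ A → ∀ {x} → x ∈ X → length (reps X) ℕ.≤ m → (∀ C → C ⊆ X → card X ℕ.≤ m ℕ.* card C → Full (Differences C)) → Step X
    step X X⊆A x∈ few full = step-at X X⊆A few full (proj₁ largest) (proj₁ (proj₂ largest)) (proj₂ (proj₂ largest))
      where largest = largest-class X x∈

  swap : ∀ {k} (S : Setup k) → (let open Setup S) →
    (∀ B → B ⊆ A → Full (Differences B) → IndexAtLeast (SumOf g f (Differences B)) (ImageOf g (Differences B)) n) → Setup k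
  swap {k} S index₂ = record
    { f = g ; g = f ; f-+ = g-+ ; g-+ = f-+ ; f-inj = g-inj ; g-inj = f-inj ; A = A ; H = H ; κ = κ ; err = err ; E = E ; m = n ; n = m ; m≥1 = n≥1 ; n≥1 = m≥1
    ; ρ = σ ; σ = ρ ; 0≤ρ = 0≤σ ; 0≤σ = 0≤ρ ; ρ-^ = σ-^ ; σ-^ = ρ-^ ; H≈ = ≈-trans H≈ (^-cong (suc k) (+-comm ρ σ)) ; κ-inverse = κ-inverse
    ; 0≤err = 0≤err ; E-mono = E-mono ; 0≤E = 0≤E
    ; IH = λ X X⊆A lt → ≡.subst (λ s → H * fromℕ (card X) ≤ fromℕ s + E (card X)) (sumset-comm f g X X) (IH X X⊆A lt)
    ; bm = λ X Y X⊆A Y⊆A X≥1 Y≥1 α β 0≤α 0≤β α≤ β≤ → ≤-respˡ (^-cong (suc k) (+-comm β α))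
        (≡.subst (λ s → (β + α) ^ suc k ≤ fromℕ s + err) (sumset-comm f g Y X) (bm Y X Y⊆A X⊆A Y≥1 X≥1 β α 0≤β 0≤α β≤ α≤))
    ; index = index₂ }
    where open Setup S

  drop-gain : ∀ {G h w s u} → G ≤ w → h + w ≤ s + u → h ≤ s + (u - G)
  drop-gain {G} {h} {w} {s} {u} G≤w le = ≤-by ((s + u - (h + w)) + (w - G)) (+-nonNeg (difference le) (difference G≤w))
    (solve 5 (λ h w s u g → s :+ (u :- g) := h :+ (((s :+ u) :- (h :+ w)) :+ (w :- g))) ≡.refl h w s u G)

  absorb-gain : ∀ {e r a G} → e + r ≤ a + G → e - G + r ≤ a
  absorb-gain {e} {r} {a} {G} le = ≤-by (a + G - (e + r)) (difference le) (solve 4 (λ a g e r → a := (e :- g :+ r) :+ ((a :+ g) :- (e :+ r))) ≡.refl a G e r)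

  swap-gain : ∀ e r G → e + r - G ≈ e - G + r
  swap-gain e r G = solve 3 (λ e r g → (e :+ r) :- g := (e :- g) :+ r) ≡.refl e r G

  module Combination {k} (S : Setup k) where
    open Setup S

    -- Each case secures a gain of at least `G`, and `three` says that this pays for cutting A into
    -- three parts and for the Brunn-Minkowski errors of the m n blocks.
    module _ (G : ℝ)
      (index₂ : ∀ B → B ⊆ A → Full (Differences B) → IndexAtLeast (SumOf g f (Differences B)) (ImageOf g (Differences B)) n)
      (full : ∀ B → B ⊆ A → card A ℕ.≤ m ℕ.* n ℕ.* card B → Full (Differences B))
      (gain : ∀ c → card A ℕ.≤ m ℕ.* n ℕ.* c → G ≤ κ * fromℕ c × G ≤ κ * E c)
      (three : ∀ x y z → x ℕ.+ (y ℕ.+ z) ≡ card A → E x + (E y + E z) + fromℕ (m ℕ.* n) * err ≤ E (card A) + G) where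

      module Half₁ = Half S
      module Half₂ = Half (swap S index₂)
      open Half₁ using (N)
      M = m ℕ.* n
      Merr = fromℕ M * err
      0≤Merr : 0# ≤ Merr
      0≤Merr = *-nonNegative (fromℕ-nonNeg M) 0≤err
      Deficit : List (V (suc k)) → ℝ → Set ℓ
      Deficit X q = H * fromℕ (card X) ≤ fromℕ (N X X) + q
      many₁ many₂ : List (V (suc k)) → Set
      many₁ X = m ℕ.≤ length (Half₁.reps X)
      many₂ X = n ℕ.≤ length (Half₂.reps X)
      weaken : ∀ {X q q′} → q ≤ q′ → Deficit X q → Deficit X q′
      weaken {X} q≤ d = ≤-trans d (+-monoʳ-≤ (fromℕ (N X X)) q≤)
      conclude : ∀ x y z → x ℕ.+ (y ℕ.+ z) ≡ card A → Deficit A ((E x + (E y + E z)) - G + Merr) → Deficit A (E (card A))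
      conclude x y z sum≡ d = weaken {A} (absorb-gain (three x y z sum≡)) d
      m≤M : m ℕ.≤ M
      m≤M = ℕ.≤-trans (ℕ.≤-reflexive (≡.sym (ℕ.*-identityʳ m))) (ℕ.*-monoʳ-≤ m n≥1)
      n≤M : n ℕ.≤ M
      n≤M = ℕ.≤-trans (ℕ.≤-reflexive (≡.sym (ℕ.+-identityʳ n))) (ℕ.*-monoˡ-≤ n m≥1)
      no-error : ∀ u → u - G ≤ u - G + Merr
      no-error u = ≤-by Merr 0≤Merr ≈-refl
      swapped-deficit : ∀ X {h q} → h ≤ fromℕ (Half₂.N X X) + q → h ≤ fromℕ (N X X) + q
      swapped-deficit X {h} {q} = ≡.subst (λ s → h ≤ fromℕ s + q) (sumset-comm g f X X)
      deficit-swapped : ∀ X {h q} → h ≤ fromℕ (N X X) + q → h ≤ fromℕ (Half₂.N X X) + q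
      deficit-swapped X {h} {q} = ≡.subst (λ s → h ≤ fromℕ s + q) (sumset-comm f g X X)

      good-at : ∀ P → P ⊆ A → many₁ P → many₂ P → card A ℕ.≤ M ℕ.* card P →
        ∃[ y ] (y ∈ Half₁.reps P × (∀ {y′} → y′ ∈ Half₁.reps P → card (Half₁.class P y) ℕ.≤ card (Half₁.class P y′))) →
        ∃[ x ] (x ∈ Half₂.reps P × (∀ {x′} → x′ ∈ Half₂.reps P → card (Half₂.class P x) ℕ.≤ card (Half₂.class P x′))) →
        Deficit P (E (card P) - G + Merr)
      good-at P P⊆A many₁P many₂P big (y , y∈ , y-min) (x , x∈ , x-min) = decide (ℕ.≤-total (m ℕ.* card (Half₁.class P y)) (n ℕ.* card (Half₂.class P x)))
        where
        case₁ : m ℕ.* card (Half₁.class P y) ℕ.≤ n ℕ.* card (Half₂.class P x) → Deficit P (E (card P) - G + Merr)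
        case₁ le = ≤-respʳ (+-congˡ (swap-gain (E (card P)) Merr G)) (drop-gain (proj₂ (gain (card P) big)) (Half₁.balanced P P⊆A many₁P many₂P y x y∈ y-min x-min le))
        case₂ : n ℕ.* card (Half₂.class P x) ℕ.≤ m ℕ.* card (Half₁.class P y) → Deficit P (E (card P) - G + Merr)
        case₂ ge = swapped-deficit P (≤-respʳ (+-congˡ (≈-trans (swap-gain (E (card P)) (fromℕ (n ℕ.* m) * err) G) (+-congˡ (*-congʳ (reflexive (≡.cong fromℕ (ℕ.*-comm n m)))))))
          (drop-gain (proj₂ (gain (card P) big)) (Half₂.balanced P P⊆A many₂P many₁P x y x∈ x-min y-min ge)))
        decide : m ℕ.* card (Half₁.class P y) ℕ.≤ n ℕ.* card (Half₂.class P x) ⊎ n ℕ.* card (Half₂.class P x) ℕ.≤ m ℕ.* card (Half₁.class P y) → Deficit P (E (card P) - G + Merr)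
        decide (inj₁ le) = case₁ le
        decide (inj₂ ge) = case₂ ge

      good : ∀ P → P ⊆ A → 1 ℕ.≤ card P → many₁ P → many₂ P → card A ℕ.≤ M ℕ.* card P → Deficit P (E (card P) - G + Merr)
      good P P⊆A P≥1 many₁P many₂P big = good-at P P⊆A many₁P many₂P big
        (argmin (λ y → card (Half₁.class P y)) (Half₁.reps P) (proj₁ (proj₂ (Transversal.covers (Half₁.classes P) (proj₂ (card-nonempty P P≥1))))))
        (argmin (λ x → card (Half₂.class P x)) (Half₂.reps P) (proj₁ (proj₂ (Transversal.covers (Half₂.classes P) (proj₂ (card-nonempty P P≥1))))))

      -- Empty parts of size 0 fill up the three places when fewer splittings occur.
      good-bound : ∀ a → a - G + Merr ≤ (a + E 0) - G + Merr
      good-bound a = ≤-by (E 0) (0≤E 0) (solve 4 (λ a c g r → (a :+ c) :- g :+ r := (a :- g :+ r) :+ c) ≡.refl a (E 0) G Merr)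
      pad : ∀ a b → (a + b) - G + Merr ≤ (a + (b + E 0)) - G + Merr
      pad a b = ≤-by (E 0) (0≤E 0) (solve 5 (λ a b c g r → (a :+ (b :+ c)) :- g :+ r := ((a :+ b) :- g :+ r) :+ c) ≡.refl a b (E 0) G Merr)
      rest-last : ∀ a b c → ((a + b) - G + Merr) + c ≈ (a + (b + c)) - G + Merr
      rest-last a b c = solve 5 (λ a b c g r → ((a :+ b) :- g :+ r) :+ c := (a :+ (b :+ c)) :- g :+ r) ≡.refl a b c G Merr
      rest-second : ∀ a b → (a - G + Merr) + b ≈ (a + b) - G + Merr
      rest-second a b = solve 4 (λ a b g r → (a :- g :+ r) :+ b := (a :+ b) :- g :+ r) ≡.refl a b G Merr

      Split : List (V (suc k)) → Set ℓ
      Split P = ∃[ a ] ∃[ b ] (a ℕ.+ b ≡ card P × Deficit P ((E a + E b) - G + Merr))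

      -- The splitting with exchanged roles: the m classes already present survive in the part,
      -- which acquires the n classes of the other kind or else provides a gain.
      split : ∀ P → P ⊆ A → 1 ℕ.≤ card P → (∀ C → card P ℕ.≤ n ℕ.* card C → card A ℕ.≤ M ℕ.* card C) → many₁ P → Split P
      split P P⊆A P≥1 big many = by-cases (n ℕ.≤? length (Half₂.reps P))
        (λ many₂P → card P , 0 , ℕ.+-identityʳ (card P) , weaken {P} (good-bound (E (card P))) (good P P⊆A P≥1 many many₂P (big P (ℕ.≤-trans (ℕ.≤-reflexive (≡.sym (ℕ.+-identityʳ (card P)))) (ℕ.*-monoˡ-≤ (card P) n≥1)))))
        (λ few → after (Half₂.step P P⊆A (proj₂ (card-nonempty P P≥1)) (ℕ.<⇒≤ (ℕ.≰⇒> few)) (λ C C⊆P large → full C (λ z z∈ → P⊆A z (C⊆P z z∈)) (big C large))))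
        where
        after : Half₂.Step P → Split P
        after st = card C , card Rst , parts , decide outcome
          where
          open Half₂.Step st
          C≤ = big C large
          decide : H * fromℕ (card P) + κ * fromℕ (card C) ≤ fromℕ (Half₂.N P P) + (E (card C) + E (card Rst)) ⊎
            (n ℕ.≤ length (Half₂.reps C) × length (Half₁.reps P) ℕ.≤ length (Half₁.reps C) ×
              (∀ q → H * fromℕ (card C) ≤ fromℕ (Half₂.N C C) + q → H * fromℕ (card P) ≤ fromℕ (Half₂.N P P) + (q + E (card Rst)))) →
            Deficit P ((E (card C) + E (card Rst)) - G + Merr)
          decide (inj₁ d) = weaken {P} (no-error _) (swapped-deficit P (drop-gain (proj₁ (gain (card C) C≤)) d))
          decide (inj₂ (many₂C , keep , extend)) = ≤-respʳ (+-congˡ (rest-second (E (card C)) (E (card Rst))))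
            (swapped-deficit P (extend _ (deficit-swapped C (good C (λ z z∈ → P⊆A z (C⊆X z z∈)) C≥1 (ℕ.≤-trans many keep) many₂C C≤))))

      -- One splitting provides the m classes, and the one in `split` the n classes, so that at most
      -- three parts arise.
      total-deficit : 1 ℕ.≤ card A → Deficit A (E (card A))
      total-deficit A≥1 = by-cases (m ℕ.≤? length (Half₁.reps A))
        (λ many → from-split (split A (λ z z∈ → z∈) A≥1 (λ C le → ℕ.≤-trans le (ℕ.*-monoˡ-≤ (card C) n≤M)) many))
        (λ few → after (Half₁.step A (λ z z∈ → z∈) (proj₂ (card-nonempty A A≥1)) (ℕ.<⇒≤ (ℕ.≰⇒> few)) (λ C C⊆A le → full C C⊆A (ℕ.≤-trans le (ℕ.*-monoˡ-≤ (card C) m≤M)))))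
        where
        from-split : Split A → Deficit A (E (card A))
        from-split (a , b , a+b≡ , d) = conclude a b 0 (≡.trans (≡.cong (a ℕ.+_) (ℕ.+-identityʳ b)) a+b≡) (weaken {A} (pad (E a) (E b)) d)
        after : Half₁.Step A → Deficit A (E (card A))
        after st = decide outcome
          where
          open Half₁.Step st
          decide : H * fromℕ (card A) + κ * fromℕ (card C) ≤ fromℕ (N A A) + (E (card C) + E (card Rst)) ⊎
            (m ℕ.≤ length (Half₁.reps C) × length (Half₂.reps A) ℕ.≤ length (Half₂.reps C) ×
              (∀ q → H * fromℕ (card C) ≤ fromℕ (N C C) + q → H * fromℕ (card A) ≤ fromℕ (N A A) + (q + E (card Rst)))) →
            Deficit A (E (card A))
          decide (inj₁ d) = from-split (card C , card Rst , parts , weaken {A} (no-error _) (drop-gain (proj₁ (gain (card C) (ℕ.≤-trans large (ℕ.*-monoˡ-≤ (card C) m≤M)))) d))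
          decide (inj₂ (many , _ , extend)) = join (split C C⊆X C≥1 (λ C′ le → ℕ.≤-trans large (ℕ.≤-trans (ℕ.*-monoʳ-≤ m le) (ℕ.≤-reflexive (≡.sym (ℕ.*-assoc m n (card C′)))))) many)
            where
            join : Split C → Deficit A (E (card A))
            join (a , b , a+b≡ , d) = conclude a b (card Rst) (≡.trans (≡.sym (ℕ.+-assoc a b (card Rst))) (≡.trans (≡.cong (ℕ._+ card Rst) a+b≡) parts))
              (≤-respʳ (+-congˡ (rest-last (E a) (E b) (E (card Rst)))) (extend _ d))

-- The error function and its behaviour under splitting.

module PowerLoss {ℓ} (R : CompleteOrderedField ℓ) where
  open Reals R hiding (total)
  open BrunnMinkowski R using (nthRoot; nthRoot-nonNeg; nthRoot-suc; nthRoot-mono; nthRoot-≥1)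
  open import Data.Nat.Base as ℕ using (ℕ; zero; suc; s≤s; z≤n)
  import Data.Nat.Properties as ℕ
  open import Data.Nat.DivMod using (_/_; _%_; m≡m%n+[m/n]*n; m%n<n)
  open import Data.Product.Base using (∃-syntax; _×_; _,_; proj₁)
  open import Relation.Nullary using (yes; no)
  import Relation.Binary.PropositionalEquality as ≡
  open ≡ using (_≡_)

  -- n^(1 - 1/s) for s = s′ + 1.
  loss-power : ℕ → ℕ → ℝ
  loss-power s′ n = nthRoot (suc s′) (n ℕ.^ s′)

  module _ (s′ : ℕ) where
    private
      s = suc s′
      y : ℕ → ℝ
      y = loss-power s′

    y-nonNeg : ∀ n → 0# ≤ y n
    y-nonNeg n = nthRoot-nonNeg s (n ℕ.^ s′)

    y-^ : ∀ n → y n ^ s ≈ fromℕ n ^ s′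
    y-^ n = ≈-trans (nthRoot-suc s′ (n ℕ.^ s′)) (fromℕ-^ n s′)

    y-mono : ∀ {m n} → m ℕ.≤ n → y m ≤ y n
    y-mono p = nthRoot-mono s (ℕ.^-monoˡ-≤ s′ p)

    y-≥1 : ∀ {n} → 1 ℕ.≤ n → 1# ≤ y n
    y-≥1 {n} p = nthRoot-≥1 s (≡.subst (ℕ._≤ n ℕ.^ s′) (ℕ.^-zeroˡ s′) (ℕ.^-monoˡ-≤ s′ p))

    y-scale : ∀ {m n c} → 1 ℕ.≤ c → n ℕ.≤ c ℕ.* m → y n ≤ fromℕ c * y m
    y-scale {m} {n} {c} c≥1 p = ^-cancel-≤ s′ (*-nonNegative (fromℕ-nonNeg c) (y-nonNeg m)) (≤-respˡ (≈-sym (y-^ n)) (≤-respʳ (≈-sym (≈-trans (^-distrib-* (fromℕ c) (y m) s) (*-congˡ (y-^ m))))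
      (≤-trans (^-mono-≤ s′ (fromℕ-nonNeg n) (≤-respʳ (fromℕ-* c m) (fromℕ-mono p))) (≤-respˡ (≈-sym (^-distrib-* (fromℕ c) (fromℕ m) s′))
        (*-monoʳ-≤ (fromℕ m ^ s′) (^-nonNeg s′ (fromℕ-nonNeg m)) (≤-respˡ (*-identityˡ _) (*-monoʳ-≤ (fromℕ c ^ s′) (^-nonNeg s′ (fromℕ-nonNeg c)) (fromℕ-≥1 c≥1))))))))

    w : ℕ → ℝ
    w n = nthRoot s n

    y*w : ∀ n → y n * w n ≈ fromℕ n
    y*w n = antisym (^-cancel-≤ s′ (fromℕ-nonNeg n) (≤-reflexive powers)) (^-cancel-≤ s′ (*-nonNegative (y-nonNeg n) (nthRoot-nonNeg s n)) (≤-reflexive (≈-sym powers)))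
      where
      powers : (y n * w n) ^ s ≈ fromℕ n ^ s
      powers = ≈-trans (^-distrib-* (y n) (w n) s) (≈-trans (*-cong (y-^ n) (nthRoot-suc s′ n)) (*-comm _ _))

    am-gm : ∀ {a b} → 0# ≤ a → 0# ≤ b → fromℕ s ^ s * (a ^ s′ * b) ≤ (fromℕ s′ * a + b) ^ s
    am-gm {a} {b} 0≤a 0≤b = ≤-respˡ left (≤-respʳ (^-cong s right) (bernoulli (fromℕ s * a) (b - a) s′ (*-nonNegative (fromℕ-nonNeg s) 0≤a)
      (≤-respʳ (≈-sym right) (+-nonNeg (*-nonNegative (fromℕ-nonNeg s′) 0≤a) 0≤b))))
      where
      right : fromℕ s * a + (b - a) ≈ fromℕ s′ * a + b
      right = solve 3 (λ n a b → (:1 :+ n) :* a :+ (b :- a) := n :* a :+ b) ≡.refl (fromℕ s′) a b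
      left : (fromℕ s * a) ^ s + fromℕ s * ((fromℕ s * a) ^ s′ * (b - a)) ≈ fromℕ s ^ s * (a ^ s′ * b)
      left = ≈-trans (solve 4 (λ n a b e → (n :* a) :* e :+ n :* (e :* (b :- a)) := n :* (e :* b)) ≡.refl (fromℕ s) a b ((fromℕ s * a) ^ s′))
        (≈-trans (*-congˡ (*-congʳ (^-distrib-* (fromℕ s) a s′))) (solve 4 (λ n p q b → n :* ((p :* q) :* b) := (n :* p) :* (q :* b)) ≡.refl (fromℕ s) (fromℕ s ^ s′) (a ^ s′) b))

    δ : ℝ
    δ = (fromℕ s) ⁻¹

    0≤δ : 0# ≤ δ
    0≤δ = proj₁ (⁻¹-pos (fromℕ-pos {s} (s≤s z≤n)))

    [1+δ]^s≥2 : fromℕ 2 ≤ (1# + δ) ^ s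
    [1+δ]^s≥2 = ≤-respˡ (≈-trans (+-cong (1^ s) (≈-trans (*-congˡ (≈-trans (*-congʳ (1^ s′)) (*-identityˡ δ))) (*-inverseʳ _ (pos⇒≉0 (fromℕ-pos {s} (s≤s z≤n)))))) (+-congˡ (≈-sym (+-identityʳ 1#))))
      (bernoulli 1# δ s′ 0≤1 (+-nonNeg 0≤1 0≤δ))

    private
      -- The tangent at n / 2 to the concave function z^(1 - 1/s), with 2^(1/s) replaced by 1 + δ.
      -- For z = a and z = b with a + b = n the two tangent values add up to (1 + δ) y(n).
      part : ∀ z n → (fromℕ 2 * (fromℕ s * fromℕ n)) * y z ≤ (1# + δ) * (y n * (fromℕ s′ * (fromℕ 2 * fromℕ z) + fromℕ n))
      part z n = ^-cancel-≤ s′ (*-nonNegative 0≤1+δ (*-nonNegative (y-nonNeg n) 0≤W)) (≤-respˡ (≈-sym left) (≤-respʳ (≈-sym right)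
        (*-mono-≤ (fromℕ-nonNeg 2) [1+δ]^s≥2 (*-nonNegative (^-nonNeg s′ (fromℕ-nonNeg n)) (*-nonNegative (^-nonNeg s (fromℕ-nonNeg s)) (*-nonNegative (^-nonNeg s′ 0≤2z) (fromℕ-nonNeg n))))
          (*-monoˡ-≤ (fromℕ n ^ s′) (^-nonNeg s′ (fromℕ-nonNeg n)) (am-gm 0≤2z (fromℕ-nonNeg n))))))
        where
        0≤1+δ = +-nonNeg 0≤1 0≤δ
        0≤2z = *-nonNegative (fromℕ-nonNeg 2) (fromℕ-nonNeg z)
        W = fromℕ s′ * (fromℕ 2 * fromℕ z) + fromℕ n
        0≤W = +-nonNeg (*-nonNegative (fromℕ-nonNeg s′) 0≤2z) (fromℕ-nonNeg n)
        right : ((1# + δ) * (y n * W)) ^ s ≈ (1# + δ) ^ s * (fromℕ n ^ s′ * W ^ s)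
        right = ≈-trans (^-distrib-* (1# + δ) (y n * W) s) (*-congˡ (≈-trans (^-distrib-* (y n) W s) (*-congʳ (y-^ n))))
        left : ((fromℕ 2 * (fromℕ s * fromℕ n)) * y z) ^ s ≈ fromℕ 2 * (fromℕ n ^ s′ * (fromℕ s ^ s * ((fromℕ 2 * fromℕ z) ^ s′ * fromℕ n)))
        left = ≈-trans (^-distrib-* _ (y z) s) (≈-trans (*-cong (≈-trans (^-distrib-* (fromℕ 2) _ s) (*-congˡ (^-distrib-* (fromℕ s) (fromℕ n) s))) (y-^ z))
          (≈-trans (solve 6 (λ t t′ ss m m′ z → (t :* t′ :* (ss :* (m :* m′))) :* z := t :* (m′ :* (ss :* ((t′ :* z) :* m)))) ≡.refl (fromℕ 2) (fromℕ 2 ^ s′) (fromℕ s ^ s) (fromℕ n) (fromℕ n ^ s′) (fromℕ z ^ s′))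
            (*-congˡ (*-congˡ (*-congˡ (*-congʳ (≈-sym (^-distrib-* (fromℕ 2) (fromℕ z) s′))))))))

    y-split : ∀ a b → 1 ℕ.≤ a ℕ.+ b → y a + y b ≤ (1# + δ) * y (a ℕ.+ b)
    y-split a b n≥1 = *-cancelˡ-≤ (fromℕ 2 * (fromℕ s * fromℕ n)) (*-pos (fromℕ-pos {2} (s≤s z≤n)) (*-pos (fromℕ-pos {s} (s≤s z≤n)) (fromℕ-pos {n} n≥1)))
      (≤-respˡ (≈-sym (distribˡ _ (y a) (y b))) (≤-respʳ eq (+-mono-≤ (part a n) (part b n))))
      where
      n = a ℕ.+ b
      eq : (1# + δ) * (y n * (fromℕ s′ * (fromℕ 2 * fromℕ a) + fromℕ n)) + (1# + δ) * (y n * (fromℕ s′ * (fromℕ 2 * fromℕ b) + fromℕ n)) ≈ (fromℕ 2 * (fromℕ s * fromℕ n)) * ((1# + δ) * y n)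
      eq = ≈-trans (solve 7 (λ e y t a b m p → e :* (y :* (m :* (t :* a) :+ p)) :+ e :* (y :* (m :* (t :* b) :+ p)) := e :* (y :* (m :* (t :* (a :+ b)) :+ (p :+ p)))) ≡.refl (1# + δ) (y n) (fromℕ 2) (fromℕ a) (fromℕ b) (fromℕ s′) (fromℕ n))
        (≈-trans (*-congˡ (*-congˡ (+-congʳ (*-congˡ (*-congˡ (≈-sym (fromℕ-+ a b))))))) (solve 4 (λ e y m p → e :* (y :* (m :* ((:1 :+ (:1 :+ :0)) :* p) :+ (p :+ p))) := ((:1 :+ (:1 :+ :0)) :* ((:1 :+ m) :* p)) :* (e :* y)) ≡.refl (1# + δ) (y n) (fromℕ s′) (fromℕ n)))

  n<2^n : ∀ n → n ℕ.< 2 ℕ.^ n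
  n<2^n zero = s≤s z≤n
  n<2^n (suc n) = ℕ.≤-trans (ℕ.+-mono-≤ (ℕ.m^n>0 2 n) (n<2^n n)) (ℕ.≤-reflexive (≡.cong (2 ℕ.^ n ℕ.+_) (≡.sym (ℕ.+-identityʳ (2 ℕ.^ n)))))

  ^-distribʳ-* : ∀ m n o → (m ℕ.* n) ℕ.^ o ≡ m ℕ.^ o ℕ.* n ℕ.^ o
  ^-distribʳ-* m n zero = ≡.refl
  ^-distribʳ-* m n (suc o) = ≡.trans (≡.cong (m ℕ.* n ℕ.*_) (^-distribʳ-* m n o)) (ℕ.[m*n]*[o*p]≡[m*o]*[n*p] m n (m ℕ.^ o) (n ℕ.^ o))

  -- With q the quotient of τ by r, the base is at most (4r + 2)(q + 1), and (q + 1)^r ≤ 2^(q r) ≤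
  -- 2^τ. Thus the polynomial growth of iterated sums costs only the square root of the length
  -- 2^(2τ) of the progression.
  polynomial≤exponential : ∀ r τ → 1 ℕ.≤ r → suc (suc ((τ ℕ.+ τ) ℕ.+ (τ ℕ.+ τ))) ℕ.^ r ℕ.≤ (4 ℕ.* r ℕ.+ 2) ℕ.^ r ℕ.* 2 ℕ.^ τ
  polynomial≤exponential r@(suc _) τ _ = begin
    suc (suc ((τ ℕ.+ τ) ℕ.+ (τ ℕ.+ τ))) ℕ.^ r     ≤⟨ ℕ.^-monoˡ-≤ r linear-bound ⟩
    (C ℕ.* 2 ℕ.^ q) ℕ.^ r                         ≡⟨ ^-distribʳ-* C (2 ℕ.^ q) r ⟩
    C ℕ.^ r ℕ.* (2 ℕ.^ q) ℕ.^ r                   ≡⟨ ≡.cong (C ℕ.^ r ℕ.*_) (ℕ.^-*-assoc 2 q r) ⟩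
    C ℕ.^ r ℕ.* 2 ℕ.^ (q ℕ.* r)                   ≤⟨ ℕ.*-monoʳ-≤ (C ℕ.^ r) (ℕ.^-monoʳ-≤ 2 (ℕ.≤-trans (ℕ.m≤n+m (q ℕ.* r) (τ % r)) (ℕ.≤-reflexive (≡.sym (m≡m%n+[m/n]*n τ r))))) ⟩
    C ℕ.^ r ℕ.* 2 ℕ.^ τ                           ∎
    where
    open ℕ.≤-Reasoning
    open import Data.Nat.Solver using (module +-*-Solver)
    q = τ / r
    C = 4 ℕ.* r ℕ.+ 2
    τ≤ : τ ℕ.≤ r ℕ.* suc q
    τ≤ = ℕ.≤-trans (ℕ.≤-reflexive (m≡m%n+[m/n]*n τ r)) (ℕ.≤-trans (ℕ.+-monoˡ-≤ (q ℕ.* r) (ℕ.<⇒≤ (m%n<n τ r))) (ℕ.≤-reflexive (≡.trans (≡.cong (r ℕ.+_) (ℕ.*-comm q r)) (≡.sym (ℕ.*-suc r q)))))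
    linear-bound : suc (suc ((τ ℕ.+ τ) ℕ.+ (τ ℕ.+ τ))) ℕ.≤ C ℕ.* 2 ℕ.^ q
    linear-bound = begin
      suc (suc ((τ ℕ.+ τ) ℕ.+ (τ ℕ.+ τ)))         ≤⟨ s≤s (s≤s (ℕ.+-mono-≤ (ℕ.+-mono-≤ τ≤ τ≤) (ℕ.+-mono-≤ τ≤ τ≤))) ⟩
      2 ℕ.+ ((r ℕ.* suc q ℕ.+ r ℕ.* suc q) ℕ.+ (r ℕ.* suc q ℕ.+ r ℕ.* suc q)) ≤⟨ ℕ.+-monoˡ-≤ _ (ℕ.m≤m*n 2 (suc q)) ⟩
      2 ℕ.* suc q ℕ.+ ((r ℕ.* suc q ℕ.+ r ℕ.* suc q) ℕ.+ (r ℕ.* suc q ℕ.+ r ℕ.* suc q)) ≡⟨ +-*-Solver.solve 2 (λ r q → +-*-Solver.con 2 +-*-Solver.:* q +-*-Solver.:+ ((r +-*-Solver.:* q +-*-Solver.:+ r +-*-Solver.:* q) +-*-Solver.:+ (r +-*-Solver.:* q +-*-Solver.:+ r +-*-Solver.:* q)) +-*-Solver.:= (+-*-Solver.con 4 +-*-Solver.:* r +-*-Solver.:+ +-*-Solver.con 2) +-*-Solver.:* q) ≡.refl r (suc q) ⟩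
      C ℕ.* suc q                                  ≤⟨ ℕ.*-monoʳ-≤ C (n<2^n q) ⟩
      C ℕ.* 2 ℕ.^ q                                ∎

  -- The even exponent gives 2τ binary digits: half of them absorb the polynomial factor, and the
  -- other half remain as the factor 2^τ saved in the number of lines.
  bracket : ∀ r n → 2 ℕ.≤ r → 2 ℕ.≤ n → ∃[ τ ] (r ℕ.^ (τ ℕ.+ τ) ℕ.< n × n ℕ.≤ r ℕ.^ (suc τ ℕ.+ suc τ))
  bracket r n r≥2 n≥2 = search n 0 n≥2 (≡.subst (λ k → n ℕ.≤ r ℕ.^ (k ℕ.+ k)) (≡.sym (ℕ.+-identityʳ n)) enough)
    where
    enough : n ℕ.≤ r ℕ.^ (n ℕ.+ n)
    enough = ℕ.≤-trans (ℕ.<⇒≤ (n<2^n n)) (ℕ.≤-trans (ℕ.^-monoˡ-≤ n r≥2) (ℕ.^-monoʳ-≤ r {{ℕ.>-nonZero (ℕ.≤-trans (s≤s z≤n) r≥2)}} (ℕ.m≤m+n n n)))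
    search : ∀ fuel τ → r ℕ.^ (τ ℕ.+ τ) ℕ.< n → n ℕ.≤ r ℕ.^ ((fuel ℕ.+ τ) ℕ.+ (fuel ℕ.+ τ)) → ∃[ τ ] (r ℕ.^ (τ ℕ.+ τ) ℕ.< n × n ℕ.≤ r ℕ.^ (suc τ ℕ.+ suc τ))
    search zero τ lt le = τ , lt , ℕ.≤-trans le (ℕ.^-monoʳ-≤ r {{ℕ.>-nonZero (ℕ.≤-trans (s≤s z≤n) r≥2)}} (ℕ.+-mono-≤ (ℕ.n≤1+n τ) (ℕ.n≤1+n τ)))
    search (suc fuel) τ lt le with r ℕ.^ (suc τ ℕ.+ suc τ) ℕ.<? n
    ... | yes lt′ = search fuel (suc τ) lt′ (≡.subst (λ k → n ℕ.≤ r ℕ.^ (k ℕ.+ k)) (≡.sym (ℕ.+-suc fuel τ)) le)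
    ... | no ≮ = τ , lt , ℕ.≮⇒≥ ≮

-- Comparison of the Brunn-Minkowski error with the error function.

module Estimates {ℓ} (R : CompleteOrderedField ℓ) where
  open Reals R hiding (total)
  open Reals R using () renaming (total to ≤-total)
  open BrunnMinkowski R using (nthRoot; nthRoot-nonNeg; nthRoot-suc; nthRoot-≥1)
  open PowerLoss R
  open import Data.Nat.Base as ℕ using (ℕ; zero; suc; s≤s; z≤n)
  import Data.Nat.Properties as ℕ
  open import Data.Sum.Base using (inj₁; inj₂)
  open import Relation.Nullary using (yes; no; ¬_)
  import Relation.Binary.PropositionalEquality as ≡
  open ≡ using (_≡_)

  ^-superadditive : ∀ {a b} n → 0# ≤ a → 0# ≤ b → a ^ suc n + b ^ suc n ≤ (a + b) ^ suc n
  ^-superadditive {a} {b} zero 0≤a 0≤b = ≤-reflexive (≈-trans (+-cong (*-identityʳ a) (*-identityʳ b)) (≈-sym (*-identityʳ (a + b))))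
  ^-superadditive {a} {b} (suc n) 0≤a 0≤b = ≤-trans (≤-by (a * b ^ suc n + b * a ^ suc n) (+-nonNeg (*-nonNegative 0≤a (^-nonNeg (suc n) 0≤b)) (*-nonNegative 0≤b (^-nonNeg (suc n) 0≤a)))
      (solve 4 (λ a b u v → (a :+ b) :* (u :+ v) := (a :* u :+ b :* v) :+ (a :* v :+ b :* u)) ≡.refl a b (a ^ suc n) (b ^ suc n)))
    (*-monoˡ-≤ (a + b) (+-nonNeg 0≤a 0≤b) (^-superadditive n 0≤a 0≤b))

  private
    difference-error : ∀ {k α β ν x ε u} → 0# ≤ x → 0# ≤ α → 0# ≤ β → α ≤ ν → β ≤ ν → 0# ≤ ε → (α + β) - x ≤ ε → x ^ suc k ≤ u →
      (α + β) ^ suc k ≤ u + fromℕ (suc k) * ((ν + ν) ^ k * ε)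
    difference-error {k} {α} {β} {ν} {x} {ε} 0≤x 0≤α 0≤β α≤ν β≤ν 0≤ε close le = ≤-trans (power-difference k 0≤x (+-nonNeg 0≤α 0≤β))
      (+-mono-≤ le (*-monoˡ-≤ (fromℕ (suc k)) (fromℕ-nonNeg (suc k))
        (≤-trans (*-monoˡ-≤ ((α + β) ^ k) (^-nonNeg k (+-nonNeg 0≤α 0≤β)) close) (*-monoʳ-≤ ε 0≤ε (^-mono-≤ k (+-nonNeg 0≤α 0≤β) (+-mono-≤ α≤ν β≤ν))))))

  -- Replacing β by β - ε, where ε^(k+1) is the size of the loss, turns an estimate for
  -- |Y| - loss into one for |Y|.
  absorb-loss : ∀ {k α β ν ε e s q} → 0# ≤ α → 0# ≤ β → 0# ≤ ε → α ≤ ν → β ≤ ν → ε ^ suc k ≈ fromℕ e →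
    β ^ suc k ≤ fromℕ s → α ^ suc k ≤ fromℕ q →
    (∀ β′ → 0# ≤ β′ → β′ ^ suc k ≤ fromℕ (s ℕ.∸ e) → (α + β′) ^ suc k ≤ fromℕ q) →
    (α + β) ^ suc k ≤ fromℕ q + fromℕ (suc k) * ((ν + ν) ^ k * ε)
  absorb-loss {k} {α} {β} {ν} {ε} {e} {s} {q} 0≤α 0≤β 0≤ε α≤ν β≤ν ε^≈ β≤s α≤q bm with ≤-total ε β
  ... | inj₁ ε≤β = difference-error {k} (+-nonNeg 0≤α 0≤β-ε) 0≤α 0≤β α≤ν β≤ν 0≤ε (≤-reflexive (solve 3 (λ a b e → (a :+ b) :- (a :+ (b :- e)) := e) ≡.refl α β ε))
      (bm (β - ε) 0≤β-ε (≤-by (fromℕ (e ℕ.+ (s ℕ.∸ e)) - fromℕ e - (β - ε) ^ suc k) (difference enough)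
        (≈-trans (solve 3 (λ a x e → a := x :+ (((e :+ a) :- e) :- x)) ≡.refl (fromℕ (s ℕ.∸ e)) ((β - ε) ^ suc k) (fromℕ e))
          (+-congˡ (+-congʳ (+-congʳ (≈-sym (fromℕ-+ e (s ℕ.∸ e)))))))))
    where
    0≤β-ε = difference ε≤β
    enough : (β - ε) ^ suc k ≤ fromℕ (e ℕ.+ (s ℕ.∸ e)) - fromℕ e
    enough = ≤-by (fromℕ (e ℕ.+ (s ℕ.∸ e)) - ((β - ε) ^ suc k + fromℕ e))
      (difference (≤-trans (≤-respˡ (+-congˡ ε^≈) (^-superadditive k 0≤β-ε 0≤ε))
        (≤-respˡ (^-cong (suc k) (solve 2 (λ b e → b := (b :- e) :+ e) ≡.refl β ε)) (≤-trans β≤s (fromℕ-mono (ℕ.m≤n+m∸n s e))))))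
      (solve 3 (λ a x e → a :- e := x :+ (a :- (x :+ e))) ≡.refl (fromℕ (e ℕ.+ (s ℕ.∸ e))) ((β - ε) ^ suc k) (fromℕ e))
  -- Now β is itself within the error, and `α≤q` suffices.
  ... | inj₂ β≤ε = difference-error {k} 0≤α 0≤α 0≤β α≤ν β≤ν 0≤ε (≤-respˡ (solve 2 (λ a b → b := (a :+ b) :- a) ≡.refl α β) β≤ε) α≤q

  -- s - 1 for s = (k+1)(j+1).
  exponent : ℕ → ℕ → ℕ
  exponent k j = j ℕ.+ k ℕ.* suc j

  -- Since s = (k + 1)(j + 1), the left side is n^(1/(j+1)), while n ≤ (r²)^(τ+1) ≤ 2^((j+1)(τ+1)).
  -- So j is chosen large against r in order to keep this power of n below the factor saved in the
  -- lines.
  w-bound : ∀ k j r τ n → r ℕ.* r ℕ.≤ suc j → n ℕ.≤ r ℕ.^ (suc τ ℕ.+ suc τ) → w (exponent k j) n ^ suc k ≤ fromℕ (2 ℕ.* 2 ℕ.^ τ)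
  w-bound k j r τ n r²≤ n≤ = ^-cancel-≤ j (fromℕ-nonNeg (2 ℕ.* 2 ℕ.^ τ)) (≤-respˡ (≈-sym (≈-trans (^-^ (w (exponent k j) n) (suc k) (suc j)) (nthRoot-suc (exponent k j) n)))
    (≤-respʳ (fromℕ-^ (2 ℕ.^ suc τ) (suc j)) (fromℕ-mono chain)))
    where
    open ℕ.≤-Reasoning
    chain : n ℕ.≤ (2 ℕ.^ suc τ) ℕ.^ suc j
    chain = begin
      n                              ≤⟨ n≤ ⟩
      r ℕ.^ (suc τ ℕ.+ suc τ)        ≡⟨ ℕ.^-distribˡ-+-* r (suc τ) (suc τ) ⟩
      r ℕ.^ suc τ ℕ.* r ℕ.^ suc τ    ≡⟨ ^-distribʳ-* r r (suc τ) ⟨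
      (r ℕ.* r) ℕ.^ suc τ            ≤⟨ ℕ.^-monoˡ-≤ (suc τ) (ℕ.≤-trans r²≤ (ℕ.<⇒≤ (n<2^n (suc j)))) ⟩
      (2 ℕ.^ suc j) ℕ.^ suc τ        ≡⟨ ℕ.^-*-assoc 2 (suc j) (suc τ) ⟩
      2 ℕ.^ (suc j ℕ.* suc τ)        ≡⟨ ≡.cong (2 ℕ.^_) (ℕ.*-comm (suc j) (suc τ)) ⟩
      2 ℕ.^ (suc τ ℕ.* suc j)        ≡⟨ ℕ.^-*-assoc 2 (suc τ) (suc j) ⟨
      (2 ℕ.^ suc τ) ℕ.^ suc j        ∎

  module _ (k s′ : ℕ) {n T : ℕ} (n≥1 : 1 ℕ.≤ n) (w≤ : w s′ n ^ suc k ≤ fromℕ (2 ℕ.* T)) where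

    -- Multiplied by w = n^(1/s) and raised to the power k + 1, the left side becomes a constant
    -- times n^k e w^(k+1). Here e is at most K n / T and w^(k+1) at most 2T, so T cancels.
    error-bound : ∀ {e K} → e ℕ.* T ℕ.≤ K ℕ.* n → let ν = nthRoot (suc k) n in
      fromℕ (suc k) * ((ν + ν) ^ k * nthRoot (suc k) e) ≤ fromℕ (suc (2 ℕ.* ((suc k ℕ.* 2 ℕ.^ k) ℕ.^ suc k ℕ.* K))) * loss-power s′ n
    error-bound {e} {K} eT≤ = *-cancelˡ-≤ (w s′ n) (<-≤-trans 0<1 (nthRoot-≥1 (suc s′) n≥1)) (≤-respˡ (*-comm _ (w s′ n)) (≤-respʳ target
      (^-cancel-≤ k (*-nonNegative (fromℕ-nonNeg K₆) (fromℕ-nonNeg n)) (≤-respˡ (≈-sym left) (≤-respʳ (≈-sym (^-distrib-* (fromℕ K₆) (fromℕ n) (suc k))) (≤-trans middle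
        (*-monoʳ-≤ (fromℕ n ^ suc k) (^-nonNeg (suc k) (fromℕ-nonNeg n)) K₆≤)))))))
      where
      K₅ = (suc k ℕ.* 2 ℕ.^ k) ℕ.^ suc k
      K₆ = suc (2 ℕ.* (K₅ ℕ.* K))
      ν = nthRoot (suc k) n
      ε = nthRoot (suc k) e
      W = w s′ n
      err = fromℕ (suc k) * ((ν + ν) ^ k * ε)
      target : fromℕ K₆ * fromℕ n ≈ W * (fromℕ K₆ * loss-power s′ n)
      target = ≈-trans (*-congˡ (≈-sym (y*w s′ n))) (solve 3 (λ k y w → k :* (y :* w) := w :* (k :* y)) ≡.refl (fromℕ K₆) (loss-power s′ n) W)
      D = fromℕ (suc k ℕ.* 2 ℕ.^ k)
      err≈ : err ≈ D * (ν ^ k * ε)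
      err≈ = ≈-trans (*-congˡ (*-congʳ (≈-trans (^-cong k (solve 1 (λ v → v :+ v := (:1 :+ (:1 :+ :0)) :* v) ≡.refl ν)) (^-distrib-* (fromℕ 2) ν k))))
        (≈-trans (solve 4 (λ d t v e → d :* ((t :* v) :* e) := (d :* t) :* (v :* e)) ≡.refl (fromℕ (suc k)) (fromℕ 2 ^ k) (ν ^ k) ε)
          (*-congʳ (≈-sym (≈-trans (fromℕ-* (suc k) (2 ℕ.^ k)) (*-congˡ (fromℕ-^ 2 k))))))
      νk : (ν ^ k) ^ suc k ≈ fromℕ n ^ k
      νk = ≈-trans (^-^ ν k (suc k)) (≈-trans (reflexive (≡.cong (ν ^_) (ℕ.*-comm k (suc k)))) (≈-trans (≈-sym (^-^ ν (suc k) k)) (^-cong k (nthRoot-suc k n))))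
      left : (err * W) ^ suc k ≈ (fromℕ K₅ * fromℕ n ^ k) * (fromℕ e * W ^ suc k)
      left = ≈-trans (^-distrib-* err W (suc k)) (≈-trans (*-congʳ (≈-trans (^-cong (suc k) err≈) (≈-trans (^-distrib-* D (ν ^ k * ε) (suc k))
          (*-cong (≈-sym (fromℕ-^ (suc k ℕ.* 2 ℕ.^ k) (suc k))) (≈-trans (^-distrib-* (ν ^ k) ε (suc k)) (*-cong νk (nthRoot-suc k e)))))))
        (solve 4 (λ a b c d → (a :* (b :* c)) :* d := (a :* b) :* (c :* d)) ≡.refl (fromℕ K₅) (fromℕ n ^ k) (fromℕ e) (W ^ suc k)))
      eW : fromℕ e * W ^ suc k ≤ fromℕ (2 ℕ.* (K ℕ.* n))
      eW = ≤-trans (*-monoˡ-≤ (fromℕ e) (fromℕ-nonNeg e) w≤) (≤-respˡ (fromℕ-* e (2 ℕ.* T)) (fromℕ-mono (ℕ.≤-trans (ℕ.≤-reflexive rearrange) (ℕ.*-monoʳ-≤ 2 eT≤))))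
        where
        rearrange : e ℕ.* (2 ℕ.* T) ≡ 2 ℕ.* (e ℕ.* T)
        rearrange = ≡.trans (≡.sym (ℕ.*-assoc e 2 T)) (≡.trans (≡.cong (ℕ._* T) (ℕ.*-comm e 2)) (ℕ.*-assoc 2 e T))
      middle : (fromℕ K₅ * fromℕ n ^ k) * (fromℕ e * W ^ suc k) ≤ fromℕ (2 ℕ.* (K₅ ℕ.* K)) * fromℕ n ^ suc k
      middle = ≤-trans (*-monoˡ-≤ (fromℕ K₅ * fromℕ n ^ k) (*-nonNegative (fromℕ-nonNeg K₅) (^-nonNeg k (fromℕ-nonNeg n))) eW) (≤-reflexive
        (≈-trans (*-congˡ (≈-trans (fromℕ-* 2 (K ℕ.* n)) (*-congˡ (fromℕ-* K n))))
          (≈-trans (solve 5 (λ a p t b n → (a :* p) :* (t :* (b :* n)) := (t :* (a :* b)) :* (n :* p)) ≡.refl (fromℕ K₅) (fromℕ n ^ k) (fromℕ 2) (fromℕ K) (fromℕ n))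
            (*-congʳ (≈-sym (≈-trans (fromℕ-* 2 (K₅ ℕ.* K)) (*-congˡ (fromℕ-* K₅ K))))))))
      K₆≤ : fromℕ (2 ℕ.* (K₅ ℕ.* K)) ≤ fromℕ K₆ ^ suc k
      K₆≤ = ≤-trans (fromℕ-mono {2 ℕ.* (K₅ ℕ.* K)} {K₆} (ℕ.n≤1+n (2 ℕ.* (K₅ ℕ.* K)))) (≤-respˡ (*-identityʳ (fromℕ K₆)) (*-monoˡ-≤ (fromℕ K₆) (fromℕ-nonNeg K₆) (^-≥1 k (fromℕ-≥1 {K₆} (s≤s z≤n)))))

    -- If T were at most Q, then n^(1/s) ≤ 2Q, so h n = h n^(1/s) y(n) would already be below D
    -- y(n). Small sets are thus covered by the error term alone.
    scale-large : ∀ {h Q D} → 2 ℕ.* h ℕ.* Q ℕ.≤ D → ¬ fromℕ h * fromℕ n ≤ fromℕ D * loss-power s′ n → Q ℕ.< T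
    scale-large {h} {Q} {D} D≥ small with T ℕ.≤? Q
    ... | no T≰Q = ℕ.≰⇒> T≰Q
    ... | yes T≤Q = ⊥-elim (small (≤-respˡ (*-congˡ (y*w s′ n)) (≤-trans (*-monoˡ-≤ (fromℕ h) (fromℕ-nonNeg h) (*-monoˡ-≤ Y 0≤Y w≤2Q))
        (≤-trans (≤-reflexive (≈-trans (≈-sym (*-assoc (fromℕ h) Y (fromℕ (2 ℕ.* Q)))) (≈-trans (solve 3 (λ h y q → (h :* y) :* q := (h :* q) :* y) ≡.refl (fromℕ h) Y (fromℕ (2 ℕ.* Q))) (*-congʳ (≈-sym (fromℕ-* h (2 ℕ.* Q)))))))
          (*-monoʳ-≤ Y 0≤Y (fromℕ-mono (ℕ.≤-trans (ℕ.≤-reflexive rearrange) D≥)))))))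
      where
      open import Data.Empty using (⊥-elim)
      Y = loss-power s′ n
      0≤Y = y-nonNeg s′ n
      rearrange : h ℕ.* (2 ℕ.* Q) ≡ 2 ℕ.* h ℕ.* Q
      rearrange = ≡.trans (≡.sym (ℕ.*-assoc h 2 Q)) (≡.cong (ℕ._* Q) (ℕ.*-comm h 2))
      w≤2Q : w s′ n ≤ fromℕ (2 ℕ.* Q)
      w≤2Q = ≤-trans (≤-respˡ (*-identityʳ (w s′ n)) (*-monoˡ-≤ (w s′ n) (nthRoot-nonNeg (suc s′) n) (^-≥1 k (nthRoot-≥1 (suc s′) n≥1)))) (≤-trans w≤ (fromℕ-mono (ℕ.*-monoʳ-≤ 2 T≤Q)))

  gain-≤ : ∀ {κ ε a c} K → fromℕ (2 ℕ.* K) * ε ≈ κ → 0# ≤ ε → a ≤ fromℕ K * c → (ε + ε) * a ≤ κ * c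
  gain-≤ {κ} {ε} {a} {c} K ε≈ 0≤ε le = ≤-trans (*-monoˡ-≤ (ε + ε) (+-nonNeg 0≤ε 0≤ε) le) (≤-reflexive
    (≈-trans (solve 3 (λ e k c → (e :+ e) :* (k :* c) := (((:1 :+ (:1 :+ :0)) :* k) :* e) :* c) ≡.refl ε (fromℕ K) c) (*-congʳ (≈-trans (*-congʳ (≈-sym (fromℕ-* 2 K))) ε≈))))

  module _ (s″ : ℕ) where
    private
      s′ = suc s″
      Y = loss-power s′
      δ₀ = δ s′

    y-0 : Y 0 ≈ 0#
    y-0 = antisym (^-cancel-≤ s′ ≤-refl (≤-reflexive (≈-trans (y-^ s′ 0) (≈-trans (zeroˡ _) (≈-sym (zeroˡ _)))))) (y-nonNeg s′ 0)

    y-split′ : ∀ a b → Y a + Y b ≤ (1# + δ₀) * Y (a ℕ.+ b)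
    y-split′ zero zero = ≤-reflexive (≈-trans (≈-trans (+-cong y-0 y-0) (+-identityˡ 0#)) (≈-sym (≈-trans (*-congˡ y-0) (zeroʳ _))))
    y-split′ zero (suc b) = y-split s′ zero (suc b) (s≤s z≤n)
    y-split′ (suc a) b = y-split s′ (suc a) b (s≤s z≤n)

    -- Two splittings cost (1 + δ)², which is at most 1 + 3δ when δ ≤ 1.
    y-split₃ : ∀ {ε} a b c n → a ℕ.+ (b ℕ.+ c) ≡ n → fromℕ 3 * δ₀ ≤ ε → δ₀ ≤ 1# → Y a + (Y b + Y c) ≤ (1# + ε) * Y n
    y-split₃ {ε} a b c n ≡.refl 3δ≤ε δ≤1 = ≤-trans (≤-trans (+-mono-≤ (≤-by (δ₀ * Y a) (*-nonNegative 0≤δ₀ (y-nonNeg s′ a)) ≈-refl) (y-split′ b c))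
      (≤-respˡ (solve 3 (λ d a b → (:1 :+ d) :* (a :+ b) := (a :+ d :* a) :+ (:1 :+ d) :* b) ≡.refl δ₀ (Y a) (Y (b ℕ.+ c))) (*-monoˡ-≤ (1# + δ₀) (+-nonNeg 0≤1 0≤δ₀) (y-split′ a (b ℕ.+ c)))))
      (≤-respˡ (*-assoc (1# + δ₀) (1# + δ₀) (Y n)) (*-monoʳ-≤ (Y n) (y-nonNeg s′ n) square))
      where
      0≤δ₀ = 0≤δ s′
      square : (1# + δ₀) * (1# + δ₀) ≤ 1# + ε
      square = ≤-by (δ₀ * (1# - δ₀) + (ε - fromℕ 3 * δ₀)) (+-nonNeg (*-nonNegative 0≤δ₀ (difference δ≤1)) (difference 3δ≤ε))
        (solve 2 (λ d e → :1 :+ e := (:1 :+ d) :* (:1 :+ d) :+ (d :* (:1 :- d) :+ (e :- (:1 :+ (:1 :+ (:1 :+ :0))) :* d))) ≡.refl δ₀ ε)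

    -- One ε pays for the splittings, the other for the M errors of Brunn-Minkowski; hence a gain
    -- with factor 2ε is called for.
    three-parts : ∀ {ε D err K M} a b c n → a ℕ.+ (b ℕ.+ c) ≡ n → fromℕ 3 * δ₀ ≤ ε → δ₀ ≤ 1# → err ≤ fromℕ K * Y n → fromℕ (M ℕ.* K) ≤ ε * fromℕ D →
      (fromℕ D * Y a + (fromℕ D * Y b + fromℕ D * Y c)) + fromℕ M * err ≤ fromℕ D * Y n + (ε + ε) * (fromℕ D * Y n)
    three-parts {ε} {D} {err} {K} {M} a b c n sum≡ 3δ≤ δ≤1 err≤ D≥ = ≤-trans (+-mono-≤ (≤-respˡ (solve 4 (λ d a b c → d :* (a :+ (b :+ c)) := d :* a :+ (d :* b :+ d :* c)) ≡.refl (fromℕ D) (Y a) (Y b) (Y c))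
        (*-monoˡ-≤ (fromℕ D) (fromℕ-nonNeg D) (y-split₃ a b c n sum≡ 3δ≤ δ≤1)))
        (≤-trans (*-monoˡ-≤ (fromℕ M) (fromℕ-nonNeg M) err≤) (≤-respˡ (≈-trans (*-congʳ (fromℕ-* M K)) (*-assoc (fromℕ M) (fromℕ K) (Y n))) (*-monoʳ-≤ (Y n) (y-nonNeg s′ n) D≥))))
      (≤-reflexive (solve 3 (λ d e y → d :* ((:1 :+ e) :* y) :+ (e :* d) :* y := d :* y :+ (e :+ e) :* (d :* y)) ≡.refl (fromℕ D) ε (Y n)))

    δ-small : ∀ {ε g} → 0# < ε → fromℕ 3 * ε ⁻¹ ≤ fromℕ g → g ℕ.≤ suc s′ → fromℕ 3 * δ₀ ≤ ε
    δ-small {ε} {g} 0<ε le g≤ = *-cancelˡ-≤ (fromℕ (suc s′)) (fromℕ-pos {suc s′} (s≤s z≤n)) (≤-respˡ (≈-sym left) (*-cancelˡ-≤ (ε ⁻¹) (⁻¹-pos 0<ε)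
      (≤-respˡ (*-comm (fromℕ 3) (ε ⁻¹)) (≤-respʳ (≈-sym right) (≤-trans le (fromℕ-mono g≤))))))
      where
      left : fromℕ (suc s′) * (fromℕ 3 * δ₀) ≈ fromℕ 3
      left = ≈-trans (solve 3 (λ s t d → s :* (t :* d) := t :* (s :* d)) ≡.refl (fromℕ (suc s′)) (fromℕ 3) δ₀) (≈-trans (*-congˡ (*-inverseʳ _ (pos⇒≉0 (fromℕ-pos {suc s′} (s≤s z≤n))))) (*-identityʳ _))
      right : ε ⁻¹ * (fromℕ (suc s′) * ε) ≈ fromℕ (suc s′)
      right = ≈-trans (solve 3 (λ i s e → i :* (s :* e) := s :* (e :* i)) ≡.refl (ε ⁻¹) (fromℕ (suc s′)) ε) (≈-trans (*-congˡ (*-inverseʳ ε (pos⇒≉0 0<ε))) (*-identityʳ _))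

    δ≤1 : δ₀ ≤ 1#
    δ≤1 = *-cancelˡ-≤ (fromℕ (suc s′)) (fromℕ-pos {suc s′} (s≤s z≤n)) (≤-respˡ (≈-sym (*-inverseʳ _ (pos⇒≉0 (fromℕ-pos {suc s′} (s≤s z≤n))))) (≤-respʳ (≈-sym (*-identityʳ _)) (fromℕ-≥1 {suc s′} (s≤s z≤n))))

-- Large parts generate lattices of full rank.

module FullDifferences (em : ∀ (P : Set) → Dec P) where
  open Counting
  open WithEM em
  open Vectors
  open IntegerLinear
  open RationalLinear using (lookup-ext)
  open Directions em
  open Lattices em using (Full; module IsSubgroup; IsSubgroup)
  open DifferenceLattices em
  open import Data.Nat.Base as ℕ using (ℕ; suc; s≤s; z≤n)
  import Data.Nat.Properties as ℕ
  open import Data.Integer.Base as ℤ using (ℤ; 0ℤ) renaming (+_ to pos)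
  import Data.Integer.Properties as ℤ
  open import Data.Fin.Base using (Fin)
  open import Data.List.Base using (List; map)
  open import Data.List.Membership.Propositional using (_∈_)
  open import Data.List.Membership.Propositional.Properties using (∈-map⁺)
  open import Data.Vec.Base using (Vec; tabulate) renaming (map to mapᵥ)
  open import Data.Vec.Properties using (lookup∘tabulate; lookup-map)
  open import Data.Product.Base using (∃-syntax; _×_; _,_; proj₁; proj₂)
  open import Data.Sum.Base using (inj₁; inj₂)
  open import Relation.Binary.PropositionalEquality

  -- If B has fewer lines than points in every coordinate direction, two points of B share a line.
  few-lines⇒full : ∀ {k} {φ : V (suc k) → V (suc k)} → Additive φ → Injective φ → ∀ B →
    (∀ i → card (map (drop i) (map φ B)) ℕ.< card B) → Full (Differences B)
  few-lines⇒full {k} {φ} φ-+ φ-inj B few = conclude (common-multiple P rescale each)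
    where
    open IsSubgroup (differences-subgroup {X = B})
    P : Fin (suc k) → ℕ → Set
    P i c = ∃[ γ ] (Differences B γ × φ γ ≡ pos c ⋆ unit i)
    rescale : ∀ {i c} m → P i c → P i (m ℕ.* c)
    rescale {i} {c} m (γ , γ∈ , e) = pos m ⋆ γ , ⋆∈ (pos m) γ∈ , trans (additive-⋆ φ-+ (pos m) γ)
      (trans (cong (pos m ⋆_) e) (trans (sym (⋆-assoc (pos m) (pos c) (unit i))) (cong (_⋆ unit i) (sym (ℤ.pos-* m c)))))
    each : ∀ i → ∃[ c ] (1 ℕ.≤ c × P i c)
    each i = from-collision (collision-rel (λ b l → l ≡ drop i (φ b)) {B} {map (drop i) (map φ B)} (λ b∈ → _ , ∈-map⁺ (drop i) (∈-map⁺ φ b∈) , refl) (few i))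
      where
      from-multiple : ∀ γ t → Differences B γ → γ ≢ 0v → φ γ ≡ t ⋆ unit i → ∃[ c ] (1 ℕ.≤ c × P i c)
      from-multiple γ t γ∈ γ≢0 e = by-sign (ℤ-abs t t≢0)
        where
        t≢0 : t ≢ 0ℤ
        t≢0 refl = γ≢0 (φ-inj γ (trans e (0⋆ (unit i))))
        by-sign : _ → ∃[ c ] (1 ℕ.≤ c × P i c)
        by-sign (c , inj₁ refl) = suc c , s≤s z≤n , γ , γ∈ , e
        by-sign (c , inj₂ refl) = suc c , s≤s z≤n , ⊝ γ , ⊝∈ γ∈ , trans (additive-⊝ φ-+ γ) (trans (cong ⊝_ e)
          (trans (sym (-1⋆ _)) (trans (sym (⋆-assoc ℤ.-1ℤ (ℤ.- pos (suc c)) (unit i))) (cong (_⋆ unit i) (ℤ.-1*i≡-i (ℤ.- pos (suc c)))))))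
      from-collision : ∃[ b ] ∃[ b′ ] ∃[ l ] (b ∈ B × b′ ∈ B × b ≢ b′ × l ≡ drop i (φ b) × l ≡ drop i (φ b′)) → ∃[ c ] (1 ℕ.≤ c × P i c)
      from-collision (b , b′ , l , b∈ , b′∈ , b≢b′ , e , e′) = from-multiple (b ⊖ b′) (proj₁ same) (single b∈ b′∈) (λ eq → b≢b′ (⊖≡0 b b′ eq))
        (trans (additive-⊖ φ-+ b b′) (trans (cong (_⊖ φ b′) (proj₂ same)) (linear ((x₀ :+ x₁) :- x₀) x₁ refl (φ b′ Vec.∷ proj₁ same ⋆ unit i Vec.∷ Vec.[]))))
        where
        same = drop-same i (φ b) (φ b′) (trans (sym e) e′)
    -- If φ(γ_i) = C e_i for every i, then C v and the combination of the γ_i with the coordinates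
    -- of φ(v) have the same image, hence are equal.
    conclude : ∃[ C ] (1 ℕ.≤ C × ∀ i → P i C) → Full (Differences B)
    conclude (C , C≥1 , p) = C , C≥1 , λ v → subst (Differences B) (injective⇒cancel φ-+ φ-inj (sym (image v))) (combination∈ (φ v) γs (λ i → subst (Differences B) (sym (lookup∘tabulate (λ i → proj₁ (p i)) i)) (proj₁ (proj₂ (p i)))))
      where
      γs = tabulate (λ i → proj₁ (p i))
      images : mapᵥ φ γs ≡ mapᵥ (pos C ⋆_) units
      images = lookup-ext (λ i → trans (lookup-map i φ γs) (trans (cong φ (lookup∘tabulate (λ i → proj₁ (p i)) i)) (trans (proj₂ (proj₂ (p i))) (sym (trans (lookup-map i (pos C ⋆_) units) (cong (pos C ⋆_) (lookup-units i)))))))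
      image : ∀ v → φ (pos C ⋆ v) ≡ φ (combination (φ v) γs)
      image v = sym (trans (additive-combination φ-+ (φ v) γs) (trans (cong (combination (φ v)) images)
        (trans (sym (additive-combination (⋆-distribˡ (pos C)) (φ v) units)) (trans (cong (pos C ⋆_) (combination-units (φ v))) (sym (additive-⋆ φ-+ (pos C) v))))))

-- Brunn-Minkowski for images of subsets in the adapted coordinates.

module StructuredSets {ℓ} (R : CompleteOrderedField ℓ) where
  open Reals R hiding (total; solve; _:*_; _:=_)
  open BrunnMinkowski R using (nthRoot; nthRoot-nonNeg; nthRoot-suc; brunn-minkowski)
  open PowerLoss R using (polynomial≤exponential)
  open Estimates R using (absorb-loss)
  open Counting
  open WithEM em
  open Vectors using (V)
  open Sumsets em
  open IntegerLinear
  open Directions em using (drop; Coordinates; module Coordinates; lines-bound)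
  open LayerCake em using (loss; sumFin; sumFin-mono)
  open DifferenceLattices em using (_⊆_)
  open import Data.Nat.Base as ℕ using (ℕ; zero; suc; z≤n)
  import Data.Nat.Properties as ℕ
  open import Data.Fin.Base using (Fin)
  open import Data.List.Base using (List; map)
  open import Data.List.Membership.Propositional using (_∈_)
  open import Data.List.Membership.Propositional.Properties using (∈-map⁺; ∈-map⁻)
  open import Data.Product.Base using (∃-syntax; _×_; _,_; proj₂)
  import Relation.Binary.PropositionalEquality as ≡
  open ≡ using (_≡_)

  map-⊆ : ∀ {d d′} (f : V d → V d′) {X Y} → X ⊆ Y → map f X ⊆ map f Y
  map-⊆ f X⊆Y z z∈ with ∈-map⁻ f z∈
  ... | x , x∈ , ≡.refl = ∈-map⁺ f (X⊆Y x x∈)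

  sumFin-* : ∀ {n} (f : Fin n → ℕ) T B → (∀ i → f i ℕ.* T ℕ.≤ B) → sumFin f ℕ.* T ℕ.≤ n ℕ.* B
  sumFin-* {zero} f T B le = z≤n
  sumFin-* {suc n} f T B le = ℕ.≤-trans (ℕ.≤-reflexive (ℕ.*-distribʳ-+ T (f Fin.zero) (sumFin (λ i → f (Fin.suc i)))))
    (ℕ.+-mono-≤ (le Fin.zero) (sumFin-* (λ i → f (Fin.suc i)) T B (λ i → le (Fin.suc i))))

  cancel-scale : ∀ x a p b n K τ → x ℕ.* 2 ℕ.^ (τ ℕ.+ τ) ℕ.≤ a ℕ.* (p ℕ.* (b ℕ.* n)) → p ℕ.≤ K ℕ.* 2 ℕ.^ τ → x ℕ.* 2 ℕ.^ τ ℕ.≤ (a ℕ.* b ℕ.* K) ℕ.* n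
  cancel-scale x a p b n K τ le p≤ = ℕ.*-cancelʳ-≤ (x ℕ.* q) ((a ℕ.* b ℕ.* K) ℕ.* n) q {{ℕ.m^n≢0 2 τ}} (begin
    (x ℕ.* q) ℕ.* q                   ≡⟨ ℕ.*-assoc x q q ⟩
    x ℕ.* (q ℕ.* q)                   ≡⟨ ≡.cong (x ℕ.*_) (ℕ.^-distribˡ-+-* 2 τ τ) ⟨
    x ℕ.* 2 ℕ.^ (τ ℕ.+ τ)             ≤⟨ le ⟩
    a ℕ.* (p ℕ.* (b ℕ.* n))           ≤⟨ ℕ.*-monoʳ-≤ a (ℕ.*-monoˡ-≤ (b ℕ.* n) p≤) ⟩
    a ℕ.* ((K ℕ.* q) ℕ.* (b ℕ.* n))   ≡⟨ solve 5 (λ a k q b n → a :* ((k :* q) :* (b :* n)) := ((a :* b :* k) :* n) :* q) ≡.refl a K q b n ⟩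
    ((a ℕ.* b ℕ.* K) ℕ.* n) ℕ.* q     ∎)
    where
    open ℕ.≤-Reasoning
    open import Data.Nat.Solver using (module +-*-Solver)
    open +-*-Solver using (solve; _:*_; _:=_)
    q = 2 ℕ.^ τ

  module _ {k} {l₁ l₂ N : V (suc k) → V (suc k)} (l₁-+ : Additive l₁) (l₂-+ : Additive l₂) (N-+ : Additive N)
    (l₁-inj : Injective l₁) (l₂-inj : Injective l₂) (N-inj : Injective N) where

    card-image₁ : ∀ X → card (map N (map l₁ X)) ≡ card X
    card-image₁ X = ≡.trans (card-map N (λ {x} {x′} → injective⇒cancel N-+ N-inj) (map l₁ X)) (card-map l₁ (λ {x} {x′} → injective⇒cancel l₁-+ l₁-inj) X)

    card-image₂ : ∀ X → card (map N (map l₂ X)) ≡ card X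
    card-image₂ X = ≡.trans (card-map N (λ {x} {x′} → injective⇒cancel N-+ N-inj) (map l₂ X)) (card-map l₂ (λ {x} {x′} → injective⇒cancel l₂-+ l₂-inj) X)

    card-sumset-image : ∀ X Y → card (map N (map l₁ X) ⊞ map N (map l₂ Y)) ℕ.≤ card (map l₁ X ⊞ map l₂ Y)
    card-sumset-image X Y = card-surj N preimage
      where
      preimage : ∀ {z} → z ∈ map N (map l₁ X) ⊞ map N (map l₂ Y) → ∃[ x ] x ∈ map l₁ X ⊞ map l₂ Y × z ≡ N x
      preimage z∈ with ∈-⊞⁻ z∈
      ... | _ , _ , a∈ , b∈ , ≡.refl with ∈-map⁻ N a∈ | ∈-map⁻ N b∈
      ... | a , a∈′ , ≡.refl | b , b∈′ , ≡.refl = a Vectors.⊕ b , ∈-⊞⁺ a∈′ b∈′ , ≡.sym (N-+ a b)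

    loss-mono : ∀ {Y A} → Y ⊆ A → loss (map N (map l₂ Y)) ℕ.≤ loss (map N (map l₂ A))
    loss-mono Y⊆A = sumFin-mono (λ i → card-⊆ (λ {z} → map-⊆ (drop i) (map-⊆ N (map-⊆ l₂ Y⊆A)) z))

    -- The loss of every part is replaced by that of all of A, so that a single error serves all
    -- pairs of subsets.
    sumset-with-loss : ∀ A X Y → X ⊆ A → Y ⊆ A → 1 ℕ.≤ card X → 1 ℕ.≤ card Y → ∀ α β → 0# ≤ α → 0# ≤ β →
      α ^ suc k ≤ fromℕ (card X) → β ^ suc k ≤ fromℕ (card Y) → let ν = nthRoot (suc k) (card A) in
      (α + β) ^ suc k ≤ fromℕ (card (map l₁ X ⊞ map l₂ Y)) + fromℕ (suc k) * ((ν + ν) ^ k * nthRoot (suc k) (loss (map N (map l₂ A))))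
    sumset-with-loss A X Y X⊆A Y⊆A X≥1 Y≥1 α β 0≤α 0≤β α≤ β≤ = absorb-loss {k} {e = e} {s = card Y} {q = card (map l₁ X ⊞ map l₂ Y)} 0≤α 0≤β (nthRoot-nonNeg (suc k) e) (≤ν {X} 0≤α X⊆A α≤) (≤ν {Y} 0≤β Y⊆A β≤) (nthRoot-suc k e) β≤
      (≤-trans α≤ (fromℕ-mono (ℕ.≤-trans (ℕ.≤-reflexive (≡.sym (card-map l₁ (λ {x} {x′} → injective⇒cancel l₁-+ l₁-inj) X))) (card-⊞≥ˡ (map l₁ X) (map l₂ Y) (∈-map⁺ l₂ y∈))))) bm
      where
      e = loss (map N (map l₂ A))
      x∈ = proj₂ (card-nonempty X X≥1)
      y∈ = proj₂ (card-nonempty Y Y≥1)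
      ≤ν : ∀ {Z γ} → 0# ≤ γ → Z ⊆ A → γ ^ suc k ≤ fromℕ (card Z) → γ ≤ nthRoot (suc k) (card A)
      ≤ν {Z} 0≤γ Z⊆A le = ^-cancel-≤ k (nthRoot-nonNeg (suc k) (card A)) (≤-respʳ (≈-sym (nthRoot-suc k (card A))) (≤-trans le (fromℕ-mono (card-⊆ (λ {z} → Z⊆A z)))))
      bm : ∀ β′ → 0# ≤ β′ → β′ ^ suc k ≤ fromℕ (card Y ℕ.∸ e) → (α + β′) ^ suc k ≤ fromℕ (card (map l₁ X ⊞ map l₂ Y))
      bm β′ 0≤β′ β′≤ = ≤-trans (brunn-minkowski (suc k) (map N (map l₁ X)) (map N (map l₂ Y)) (∈-map⁺ N (∈-map⁺ l₁ x∈)) (∈-map⁺ N (∈-map⁺ l₂ y∈)) 0≤α 0≤β′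
          (≤-respʳ (reflexive (≡.cong fromℕ (≡.sym (card-image₁ X)))) α≤)
          (≤-trans β′≤ (fromℕ-mono (ℕ.∸-mono (ℕ.≤-reflexive (≡.sym (card-image₂ Y))) (loss-mono Y⊆A)))))
        (fromℕ-mono (card-sumset-image X Y))

  module _ {k} {l₂ : V (suc k) → V (suc k)} {A : List (V (suc k))} {c h τ : ℕ} (h≥1 : 1 ℕ.≤ h ℕ.^ 5)
    (C : Coordinates (map l₂ A) (2 ℕ.^ (τ ℕ.+ τ)) ((c ℕ.* h) ℕ.^ suc k ℕ.* (suc (suc ((τ ℕ.+ τ) ℕ.+ (τ ℕ.+ τ))) ℕ.^ (h ℕ.^ 5) ℕ.* (h ℕ.* h ℕ.* card A)))) where
    open Coordinates C

    lines≤ : ∀ i → card (map (drop i) (map coordinates (map l₂ A))) ℕ.* 2 ℕ.^ τ ℕ.≤ ((c ℕ.* h) ℕ.^ suc k ℕ.* (h ℕ.* h) ℕ.* (4 ℕ.* h ℕ.^ 5 ℕ.+ 2) ℕ.^ (h ℕ.^ 5)) ℕ.* card A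
    lines≤ i = cancel-scale (card (map (drop i) (map coordinates (map l₂ A)))) ((c ℕ.* h) ℕ.^ suc k) (suc (suc ((τ ℕ.+ τ) ℕ.+ (τ ℕ.+ τ))) ℕ.^ (h ℕ.^ 5)) (h ℕ.* h) (card A) ((4 ℕ.* h ℕ.^ 5 ℕ.+ 2) ℕ.^ (h ℕ.^ 5)) τ
      (lines-bound (map l₂ A) C i) (polynomial≤exponential (h ℕ.^ 5) τ h≥1)

-- The inequality for injective integer matrices, with all constants.

module IntegerCase {ℓ} (R : CompleteOrderedField ℓ) where
  open Reals R hiding (total)
  open BrunnMinkowski R using (nthRoot; nthRoot-nonNeg; nthRoot-suc)
  open PowerLoss R
  open Estimates R
  open Counting
  open WithEM em
  open Vectors using (V; 0v)
  open Sumsets em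
  open IntegerLinear
  open RationalLinear using (act; act-+)
  open Directions em using (drop; Coordinates; module Coordinates; coordinate-system)
  open LayerCake em using (loss)
  open Lattices em using (Full; IndexAtLeast; IsSubgroup; module IsSubgroup)
  open Coprimality em using (ImageOf; SumOf; coprime-index)
  open DifferenceLattices em
  open FullDifferences em
  open StructuredSets R
  open Gains R
  open import Data.Nat.Base as ℕ using (ℕ; suc; s≤s; z≤n)
  import Data.Nat.Properties as ℕ
  open import Data.Nat.Induction using (<-wellFounded)
  open import Induction.WellFounded using (Acc; acc)
  open import Data.Integer.Base using (ℤ; ∣_∣)
  open import Data.List.Base using (List; map)
  open import Data.List.Membership.Propositional using (_∈_)
  open import Data.Product.Base using (∃-syntax; _×_; _,_; proj₁; proj₂)
  open import Relation.Nullary using (¬_)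
  import Relation.Binary.PropositionalEquality as ≡
  open ≡ using (_≡_)

  by-index-cover : ∀ {d} {f g : V d → V d} {Γ n} → IsSubgroup Γ → IndexAtLeast (SumOf f g Γ) (ImageOf f Γ) n → IndexAtLeast (SumOf f g Γ) (ImageOf f Γ) (1 ℕ.⊔ n)
  by-index-cover {f = f} {g} subΓ index ρ cover = ℕ.⊔-lub (card-pos (proj₁ (proj₂ (cover (f 0v Vectors.⊕ g 0v) (0v , 0v , IsSubgroup.0∈ subΓ , IsSubgroup.0∈ subΓ , ≡.refl))))) (index ρ cover)

  module Bound {k} (L₁ L₂ : Mat ℤ (suc k)) (irreducible : Irreducible L₁ L₂) (coprime : Coprime L₁ L₂)
    (l₁-inj : Injective (act L₁)) (l₂-inj : Injective (act L₂)) where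

    private
      l₁ l₂ : V (suc k) → V (suc k)
      l₁ = act L₁
      l₂ = act L₂
      l₁-+ : Additive l₁
      l₁-+ = act-+ L₁
      l₂-+ : Additive l₂
      l₂-+ = act-+ L₂
      inverse₁ : ScaledInverse l₁
      inverse₁ = scaled-inverse l₁-+ l₁-inj
      inverse₂ : ScaledInverse l₂
      inverse₂ = scaled-inverse l₂-+ l₂-inj

    -- The maximum with 1 gives positivity directly; the index bounds survive it because a covering
    -- list is never empty, and the constant H can only grow.
    m n : ℕ
    m = 1 ℕ.⊔ ∣ detℤ L₁ ∣
    n = 1 ℕ.⊔ ∣ detℤ L₂ ∣

    m≥1 : 1 ℕ.≤ m
    m≥1 = ℕ.m≤m⊔n 1 ∣ detℤ L₁ ∣

    n≥1 : 1 ℕ.≤ n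
    n≥1 = ℕ.m≤m⊔n 1 ∣ detℤ L₂ ∣

    ρ σ H : ℝ
    ρ = nthRoot (suc k) m
    σ = nthRoot (suc k) n
    H = (ρ + σ) ^ suc k

    0≤ρ : 0# ≤ ρ
    0≤ρ = nthRoot-nonNeg (suc k) m

    0≤σ : 0# ≤ σ
    0≤σ = nthRoot-nonNeg (suc k) n

    0≤H : 0# ≤ H
    0≤H = ^-nonNeg (suc k) (+-nonNeg 0≤ρ 0≤σ)

    abstract
      -- Serves as upper bound for H and as threshold: a sumset with more than h|A| elements needs
      -- no argument. The summand 2 makes h, and with it r, at least 2 for `bracket`.
      h : ℕ
      h = proj₁ (archimedean H) ℕ.+ 2

      h≥2 : 2 ℕ.≤ h
      h≥2 = ℕ.m≤n+m 2 (proj₁ (archimedean H))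

      H≤h : H ≤ fromℕ h
      H≤h = ≤-trans (proj₂ (archimedean H)) (fromℕ-mono {proj₁ (archimedean H)} {h} (ℕ.m≤m+n _ 2))

    -- r bounds the number of translates in the covering behind `good-direction`, Q |A| / 2^τ the
    -- number of lines in each direction, and K is the constant from `error-bound` for the loss in
    -- all k + 1 directions together.
    M r Q K : ℕ
    M = m ℕ.* n
    r = h ℕ.^ 5
    Q = (ScaledInverse.scale inverse₁ ℕ.* h) ℕ.^ suc k ℕ.* (h ℕ.* h) ℕ.* (4 ℕ.* r ℕ.+ 2) ℕ.^ r
    K = suc (2 ℕ.* ((suc k ℕ.* 2 ℕ.^ k) ℕ.^ suc k ℕ.* (suc k ℕ.* Q)))

    M≥1 : 1 ℕ.≤ M
    M≥1 = ℕ.*-mono-≤ m≥1 n≥1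

    h≥1 : 1 ℕ.≤ h
    h≥1 = ℕ.≤-trans (s≤s z≤n) h≥2

    r≥2 : 2 ℕ.≤ r
    r≥2 = ℕ.≤-trans (s≤s (s≤s z≤n)) (ℕ.^-monoˡ-≤ 5 h≥2)

    0<1+H : 0# < 1# + H
    0<1+H = <-≤-trans 0<1 (≤-by H 0≤H ≈-refl)

    -- 2 ε h M = κ. If |A| ≤ M c and E(|A|) ≤ h |A|, both κ c and κ E(c) are then at least 2 ε
    -- E(|A|).
    κ ε : ℝ
    κ = (1# + H) ⁻¹
    ε = κ * (fromℕ (2 ℕ.* (h ℕ.* M))) ⁻¹

    0<2hM : 0# < fromℕ (2 ℕ.* (h ℕ.* M))
    0<2hM = fromℕ-pos {2 ℕ.* (h ℕ.* M)} (ℕ.*-mono-≤ {1} {2} {1} {h ℕ.* M} (s≤s z≤n) (ℕ.*-mono-≤ h≥1 M≥1))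

    0<ε : 0# < ε
    0<ε = *-pos (⁻¹-pos 0<1+H) (⁻¹-pos 0<2hM)

    ε≈ : fromℕ (2 ℕ.* (h ℕ.* M)) * ε ≈ κ
    ε≈ = ≈-trans (solve 3 (λ a k i → a :* (k :* i) := k :* (a :* i)) ≡.refl (fromℕ (2 ℕ.* (h ℕ.* M))) κ ((fromℕ (2 ℕ.* (h ℕ.* M))) ⁻¹))
      (≈-trans (*-congˡ (*-inverseʳ _ (pos⇒≉0 0<2hM))) (*-identityʳ κ))

    abstract
      g : ℕ
      g = proj₁ (archimedean (fromℕ 3 * ε ⁻¹))

      g≥ : fromℕ 3 * ε ⁻¹ ≤ fromℕ g
      g≥ = proj₂ (archimedean (fromℕ 3 * ε ⁻¹))

      -- Three demands: at least h, so that singletons are covered by the error; large against Q M,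
      -- so that the remaining sets satisfy Q M < 2^τ; and ε D₀ at least M K, to absorb the errors
      -- of all blocks.
      D₀ : ℕ
      D₀ = h ℕ.+ (2 ℕ.* h ℕ.* (Q ℕ.* M) ℕ.+ proj₁ (archimedean (fromℕ (M ℕ.* K) * ε ⁻¹)))

      D₀≥h : h ℕ.≤ D₀
      D₀≥h = ℕ.m≤m+n h _

      D₀≥Q : 2 ℕ.* h ℕ.* (Q ℕ.* M) ℕ.≤ D₀
      D₀≥Q = ℕ.≤-trans (ℕ.m≤m+n _ _) (ℕ.m≤n+m _ h)

      D₀≥K : fromℕ (M ℕ.* K) ≤ ε * fromℕ D₀
      D₀≥K = ≤-respˡ (≈-trans (solve 3 (λ e i m → e :* (m :* i) := m :* (e :* i)) ≡.refl ε (ε ⁻¹) (fromℕ (M ℕ.* K))) (≈-trans (*-congˡ (*-inverseʳ ε (pos⇒≉0 0<ε))) (*-identityʳ _)))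
        (*-monoˡ-≤ ε (proj₁ 0<ε) (≤-trans (proj₂ (archimedean (fromℕ (M ℕ.* K) * ε ⁻¹))) (fromℕ-mono (ℕ.≤-trans (ℕ.m≤n+m _ (2 ℕ.* h ℕ.* (Q ℕ.* M))) (ℕ.m≤n+m _ h)))))

    -- j + 1 ≥ r² is needed for `w-bound`, and s ≥ g ≥ 3 / ε for the splittings. The form of s″
    -- makes s′ + 1 = (k + 1)(j + 1) hold by computation.
    j s″ s′ : ℕ
    j = suc (r ℕ.* r ℕ.+ g)
    s″ = (r ℕ.* r ℕ.+ g) ℕ.+ k ℕ.* suc j
    s′ = suc s″

    E : ℕ → ℝ
    E a = fromℕ D₀ * loss-power s′ a

    E-mono : ∀ {a b} → a ℕ.≤ b → E a ≤ E b
    E-mono a≤b = *-monoˡ-≤ (fromℕ D₀) (fromℕ-nonNeg D₀) (y-mono s′ a≤b)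

    0≤E : ∀ a → 0# ≤ E a
    0≤E a = *-nonNegative (fromℕ-nonNeg D₀) (y-nonNeg s′ a)

    Bounded : List (V (suc k)) → Set ℓ
    Bounded A = H * fromℕ (card A) ≤ fromℕ (card (map l₁ A ⊞ map l₂ A)) + E (card A)

    module Structured (A : List (V (suc k))) (A≥1 : 1 ℕ.≤ card A) (large : ¬ fromℕ h * fromℕ (card A) ≤ E (card A))
      (IH : ∀ X → X ⊆ A → card X ℕ.< card A → Bounded X) (τ : ℕ) (n≤ : card A ℕ.≤ r ℕ.^ (suc τ ℕ.+ suc τ))
      (C : Coordinates (map l₂ A) (2 ℕ.^ (τ ℕ.+ τ)) ((ScaledInverse.scale inverse₁ ℕ.* h) ℕ.^ suc k ℕ.* (suc (suc ((τ ℕ.+ τ) ℕ.+ (τ ℕ.+ τ))) ℕ.^ (h ℕ.^ 5) ℕ.* (h ℕ.* h ℕ.* card A)))) where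
      open Coordinates C

      T e : ℕ
      T = 2 ℕ.^ τ
      e = loss (map coordinates (map l₂ A))

      ν err : ℝ
      ν = nthRoot (suc k) (card A)
      err = fromℕ (suc k) * ((ν + ν) ^ k * nthRoot (suc k) e)

      lines : ∀ i → card (map (drop i) (map coordinates (map l₂ A))) ℕ.* T ℕ.≤ Q ℕ.* card A
      lines = lines≤ {c = ScaledInverse.scale inverse₁} {h} {τ} (ℕ.≤-trans (s≤s z≤n) r≥2) C

      w≤ : w s′ (card A) ^ suc k ≤ fromℕ (2 ℕ.* T)
      w≤ = w-bound k j r τ (card A) (ℕ.≤-trans (ℕ.m≤m+n (r ℕ.* r) g) (ℕ.≤-trans (ℕ.n≤1+n _) (ℕ.n≤1+n _))) n≤

      err≤ : err ≤ fromℕ K * loss-power s′ (card A)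
      err≤ = error-bound k s′ {card A} {T} A≥1 w≤ {e} {suc k ℕ.* Q} (ℕ.≤-trans (sumFin-* (λ i → card (map (drop i) (map coordinates (map l₂ A)))) T (Q ℕ.* card A) lines)
        (ℕ.≤-reflexive (≡.sym (ℕ.*-assoc (suc k) Q (card A)))))

      QM<T : Q ℕ.* M ℕ.< T
      QM<T = scale-large k s′ A≥1 w≤ {h} {Q ℕ.* M} {D₀} D₀≥Q large

      full : ∀ B → B ⊆ A → card A ℕ.≤ M ℕ.* card B → Full (Differences B)
      full B B⊆A A≤ = few-lines⇒full {φ = λ v → coordinates (l₂ v)} (λ u v → ≡.trans (≡.cong coordinates (l₂-+ u v)) (coordinates-+ (l₂ u) (l₂ v)))
        (λ v v≡ → l₂-inj v (coordinates-injective (l₂ v) v≡)) B few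
        where
        B≥1 : 1 ℕ.≤ card B
        B≥1 = ℕ.≰⇒> λ B≤0 → ℕ.<⇒≱ A≥1 (ℕ.≤-trans A≤ (ℕ.≤-trans (ℕ.*-monoʳ-≤ M B≤0) (ℕ.≤-reflexive (ℕ.*-zeroʳ M))))
        to-A : ∀ i {z} → z ∈ map (drop i) (map (λ v → coordinates (l₂ v)) B) → z ∈ map (drop i) (map coordinates (map l₂ A))
        to-A i {z} = map-⊆ (drop i) (λ z z∈ → ≡.subst (λ L → z ∈ L) (Data.List.Properties.map-∘ A) (map-⊆ (λ v → coordinates (l₂ v)) B⊆A z z∈)) z
          where import Data.List.Properties
        -- B meets at most Q |A| / 2^τ ≤ Q M |B| / 2^τ < |B| lines in each direction.
        few : ∀ i → card (map (drop i) (map (λ v → coordinates (l₂ v)) B)) ℕ.< card B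
        few i = ℕ.≤-<-trans (card-⊆ (λ {z} → to-A i {z})) (ℕ.*-cancelʳ-< T _ (card B) (ℕ.≤-<-trans (lines i) (ℕ.≤-<-trans (ℕ.≤-trans (ℕ.*-monoʳ-≤ Q A≤) (ℕ.≤-reflexive (≡.sym (ℕ.*-assoc Q M (card B)))))
          (ℕ.<-≤-trans (ℕ.*-monoˡ-< (card B) {{ℕ.>-nonZero B≥1}} QM<T) (ℕ.≤-reflexive (ℕ.*-comm T (card B)))))))

      setup : Setup k
      setup = record
        { f = l₁ ; g = l₂ ; f-+ = l₁-+ ; g-+ = l₂-+ ; f-inj = l₁-inj ; g-inj = l₂-inj ; A = A ; H = H ; κ = κ ; err = err ; E = E ; m = m ; n = n ; m≥1 = m≥1 ; n≥1 = n≥1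
        ; ρ = ρ ; σ = σ ; 0≤ρ = 0≤ρ ; 0≤σ = 0≤σ ; ρ-^ = nthRoot-suc k m ; σ-^ = nthRoot-suc k n ; H≈ = ≈-refl ; κ-inverse = *-inverseʳ _ (pos⇒≉0 0<1+H)
        ; 0≤err = *-nonNegative (fromℕ-nonNeg (suc k)) (*-nonNegative (^-nonNeg k (+-nonNeg 0≤ν 0≤ν)) (nthRoot-nonNeg (suc k) e))
        ; E-mono = E-mono ; 0≤E = 0≤E ; IH = IH
        ; bm = sumset-with-loss l₁-+ l₂-+ coordinates-+ l₁-inj l₂-inj coordinates-injective A
        ; index = λ B _ full → by-index-cover differences-subgroup (coprime-index L₁ L₂ coprime inverse₁ l₁-inj (Differences B) differences-subgroup full) }
        where
        0≤ν = nthRoot-nonNeg (suc k) (card A)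

      G : ℝ
      G = (ε + ε) * E (card A)

      E≤ : ∀ c → card A ℕ.≤ M ℕ.* c → E (card A) ≤ fromℕ (h ℕ.* M) * fromℕ c
      E≤ c A≤ = ≤-trans (≰⇒≥ large) (≤-respʳ (≈-trans (≈-sym (*-assoc (fromℕ h) (fromℕ M) (fromℕ c))) (*-congʳ (≈-sym (fromℕ-* h M)))) (*-monoˡ-≤ (fromℕ h) (fromℕ-nonNeg h) (≤-respʳ (fromℕ-* M c) (fromℕ-mono A≤))))

      E≤′ : ∀ c → card A ℕ.≤ M ℕ.* c → E (card A) ≤ fromℕ (h ℕ.* M) * E c
      E≤′ c A≤ = ≤-trans (*-monoˡ-≤ (fromℕ D₀) (fromℕ-nonNeg D₀) (y-scale s′ {c} {card A} {M} M≥1 A≤)) (≤-respˡ (solve 3 (λ d m y → m :* (d :* y) := d :* (m :* y)) ≡.refl (fromℕ D₀) (fromℕ M) (loss-power s′ c))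
        (*-monoʳ-≤ (E c) (0≤E c) (fromℕ-mono (ℕ.m≤n*m M h {{ℕ.>-nonZero h≥1}}))))

      bounded : Bounded A
      bounded = Combination.total-deficit setup G
        (λ B _ full → by-index-cover differences-subgroup (coprime-index L₂ L₁ (λ { (P , N , P-inv , N-inv , pos , small , int₁ , int₂) → coprime (P , N , P-inv , N-inv , pos , small , int₂ , int₁) })
          inverse₂ l₂-inj (Differences B) differences-subgroup full))
        full
        (λ c A≤ → gain-≤ (h ℕ.* M) ε≈ (proj₁ 0<ε) (E≤ c A≤) , gain-≤ (h ℕ.* M) ε≈ (proj₁ 0<ε) (E≤′ c A≤))
        (λ a b c sum≡ → three-parts s″ {ε} {D₀} {err} {K} {M} a b c (card A) sum≡ (δ-small s″ 0<ε g≥ g≤) (δ≤1 s″) err≤ D₀≥K)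
        A≥1
        where
        g≤ : g ℕ.≤ suc s′
        g≤ = ℕ.≤-trans (ℕ.m≤n+m g (r ℕ.* r)) (ℕ.≤-trans (ℕ.m≤m+n _ (k ℕ.* suc j)) (ℕ.≤-trans (ℕ.n≤1+n _) (ℕ.n≤1+n _)))

    -- Induction on |A|. Nothing is to be shown if A is empty, if the error reaches h|A|, or if the
    -- sumset exceeds h|A|; otherwise |A| is at least 2 and `bracket` and `coordinate-system`
    -- provide the structure.
    bounded : ∀ A → Acc ℕ._<_ (card A) → Bounded A
    bounded A (acc smaller) = by-cases (1 ℕ.≤? card A) nonempty empty
      where
      S = card (map l₁ A ⊞ map l₂ A)
      empty : ¬ 1 ℕ.≤ card A → Bounded A
      empty A≱1 = ≤-respˡ (≈-sym (≈-trans (*-congˡ (reflexive (≡.cong fromℕ (ℕ.n≤0⇒n≡0 (ℕ.≤-pred (ℕ.≰⇒> A≱1)))))) (zeroʳ H))) (+-nonNeg (fromℕ-nonNeg S) (0≤E (card A)))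
      H≤hn : H * fromℕ (card A) ≤ fromℕ h * fromℕ (card A)
      H≤hn = *-monoʳ-≤ (fromℕ (card A)) (fromℕ-nonNeg (card A)) H≤h
      IH : ∀ X → X ⊆ A → card X ℕ.< card A → Bounded X
      IH X _ lt = bounded X (smaller lt)
      nonempty : 1 ℕ.≤ card A → Bounded A
      nonempty A≥1 = by-cases (fromℕ h * fromℕ (card A) ≤? E (card A))
        (λ hn≤E → ≤-trans H≤hn (≤-trans hn≤E (≤-by (fromℕ S) (fromℕ-nonNeg S) (+-comm (fromℕ S) (E (card A))))))
        (λ large → by-cases (S ℕ.≤? h ℕ.* card A)
          (λ S≤ → structured large S≤ (bracket r (card A) r≥2 (≥2 large)))
          (λ S≰ → ≤-trans H≤hn (≤-respˡ (fromℕ-* h (card A)) (≤-trans (fromℕ-mono (ℕ.≰⇒≥ S≰)) (≤-by (E (card A)) (0≤E (card A)) ≈-refl)))))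
        where
        ≥2 : ¬ fromℕ h * fromℕ (card A) ≤ E (card A) → 2 ℕ.≤ card A
        ≥2 large = ℕ.≰⇒> λ A≤1 → large (*-mono-≤ (fromℕ-nonNeg h) (fromℕ-mono D₀≥h) (fromℕ-nonNeg (card A)) (≤-trans (fromℕ-mono A≤1) (≤-respˡ (≈-sym fromℕ-1) (y-≥1 s′ A≥1))))
        structured : ¬ fromℕ h * fromℕ (card A) ≤ E (card A) → S ℕ.≤ h ℕ.* card A → ∃[ τ ] (r ℕ.^ (τ ℕ.+ τ) ℕ.< card A × card A ℕ.≤ r ℕ.^ (suc τ ℕ.+ suc τ)) → Bounded A
        structured large S≤ (τ , lt , le) = Structured.bounded A A≥1 large IH τ le
          (coordinate-system L₁ L₂ irreducible l₁-inj l₂-inj inverse₁ A h (τ ℕ.+ τ) (proj₂ (card-nonempty A A≥1)) h≥1 S≤ lt)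

    all-bounded : ∀ A → Bounded A
    all-bounded A = bounded A (<-wellFounded (card A))

-- Injectivity from irreducibility, and dimension one.

module IntegerTheorem {ℓ} (R : CompleteOrderedField ℓ) where
  open Reals R hiding (total)
  open BrunnMinkowski R using (nthRoot; nthRoot-nonNeg; nthRoot-suc; nthRoot-mono)
  open PowerLoss R using (loss-power)
  open IntegerCase R using (module Bound)
  open Counting
  open WithEM em
  open Vectors using (V; 0v; _⋆_; combination; 1⋆; ⊕-identityʳ; combination-0)
  open Sumsets em
  open IntegerLinear
  open RationalLinear using (act; act-+; Independent; reducible)
  open Coprimality em using (Triangular; block; []; matrix; act-block; coprime-volumes)
  open import Data.Nat.Base as ℕ using (ℕ; zero; suc; s≤s; z≤n)
  import Data.Nat.Properties as ℕ
  open import Data.Integer.Base as ℤ using (ℤ; 0ℤ; 1ℤ; ∣_∣) renaming (+_ to pos)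
  import Data.Integer.Properties as ℤ
  open import Data.Fin.Base using (Fin; zero; suc)
  open import Data.Vec.Base using (Vec; []; _∷_)
  open import Data.List.Base using (List; map)
  open import Data.List.Membership.Propositional.Properties using (∈-map⁺)
  open import Data.Product.Base using (∃-syntax; _×_; _,_; proj₁; proj₂)
  open import Data.Sum.Base using (_⊎_; inj₁; inj₂)
  open import Data.Empty using (⊥-elim)
  open import Relation.Nullary using (yes; no; Dec)
  open import Relation.Binary.PropositionalEquality using (_≡_; _≢_; sym; trans; cong; cong₂)

  LowerBound : ∀ {d} → Mat ℤ d → Mat ℤ d → Set ℓ
  LowerBound {d} L₁ L₂ = ∃[ D ] ∃[ s′ ] ∀ (A : List (V d)) → (nthRoot d ∣ detℤ L₁ ∣ + nthRoot d ∣ detℤ L₂ ∣) ^ d * fromℕ (card A) ≤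
    fromℕ (card (map (act L₁) A ⊞ map (act L₂) A)) + fromℕ D * loss-power s′ (card A)

  irreducible-swap : ∀ {d} {L₁ L₂ : Mat ℤ d} → Irreducible L₁ L₂ → Irreducible L₂ L₁
  irreducible-swap irr (U , W , subU , subW , nonU , nonW , dim , into₁ , into₂) = irr (U , W , subU , subW , nonU , nonW , dim , into₂ , into₁)

  coprime-swap : ∀ {d} {L₁ L₂ : Mat ℤ d} → Coprime L₁ L₂ → Coprime L₂ L₁
  coprime-swap cop (P , N , P-inv , N-inv , det>0 , small , int₁ , int₂) = cop (P , N , P-inv , N-inv , det>0 , small , int₂ , int₁)

  singleton-independent : ∀ {d} {v : V d} → v ≢ 0v → Independent (v ∷ [])
  singleton-independent {v = v} v≢0 (c ∷ []) e = cong (_∷ []) (decide (c ℤ.≟ 0ℤ))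
    where
    decide : Dec (c ≡ 0ℤ) → c ≡ 0ℤ
    decide (yes c≡0) = c≡0
    decide (no c≢0) = ⊥-elim (v≢0 (⋆-cancel v c≢0 (trans (sym (⊕-identityʳ _)) e)))

  -- A kernel vector v of L₁ would make the lines spanned by v and by L₂ v a forbidden pair.
  irreducible⇒injective : ∀ {k} (L₁ L₂ : Mat ℤ (suc (suc k))) → Irreducible L₁ L₂ → Injective (act L₁)
  irreducible⇒injective L₁ L₂ irr v L₁v≡0 = decide (em (v ≡ 0v)) (em (act L₂ v ≡ 0v))
    where
    vanishing : ∀ {L u} → act L v ≡ 0v → (i : Fin 1) → ∃[ c ] (c ≢ 0ℤ × ∃[ z ] c ⋆ act L (Data.Vec.Base.lookup (v ∷ []) i) ≡ combination z (u ∷ []))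
    vanishing {u = u} e zero = 1ℤ , (λ ()) , 0v , trans (1⋆ _) (trans e (sym (combination-0 (u ∷ []))))
    decide : Dec (v ≡ 0v) → Dec (act L₂ v ≡ 0v) → v ≡ 0v
    decide (yes v≡0) _ = v≡0
    decide (no v≢0) (yes L₂v≡0) = ⊥-elim (reducible L₁ L₂ (v ∷ []) (v ∷ []) (s≤s (s≤s z≤n)) (singleton-independent v≢0) (singleton-independent v≢0)
      (vanishing {L₁} L₁v≡0) (vanishing {L₂} L₂v≡0) irr)
    decide (no v≢0) (no L₂v≢0) = ⊥-elim (reducible L₁ L₂ (v ∷ []) (act L₂ v ∷ []) (s≤s (s≤s z≤n)) (singleton-independent v≢0) (singleton-independent L₂v≢0)
      (vanishing {L₁} L₁v≡0) (λ { zero → 1ℤ , (λ ()) , 1ℤ ∷ [] , sym (⊕-identityʳ _) }) irr)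

  from-injective : ∀ {k} (L₁ L₂ : Mat ℤ (suc k)) → Irreducible L₁ L₂ → Coprime L₁ L₂ → Injective (act L₁) → Injective (act L₂) → LowerBound L₁ L₂
  from-injective {k} L₁ L₂ irr coprime l₁-inj l₂-inj = D₀ , s′ , λ A → ≤-trans (*-monoʳ-≤ (fromℕ (card A)) (fromℕ-nonNeg (card A))
      (^-mono-≤ (suc k) (+-nonNeg (nthRoot-nonNeg (suc k) ∣ detℤ L₁ ∣) (nthRoot-nonNeg (suc k) ∣ detℤ L₂ ∣)) (+-mono-≤ (nthRoot-mono (suc k) (ℕ.m≤n⊔m 1 ∣ detℤ L₁ ∣)) (nthRoot-mono (suc k) (ℕ.m≤n⊔m 1 ∣ detℤ L₂ ∣)))))
    (all-bounded A)
    where open Bound L₁ L₂ irr coprime l₁-inj l₂-inj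

  entry : Mat ℤ 1 → ℤ
  entry L = L zero zero

  act₁ : ∀ (L : Mat ℤ 1) x → act L (x ∷ []) ≡ entry L ℤ.* x ∷ []
  act₁ L x = cong (_∷ []) (ℤ.+-identityʳ _)

  det₁ : ∀ (L : Mat ℤ 1) → detℤ L ≡ entry L
  det₁ L = trans (ℤ.+-identityʳ _) (trans (ℤ.*-identityˡ _) (ℤ.*-identityʳ _))

  nonzero⇒injective : ∀ (L : Mat ℤ 1) → entry L ≢ 0ℤ → Injective (act L)
  nonzero⇒injective L a≢0 (x ∷ []) e = ⋆-cancel (x ∷ []) a≢0 (trans (sym (act₁ L x)) e)

  -- When L₁ = 0, both matrices map ℤ into |b| ℤ; comparing the volumes |b| and 1 gives the bound.
  zero-entry : ∀ (L₁ L₂ : Mat ℤ 1) → Coprime L₁ L₂ → entry L₁ ≡ 0ℤ → ∣ entry L₂ ∣ ℕ.≤ 1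
  zero-entry L₁ L₂ coprime a≡0 = decide (entry L₂ ℤ.≟ 0ℤ)
    where
    b = entry L₂
    decide : Dec (b ≡ 0ℤ) → ∣ b ∣ ℕ.≤ 1
    decide (yes b≡0) = ℕ.≤-trans (ℕ.≤-reflexive (cong ∣_∣ b≡0)) z≤n
    decide (no b≢0) = ℕ.≤-trans (ℕ.≤-reflexive (trans (proj₁ (proj₂ (signed (ℤ-abs b b≢0)))) (sym (ℕ.*-identityʳ _))))
        (coprime-volumes L₁ L₂ coprime S Q into₁ into₂)
      where
      signed : ∃[ k ] (b ≡ pos (suc k) ⊎ b ≡ ℤ.- pos (suc k)) → ∃[ k ] (∣ b ∣ ≡ suc k × (∀ x → ∃[ y ] b ℤ.* x ≡ y ℤ.* pos (suc k)))
      signed (k , inj₁ e) = k , cong ∣_∣ e , λ x → x , trans (cong (ℤ._* x) e) (ℤ.*-comm (pos (suc k)) x)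
      signed (k , inj₂ e) = k , cong ∣_∣ e , λ x → ℤ.- x , trans (cong (ℤ._* x) e) (trans (sym (ℤ.neg-distribˡ-* (pos (suc k)) x)) (trans (cong ℤ.-_ (ℤ.*-comm (pos (suc k)) x)) (ℤ.neg-distribˡ-* x (pos (suc k)))))
      g = suc (proj₁ (signed (ℤ-abs b b≢0)))
      S Q : Triangular 1
      S = block g (s≤s z≤n) [] []
      Q = block 1 (s≤s z≤n) [] []
      multiple : ∀ y → y ℤ.* pos g ∷ [] ≡ act (matrix S) (y ∷ [])
      multiple y = sym (act-block g (s≤s z≤n) [] [] y [])
      into₁ : ∀ c → ∃[ c′ ] act (matrix S) c′ ≡ act L₁ (act (matrix Q) c)
      into₁ c = vanish (act (matrix Q) c)
        where
        vanish : ∀ u → ∃[ c′ ] act (matrix S) c′ ≡ act L₁ u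
        vanish (x ∷ []) = 0ℤ ∷ [] , sym (trans (act₁ L₁ x) (trans (cong (_∷ []) (cong (ℤ._* x) a≡0)) (multiple 0ℤ)))
      into₂ : ∀ c → ∃[ c′ ] act (matrix S) c′ ≡ act L₂ (act (matrix Q) c)
      into₂ c = divide (act (matrix Q) c)
        where
        divide : ∀ u → ∃[ c′ ] act (matrix S) c′ ≡ act L₂ u
        divide (x ∷ []) = let y , e = proj₂ (proj₂ (signed (ℤ-abs b b≢0))) x in y ∷ [] , sym (trans (act₁ L₂ x) (trans (cong (_∷ []) e) (multiple y)))

  -- In dimension one a zero matrix is irreducible, but then coprimality forces the other entry to be 0, 1 or -1.
  degenerate : ∀ (L₁ L₂ : Mat ℤ 1) → ∣ entry L₁ ∣ ℕ.+ ∣ entry L₂ ∣ ℕ.≤ 1 → LowerBound L₁ L₂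
  degenerate L₁ L₂ small = 0 , 0 , λ A → ≤-respʳ (≈-sym (≈-trans (+-congˡ (zeroˡ _)) (+-identityʳ _)))
    (≤-respˡ (≈-sym (≈-trans (*-congʳ det-sum) (≈-sym (fromℕ-* (∣ entry L₁ ∣ ℕ.+ ∣ entry L₂ ∣) (card A))))) (fromℕ-mono (bound A)))
    where
    root₁ : ∀ L → nthRoot 1 ∣ detℤ L ∣ ≈ fromℕ ∣ entry L ∣
    root₁ L = ≈-trans (≈-sym (*-identityʳ _)) (≈-trans (nthRoot-suc 0 ∣ detℤ L ∣) (reflexive (cong (λ a → fromℕ ∣ a ∣) (det₁ L))))
    det-sum : (nthRoot 1 ∣ detℤ L₁ ∣ + nthRoot 1 ∣ detℤ L₂ ∣) ^ 1 ≈ fromℕ (∣ entry L₁ ∣ ℕ.+ ∣ entry L₂ ∣)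
    det-sum = ≈-trans (*-identityʳ _) (≈-trans (+-cong (root₁ L₁) (root₁ L₂)) (≈-sym (fromℕ-+ ∣ entry L₁ ∣ ∣ entry L₂ ∣)))
    bound : ∀ A → (∣ entry L₁ ∣ ℕ.+ ∣ entry L₂ ∣) ℕ.* card A ℕ.≤ card (map (act L₁) A ⊞ map (act L₂) A)
    bound A = decide (entry L₁ ℤ.≟ 0ℤ) (entry L₂ ℤ.≟ 0ℤ) (1 ℕ.≤? card A)
      where
      t = (∣ entry L₁ ∣ ℕ.+ ∣ entry L₂ ∣) ℕ.* card A
      S = card (map (act L₁) A ⊞ map (act L₂) A)
      ≤A : t ℕ.≤ card A
      ≤A = ℕ.≤-trans (ℕ.*-monoˡ-≤ (card A) small) (ℕ.≤-reflexive (ℕ.*-identityˡ (card A)))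
      decide : Dec (entry L₁ ≡ 0ℤ) → Dec (entry L₂ ≡ 0ℤ) → Dec (1 ℕ.≤ card A) → t ℕ.≤ S
      decide _ _ (no A≱1) = ℕ.≤-trans ≤A (ℕ.≤-trans (ℕ.≤-pred (ℕ.≰⇒> A≱1)) z≤n)
      decide (yes a≡0) (yes b≡0) _ = ℕ.≤-trans (ℕ.≤-reflexive (cong₂ (λ a b → (∣ a ∣ ℕ.+ ∣ b ∣) ℕ.* card A) a≡0 b≡0)) z≤n
      decide (no a≢0) _ (yes A≥1) = ℕ.≤-trans ≤A (ℕ.≤-trans (ℕ.≤-reflexive (sym (card-map (act L₁) (λ {x} {x′} → injective⇒cancel (act-+ L₁) (nonzero⇒injective L₁ a≢0)) A)))
        (card-⊞≥ˡ (map (act L₁) A) (map (act L₂) A) (∈-map⁺ (act L₂) (proj₂ (card-nonempty A A≥1)))))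
      decide (yes _) (no b≢0) (yes A≥1) = ℕ.≤-trans ≤A (ℕ.≤-trans (ℕ.≤-reflexive (sym (card-map (act L₂) (λ {x} {x′} → injective⇒cancel (act-+ L₂) (nonzero⇒injective L₂ b≢0)) A)))
        (card-⊞≥ʳ (map (act L₁) A) (map (act L₂) A) (∈-map⁺ (act L₁) (proj₂ (card-nonempty A A≥1)))))

  -- In dimension one there are no nontrivial subspaces, so irreducibility says nothing about the
  -- entries and zeros are treated separately.
  lower-bound : ∀ {k} (L₁ L₂ : Mat ℤ (suc k)) → Irreducible L₁ L₂ → Coprime L₁ L₂ → LowerBound L₁ L₂
  lower-bound {suc k} L₁ L₂ irr coprime = from-injective L₁ L₂ irr coprime (irreducible⇒injective L₁ L₂ irr) (irreducible⇒injective L₂ L₁ (irreducible-swap {L₁ = L₁} {L₂} irr))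
  lower-bound {zero} L₁ L₂ irr coprime = decide (entry L₁ ℤ.≟ 0ℤ) (entry L₂ ℤ.≟ 0ℤ)
    where
    decide : Dec (entry L₁ ≡ 0ℤ) → Dec (entry L₂ ≡ 0ℤ) → LowerBound L₁ L₂
    decide (yes a≡0) _ = degenerate L₁ L₂ (ℕ.≤-trans (ℕ.≤-reflexive (cong (λ a → ∣ a ∣ ℕ.+ ∣ entry L₂ ∣) a≡0)) (zero-entry L₁ L₂ coprime a≡0))
    decide (no _) (yes b≡0) = degenerate L₁ L₂ (ℕ.≤-trans (ℕ.≤-reflexive (trans (cong (λ b → ∣ entry L₁ ∣ ℕ.+ ∣ b ∣) b≡0) (ℕ.+-identityʳ _)))
      (zero-entry L₂ L₁ (coprime-swap {L₁ = L₁} {L₂} coprime) b≡0))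
    decide (no a≢0) (no b≢0) = from-injective L₁ L₂ irr coprime (nonzero⇒injective L₁ a≢0) (nonzero⇒injective L₂ b≢0)

-- Reduction from real to integer points.

module IntegerModel {ℓ} (R : CompleteOrderedField ℓ) where
  open Reals R hiding (total)
  open Gains R using (by-cases)
  open Counting
  open WithEM em
  open Vectors hiding (_:+_; _:-_; _:*_; :-_; :0; linear; x₀; x₁; x₂; x₃; x₄; x₅)
  open Sumsets em
  open RationalLinear using (act; lookup-ext; module Σℤ)
  open import Algebra.Bundles using (CommutativeRing)
  import Algebra.Properties.Semiring.Sum as SemiringSum
  open import Data.Nat.Base as ℕ using (ℕ; zero; suc; s≤s; z≤n)
  import Data.Nat.Properties as ℕ
  open import Data.Integer.Base as ℤ using (ℤ; 0ℤ; 1ℤ; -1ℤ; -[1+_]; ∣_∣) renaming (+_ to pos)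
  import Data.Integer.Properties as ℤ
  open import Data.Fin.Base using (Fin; zero; suc)
  open import Data.List.Base as List using (List; []; _∷_; map; concatMap; cartesianProductWith; allFin; deduplicate)
  open import Data.List.Membership.Propositional using (_∈_; find; lose)
  open import Data.List.Membership.Propositional.Properties
  open import Data.List.Relation.Unary.Any as Any using (Any; here; there)
  import Data.List.Relation.Unary.Any.Properties as Any
  open import Data.List.Relation.Unary.AllPairs using (AllPairs)
  open import Data.Vec.Base as Vec using (Vec; []; _∷_; lookup; head; tail; tabulate; fromList)
  open import Data.Vec.Properties using (lookup∘tabulate; lookup-zipWith)
  import Data.Vec.Functional as Vector
  open Vector using (Vector)
  open import Data.Product.Base using (∃; ∃-syntax; _×_; _,_; proj₁; proj₂)
  open import Data.Empty using (⊥-elim)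
  open import Relation.Nullary using (yes; no; ¬_; Dec)
  open import Relation.Binary.Bundles using (DecSetoid)
  import Data.Vec.Functional.Relation.Binary.Pointwise.Properties as Pointwise
  import Data.List.Relation.Unary.Unique.DecSetoid.Properties as Unique
  open import Relation.Binary.PropositionalEquality using (_≡_; _≢_; refl; sym; trans; cong; cong₂; subst)
  open import Function.Base using (_∘_; id)
  import Level
  private
    module S = Real R
    module Σℝ = SemiringSum (CommutativeRing.semiring commutativeRing)

  -- Integer linear forms evaluated in a ring that receives ℤ. The reals and ℤ itself are both used,
  -- so that the real and the integral value of one form can be compared.
  module Form {c e} (K : CommutativeRing c e) where
    open CommutativeRing K renaming (_≈_ to _≋_; _+_ to _+′_; _*_ to _*′_; 0# to 0′; 1# to 1′; Carrier to C) hiding (refl; sym; trans)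
    private
      module K = CommutativeRing K

    module Along (ι : ℤ → C) (ι-+ : ∀ i j → ι (i ℤ.+ j) ≋ ι i +′ ι j) (ι-* : ∀ i j → ι (i ℤ.* j) ≋ ι i *′ ι j) (ι-0 : ι 0ℤ ≋ 0′) (ι-1 : ι 1ℤ ≋ 1′) where

      form : ∀ {N} → V N → Vec C N → C
      form [] [] = 0′
      form (z ∷ zs) (x ∷ xs) = (ι z *′ x) +′ form zs xs

      form-⊕ : ∀ {N} (u v : V N) xs → form (u ⊕ v) xs ≋ form u xs +′ form v xs
      form-⊕ [] [] [] = K.sym (K.+-identityˡ 0′)
      form-⊕ (a ∷ u) (b ∷ v) (x ∷ xs) = K.trans (K.+-cong (K.trans (K.*-congʳ (ι-+ a b)) (K.distribʳ x (ι a) (ι b))) (form-⊕ u v xs))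
        (interchange (ι a *′ x) (ι b *′ x) (form u xs) (form v xs))
        where open import Algebra.Properties.CommutativeSemigroup (CommutativeRing.+-commutativeSemigroup K) using (interchange)

      form-⋆ : ∀ {N} k (v : V N) xs → form (k ⋆ v) xs ≋ ι k *′ form v xs
      form-⋆ k [] [] = K.sym (K.zeroʳ (ι k))
      form-⋆ k (a ∷ v) (x ∷ xs) = K.trans (K.+-cong (K.trans (K.*-congʳ (ι-* k a)) (K.*-assoc (ι k) (ι a) x)) (form-⋆ k v xs)) (K.sym (K.distribˡ (ι k) (ι a *′ x) (form v xs)))

      form-0 : ∀ {N} (xs : Vec C N) → form 0v xs ≋ 0′
      form-0 [] = K.refl
      form-0 (x ∷ xs) = K.trans (K.+-cong (K.trans (K.*-congʳ ι-0) (K.zeroˡ x)) (form-0 xs)) (K.+-identityˡ 0′)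

      form-unit : ∀ {N} i (xs : Vec C N) → form (unit i) xs ≋ lookup xs i
      form-unit zero (x ∷ xs) = K.trans (K.+-cong (K.trans (K.*-congʳ ι-1) (K.*-identityˡ x)) (form-0 xs)) (K.+-identityʳ x)
      form-unit (suc i) (x ∷ xs) = K.trans (K.+-cong (K.trans (K.*-congʳ ι-0) (K.zeroˡ x)) (form-unit i xs)) (K.+-identityˡ _)

  open Form.Along commutativeRing fromℤ fromℤ-+ fromℤ-* ≈-refl fromℕ-1
  private
    id-+ : ∀ i j → id (i ℤ.+ j) ≡ id i ℤ.+ id j
    id-+ _ _ = refl
    id-* : ∀ i j → id (i ℤ.* j) ≡ id i ℤ.* id j
    id-* _ _ = refl
  module Fℤ = Form.Along ℤ.+-*-commutativeRing id id-+ id-* refl refl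
  open Fℤ using () renaming (form to formℤ)

  formℤ-⋆ʳ : ∀ {N} (z : V N) k q → formℤ z (k ⋆ q) ≡ k ℤ.* formℤ z q
  formℤ-⋆ʳ [] k [] = sym (ℤ.*-zeroʳ k)
  formℤ-⋆ʳ (a ∷ z) k (b ∷ q) = trans (cong₂ ℤ._+_ (trans (sym (ℤ.*-assoc a k b)) (trans (cong (ℤ._* b) (ℤ.*-comm a k)) (ℤ.*-assoc k a b))) (formℤ-⋆ʳ z k q)) (sym (ℤ.*-distribˡ-+ k (a ℤ.* b) (formℤ z q)))

  fromℤ-≉0 : ∀ {c} → c ≢ 0ℤ → ¬ fromℤ c ≈ 0#
  fromℤ-≉0 {pos zero} c≢0 _ = c≢0 refl
  fromℤ-≉0 {pos (suc n)} _ = pos⇒≉0 (fromℕ-pos {suc n} (s≤s z≤n))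
  fromℤ-≉0 { -[1+ n ]} _ e = pos⇒≉0 (fromℕ-pos {suc n} (s≤s z≤n)) (≈-trans (≈-sym (-‿involutive _)) (≈-trans (-‿cong e) -0#≈0#))

  *-zero-cancel : ∀ {x y} → ¬ x ≈ 0# → x * y ≈ 0# → y ≈ 0#
  *-zero-cancel {x} {y} x≉0 e = ≈-trans (≈-sym (≈-trans (≈-trans (solve 3 (λ i x y → i :* (x :* y) := (x :* i) :* y) _≡_.refl (x ⁻¹) x y) (*-congʳ (*-inverseʳ x x≉0))) (*-identityˡ y)))
    (≈-trans (*-congˡ e) (zeroʳ (x ⁻¹)))

  -- Integer relations among the real numbers persist among the integers, so the assignment extends
  -- to an additive map on the group that they generate.
  Preserves : ∀ {N} → Vec ℝ N → V N → Set ℓ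
  Preserves xs q = ∀ z → form z xs ≈ 0# → formℤ z q ≡ 0ℤ

  Separates : ∀ {N} → Vec ℝ N → V N → List (V N) → Set ℓ
  Separates xs q F = ∀ {z} → z ∈ F → ¬ form z xs ≈ 0# → formℤ z q ≢ 0ℤ

  ∈⇒≤sum : ∀ {a} {A : Set a} (f : A → ℕ) {x} L → x ∈ L → f x ℕ.≤ sum (map f L)
  ∈⇒≤sum f (x ∷ L) (here refl) = ℕ.m≤m+n (f x) _
  ∈⇒≤sum f (y ∷ L) (there x∈) = ℕ.≤-trans (∈⇒≤sum f L x∈) (ℕ.m≤n+m _ (f y))

  -- A number that is rationally dependent on the others is mapped as the relation dictates; an
  -- independent one can be mapped to any sufficiently large integer.
  integer-values : ∀ {N} (xs : Vec ℝ N) (F : List (V N)) → ∃[ q ] (Preserves xs q × Separates xs q F)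
  integer-values [] F = [] , (λ { [] _ → refl }) , (λ { {[]} _ n → ⊥-elim (n ≈-refl) })
  integer-values {suc N} (x ∷ xs) F = by-cases (em-ℓ (∃[ c ] ∃[ w ] (c ≢ 0ℤ × fromℤ c * x ≈ form w xs)))
    (λ { (c , w , c≢0 , e) → dependent c w c≢0 e }) independent
    where
    -- From c x = w(xs) the value of x would be w(q) / c. Multiplying all other values by c instead
    -- keeps them integral; `reduce` eliminates x from a form accordingly.
    dependent : ∀ c w → c ≢ 0ℤ → fromℤ c * x ≈ form w xs → ∃[ q ] (Preserves (x ∷ xs) q × Separates (x ∷ xs) q F)
    dependent c w c≢0 e = formℤ w q ∷ c ⋆ q , (λ z z≈0 → trans (identityℤ z) (preserves (reduce z) (≈-trans (≈-sym (identityℝ z)) (≈-trans (*-congˡ z≈0) (zeroʳ (fromℤ c)))))) ,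
      λ {z} z∈ z≉0 z≡0 → separates (∈-map⁺ reduce z∈) (λ r≈0 → z≉0 (*-zero-cancel (fromℤ-≉0 c≢0) (≈-trans (identityℝ z) r≈0))) (trans (sym (identityℤ z)) z≡0)
      where
      reduce : V (suc N) → V N
      reduce z = c ⋆ tail z ⊕ head z ⋆ w
      IH = integer-values xs (map reduce F)
      q = proj₁ IH
      preserves = proj₁ (proj₂ IH)
      separates : Separates xs q (map reduce F)
      separates = proj₂ (proj₂ IH)
      identityℤ : ∀ z → formℤ z (formℤ w q ∷ c ⋆ q) ≡ formℤ (reduce z) q
      identityℤ (a ∷ z) = trans (cong₂ ℤ._+_ (sym (Fℤ.form-⋆ a w q)) (trans (formℤ-⋆ʳ z c q) (sym (Fℤ.form-⋆ c z q)))) (trans (ℤ.+-comm (formℤ (a ⋆ w) q) (formℤ (c ⋆ z) q)) (sym (Fℤ.form-⊕ (c ⋆ z) (a ⋆ w) q)))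
      identityℝ : ∀ z → fromℤ c * form z (x ∷ xs) ≈ form (reduce z) xs
      identityℝ (a ∷ z) = ≈-trans (solve 4 (λ c a x f → c :* (a :* x :+ f) := c :* f :+ a :* (c :* x)) _≡_.refl (fromℤ c) (fromℤ a) x (form z xs))
        (≈-trans (+-cong (≈-sym (form-⋆ c z xs)) (≈-trans (*-congˡ e) (≈-sym (form-⋆ a w xs)))) (≈-sym (form-⊕ (c ⋆ z) (a ⋆ w) xs)))
    independent : ¬ (∃[ c ] ∃[ w ] (c ≢ 0ℤ × fromℤ c * x ≈ form w xs)) → ∃[ q ] (Preserves (x ∷ xs) q × Separates (x ∷ xs) q F)
    independent free = pos B ∷ q , preserves′ , separates′
      where
      IH = integer-values xs (map tail F)
      q = proj₁ IH
      preserves = proj₁ (proj₂ IH)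
      separates : Separates xs q (map tail F)
      separates = proj₂ (proj₂ IH)
      -- Larger than every value taken by the rest of a form in `F`, so a nonzero multiple of it
      -- cannot be cancelled.
      B = suc (sum (map (λ z → ∣ formℤ (tail z) q ∣) F))
      preserves′ : Preserves (x ∷ xs) (pos B ∷ q)
      preserves′ (a ∷ z) z≈0 = decide (a ℤ.≟ 0ℤ)
        where
        decide : Dec (a ≡ 0ℤ) → a ℤ.* pos B ℤ.+ formℤ z q ≡ 0ℤ
        decide (yes refl) = trans (ℤ.+-identityˡ _) (preserves z (≈-trans (≈-sym (≈-trans (+-congʳ (zeroˡ x)) (+-identityˡ _))) z≈0))
        decide (no a≢0) = ⊥-elim (free (a , -1ℤ ⋆ z , a≢0 , ≈-trans (solve 2 (λ p f → p := (p :+ f) :- f) _≡_.refl (fromℤ a * x) (form z xs))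
          (≈-trans (≈-trans (+-congʳ z≈0) (≈-trans (+-identityˡ _) (≈-sym (≈-trans (*-congʳ (-‿cong fromℕ-1)) (≈-trans (≈-sym (-‿distribˡ-* 1# (form z xs))) (-‿cong (*-identityˡ _))))))) (≈-sym (form-⋆ -1ℤ z xs)))))
      separates′ : Separates (x ∷ xs) (pos B ∷ q) F
      separates′ {a ∷ z} z∈ z≉0 z≡0 = decide (a ℤ.≟ 0ℤ)
        where
        t = formℤ z q
        decide : Dec (a ≡ 0ℤ) → _
        decide (yes refl) = separates (∈-map⁺ tail z∈) (λ f≈0 → z≉0 (≈-trans (+-cong (zeroˡ x) f≈0) (+-identityˡ 0#))) (trans (sym (ℤ.+-identityˡ t)) z≡0)
        decide (no a≢0) = ℕ.<⇒≱ (s≤s (∈⇒≤sum (λ z → ∣ formℤ (tail z) q ∣) F z∈)) (begin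
          B                     ≤⟨ ℕ.m≤n*m B ∣ a ∣ {{ℕ.≢-nonZero (λ ∣a∣≡0 → a≢0 (ℤ.∣i∣≡0⇒i≡0 ∣a∣≡0))}} ⟩
          ∣ a ∣ ℕ.* B           ≡⟨ ℤ.abs-* a (pos B) ⟨
          ∣ a ℤ.* pos B ∣       ≡⟨ cong ∣_∣ aB≡-t ⟩
          ∣ ℤ.- t ∣             ≡⟨ ℤ.∣-i∣≡∣i∣ t ⟩
          ∣ t ∣                 ∎)
          where
          open ℕ.≤-Reasoning
          aB≡-t : a ℤ.* pos B ≡ ℤ.- t
          aB≡-t = trans (sym (ℤ.+-identityʳ _)) (trans (cong (λ u → a ℤ.* pos B ℤ.+ u) (sym (ℤ.+-inverseʳ t))) (trans (sym (ℤ.+-assoc (a ℤ.* pos B) t (ℤ.- t))) (trans (cong (ℤ._+ ℤ.- t) z≡0) (ℤ.+-identityˡ _))))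

  position : ∀ {a} {A : Set a} {x : A} L → x ∈ L → ∃[ i ] lookup (fromList L) i ≡ x
  position (x ∷ L) (here refl) = zero , refl
  position (y ∷ L) (there x∈) = let i , e = position L x∈ in suc i , e

  -- Image r n says that the integer n stands for the real number r, where r ranges over the
  -- subgroup generated by the entries.
  record Model (entries : List ℝ) : Set (Level.suc ℓ) where
    field
      Image      : ℝ → ℤ → Set ℓ
      respects   : ∀ {r r′ n} → r ≈ r′ → Image r n → Image r′ n
      functional : ∀ {r n n′} → Image r n → Image r n′ → n ≡ n′
      image-0    : Image 0# 0ℤ
      image-+    : ∀ {r r′ n n′} → Image r n → Image r′ n′ → Image (r + r′) (n ℤ.+ n′)
      image-*    : ∀ {r n} k → Image r n → Image (fromℤ k * r) (k ℤ.* n)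
      value      : ℝ → ℤ
      image      : ∀ {r} → r ∈ entries → Image r (value r)
      separates  : ∀ {r r′} → r ∈ entries → r′ ∈ entries → value r ≡ value r′ → r ≈ r′

    value-cong : ∀ {r r′} → r ∈ entries → r′ ∈ entries → r ≈ r′ → value r ≡ value r′
    value-cong r∈ r′∈ e = functional (respects e (image r∈)) (image r′∈)

    image-sum : ∀ {d} (t : Vector ℝ d) (u : Vector ℤ d) → (∀ j → Image (t j) (u j)) → Image (Σℝ.sum t) (Σℤ.sum u)
    image-sum {zero} t u p = image-0
    image-sum {suc d} t u p = image-+ (p zero) (image-sum (t ∘ suc) (u ∘ suc) (p ∘ suc))

  model : ∀ entries → Model entries
  model entries = record
    { Image = Image
    ; respects = λ { e (z , r≈ , n≡) → z , ≈-trans (≈-sym e) r≈ , n≡ }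
    ; functional = functional
    ; image-0 = 0v , ≈-sym (form-0 xs) , sym (Fℤ.form-0 q)
    ; image-+ = λ { (z , r≈ , n≡) (z′ , r′≈ , n′≡) → z ⊕ z′ , ≈-trans (+-cong r≈ r′≈) (≈-sym (form-⊕ z z′ xs)) , trans (cong₂ ℤ._+_ n≡ n′≡) (sym (Fℤ.form-⊕ z z′ q)) }
    ; image-* = λ { k (z , r≈ , n≡) → k ⋆ z , ≈-trans (*-congˡ r≈) (≈-sym (form-⋆ k z xs)) , trans (cong (k ℤ.*_) n≡) (sym (Fℤ.form-⋆ k z q)) }
    ; value = value
    ; image = λ r∈ → value-image (at r∈)
    ; separates = separates }
    where
    xs = fromList entries
    N = List.length entries
    -- The differences of two entries: keeping them nonzero makes the model injective on the
    -- coordinates of A.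
    F : List (V N)
    F = cartesianProductWith (λ i j → unit i ⊕ -1ℤ ⋆ unit j) (allFin N) (allFin N)
    values = integer-values xs F
    q = proj₁ values
    Image : ℝ → ℤ → Set ℓ
    Image r n = ∃[ z ] (r ≈ form z xs × n ≡ formℤ z q)
    minus-form : ∀ z z′ → form (z ⊕ -1ℤ ⋆ z′) xs ≈ form z xs - form z′ xs
    minus-form z z′ = ≈-trans (form-⊕ z (-1ℤ ⋆ z′) xs) (+-congˡ (≈-trans (form-⋆ -1ℤ z′ xs) (≈-trans (*-congʳ (-‿cong fromℕ-1)) (≈-trans (≈-sym (-‿distribˡ-* 1# (form z′ xs))) (-‿cong (*-identityˡ _))))))
    minus-formℤ : ∀ z z′ → formℤ (z ⊕ -1ℤ ⋆ z′) q ≡ formℤ z q ℤ.- formℤ z′ q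
    minus-formℤ z z′ = trans (Fℤ.form-⊕ z (-1ℤ ⋆ z′) q) (cong (λ u → formℤ z q ℤ.+ u) (trans (Fℤ.form-⋆ -1ℤ z′ q) (ℤ.-1*i≡-i (formℤ z′ q))))
    functional : ∀ {r n n′} → Image r n → Image r n′ → n ≡ n′
    functional {r} (z , r≈ , n≡) (z′ , r≈′ , n′≡) = trans n≡ (trans (ℤ.i-j≡0⇒i≡j (formℤ z q) (formℤ z′ q) (trans (sym (minus-formℤ z z′))
      (proj₁ (proj₂ values) (z ⊕ -1ℤ ⋆ z′) (≈-trans (minus-form z z′) (≈-trans (+-cong (≈-sym r≈) (-‿cong (≈-sym r≈′))) (-‿inverseʳ r)))))) (sym n′≡))
    value-of : ∀ {r} → Dec (∃ (Image r)) → ℤ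
    value-of (yes (n , _)) = n
    value-of (no _) = 0ℤ
    value : ℝ → ℤ
    value r = value-of (em-ℓ (∃ (Image r)))
    value-image : ∀ {r n} → Image r n → Image r (value r)
    value-image {r} p with em-ℓ (∃ (Image r))
    ... | yes (_ , i) = i
    ... | no none = ⊥-elim (none (_ , p))
    index : ∀ {r} → r ∈ entries → Fin N
    index r∈ = proj₁ (position entries r∈)
    at-index : ∀ {r} (r∈ : r ∈ entries) → r ≈ form (unit (index r∈)) xs
    at-index r∈ = ≈-sym (≈-trans (form-unit (index r∈) xs) (reflexive (proj₂ (position entries r∈))))
    at : ∀ {r} (r∈ : r ∈ entries) → Image r (formℤ (unit (index r∈)) q)
    at r∈ = unit (index r∈) , at-index r∈ , refl
    separates : ∀ {r r′} → r ∈ entries → r′ ∈ entries → value r ≡ value r′ → r ≈ r′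
    separates {r} {r′} r∈ r′∈ e = by-cases (r ≟ r′) (λ r≈r′ → r≈r′) (λ r≉r′ → ⊥-elim (proj₂ (proj₂ values)
      (∈-cartesianProductWith⁺ (λ i j → unit i ⊕ -1ℤ ⋆ unit j) (∈-allFin (index r∈)) (∈-allFin (index r′∈)))
      (λ f≈0 → r≉r′ (≈-trans (at-index r∈) (≈-trans (zero-difference (≈-trans (≈-sym (minus-form u u′)) f≈0)) (≈-sym (at-index r′∈)))))
      (trans (minus-formℤ u u′) (ℤ.i≡j⇒i-j≡0 (trans (functional (at r∈) (value-image (at r∈))) (trans e (functional (value-image (at r′∈)) (at r′∈))))))))
      where
      u = unit (index r∈)
      u′ = unit (index r′∈)
      zero-difference : ∀ {a b} → a - b ≈ 0# → a ≈ b
      zero-difference {a} {b} a-b≈0 = ≈-trans (solve 2 (λ a b → a := (a :- b) :+ b) _≡_.refl a b) (≈-trans (+-congʳ a-b≈0) (+-identityˡ b))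

  module _ {d : ℕ} where
    private
      points : DecSetoid ℓ ℓ
      points = Pointwise.decSetoid (record { isDecEquivalence = record { isEquivalence = isEquivalence ; _≟_ = _≟_ } }) d

    distinct : ∀ (A : List (Vector ℝ d)) → AllPairs (λ a b → ¬ (∀ i → a i ≈ b i)) (deduplicate (Pointwise.decidable _≟_) A)
    distinct = Unique.deduplicate-! points

    represented : ∀ {A : List (Vector ℝ d)} {a} → a ∈ A → ∃[ b ] (b ∈ deduplicate (Pointwise.decidable _≟_) A × (∀ i → a i ≈ b i))
    represented {A} {a} a∈ = find (Any.deduplicate⁺ (Pointwise.decidable _≟_) (λ b≈c a≈b i → ≈-trans (a≈b i) (≈-sym (b≈c i))) (lose a∈ (λ i → ≈-refl)))

    module _ (L₁ L₂ : Mat ℤ d) (A : List (Vector ℝ d)) where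
      private
        module M = Model (model (concatMap List.tabulate A))

        entry∈ : ∀ {a} → a ∈ A → ∀ i → a i ∈ concatMap List.tabulate A
        entry∈ {a} a∈ i = ∈-concatMap⁺ List.tabulate (lose a∈ (∈-tabulate⁺ i))

        Φ : Vector ℝ d → V d
        Φ a = tabulate (M.value ∘ a)

        A′ : List (V d)
        A′ = map Φ A

        image-act : ∀ L {a} → a ∈ A → ∀ i → M.Image (Σℝ.sum (λ j → fromℤ (L i j) * a j)) (lookup (act L (Φ a)) i)
        image-act L {a} a∈ i = subst (M.Image _) (sym (lookup∘tabulate _ i)) (M.image-sum (λ j → fromℤ (L i j) * a j) (λ j → L i j ℤ.* lookup (Φ a) j)
          (λ j → M.image-* (L i j) (subst (M.Image (a j)) (sym (lookup∘tabulate (M.value ∘ a) j)) (M.image (entry∈ a∈ j)))))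

        same-point : ∀ {a b} → a ∈ A → b ∈ A → (∀ i → a i ≈ b i) → Φ a ≡ Φ b
        same-point a∈ b∈ e = lookup-ext (λ i → trans (lookup∘tabulate _ i) (trans (M.value-cong (entry∈ a∈ i) (entry∈ b∈ i) (e i)) (sym (lookup∘tabulate _ i))))

        same-image : ∀ {a b} → a ∈ A → b ∈ A → Φ a ≡ Φ b → ∀ i → a i ≈ b i
        same-image a∈ b∈ e i = M.separates (entry∈ a∈ i) (entry∈ b∈ i) (trans (sym (lookup∘tabulate _ i)) (trans (cong (λ v → lookup v i) e) (lookup∘tabulate _ i)))

        ⊆A : ∀ {a} → a ∈ deduplicate (Pointwise.decidable _≟_) A → a ∈ A
        ⊆A = ∈-deduplicate⁻ (Pointwise.decidable _≟_) A

      card-model : card A′ ≡ S.∣ A ∣ₛ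
      card-model = ℕ.≤-antisym
        (ℕ.≤-trans (ℕ.≤-reflexive (card≡length-uniq A′)) (pigeonhole _≢_ (λ v a → a ∈ A × v ≡ Φ a) (uniq A′) _ (uniq-unique A′) to (λ { (_ , e) (_ , e′) v≢ → v≢ (trans e (sym e′)) })))
        (ℕ.≤-trans (pigeonhole _ (λ a v → a ∈ A × v ≡ Φ a) _ (uniq A′) (distinct A) (λ a∈ → _ , ∈-uniq⁺ A′ (∈-map⁺ Φ (⊆A a∈)) , ⊆A a∈ , refl)
          (λ { (a∈ , e) (b∈ , e′) a#b → a#b (same-image a∈ b∈ (trans (sym e) e′)) })) (ℕ.≤-reflexive (sym (card≡length-uniq A′))))
        where
        to : ∀ {v} → v ∈ uniq A′ → ∃[ a ] (a ∈ deduplicate (Pointwise.decidable _≟_) A × (a ∈ A × v ≡ Φ a))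
        to v∈ with ∈-map⁻ Φ (∈-uniq⁻ A′ v∈)
        ... | a , a∈ , refl = let b , b∈ , e = represented a∈ in b , b∈ , ⊆A b∈ , same-point a∈ (⊆A b∈) e

      -- Each integer sum stands for a real sum, and a real point stands for only one integer point.
      -- Different real sums may coincide in the model, but a lower bound for the real sumset needs
      -- just this inequality.
      card-sumset-model : card (map (act L₁) A′ ⊞ map (act L₂) A′) ℕ.≤ S.∣ (L₁ S.∙ A) S.⊕ (L₂ S.∙ A) ∣ₛ
      card-sumset-model = ℕ.≤-trans (ℕ.≤-reflexive (card≡length-uniq Y)) (pigeonhole _≢_ Stands (uniq Y) _ (uniq-unique Y) to
          (λ s s′ v≢ → v≢ (lookup-ext (λ i → M.functional (s i) (s′ i)))))
        where
        Y = map (act L₁) A′ ⊞ map (act L₂) A′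
        T = (L₁ S.∙ A) S.⊕ (L₂ S.∙ A)
        Stands : V d → Vector ℝ d → Set ℓ
        Stands v y = ∀ i → M.Image (y i) (lookup v i)
        preimage : ∀ L {v} → v ∈ map (act L) A′ → ∃[ a ] (a ∈ A × v ≡ act L (Φ a))
        preimage L v∈ with ∈-map⁻ (act L) v∈
        ... | u , u∈ , e with ∈-map⁻ Φ u∈
        ... | a , a∈ , refl = a , a∈ , e
        to : ∀ {v} → v ∈ uniq Y → ∃[ y ] (y ∈ deduplicate (Pointwise.decidable _≟_) T × Stands v y)
        to v∈ with ∈-⊞⁻ (∈-uniq⁻ Y v∈)
        ... | v₁ , v₂ , v₁∈ , v₂∈ , refl with preimage L₁ v₁∈ | preimage L₂ v₂∈
        ... | a , a∈ , refl | b , b∈ , refl =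
          let y , y∈ , e = represented {T} (∈-cartesianProductWith⁺ (Vector.zipWith _+_) (∈-map⁺ _ a∈) (∈-map⁺ _ b∈)) in
          y , y∈ , λ i → M.respects (e i) (subst (M.Image _) (sym (lookup-zipWith ℤ._+_ i (act L₁ (Φ a)) (act L₂ (Φ b)))) (M.image-+ (image-act L₁ a∈ i) (image-act L₂ b∈ i)))

      integer-model : ∃[ B ] (card B ≡ S.∣ A ∣ₛ × card (map (act L₁) B ⊞ map (act L₂) B) ℕ.≤ S.∣ (L₁ S.∙ A) S.⊕ (L₂ S.∙ A) ∣ₛ)
      integer-model = A′ , card-model , card-sumset-model

-- Roots and the error function as real powers, and the conclusion.

module RealPowers {ℓ} (R : CompleteOrderedField ℓ) where
  open Reals R hiding (total)
  open BrunnMinkowski R using (nthRoot; nthRoot-nonNeg; nthRoot-suc)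
  open PowerLoss R using (loss-power; y-nonNeg; y-^)
  open IntegerTheorem R using (lower-bound)
  open IntegerModel R using (integer-model)
  open import Data.Nat.Base as ℕ using (ℕ; zero; suc; s≤s; z≤n)
  import Data.Nat.Properties as ℕ
  open import Data.Integer.Base using (ℤ; -[1+_]; ∣_∣) renaming (+_ to pos)
  open import Data.List.Base using (List)
  open import Data.Product.Base using (Σ-syntax; _×_; _,_; proj₁; proj₂)
  open import Data.Empty using (⊥-elim)
  open import Data.Vec.Functional using (Vector)
  open import Relation.Nullary using (yes; no)
  import Relation.Binary.PropositionalEquality as ≡
  open ≡ using (_≡_)

  ^ʳ-lower : ∀ b s {x} → (∀ y → AbovePower b s y → x ≤ y) → x ≤ b ^ʳ s
  ^ʳ-lower b s lower = proj₁ (proj₂ (complete (λ x → ∀ y → AbovePower b s y → x ≤ y) _ _)) lower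

  ^ʳ-nonNeg : ∀ b s → 0# ≤ b ^ʳ s
  ^ʳ-nonNeg b s = ^ʳ-lower b s (λ y → proj₁)

  ^ʳ-upper : ∀ b s {y} → AbovePower b s y → b ^ʳ s ≤ y
  ^ʳ-upper b s {y} above with b ^ʳ s ≤? y
  ... | yes le = le
  ... | no ≰ = let x , lower , y<x = proj₂ (proj₂ (complete (λ x → ∀ y → AbovePower b s y → x ≤ y) _ _)) (≰⇒> ≰) in ⊥-elim (<⇒≱ y<x (lower y above))

  -- The exponent is the rational number 1/(k + 1), so the root is one of the numbers whose infimum
  -- defines the power.
  ^ʳ-root : ∀ k b → b ^ʳ (fromℕ (suc k) ⁻¹) ≤ nthRoot (suc k) b
  ^ʳ-root k b = ^ʳ-upper b _ (nthRoot-nonNeg (suc k) b , pos 1 , k ,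
    ≤-reflexive (≈-trans (≈-trans (*-comm _ _) (*-inverseʳ _ (pos⇒≉0 (fromℕ-pos {suc k} (s≤s z≤n))))) (≈-sym fromℕ-1)) ,
    ≤-reflexive (≈-trans (*-identityʳ _) (≈-sym (nthRoot-suc k b))))

  -- For n ≥ 1 and a rational p/q ≥ 1 - 1/s, the comparison with n^(p/q) reduces to one between
  -- natural powers of n. Applied to the subtracted error, this direction is the required one.
  loss-power≤^ʳ : ∀ s′ {n} → 1 ℕ.≤ n → loss-power s′ n ≤ n ^ʳ (1# - fromℕ (suc s′) ⁻¹)
  loss-power≤^ʳ s′ {n} n≥1 = ^ʳ-lower n _ below
    where
    s = suc s′
    ε = fromℕ s ⁻¹
    y = loss-power s′ n
    0<s = fromℕ-pos {s} (s≤s z≤n)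
    exponents : ∀ r q → (1# - ε) * fromℕ (suc r) ≤ q → fromℕ (s′ ℕ.* suc r) ≤ fromℕ s * q
    exponents r q le = ≤-respˡ (≈-trans (solve 4 (λ a m e r → (:1 :+ m) :* ((:1 :- e) :* r) := ((:1 :+ m) :- (:1 :+ m) :* e) :* r) ≡.refl ε (fromℕ s′) ε (fromℕ (suc r)))
        (≈-trans (*-congʳ (≈-trans (+-congˡ (-‿cong (*-inverseʳ _ (pos⇒≉0 0<s)))) (solve 1 (λ m → (:1 :+ m) :- :1 := m) ≡.refl (fromℕ s′)))) (≈-sym (fromℕ-* s′ (suc r)))))
      (*-monoˡ-≤ (fromℕ s) (proj₁ 0<s) le)
    below : ∀ z → AbovePower n (1# - ε) z → y ≤ z
    -- A negative numerator is impossible since 1 - 1/s is nonnegative.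
    below z (0≤z , -[1+ p ] , r , le , _) = ⊥-elim (<⇒≱ (*-pos 0<s (fromℕ-pos {suc p} (s≤s z≤n))) (≤-by (fromℕ s * - fromℕ (suc p)) (≤-trans (fromℕ-nonNeg (s′ ℕ.* suc r)) (exponents r _ le))
      (solve 2 (λ s p → :0 := s :* p :+ s :* (:- p)) ≡.refl (fromℕ s) (fromℕ (suc p)))))
    below z (0≤z , pos p , r , le , power) = ^-cancel-≤ r 0≤z (^-cancel-≤ s′ (^-nonNeg (suc r) 0≤z) (≤-respˡ (≈-sym left) (≤-trans (≤-respˡ (fromℕ-^ n (s′ ℕ.* suc r)) (≤-respʳ (fromℕ-^ n (p ℕ.* s))
        (fromℕ-mono (ℕ.^-monoʳ-≤ n {{ℕ.>-nonZero n≥1}} exponents′)))) (≤-respˡ (^-^ (fromℕ n) p s) (^-mono-≤ s (^-nonNeg p (fromℕ-nonNeg n)) power)))))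
      where
      exponents′ : s′ ℕ.* suc r ℕ.≤ p ℕ.* s
      exponents′ = fromℕ-cancel-≤ (≤-respʳ (≈-trans (*-comm (fromℕ s) (fromℕ p)) (≈-sym (fromℕ-* p s))) (exponents r (fromℕ p) le))
      left : (y ^ suc r) ^ s ≈ fromℕ n ^ (s′ ℕ.* suc r)
      left = ≈-trans (^-^ y (suc r) s) (≈-trans (reflexive (≡.cong (y ^_) (ℕ.*-comm (suc r) s))) (≈-trans (≈-sym (^-^ y s (suc r))) (≈-trans (^-cong (suc r) (y-^ s′ n)) (^-^ (fromℕ n) s′ (suc r)))))

  module _ {k : ℕ} (L₁ L₂ : Mat ℤ (suc k)) (irreducible : Irreducible L₁ L₂) (coprime : Coprime L₁ L₂) where
    open Real R using (∣_∣ₛ; _∙_; _⊕_)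

    private
      d = suc k
      a b : ℝ
      a = ∣ detℤ L₁ ∣ ^ʳ (fromℕ d ⁻¹)
      b = ∣ detℤ L₂ ∣ ^ʳ (fromℕ d ⁻¹)
      integer-bound = lower-bound L₁ L₂ irreducible coprime
      D₀ = proj₁ integer-bound
      s′ = proj₁ (proj₂ integer-bound)
      -- One is added because the integral constant may be 0, as in the degenerate case, while D has
      -- to be positive.
      D σ : ℝ
      D = fromℕ (suc D₀)
      σ = fromℕ (suc s′) ⁻¹

      subtract : ∀ {x s y z} → 0# ≤ y → x ≤ s + fromℕ D₀ * y → y ≤ z → x - D * z ≤ s
      subtract {x} {s} {y} {z} 0≤y le y≤z = ≤-by ((s + fromℕ D₀ * y - x) + (fromℕ D₀ * (z - y) + z))
        (+-nonNeg (difference le) (+-nonNeg (*-nonNegative (fromℕ-nonNeg D₀) (difference y≤z)) (≤-trans 0≤y y≤z)))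
        (solve 5 (λ x s y z d → s := (x :- (:1 :+ d) :* z) :+ ((s :+ d :* y :- x) :+ (d :* (z :- y) :+ z))) ≡.refl x s y z (fromℕ D₀))

      constant≤ : (a + b) ^ d ≤ (nthRoot d ∣ detℤ L₁ ∣ + nthRoot d ∣ detℤ L₂ ∣) ^ d
      constant≤ = ^-mono-≤ d (+-nonNeg (^ʳ-nonNeg ∣ detℤ L₁ ∣ _) (^ʳ-nonNeg ∣ detℤ L₂ ∣ _)) (+-mono-≤ (^ʳ-root k ∣ detℤ L₁ ∣) (^ʳ-root k ∣ detℤ L₂ ∣))

      sumset-bound : ∀ (A : List (Vector ℝ d)) → (a + b) ^ d * fromℕ ∣ A ∣ₛ ≤ fromℕ ∣ (L₁ ∙ A) ⊕ (L₂ ∙ A) ∣ₛ + fromℕ D₀ * loss-power s′ ∣ A ∣ₛ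
      sumset-bound A = let B , card≡ , card≤ = integer-model L₁ L₂ A in
        ≤-trans (*-monoʳ-≤ (fromℕ ∣ A ∣ₛ) (fromℕ-nonNeg ∣ A ∣ₛ) constant≤)
          (≡.subst (λ n → (nthRoot d ∣ detℤ L₁ ∣ + nthRoot d ∣ detℤ L₂ ∣) ^ d * fromℕ n ≤ fromℕ ∣ (L₁ ∙ A) ⊕ (L₂ ∙ A) ∣ₛ + fromℕ D₀ * loss-power s′ n) card≡
            (≤-trans (proj₂ (proj₂ integer-bound) B) (+-mono-≤ (fromℕ-mono card≤) ≤-refl)))

      -- The empty set is set apart, as `loss-power≤^ʳ` requires n ≥ 1; there the main term vanishes
      -- and the subtracted power is nonnegative.
      final : ∀ n x S → (n ≡ 0 → x ≈ 0#) → x ≤ fromℕ S + fromℕ D₀ * loss-power s′ n → x - D * n ^ʳ (1# - σ) ≤ fromℕ S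
      final zero x S x≈0 _ = subtract {y = 0#} ≤-refl (≤-respˡ (≈-sym (x≈0 ≡.refl)) (+-nonNeg (fromℕ-nonNeg S) (≤-reflexive (≈-sym (zeroʳ (fromℕ D₀)))))) (^ʳ-nonNeg 0 (1# - σ))
      final (suc n) x S _ le = subtract (y-nonNeg s′ (suc n)) le (loss-power≤^ʳ s′ (s≤s z≤n))

    sumset-of-images : Σ[ D ∈ ℝ ] Σ[ σ ∈ ℝ ] (0# < D × 0# < σ ×
      ((A : List (Vector ℝ d)) → (a + b) ^ d * fromℕ ∣ A ∣ₛ - D * ∣ A ∣ₛ ^ʳ (1# - σ) ≤ fromℕ ∣ (L₁ ∙ A) ⊕ (L₂ ∙ A) ∣ₛ))
    sumset-of-images = D , σ , fromℕ-pos {suc D₀} (s≤s z≤n) , ⁻¹-pos (fromℕ-pos {suc s′} (s≤s z≤n)) ,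
      λ A → final ∣ A ∣ₛ ((a + b) ^ d * fromℕ ∣ A ∣ₛ) ∣ (L₁ ∙ A) ⊕ (L₂ ∙ A) ∣ₛ (λ e → ≈-trans (*-congˡ (reflexive (≡.cong fromℕ e))) (zeroʳ _)) (sumset-bound A)

open import Data.Integer.Base using (ℤ; ∣_∣)
open import Data.List.Base using (List)
open import Data.Nat.Base using (ℕ; suc; NonZero)
open import Data.Product.Base using (Σ-syntax; _×_)
open import Data.Vec.Functional using (Vector)

theorem6p1 : ∀ {ℓ} (R : CompleteOrderedField ℓ) →
    let open CompleteOrderedField R
        open Real R
    in
    (d : ℕ) → .{{_ : NonZero d}} → (L₁ L₂ : Mat ℤ d) →
    Irreducible L₁ L₂ → Coprime L₁ L₂ →
    Σ[ D ∈ ℝ ] Σ[ σ ∈ ℝ ] (0# < D × 0# < σ ×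
      ((A : List (Vector ℝ d)) →
        (∣ detℤ L₁ ∣ ^ʳ (fromℕ d ⁻¹) + ∣ detℤ L₂ ∣ ^ʳ (fromℕ d ⁻¹)) ^ d * fromℕ ∣ A ∣ₛ
          - D * ∣ A ∣ₛ ^ʳ (1# - σ)
          ≤ fromℕ ∣ (L₁ ∙ A) ⊕ (L₂ ∙ A) ∣ₛ))
theorem6p1 R (suc k) L₁ L₂ irreducible coprime = RealPowers.sumset-of-images R L₁ L₂ irreducible coprime
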